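{- Let $a_1,\ldots,a_r\in\mathbb{Q}$. Then there exists a probability distribution of a random vector $(X_1,\ldots,X_r)$ on $\mathbb{Q}^r$ which is supported on a finite subset of the hyperplane $\{x\in\mathbb{Q}^r:\sum_{i=1}^r a_ix_i=0\}$, which is not the point mass at the origin, and whose marginals $X_1,\ldots,X_r$ are all equal in distribution, if and only if the following local conditions hold: (i) for every prime $p$ and every $i$, $|a_i|_p\le \max_{j\ne i}|a_j|_p$; (ii) for every $i$, $|a_i|\le \sum_{j\ne i}|a_j|$ (usual real absolute value).
   Context: $|\cdot|_p$ denotes the $p$-adic absolute value on $\mathbb{Q}$.
   Formalization: The probability distribution of the random vector is taken to have rational probabilities at its finitely many atoms, where the English allows arbitrary real probabilities. -}

module Defs where

open import Data.Nat as ℕ using (ℕ; zero; suc; NonZero)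
open import Data.Nat.DivMod using (_/_; _%_)
open import Data.Nat.Primality using (Prime; prime⇒nonZero)
open import Data.Nat.Properties using (m^n≢0)
open import Data.Integer as ℤ using (ℤ; +_)
open import Data.Rational as ℚ using (ℚ; 0ℚ; 1ℚ; _+_; _*_; _⊔_; _≤_; _<_)
open import Data.Fin using (Fin) renaming (_≟_ to _≟ᶠ_)
open import Data.List using (List; []; _∷_; foldr; map; filter; allFin)
open import Data.List.Relation.Unary.All using (All)
open import Data.List.Relation.Unary.Any using (Any)
open import Data.Product using (_×_; proj₁; proj₂)
open import Data.Bool using (if_then_else_)
open import Relation.Nullary using (¬_; does)
open import Relation.Binary.PropositionalEquality using (_≡_)

-- multiplicity of p in m (with fuel; fuel m suffices for p ≥ 2, m ≥ 1)
multAux : (p : ℕ) → .{{_ : NonZero p}} → ℕ → ℕ → ℕ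
multAux p zero    m = 0
multAux p (suc f) zero = 0
multAux p (suc f) (suc m) with (suc m) % p ℕ.≟ 0
... | Relation.Nullary.yes _ = suc (multAux p f ((suc m) / p))
... | Relation.Nullary.no  _ = 0

vp : (p : ℕ) → .{{_ : NonZero p}} → ℕ → ℕ
vp p m = multAux p m m

-- |x|_p = p^{-v_p(x)} for x ≠ 0, and |0|_p = 0.
-- For x = n/d in lowest terms, |x|_p = p^{v_p(d)} / p^{v_p(|n|)}.
padicAbs : (p : ℕ) → Prime p → ℚ → ℚ
padicAbs p pp x with x ℚ.≟ 0ℚ
... | Relation.Nullary.yes _ = 0ℚ
... | Relation.Nullary.no  _ =
  let instance _ = prime⇒nonZero pp
      kn = vp p ℤ.∣ ℚ.↥ x ∣
      kd = vp p (ℤ.∣ ℚ.↧ x ∣)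
      instance _ = m^n≢0 p kn
  in (+ (p ℕ.^ kd)) ℚ./ (p ℕ.^ kn)

sumℚ : List ℚ → ℚ
sumℚ = foldr _+_ 0ℚ

sumFin : {r : ℕ} → (Fin r → ℚ) → ℚ
sumFin {r} f = sumℚ (map f (allFin r))

sumExcept : {r : ℕ} → (Fin r → ℚ) → Fin r → ℚ
sumExcept {r} f i = foldr (λ j s → if does (j ≟ᶠ i) then s else f j + s) 0ℚ (allFin r)

-- max_{j ≠ i} f j  (empty maximum = 0; only used for nonnegative f)
maxExcept : {r : ℕ} → (Fin r → ℚ) → Fin r → ℚ
maxExcept {r} f i = foldr (λ j s → if does (j ≟ᶠ i) then s else f j ⊔ s) 0ℚ (allFin r)

-- finitely supported probability distributions on ℚ^r
-- (a finite list of atoms: point with its probability weight)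

Point : ℕ → Set
Point r = Fin r → ℚ

FinDist : ℕ → Set
FinDist r = List (Point r × ℚ)

IsProbability : {r : ℕ} → FinDist r → Set
IsProbability d = All (λ e → 0ℚ ≤ proj₂ e) d × sumℚ (map proj₂ d) ≡ 1ℚ

SupportedOnHyperplane : {r : ℕ} → (Fin r → ℚ) → FinDist r → Set
SupportedOnHyperplane a d = All (λ e → sumFin (λ i → a i * proj₁ e i) ≡ 0ℚ) d

NotPointMassAtOrigin : {r : ℕ} → FinDist r → Set
NotPointMassAtOrigin d = Any (λ e → (0ℚ < proj₂ e) × ¬ (∀ i → proj₁ e i ≡ 0ℚ)) d

marginal : {r : ℕ} → FinDist r → Fin r → ℚ → ℚ
marginal d i q = sumℚ (map proj₂ (filter (λ e → proj₁ e i ℚ.≟ q) d))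

EqualMarginals : {r : ℕ} → FinDist r → Set
EqualMarginals d = ∀ i j q → marginal d i q ≡ marginal d j q

PAdicCondition : {r : ℕ} → (Fin r → ℚ) → Set
PAdicCondition a = ∀ p (pp : Prime p) i →
  padicAbs p pp (a i) ≤ maxExcept (λ j → padicAbs p pp (a j)) i

ArchimedeanCondition : {r : ℕ} → (Fin r → ℚ) → Set
ArchimedeanCondition a = ∀ i → ℚ.∣ a i ∣ ≤ sumExcept (λ j → ℚ.∣ a j ∣) i

{-# OPTIONS --safe #-}

{-
Necessity.  Let M be the largest value of N(x_k), where N is |·| or |·|_p, over all coordinates k of all
atoms x of positive weight, attained at the value q.  Since the marginals agree, for every i some atom
x has x_i = q, and N(a_i) M = N(a_i x_i) is at most the sum (maximum) of the N(a_j x_j) ≤ N(a_j) M over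
j ≠ i.

Sufficiency.  Clear denominators, so that the a_i become integers A_i.  By (i) the gcd of the A_j with
j ≠ i divides A_i, hence the lattice A^⊥ ⊆ ℤ^r has for each i an element whose i-th coordinate is 1.
By (ii), either A^⊥ contains a nonzero vector with coordinates ±c, and then x and −x with equal weights
do, or A^⊥ contains finitely many vectors, among them those just mentioned, whose coordinates all have
the same second moment σ.  Regard these vectors as the columns of a matrix with rows u_i of squared norm
σ, and let V be random in ℤ^m with weight (N² − σ‖V‖²)₊^(2k), N large.  The vector of the ⟨u_i,V⟩ lies in
A^⊥, and by rotational symmetry the laws of the ⟨u_i,V⟩ agree up to a small error with the law of
⟨u_0,V⟩ for a further vector u_0 of the same norm orthogonal to all u_i.

The error is removed exactly.  For a suitable modulus M there are v, v′ with ⟨u_i,v⟩ = ⟨u_i,v′⟩ = M such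
that every other u_j is orthogonal to one of the two, so the signed measure
δ_l − δ_{l+v} − δ_{l+v′} + δ_{l+v+v′} changes the law of ⟨u_i,V⟩ by a second difference of step M and no
other law.  After a small adjustment that makes V uniformly distributed modulo M with mean zero on each
class, the discrepancy of the laws of ⟨u_i,V⟩ and ⟨u_0,V⟩ has mass and mean zero on each class modulo M,
and is therefore a second difference of step M of a function with small values.  The resulting
corrections are dominated by the original weights, so the total weights stay nonnegative.
-}

module Submission where

open import Defs
open import Data.Nat.Base as ℕ using (ℕ; zero; suc; z≤n; s≤s; NonZero)
import Data.Nat.Properties as ℕₚ
open import Data.Integer.Base as ℤ
  using (ℤ; +_; -[1+_]; 0ℤ; 1ℤ; ∣_∣; _+_; _*_; _-_; -_; +≤+; -≤+; -≤-; +<+)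
import Data.Integer.Properties as ℤₚ
import Data.Integer.Divisibility.Signed as ℤ-∣
open import Data.Integer.Tactic.RingSolver using (solve-∀)
open import Data.Rational.Base as ℚ using (ℚ; 0ℚ; 1ℚ)
import Data.Rational.Properties as ℚₚ
import Algebra.Properties.Group ℚₚ.+-0-group as ℚ-group
open import Data.Fin.Base using (Fin; zero; suc)
import Data.Fin.Properties as Finₚ
open import Data.List.Base
  using (List; []; _∷_; _++_; map; length; upTo; replicate; cartesianProductWith; cartesianProduct; filter; foldr; allFin; concatMap)
import Data.List.Properties as Listₚ
open import Data.List.Membership.Propositional using (_∈_; find; lose)
open import Data.List.Membership.Propositional.Properties
  using (∈-map⁺; ∈-map⁻; ∈-++⁺ˡ; ∈-++⁺ʳ; ∈-++⁻; ∈-upTo⁺; ∈-upTo⁻; ∈-allFin;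
         ∈-cartesianProductWith⁺; ∈-cartesianProductWith⁻; ∈-cartesianProduct⁺; ∈-cartesianProduct⁻; ∈-filter⁺; ∈-filter⁻)
open import Data.List.Relation.Unary.Any as Any using (Any; here; there)
open import Data.List.Relation.Unary.All as All using (All; []; _∷_)
import Data.List.Relation.Unary.All.Properties as Allₚ
open import Data.List.Relation.Unary.AllPairs using ([]; _∷_)
open import Data.List.Relation.Unary.Unique.Propositional using (Unique)
import Data.List.Relation.Unary.Unique.Propositional.Properties as Uniqueₚ
open import Data.Vec.Base as Vec using (Vec; []; _∷_)
import Data.Vec.Properties as Vecₚ
open import Data.Product.Base using (Σ; ∃; _×_; _,_; proj₁; proj₂)
open import Data.Sum.Base using (_⊎_; inj₁; inj₂; [_,_]′)
open import Data.Empty using (⊥; ⊥-elim)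
open import Data.Bool.Base using (true; false; if_then_else_)
open import Function.Base using (_∘_; id)
open import Function.Bundles using (_⇔_; mk⇔)
open import Relation.Nullary using (¬_; Dec; yes; no; does; contradiction)
open import Relation.Nullary.Decidable using (_×-dec_; ¬?)
open import Relation.Binary.PropositionalEquality
open import Relation.Binary.Definitions using (tri<; tri≈; tri>)
import Data.Nat.Tactic.RingSolver as ℕ-Solver
open import Data.Integer.DivMod using (_/ℕ_; _%ℕ_; n%ℕd<d; a≡a%ℕn+[a/ℕn]*n)
open import Data.Nat.Divisibility using (divides; m%n≡0⇒n∣m; n∣m⇒m%n≡0; ∣-trans; ∣m∣n⇒∣m+n; *-monoʳ-∣; *-cancelˡ-∣; *-pres-∣; _∣0; 0∣⇒≡0) renaming (_∣_ to _∣ℕ_)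
open import Data.Nat.DivMod using (m*[n/m]≡n; m/n<m; _/_; _%_)
open import Data.Nat.Primality using (Prime; prime⇒nonZero; prime⇒nonTrivial; euclidsLemma; prime[2])
open import Data.Nat.Primality.Factorisation using (factorise; PrimeFactorisation)
open import Data.Nat.GCD using (gcd; gcd-GCD; gcd[m,n]∣m; gcd[m,n]∣n; gcd-greatest; module Bézout)
open import Data.Rational.Unnormalised.Base as ℚᵘ using (mkℚᵘ; *≡*; *≤*)
import Data.Rational.Unnormalised.Properties as ℚᵘₚ

-- The lattice has no rotations to use; the symmetry is recovered slice by slice. The points with
-- values (y, t) under `u i` and `u₀` and those with values (t, y), projected off the plane of the
-- two vectors, form translates of one lattice and carry the same radial weight. A sum over a
-- translate is periodic in the displacement, its high differences fall on the weight, which along a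
-- line is polynomial except near the sphere, and a periodic sequence with small high differences is
-- nearly constant. The obstacle is positivity: the weights tend to 0 at the sphere, so the
-- corrections must be small relative to the weight at the place where they are put. The laws at y
-- differ by O(N^(m+1) (N² - y²)^k), half the exponent of the weight. The corrections are placed
-- near the line spanned by `u i`, where the weight is about (N² - y²)^(2k), the most that the value
-- y permits. Since N² - y² is at least N once positive, this gains a factor N^k, and k = m + 5
-- outweighs the powers of N lost to counting and to the second antidifference.

-- Finite sums

private variable
  𝒜 ℬ : Set

+-congˡ : ∀ a {b c} → b ≡ c → a + b ≡ a + c
+-congˡ a refl = refl

*-congˡ : ∀ a {b c} → b ≡ c → a * b ≡ a * c
*-congˡ a refl = refl

∑ : (𝒜 → ℤ) → List 𝒜 → ℤ
∑ f []       = 0ℤ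
∑ f (x ∷ xs) = f x + ∑ f xs

∑-cong : ∀ {f g : 𝒜 → ℤ} xs → (∀ x → x ∈ xs → f x ≡ g x) → ∑ f xs ≡ ∑ g xs
∑-cong []       eq = refl
∑-cong (x ∷ xs) eq = cong₂ _+_ (eq x (here refl)) (∑-cong xs λ y y∈ → eq y (there y∈))

∑-cong′ : ∀ {f g : 𝒜 → ℤ} xs → (∀ x → f x ≡ g x) → ∑ f xs ≡ ∑ g xs
∑-cong′ xs eq = ∑-cong xs λ x _ → eq x

∑-zero : ∀ {f : 𝒜 → ℤ} xs → (∀ x → x ∈ xs → f x ≡ 0ℤ) → ∑ f xs ≡ 0ℤ
∑-zero []       eq = refl
∑-zero (x ∷ xs) eq = cong₂ _+_ (eq x (here refl)) (∑-zero xs λ y y∈ → eq y (there y∈))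

∑-+ : ∀ (f g : 𝒜 → ℤ) xs → ∑ (λ x → f x + g x) xs ≡ ∑ f xs + ∑ g xs
∑-+ f g []       = refl
∑-+ f g (x ∷ xs) = trans (+-congˡ (f x + g x) (∑-+ f g xs)) (lemma (f x) (g x) (∑ f xs) (∑ g xs))
  where
  lemma : ∀ a b c d → a + b + (c + d) ≡ a + c + (b + d)
  lemma = solve-∀

∑-*ˡ : ∀ c (f : 𝒜 → ℤ) xs → ∑ (λ x → c * f x) xs ≡ c * ∑ f xs
∑-*ˡ c f []       = sym (ℤₚ.*-zeroʳ c)
∑-*ˡ c f (x ∷ xs) = trans (+-congˡ (c * f x) (∑-*ˡ c f xs)) (sym (ℤₚ.*-distribˡ-+ c (f x) _))

∑-*ʳ : ∀ c (f : 𝒜 → ℤ) xs → ∑ (λ x → f x * c) xs ≡ ∑ f xs * c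
∑-*ʳ c f xs = trans (∑-cong′ xs λ x → ℤₚ.*-comm (f x) c) (trans (∑-*ˡ c f xs) (ℤₚ.*-comm c _))

∑-neg : ∀ (f : 𝒜 → ℤ) xs → ∑ (λ x → - f x) xs ≡ - ∑ f xs
∑-neg f []       = refl
∑-neg f (x ∷ xs) = trans (+-congˡ (- f x) (∑-neg f xs)) (sym (ℤₚ.neg-distrib-+ (f x) _))

∑-- : ∀ (f g : 𝒜 → ℤ) xs → ∑ (λ x → f x - g x) xs ≡ ∑ f xs - ∑ g xs
∑-- f g xs = trans (∑-+ f (λ x → - g x) xs) (+-congˡ (∑ f xs) (∑-neg g xs))

∑-++ : ∀ (f : 𝒜 → ℤ) xs ys → ∑ f (xs ++ ys) ≡ ∑ f xs + ∑ f ys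
∑-++ f []       ys = sym (ℤₚ.+-identityˡ _)
∑-++ f (x ∷ xs) ys = trans (+-congˡ (f x) (∑-++ f xs ys)) (sym (ℤₚ.+-assoc (f x) _ _))

∑-map : ∀ (f : ℬ → ℤ) (h : 𝒜 → ℬ) xs → ∑ f (map h xs) ≡ ∑ (f ∘ h) xs
∑-map f h []       = refl
∑-map f h (x ∷ xs) = +-congˡ (f (h x)) (∑-map f h xs)

∑-concatMap : ∀ (f : ℬ → ℤ) (h : 𝒜 → List ℬ) xs → ∑ f (concatMap h xs) ≡ ∑ (λ x → ∑ f (h x)) xs
∑-concatMap f h []       = refl
∑-concatMap f h (x ∷ xs) = trans (∑-++ f (h x) _) (+-congˡ (∑ f (h x)) (∑-concatMap f h xs))

∑-swap : ∀ (f : 𝒜 → ℬ → ℤ) xs ys → ∑ (λ x → ∑ (f x) ys) xs ≡ ∑ (λ y → ∑ (λ x → f x y) xs) ys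
∑-swap f []       ys = sym (∑-zero ys λ _ _ → refl)
∑-swap f (x ∷ xs) ys = trans (+-congˡ (∑ (f x) ys) (∑-swap f xs ys)) (sym (∑-+ (f x) (λ y → ∑ (λ x → f x y) xs) ys))

∑-single : ∀ {f : 𝒜 → ℤ} {xs a} → Unique xs → a ∈ xs →
  (∀ x → x ∈ xs → x ≢ a → f x ≡ 0ℤ) → ∑ f xs ≡ f a
∑-single {f = f} {x ∷ xs} (x∉ ∷ _) (here refl) z =
  trans (+-congˡ (f x) (∑-zero xs λ y y∈ → z y (there y∈) (All.lookup x∉ y∈ ∘ sym))) (ℤₚ.+-identityʳ (f x))
∑-single {f = f} {x ∷ xs} {a} (x∉ ∷ u) (there a∈) z =
  trans (cong₂ _+_ (z x (here refl) (All.lookup x∉ a∈)) (∑-single u a∈ λ y y∈ → z y (there y∈))) (ℤₚ.+-identityˡ (f a))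

∑-bound : ∀ {f : 𝒜 → ℤ} xs {b} → (∀ x → x ∈ xs → ∣ f x ∣ ℕ.≤ b) → ∣ ∑ f xs ∣ ℕ.≤ length xs ℕ.* b
∑-bound []       h = z≤n
∑-bound {f = f} (x ∷ xs) h = ℕₚ.≤-trans (ℤₚ.∣i+j∣≤∣i∣+∣j∣ (f x) _)
  (ℕₚ.+-mono-≤ (h x (here refl)) (∑-bound xs λ y y∈ → h y (there y∈)))

∑-nonNeg : ∀ {f : 𝒜 → ℤ} xs → (∀ x → x ∈ xs → 0ℤ ℤ.≤ f x) → 0ℤ ℤ.≤ ∑ f xs
∑-nonNeg []       h = ℤₚ.≤-refl
∑-nonNeg (x ∷ xs) h = ℤₚ.+-mono-≤ (h x (here refl)) (∑-nonNeg xs λ y y∈ → h y (there y∈))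

∑-member-≤ : ∀ {f : 𝒜 → ℤ} xs {a} → (∀ x → x ∈ xs → 0ℤ ℤ.≤ f x) → a ∈ xs → f a ℤ.≤ ∑ f xs
∑-member-≤ {f = f} (x ∷ xs) h (here refl) = subst (ℤ._≤ f x + ∑ f xs) (ℤₚ.+-identityʳ (f x))
  (ℤₚ.+-monoʳ-≤ (f x) (∑-nonNeg xs λ y y∈ → h y (there y∈)))
∑-member-≤ {f = f} (x ∷ xs) h (there a∈) = subst (ℤ._≤ f x + ∑ f xs) (ℤₚ.+-identityˡ _)
  (ℤₚ.+-mono-≤ (h x (here refl)) (∑-member-≤ xs (λ y y∈ → h y (there y∈)) a∈))

ind : {P : Set} → Dec P → ℤ
ind (yes _) = 1ℤ
ind (no _)  = 0ℤ

ind-yes : {P : Set} (d : Dec P) → P → ind d ≡ 1ℤ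
ind-yes (yes _) p = refl
ind-yes (no ¬p) p = contradiction p ¬p

ind-no : {P : Set} (d : Dec P) → ¬ P → ind d ≡ 0ℤ
ind-no (yes p) ¬p = contradiction p ¬p
ind-no (no _)  ¬p = refl

ind-cong : {P Q : Set} (d : Dec P) (e : Dec Q) → (P → Q) → (Q → P) → ind d ≡ ind e
ind-cong (yes p) e f g = sym (ind-yes e (f p))
ind-cong (no ¬p) e f g = sym (ind-no e (¬p ∘ g))

ind-≢0 : {P : Set} (d : Dec P) → ind d ≢ 0ℤ → P
ind-≢0 (yes p) _  = p
ind-≢0 (no _)  ne = contradiction refl ne

∣ind∣≤1 : {P : Set} (d : Dec P) → ∣ ind d ∣ ℕ.≤ 1
∣ind∣≤1 (yes _) = s≤s z≤n
∣ind∣≤1 (no _)  = z≤n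

*≢0ˡ : ∀ {a b} → a * b ≢ 0ℤ → a ≢ 0ℤ
*≢0ˡ ne refl = ne refl

*≢0ʳ : ∀ a {b} → a * b ≢ 0ℤ → b ≢ 0ℤ
*≢0ʳ a ne refl = ne (ℤₚ.*-zeroʳ a)

ind-*-bound : {P : Set} (d : Dec P) (x : ℤ) → ∣ ind d * x ∣ ℕ.≤ ∣ x ∣
ind-*-bound (yes _) x = ℕₚ.≤-reflexive (cong ∣_∣ (ℤₚ.*-identityˡ x))
ind-*-bound (no _)  x = z≤n

ind-*-cases : {P : Set} (d : Dec P) (x : ℤ) {b : ℕ} → (P → ∣ x ∣ ℕ.≤ b) → ∣ ind d * x ∣ ℕ.≤ b
ind-*-cases (yes p) x h = ℕₚ.≤-trans (ℕₚ.≤-reflexive (cong ∣_∣ (ℤₚ.*-identityˡ x))) (h p)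
ind-*-cases (no _)  x h = z≤n

ind-slice : {P Q : Set} (d : Dec P) (e : Dec Q) {c x s w : ℤ} → c ≡ ind d * ind e → (P → Q → x ≡ s * w) → c * x ≡ s * (ind d * ind e * w)
ind-slice (yes p) (yes q) {s = s} {w} refl h = trans (*-congˡ 1ℤ (h p q)) (lemma s w)
  where
  lemma : ∀ s w → 1ℤ * (s * w) ≡ s * (1ℤ * w)
  lemma = solve-∀
ind-slice (yes _) (no _) {s = s} refl h = sym (ℤₚ.*-zeroʳ s)
ind-slice (no _)  e      {s = s} refl h = sym (ℤₚ.*-zeroʳ s)

-- Both sums equal the double sum over the graph of `ψ`. Only nonzero terms have to be matched, so
-- sums over boxes of different sizes can be compared without any care for what happens at their
-- boundaries.
∑-reindex : {xs : List 𝒜} {ys : List ℬ} {f : 𝒜 → ℤ} {g : ℬ → ℤ}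
  (_≟B_ : ∀ (a b : ℬ) → Dec (a ≡ b)) (φ : ℬ → 𝒜) (ψ : 𝒜 → ℬ) →
  Unique xs → Unique ys →
  (∀ x → x ∈ xs → f x ≢ 0ℤ → ψ x ∈ ys × φ (ψ x) ≡ x × g (ψ x) ≡ f x) →
  (∀ y → y ∈ ys → g y ≢ 0ℤ → φ y ∈ xs × ψ (φ y) ≡ y × f (φ y) ≡ g y) →
  ∑ f xs ≡ ∑ g ys
∑-reindex {xs = xs} {ys} {f} {g} _≟B_ φ ψ ux uy to from =
  trans (∑-cong xs (λ x x∈ → sym (row x x∈))) (trans (∑-swap m xs ys) (∑-cong ys col))
  where
  m : _ → _ → ℤ
  m x y = ind (ψ x ≟B y) * f x
  row : ∀ x → x ∈ xs → ∑ (m x) ys ≡ f x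
  row x x∈ with f x ℤₚ.≟ 0ℤ
  ... | yes fx≡0 = trans (∑-zero ys λ y _ → trans (cong (ind (ψ x ≟B y) *_) fx≡0) (ℤₚ.*-zeroʳ (ind (ψ x ≟B y)))) (sym fx≡0)
  ... | no fx≢0 = trans
    (∑-single uy (proj₁ (to x x∈ fx≢0)) λ y _ y≢ → cong (_* f x) (ind-no (ψ x ≟B y) (y≢ ∘ sym)))
    (trans (cong (_* f x) (ind-yes (ψ x ≟B ψ x) refl)) (ℤₚ.*-identityˡ (f x)))
  offDiagonal : ∀ x → x ∈ xs → ∀ y → (ψ x ≡ y → f x ≢ 0ℤ → ⊥) → m x y ≡ 0ℤ
  offDiagonal x x∈ y h with f x ℤₚ.≟ 0ℤ | ψ x ≟B y
  ... | yes fx≡0 | d = trans (cong (ind d *_) fx≡0) (ℤₚ.*-zeroʳ (ind d))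
  ... | no fx≢0 | yes e = ⊥-elim (h e fx≢0)
  ... | no fx≢0 | no _  = refl
  col : ∀ y → y ∈ ys → ∑ (λ x → m x y) xs ≡ g y
  col y y∈ with g y ℤₚ.≟ 0ℤ
  ... | yes gy≡0 = trans (∑-zero xs λ x x∈ → offDiagonal x x∈ y λ { refl fx≢0 →
          fx≢0 (trans (sym (proj₂ (proj₂ (to x x∈ fx≢0)))) gy≡0) }) (sym gy≡0)
  ... | no gy≢0 = let φy∈ , ψφ , fφ = from y y∈ gy≢0 in trans
    (∑-single ux φy∈ λ x x∈ x≢ → offDiagonal x x∈ y λ { refl fx≢0 →
      x≢ (sym (proj₁ (proj₂ (to x x∈ fx≢0)))) })
    (trans (cong (_* f (φ y)) (ind-yes (ψ (φ y) ≟B y) ψφ)) (trans (ℤₚ.*-identityˡ _) fφ))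

interval : ℕ → List ℤ
interval b = map (λ k → + k - + b) (upTo (suc (b ℕ.+ b)))

∈-interval : ∀ {b z} → ∣ z ∣ ℕ.≤ b → z ∈ interval b
∈-interval {b} {z} z≤b = subst (_∈ interval b) eq (∈-map⁺ (λ k → + k - + b) (∈-upTo⁺ (s≤s k≤)))
  where
  0≤ : 0ℤ ℤ.≤ z + + b
  0≤ = subst (ℤ._≤ z + + b) (ℤₚ.+-inverseˡ (+ b)) (ℤₚ.+-monoˡ-≤ (+ b)
    (ℤₚ.≤-trans (ℤₚ.neg-mono-≤ (+≤+ z≤b)) (-∣∣≤ z)))
    where
    -∣∣≤ : ∀ z → - + ∣ z ∣ ℤ.≤ z
    -∣∣≤ (+ zero)  = ℤₚ.≤-refl
    -∣∣≤ (+ suc n) = -≤+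
    -∣∣≤ -[1+ n ]  = ℤₚ.≤-refl
  k≤ : ∣ z + + b ∣ ℕ.≤ b ℕ.+ b
  k≤ = ℕₚ.≤-trans (ℤₚ.∣i+j∣≤∣i∣+∣j∣ z (+ b)) (ℕₚ.+-monoˡ-≤ b z≤b)
  eq : + ∣ z + + b ∣ - + b ≡ z
  eq = trans (cong (_- + b) (ℤₚ.0≤i⇒+∣i∣≡i 0≤)) (cancel z (+ b))
    where
    cancel : ∀ z b → z + b - b ≡ z
    cancel = solve-∀

interval-unique : ∀ b → Unique (interval b)
interval-unique b = Uniqueₚ.map⁺
  (λ {x} {y} eq → ℤₚ.+-injective (trans (sym (cancel (+ x) (+ b))) (trans (cong (_+ + b) eq) (cancel (+ y) (+ b)))))
  (Uniqueₚ.upTo⁺ _)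
  where
  cancel : ∀ x b → x - b + b ≡ x
  cancel = solve-∀

∈-interval⁻ : ∀ {b z} → z ∈ interval b → ∣ z ∣ ℕ.≤ b
∈-interval⁻ {b} {z} z∈ with ∈-map⁻ (λ k → + k - + b) z∈
... | k , k∈ , refl with ∈-upTo⁻ k∈
... | s≤s k≤ = bound k≤
  where
  bound : ∀ {k} → k ℕ.≤ b ℕ.+ b → ∣ + k - + b ∣ ℕ.≤ b
  bound {k} k≤ with ℕₚ.≤-total b k
  ... | inj₁ b≤k = subst (ℕ._≤ b) (sym (cong ∣_∣ (trans (ℤₚ.m-n≡m⊖n k b) (ℤₚ.⊖-≥ b≤k))))
    (ℕₚ.m≤n+o⇒m∸n≤o k b k≤)
  ... | inj₂ k≤b = subst (ℕ._≤ b) (sym (trans (cong ∣_∣ (ℤₚ.m-n≡m⊖n k b)) (ℤₚ.∣⊖∣-≤ k≤b))) (ℕₚ.m∸n≤m b k)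

length-interval : ∀ b → length (interval b) ≡ suc (b ℕ.+ b)
length-interval b = trans (Listₚ.length-map (λ k → + k - + b) (upTo (suc (b ℕ.+ b)))) (Listₚ.length-upTo _)

cube : List ℤ → (m : ℕ) → List (Vec ℤ m)
cube xs zero    = [] ∷ []
cube xs (suc m) = cartesianProductWith _∷_ xs (cube xs m)

∈-cube : ∀ {xs m} (v : Vec ℤ m) → (∀ s → Vec.lookup v s ∈ xs) → v ∈ cube xs m
∈-cube []      h = here refl
∈-cube (x ∷ v) h = ∈-cartesianProductWith⁺ _∷_ (h zero) (∈-cube v (h ∘ suc))

∈-cube⁻ : ∀ {xs m} {v : Vec ℤ m} → v ∈ cube xs m → ∀ s → Vec.lookup v s ∈ xs
∈-cube⁻ {xs} {suc m} v∈ s with ∈-cartesianProductWith⁻ _∷_ xs (cube xs m) v∈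
∈-cube⁻ {xs} {suc m} v∈ zero    | x , w , x∈ , w∈ , refl = x∈
∈-cube⁻ {xs} {suc m} v∈ (suc s) | x , w , x∈ , w∈ , refl = ∈-cube⁻ w∈ s

cube-unique : ∀ {xs} m → Unique xs → Unique (cube xs m)
cube-unique zero    u = [] ∷ []
cube-unique (suc m) u = Uniqueₚ.cartesianProductWith⁺ _∷_ Vecₚ.∷-injective u (cube-unique m u)

length-cartesianProductWith : ∀ {𝒜 ℬ C : Set} (f : 𝒜 → ℬ → C) xs ys →
  length (cartesianProductWith f xs ys) ≡ length xs ℕ.* length ys
length-cartesianProductWith f []       ys = refl
length-cartesianProductWith f (x ∷ xs) ys = trans (Listₚ.length-++ (map (f x) ys))
  (cong₂ ℕ._+_ (Listₚ.length-map (f x) ys) (length-cartesianProductWith f xs ys))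

length-cube : ∀ xs m → length (cube xs m) ≡ length xs ℕ.^ m
length-cube xs zero    = refl
length-cube xs (suc m) = trans (length-cartesianProductWith _∷_ xs (cube xs m)) (cong (length xs ℕ.*_) (length-cube xs m))

_≟ᵛ_ : ∀ {m} (v w : Vec ℤ m) → Dec (v ≡ w)
_≟ᵛ_ = Vecₚ.≡-dec ℤₚ._≟_

-- Integer vectors

infixl 6 _⊕_ _⊖_
infixr 7 _⊙_

_⊕_ : ∀ {m} → Vec ℤ m → Vec ℤ m → Vec ℤ m
_⊕_ = Vec.zipWith _+_

_⊙_ : ∀ {m} → ℤ → Vec ℤ m → Vec ℤ m
c ⊙ v = Vec.map (c *_) v

neg : ∀ {m} → Vec ℤ m → Vec ℤ m
neg = Vec.map (-_)

_⊖_ : ∀ {m} → Vec ℤ m → Vec ℤ m → Vec ℤ m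
v ⊖ w = v ⊕ neg w

𝟎 : ∀ {m} → Vec ℤ m
𝟎 = Vec.replicate _ 0ℤ

⟨_,_⟩ : ∀ {m} → Vec ℤ m → Vec ℤ m → ℤ
⟨ [] , [] ⟩ = 0ℤ
⟨ x ∷ v , y ∷ w ⟩ = x * y + ⟨ v , w ⟩

‖_‖² : ∀ {m} → Vec ℤ m → ℤ
‖ v ‖² = ⟨ v , v ⟩

dot-comm : ∀ {m} (v w : Vec ℤ m) → ⟨ v , w ⟩ ≡ ⟨ w , v ⟩
dot-comm [] [] = refl
dot-comm (x ∷ v) (y ∷ w) = cong₂ _+_ (ℤₚ.*-comm x y) (dot-comm v w)

dot-⊕ʳ : ∀ {m} (u v w : Vec ℤ m) → ⟨ u , v ⊕ w ⟩ ≡ ⟨ u , v ⟩ + ⟨ u , w ⟩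
dot-⊕ʳ [] [] [] = refl
dot-⊕ʳ (x ∷ u) (y ∷ v) (z ∷ w) = trans (+-congˡ (x * (y + z)) (dot-⊕ʳ u v w)) (lemma x y z _ _)
  where
  lemma : ∀ x y z a b → x * (y + z) + (a + b) ≡ x * y + a + (x * z + b)
  lemma = solve-∀

dot-⊙ʳ : ∀ {m} c (u v : Vec ℤ m) → ⟨ u , c ⊙ v ⟩ ≡ c * ⟨ u , v ⟩
dot-⊙ʳ c [] [] = sym (ℤₚ.*-zeroʳ c)
dot-⊙ʳ c (x ∷ u) (y ∷ v) = trans (+-congˡ (x * (c * y)) (dot-⊙ʳ c u v)) (lemma c x y _)
  where
  lemma : ∀ c x y a → x * (c * y) + c * a ≡ c * (x * y + a)
  lemma = solve-∀

dot-negʳ : ∀ {m} (u v : Vec ℤ m) → ⟨ u , neg v ⟩ ≡ - ⟨ u , v ⟩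
dot-negʳ [] [] = refl
dot-negʳ (x ∷ u) (y ∷ v) = trans (+-congˡ (x * - y) (dot-negʳ u v)) (lemma x y _)
  where
  lemma : ∀ x y a → x * - y + - a ≡ - (x * y + a)
  lemma = solve-∀

dot-⊖ʳ : ∀ {m} (u v w : Vec ℤ m) → ⟨ u , v ⊖ w ⟩ ≡ ⟨ u , v ⟩ - ⟨ u , w ⟩
dot-⊖ʳ u v w = trans (dot-⊕ʳ u v (neg w)) (+-congˡ ⟨ u , v ⟩ (dot-negʳ u w))

dot-𝟎ʳ : ∀ {m} (u : Vec ℤ m) → ⟨ u , 𝟎 ⟩ ≡ 0ℤ
dot-𝟎ʳ []      = refl
dot-𝟎ʳ (x ∷ u) = cong₂ _+_ (ℤₚ.*-zeroʳ x) (dot-𝟎ʳ u)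

dot-⊕ˡ : ∀ {m} (u v w : Vec ℤ m) → ⟨ u ⊕ v , w ⟩ ≡ ⟨ u , w ⟩ + ⟨ v , w ⟩
dot-⊕ˡ u v w = trans (dot-comm (u ⊕ v) w) (trans (dot-⊕ʳ w u v) (cong₂ _+_ (dot-comm w u) (dot-comm w v)))

dot-⊙ˡ : ∀ {m} c (u v : Vec ℤ m) → ⟨ c ⊙ u , v ⟩ ≡ c * ⟨ u , v ⟩
dot-⊙ˡ c u v = trans (dot-comm (c ⊙ u) v) (trans (dot-⊙ʳ c v u) (cong (c *_) (dot-comm v u)))

dot-negˡ : ∀ {m} (u v : Vec ℤ m) → ⟨ neg u , v ⟩ ≡ - ⟨ u , v ⟩
dot-negˡ u v = trans (dot-comm (neg u) v) (trans (dot-negʳ v u) (cong (-_) (dot-comm v u)))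

norm-⊕ : ∀ {m} (v w : Vec ℤ m) → ‖ v ⊕ w ‖² ≡ ‖ v ‖² + + 2 * ⟨ v , w ⟩ + ‖ w ‖²
norm-⊕ v w = trans (dot-⊕ˡ v w (v ⊕ w)) (trans (cong₂ _+_ (dot-⊕ʳ v v w) (trans (dot-⊕ʳ w v w) (cong (_+ _) (dot-comm w v))))
  (lemma ‖ v ‖² ⟨ v , w ⟩ ‖ w ‖²))
  where
  lemma : ∀ a b c → a + b + (b + c) ≡ a + + 2 * b + c
  lemma = solve-∀

norm-⊙ : ∀ {m} c (v : Vec ℤ m) → ‖ c ⊙ v ‖² ≡ c * c * ‖ v ‖²
norm-⊙ c v = trans (dot-⊙ˡ c v (c ⊙ v)) (trans (cong (c *_) (dot-⊙ʳ c v v)) (sym (ℤₚ.*-assoc c c _)))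

norm-neg : ∀ {m} (v : Vec ℤ m) → ‖ neg v ‖² ≡ ‖ v ‖²
norm-neg v = trans (dot-negˡ v (neg v)) (trans (cong (-_) (dot-negʳ v v)) (ℤₚ.neg-involutive _))

i*i≥0 : ∀ i → 0ℤ ℤ.≤ i * i
i*i≥0 (+ n)    = subst (0ℤ ℤ.≤_) (ℤₚ.pos-* n n) (+≤+ z≤n)
i*i≥0 -[1+ n ] = +≤+ z≤n

norm≥0 : ∀ {m} (v : Vec ℤ m) → 0ℤ ℤ.≤ ‖ v ‖²
norm≥0 []      = ℤₚ.≤-refl
norm≥0 (x ∷ v) = ℤₚ.+-mono-≤ (i*i≥0 x) (norm≥0 v)

0≤i-j⇒j≤i : ∀ {i j} → 0ℤ ℤ.≤ i - j → j ℤ.≤ i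
0≤i-j⇒j≤i = ℤₚ.0≤i-j⇒j≤i

0≤*⇒0≤ : ∀ {a b} → 0ℤ ℤ.< a → 0ℤ ℤ.≤ a * b → 0ℤ ℤ.≤ b
0≤*⇒0≤ {+ suc n} {b} _ h = ℤₚ.*-cancelˡ-≤-pos 0ℤ b (+ suc n) (subst (ℤ._≤ + suc n * b) (sym (ℤₚ.*-zeroʳ (+ suc n))) h)
0≤*⇒0≤ {+ zero} (+<+ ()) _

-- ‖v‖²(‖v‖²‖w‖² − ⟨v,w⟩²) = ‖ ‖v‖² w − ⟨v,w⟩ v ‖²
cauchy-schwarz : ∀ {m} (v w : Vec ℤ m) → ⟨ v , w ⟩ * ⟨ v , w ⟩ ℤ.≤ ‖ v ‖² * ‖ w ‖²
cauchy-schwarz v w with ℤₚ.<-cmp 0ℤ ‖ v ‖²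
... | tri< 0<n _ _ = 0≤i-j⇒j≤i (0≤*⇒0≤ 0<n (subst (0ℤ ℤ.≤_) eq (norm≥0 (‖ v ‖² ⊙ w ⊖ ⟨ v , w ⟩ ⊙ v))))
  where
  n p q : ℤ
  n = ‖ v ‖²
  p = ⟨ v , w ⟩
  q = ‖ w ‖²
  eq : ‖ n ⊙ w ⊖ p ⊙ v ‖² ≡ n * (n * q - p * p)
  eq = trans (norm-⊕ (n ⊙ w) (neg (p ⊙ v)))
    (trans (cong₂ _+_ (cong₂ _+_ (norm-⊙ n w) (cong (+ 2 *_) (trans (dot-⊙ˡ n w _) (cong (n *_)
        (trans (dot-negʳ w (p ⊙ v)) (cong (-_) (trans (dot-⊙ʳ p w v) (cong (p *_) (dot-comm w v)))))))))
      (trans (norm-neg (p ⊙ v)) (norm-⊙ p v)))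
    (lemma n p q))
    where
    lemma : ∀ n p q → n * n * q + + 2 * (n * - (p * p)) + p * p * n ≡ n * (n * q - p * p)
    lemma = solve-∀
... | tri≈ _ 0≡n _ = ℤₚ.≤-reflexive (trans (cong₂ _*_ z z) (sym (trans (cong (_* ‖ w ‖²) (sym 0≡n)) (ℤₚ.*-zeroˡ ‖ w ‖²))))
  where
  norm≡0 : ∀ {m} (v w : Vec ℤ m) → ‖ v ‖² ≡ 0ℤ → ⟨ v , w ⟩ ≡ 0ℤ
  norm≡0 []      []      _ = refl
  norm≡0 (x ∷ v) (y ∷ w) e = cong₂ _+_ (cong (_* y) x≡0) (norm≡0 v w v≡0)
    where
    xx≤0 : x * x ℤ.≤ 0ℤ
    xx≤0 = subst₂ ℤ._≤_ (ℤₚ.+-identityʳ (x * x)) e (ℤₚ.+-monoʳ-≤ (x * x) (norm≥0 v))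
    xx≡0 : x * x ≡ 0ℤ
    xx≡0 = ℤₚ.≤-antisym xx≤0 (i*i≥0 x)
    x≡0 : x ≡ 0ℤ
    x≡0 with ℤₚ.i*j≡0⇒i≡0∨j≡0 x xx≡0
    ... | inj₁ p = p
    ... | inj₂ p = p
    v≡0 : ‖ v ‖² ≡ 0ℤ
    v≡0 = trans (sym (ℤₚ.+-identityˡ _)) (trans (cong (_+ ‖ v ‖²) (sym xx≡0)) e)
  z : ⟨ v , w ⟩ ≡ 0ℤ
  z = norm≡0 v w (sym 0≡n)
... | tri> _ _ n<0 = contradiction (norm≥0 v) (ℤₚ.<⇒≱ n<0)

lookup-⊕ : ∀ {m} (v w : Vec ℤ m) s → Vec.lookup (v ⊕ w) s ≡ Vec.lookup v s + Vec.lookup w s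
lookup-⊕ v w s = Vecₚ.lookup-zipWith _+_ s v w

lookup-⊙ : ∀ {m} c (v : Vec ℤ m) s → Vec.lookup (c ⊙ v) s ≡ c * Vec.lookup v s
lookup-⊙ c v s = Vecₚ.lookup-map s (c *_) v

lookup-neg : ∀ {m} (v : Vec ℤ m) s → Vec.lookup (neg v) s ≡ - Vec.lookup v s
lookup-neg v s = Vecₚ.lookup-map s (-_) v

lookup-⊖ : ∀ {m} (v w : Vec ℤ m) s → Vec.lookup (v ⊖ w) s ≡ Vec.lookup v s - Vec.lookup w s
lookup-⊖ v w s = trans (lookup-⊕ v (neg w) s) (+-congˡ (Vec.lookup v s) (lookup-neg w s))

vec-ext : ∀ {m} {v w : Vec ℤ m} → (∀ s → Vec.lookup v s ≡ Vec.lookup w s) → v ≡ w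
vec-ext {v = []}    {[]}    h = refl
vec-ext {v = x ∷ v} {y ∷ w} h = cong₂ _∷_ (h zero) (vec-ext (h ∘ suc))

lookup²≤norm : ∀ {m} (v : Vec ℤ m) s → Vec.lookup v s * Vec.lookup v s ℤ.≤ ‖ v ‖²
lookup²≤norm (x ∷ v) zero    = subst (ℤ._≤ x * x + ‖ v ‖²) (ℤₚ.+-identityʳ (x * x)) (ℤₚ.+-monoʳ-≤ (x * x) (norm≥0 v))
lookup²≤norm (x ∷ v) (suc s) = subst (ℤ._≤ x * x + ‖ v ‖²) (ℤₚ.+-identityˡ _) (ℤₚ.+-mono-≤ (i*i≥0 x) (lookup²≤norm v s))

∣i∣*∣i∣ : ∀ i → + (∣ i ∣ ℕ.* ∣ i ∣) ≡ i * i
∣i∣*∣i∣ i = trans (cong +_ (sym (ℤₚ.abs-* i i))) (ℤₚ.0≤i⇒+∣i∣≡i (i*i≥0 i))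

sq≤⇒∣∣≤ : ∀ i b → i * i ℤ.≤ + (b ℕ.* b) → ∣ i ∣ ℕ.≤ b
sq≤⇒∣∣≤ i b h = ℕₚ.≮⇒≥ λ b<i → ℕₚ.<⇒≱ (ℕₚ.*-mono-< b<i b<i)
  (ℤₚ.drop‿+≤+ (subst (ℤ._≤ + (b ℕ.* b)) (sym (∣i∣*∣i∣ i)) h))

∣i∣≤i² : ∀ i → + ∣ i ∣ ℤ.≤ i * i
∣i∣≤i² i = subst (+ ∣ i ∣ ℤ.≤_) (∣i∣*∣i∣ i) (+≤+ (lemma ∣ i ∣))
  where
  lemma : ∀ n → n ℕ.≤ n ℕ.* n
  lemma zero    = z≤n
  lemma (suc n) = ℕₚ.m≤m+n (suc n) (n ℕ.* suc n)

-- Finite differences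

Δ : (ℕ → ℤ) → ℕ → ℤ
Δ f j = f (suc j) - f j

Δ^ : ℕ → (ℕ → ℤ) → ℕ → ℤ
Δ^ zero    f = f
Δ^ (suc n) f = Δ^ n (Δ f)

Δ^-local : ∀ n {f g : ℕ → ℤ} j k → (∀ i → i ℕ.≤ n → f (j ℕ.+ i) ≡ g (k ℕ.+ i)) → Δ^ n f j ≡ Δ^ n g k
Δ^-local zero {f} {g} j k h =
  trans (cong f (sym (ℕₚ.+-identityʳ j))) (trans (h 0 z≤n) (cong g (ℕₚ.+-identityʳ k)))
Δ^-local (suc n) {f} {g} j k h = Δ^-local n j k λ i i≤n → cong₂ _-_
  (trans (cong f (sym (ℕₚ.+-suc j i))) (trans (h (suc i) (s≤s i≤n)) (cong g (ℕₚ.+-suc k i))))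
  (h i (ℕₚ.≤-trans i≤n (ℕₚ.n≤1+n n)))

Δ^-cong : ∀ n {f g : ℕ → ℤ} → (∀ i → f i ≡ g i) → ∀ j → Δ^ n f j ≡ Δ^ n g j
Δ^-cong n h j = Δ^-local n j j λ i _ → h (j ℕ.+ i)

Δ^-bound : ∀ n {f : ℕ → ℤ} {b} j → (∀ i → i ℕ.≤ n → ∣ f (j ℕ.+ i) ∣ ℕ.≤ b) → ∣ Δ^ n f j ∣ ℕ.≤ 2 ℕ.^ n ℕ.* b
Δ^-bound zero {f} {b} j h = subst₂ ℕ._≤_ (cong (∣_∣ ∘ f) (ℕₚ.+-identityʳ j)) (sym (ℕₚ.*-identityˡ b)) (h 0 z≤n)
Δ^-bound (suc n) {f} {b} j h = subst (∣ Δ^ n (Δ f) j ∣ ℕ.≤_) eq (Δ^-bound n {Δ f} {b ℕ.+ b} j λ i i≤n →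
  ℕₚ.≤-trans (ℤₚ.∣i-j∣≤∣i∣+∣j∣ (f (suc (j ℕ.+ i))) (f (j ℕ.+ i))) (ℕₚ.+-mono-≤
    (subst (λ z → ∣ f z ∣ ℕ.≤ b) (ℕₚ.+-suc j i) (h (suc i) (s≤s i≤n)))
    (h i (ℕₚ.≤-trans i≤n (ℕₚ.n≤1+n n)))))
  where
  eq : 2 ℕ.^ n ℕ.* (b ℕ.+ b) ≡ 2 ℕ.^ suc n ℕ.* b
  eq = trans (cong (2 ℕ.^ n ℕ.*_) (cong (b ℕ.+_) (sym (ℕₚ.+-identityʳ b))))
    (trans (sym (ℕₚ.*-assoc (2 ℕ.^ n) 2 b)) (cong (ℕ._* b) (ℕₚ.*-comm (2 ℕ.^ n) 2)))

Δ^-∑ : ∀ {A : Set} n (F : A → ℕ → ℤ) xs j → Δ^ n (λ j → ∑ (λ x → F x j) xs) j ≡ ∑ (λ x → Δ^ n (F x) j) xs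
Δ^-∑ zero    F xs j = refl
Δ^-∑ (suc n) F xs j = trans
  (Δ^-cong n (λ i → sym (∑-- (λ x → F x (suc i)) (λ x → F x i) xs)) j)
  (Δ^-∑ n (λ x → Δ (F x)) xs j)

Δ^-*ˡ : ∀ n c (f : ℕ → ℤ) j → Δ^ n (λ j → c * f j) j ≡ c * Δ^ n f j
Δ^-*ˡ zero    c f j = refl
Δ^-*ˡ (suc n) c f j = trans (Δ^-cong n (λ i → lemma c (f (suc i)) (f i)) j) (Δ^-*ˡ n c (Δ f) j)
  where
  lemma : ∀ c a b → c * a - c * b ≡ c * (a - b)
  lemma = solve-∀

-- Degree at most n, encoded by constancy of the n-th difference, so that no coefficients have to be
-- carried through products and powers.
IsPoly : ℕ → (ℕ → ℤ) → Set
IsPoly zero    f = ∀ j → f (suc j) ≡ f j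
IsPoly (suc n) f = IsPoly n (Δ f)

poly-Δ^ : ∀ n {f} → IsPoly n f → ∀ j → Δ^ (suc n) f j ≡ 0ℤ
poly-Δ^ zero {f} p j = trans (cong (_- f j) (p j)) (ℤₚ.+-inverseʳ (f j))
poly-Δ^ (suc n)  p j = poly-Δ^ n p j

poly-ext : ∀ n {f g} → (∀ i → f i ≡ g i) → IsPoly n f → IsPoly n g
poly-ext zero    h p j = trans (sym (h (suc j))) (trans (p j) (h j))
poly-ext (suc n) h p   = poly-ext n (λ i → cong₂ _-_ (h (suc i)) (h i)) p

poly-suc : ∀ n {f} → IsPoly n f → IsPoly n (f ∘ suc)
poly-suc zero    p j = p (suc j)
poly-suc (suc n) p   = poly-suc n p

poly-weaken : ∀ n {f} → IsPoly n f → IsPoly (suc n) f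
poly-weaken zero {f} p j = cong₂ _-_ (p (suc j)) (p j)
poly-weaken (suc n)  p   = poly-weaken n p

poly-+ : ∀ n {f g} → IsPoly n f → IsPoly n g → IsPoly n (λ j → f j + g j)
poly-+ zero    p q j = cong₂ _+_ (p j) (q j)
poly-+ (suc n) {f} {g} p q = poly-ext n (λ i → lemma (f (suc i)) (f i) (g (suc i)) (g i)) (poly-+ n p q)
  where
  lemma : ∀ a b c d → a - b + (c - d) ≡ a + c - (b + d)
  lemma = solve-∀

-- Induction on both degrees by the discrete Leibniz rule Δ(f g)(j) = f(j+1) Δg(j) + Δf(j) g(j).
poly-* : ∀ m n {f g} → IsPoly m f → IsPoly n g → IsPoly (m ℕ.+ n) (λ j → f j * g j)
poly-* zero zero p q j = cong₂ _*_ (p j) (q j)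
poly-* zero (suc n) {f} {g} p q = poly-ext n
  (λ i → trans (lemma (f i) (g (suc i)) (g i)) (cong (λ z → z * g (suc i) - f i * g i) (sym (p i))))
  (poly-* zero n {f} {Δ g} p q)
  where
  lemma : ∀ a b c → a * (b - c) ≡ a * b - a * c
  lemma = solve-∀
poly-* (suc m) zero {f} {g} p q = poly-ext (m ℕ.+ 0)
  (λ i → trans (lemma (f (suc i)) (f i) (g i)) (cong (λ z → f (suc i) * z - f i * g i) (sym (q i))))
  (poly-* m zero {Δ f} {g} p q)
  where
  lemma : ∀ a b c → (a - b) * c ≡ a * c - b * c
  lemma = solve-∀
poly-* (suc m) (suc n) {f} {g} p q = poly-ext (m ℕ.+ suc n) (λ i → lemma (f (suc i)) (f i) (g (suc i)) (g i))
  (poly-+ (m ℕ.+ suc n)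
    (subst (λ k → IsPoly k (λ j → f (suc j) * Δ g j)) (sym (ℕₚ.+-suc m n))
      (poly-* (suc m) n {f ∘ suc} {Δ g} (poly-suc (suc m) {f} p) q))
    (poly-* m (suc n) {Δ f} {g} p q))
  where
  lemma : ∀ a b c d → a * (c - d) + (a - b) * d ≡ a * c - b * d
  lemma = solve-∀

poly-const : ∀ c → IsPoly 0 (λ _ → c)
poly-const c j = refl

poly-id : IsPoly 1 (λ j → + j)
poly-id j = trans (lemma (+ j)) (sym (lemma′ (+ j)))
  where
  lemma : ∀ x → 1ℤ + (1ℤ + x) - (1ℤ + x) ≡ 1ℤ
  lemma = solve-∀
  lemma′ : ∀ x → 1ℤ + x - x ≡ 1ℤ
  lemma′ = solve-∀

poly-linear : ∀ a b → IsPoly 1 (λ j → a + + j * b)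
poly-linear a b = poly-+ 1 {λ _ → a} (poly-weaken 0 {λ _ → a} (poly-const a))
  (poly-* 1 0 {λ j → + j} {λ _ → b} poly-id (poly-const b))

poly-quadratic : ∀ a b c → IsPoly 2 (λ j → a + + j * b + + j * + j * c)
poly-quadratic a b c = poly-+ 2 {λ j → a + + j * b} (poly-weaken 1 {λ j → a + + j * b} (poly-linear a b))
  (poly-* 2 0 {λ j → + j * + j} {λ _ → c} (poly-* 1 1 {λ j → + j} {λ j → + j} poly-id poly-id) (poly-const c))

poly-^ : ∀ k n {f} → IsPoly n f → IsPoly (k ℕ.* n) (λ j → f j ℤ.^ k)
poly-^ zero    n p j = refl
poly-^ (suc k) n {f} p = poly-* n (k ℕ.* n) {f} p (poly-^ k n {f} p)

sumTo : ℕ → (ℕ → ℤ) → ℤ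
sumTo zero    f = 0ℤ
sumTo (suc n) f = sumTo n f + f n

sumTo-Δ : ∀ n h j → sumTo n (λ k → Δ h (j ℕ.+ k)) ≡ h (j ℕ.+ n) - h j
sumTo-Δ zero    h j = sym (trans (cong (λ z → h z - h j) (ℕₚ.+-identityʳ j)) (ℤₚ.+-inverseʳ (h j)))
sumTo-Δ (suc n) h j = trans (cong (_+ Δ h (j ℕ.+ n)) (sumTo-Δ n h j))
  (trans (lemma (h (j ℕ.+ n)) (h j) (h (suc (j ℕ.+ n)))) (cong (λ z → h z - h j) (sym (ℕₚ.+-suc j n))))
  where
  lemma : ∀ a b c → a - b + (c - a) ≡ c - b
  lemma = solve-∀

sumTo-bound : ∀ n {f b} → (∀ k → k ℕ.< n → ∣ f k ∣ ℕ.≤ b) → ∣ sumTo n f ∣ ℕ.≤ n ℕ.* b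
sumTo-bound zero    h = z≤n
sumTo-bound (suc n) {f} {b} h = ℕₚ.≤-trans (ℤₚ.∣i+j∣≤∣i∣+∣j∣ (sumTo n f) (f n))
  (ℕₚ.≤-trans (ℕₚ.+-mono-≤ (sumTo-bound n λ k k<n → h k (ℕₚ.<-trans k<n (ℕₚ.n<1+n n))) (h n (ℕₚ.n<1+n n)))
    (ℕₚ.≤-reflexive (ℕₚ.+-comm (n ℕ.* b) b)))

sumTo-shift : ∀ n c f → sumTo n (λ k → c - f k) ≡ + n * c - sumTo n f
sumTo-shift zero    c f = refl
sumTo-shift (suc n) c f = trans (cong (_+ (c - f n)) (sumTo-shift n c f)) (lemma (+ n) c (sumTo n f) (f n))
  where
  lemma : ∀ n c s x → n * c - s + (c - x) ≡ (1ℤ + n) * c - (s + x)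
  lemma = solve-∀

module _ (D : ℕ) .{{_ : NonZero D}} where

  Periodic : (ℕ → ℤ) → Set
  Periodic f = ∀ j → f (j ℕ.+ D) ≡ f j

  -- The values of Δh over a period sum to zero, so if they vary little they are all small.
  periodic-step : ∀ {h ε} → Periodic h → (∀ j → ∣ Δ (Δ h) j ∣ ℕ.≤ ε) → ∀ j → ∣ Δ h j ∣ ℕ.≤ D ℕ.* ε
  periodic-step {h} {ε} per small j = ℕₚ.*-cancelˡ-≤ D (subst (ℕ._≤ D ℕ.* (D ℕ.* ε)) abs-eq
    (sumTo-bound D λ k k<D → near k k<D))
    where
    g = Δ h
    near : ∀ k → k ℕ.< D → ∣ g j - g (j ℕ.+ k) ∣ ℕ.≤ D ℕ.* ε
    near k k<D = subst (ℕ._≤ D ℕ.* ε) (trans (cong ∣_∣ (sumTo-Δ k g j)) (ℤₚ.∣i-j∣≡∣j-i∣ (g (j ℕ.+ k)) (g j)))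
      (ℕₚ.≤-trans (sumTo-bound k λ i _ → small (j ℕ.+ i)) (ℕₚ.*-monoˡ-≤ ε (ℕₚ.<⇒≤ k<D)))
    total : sumTo D (λ k → g (j ℕ.+ k)) ≡ 0ℤ
    total = trans (sumTo-Δ D h j) (trans (cong (_- h j) (per j)) (ℤₚ.+-inverseʳ (h j)))
    eq : sumTo D (λ k → g j - g (j ℕ.+ k)) ≡ + D * g j
    eq = trans (sumTo-shift D (g j) (λ k → g (j ℕ.+ k)))
      (trans (cong (λ z → + D * g j - z) total) (ℤₚ.+-identityʳ (+ D * g j)))
    abs-eq : ∣ sumTo D (λ k → g j - g (j ℕ.+ k)) ∣ ≡ D ℕ.* ∣ g j ∣
    abs-eq = trans (cong ∣_∣ eq) (ℤₚ.abs-* (+ D) (g j))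

  periodic-Δ : ∀ {f} → Periodic f → Periodic (Δ f)
  periodic-Δ per j = cong₂ _-_ (per (suc j)) (per j)

  -- The differences of a periodic sequence are again periodic, so `periodic-step` applies at every
  -- level from the highest difference downwards; each descent costs a factor D.
  periodic-small : ∀ n {f ε} → Periodic f → (∀ j → ∣ Δ^ (suc n) f j ∣ ℕ.≤ ε) → ∀ j → ∣ Δ f j ∣ ℕ.≤ D ℕ.^ n ℕ.* ε
  periodic-small zero    {f} {ε} per small j = subst (∣ Δ f j ∣ ℕ.≤_) (sym (ℕₚ.*-identityˡ ε)) (small j)
  periodic-small (suc n) {f} {ε} per small j = subst (∣ Δ f j ∣ ℕ.≤_) (sym (ℕₚ.*-assoc D (D ℕ.^ n) ε))
    (periodic-step per (periodic-small n (periodic-Δ per) small) j)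

-- Radial weights and lattice sums

pos : ℤ → ℕ
pos (+ n)    = n
pos -[1+ _ ] = 0

pos-≢0 : ∀ {z} → pos z ≢ 0 → 0ℤ ℤ.< z
pos-≢0 {+ zero}   h = contradiction refl h
pos-≢0 {+ suc n}  h = +<+ (s≤s z≤n)
pos-≢0 { -[1+ n ]} h = contradiction refl h

pos-nonNeg : ∀ {z} → 0ℤ ℤ.≤ z → + pos z ≡ z
pos-nonNeg (+≤+ _) = refl

pos-neg : ∀ {z} → z ℤ.≤ 0ℤ → pos z ≡ 0
pos-neg (+≤+ z≤n) = refl
pos-neg -≤+       = refl

pos-mono : ∀ {y z} → y ℤ.≤ z → pos y ℕ.≤ pos z
pos-mono { -[1+ m ]}        _       = z≤n
pos-mono {+ m}       {+ n} (+≤+ h) = h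

pos-^ : ∀ {z} n → 0ℤ ℤ.≤ z → + (pos z ℕ.^ n) ≡ z ℤ.^ n
pos-^ zero    h = refl
pos-^ {z} (suc n) h = trans (ℤₚ.pos-* (pos z) (pos z ℕ.^ n)) (cong₂ _*_ (pos-nonNeg h) (pos-^ n h))

*-nonNeg : ∀ {a b} → 0ℤ ℤ.≤ a → 0ℤ ℤ.≤ b → 0ℤ ℤ.≤ a * b
*-nonNeg {+ a} {+ b} _ _ = subst (0ℤ ℤ.≤_) (ℤₚ.pos-* a b) (+≤+ z≤n)

*-monoˡ-≤ : ∀ {a b c} → 0ℤ ℤ.≤ c → a ℤ.≤ b → c * a ℤ.≤ c * b
*-monoˡ-≤ {a} {b} {+ c} _ h = ℤₚ.*-monoˡ-≤-nonNeg (+ c) h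

*-mono-≤ : ∀ {a b c d} → 0ℤ ℤ.≤ a → 0ℤ ℤ.≤ d → a ℤ.≤ b → c ℤ.≤ d → a * c ℤ.≤ b * d
*-mono-≤ {a} {b} {c} {d} 0≤a 0≤d a≤b c≤d = ℤₚ.≤-trans (*-monoˡ-≤ 0≤a c≤d)
  (subst₂ ℤ._≤_ (ℤₚ.*-comm d a) (ℤₚ.*-comm d b) (*-monoˡ-≤ 0≤d a≤b))

box : ℕ → (m : ℕ) → List (Vec ℤ m)
box b m = cube (interval b) m

box-unique : ∀ b m → Unique (box b m)
box-unique b m = cube-unique m (interval-unique b)

∈-box : ∀ b {m} (v : Vec ℤ m) → (∀ s → ∣ Vec.lookup v s ∣ ℕ.≤ b) → v ∈ box b m
∈-box b v h = ∈-cube v (λ s → ∈-interval (h s))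

∈-box⁻ : ∀ b {m} {v : Vec ℤ m} → v ∈ box b m → ∀ s → ∣ Vec.lookup v s ∣ ℕ.≤ b
∈-box⁻ b v∈ s = ∈-interval⁻ (∈-cube⁻ v∈ s)

length-box : ∀ b m → length (box b m) ≡ suc (b ℕ.+ b) ℕ.^ m
length-box b m = trans (length-cube (interval b) m) (cong (ℕ._^ m) (length-interval b))

_▷_·_ : ∀ {m} → Vec ℤ m → ℕ → Vec ℤ m → Vec ℤ m
X ▷ j · v = X ⊕ (+ j) ⊙ v

_◁_·_ : ∀ {m} → Vec ℤ m → ℕ → Vec ℤ m → Vec ℤ m
X ◁ j · v = X ⊖ (+ j) ⊙ v

lookup-▷ : ∀ {m} (X : Vec ℤ m) j v s → Vec.lookup (X ▷ j · v) s ≡ Vec.lookup X s + + j * Vec.lookup v s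
lookup-▷ X j v s = trans (lookup-⊕ X _ s) (+-congˡ (Vec.lookup X s) (lookup-⊙ (+ j) v s))

lookup-◁ : ∀ {m} (X : Vec ℤ m) j v s → Vec.lookup (X ◁ j · v) s ≡ Vec.lookup X s - + j * Vec.lookup v s
lookup-◁ X j v s = trans (lookup-⊖ X _ s) (cong (λ z → Vec.lookup X s - z) (lookup-⊙ (+ j) v s))

▷-◁ : ∀ {m} (X : Vec ℤ m) j v → (X ◁ j · v) ▷ j · v ≡ X
▷-◁ X j v = vec-ext λ s → trans (lookup-▷ (X ◁ j · v) j v s)
  (trans (cong (_+ + j * Vec.lookup v s) (lookup-◁ X j v s)) (lemma (Vec.lookup X s) (+ j * Vec.lookup v s)))
  where
  lemma : ∀ a b → a - b + b ≡ a
  lemma = solve-∀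

◁-▷ : ∀ {m} (X : Vec ℤ m) j v → (X ▷ j · v) ◁ j · v ≡ X
◁-▷ X j v = vec-ext λ s → trans (lookup-◁ (X ▷ j · v) j v s)
  (trans (cong (_- + j * Vec.lookup v s) (lookup-▷ X j v s)) (lemma (Vec.lookup X s) (+ j * Vec.lookup v s)))
  where
  lemma : ∀ a b → a + b - b ≡ a
  lemma = solve-∀

◁-+ : ∀ {m} (X : Vec ℤ m) i j v → X ◁ (i ℕ.+ j) · v ≡ (X ◁ j · v) ◁ i · v
◁-+ X i j v = vec-ext λ s → trans (lookup-◁ X (i ℕ.+ j) v s)
  (trans (trans (cong (λ z → Vec.lookup X s - z * Vec.lookup v s) (ℤₚ.pos-+ i j)) (lemma (Vec.lookup X s) (+ i) (+ j) (Vec.lookup v s)))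
    (sym (trans (lookup-◁ (X ◁ j · v) i v s) (cong (_- + i * Vec.lookup v s) (lookup-◁ X j v s)))))
  where
  lemma : ∀ x i j v → x - (i + j) * v ≡ x - j * v - i * v
  lemma = solve-∀

◁-▷-+ : ∀ {m} (X : Vec ℤ m) i j v → (X ▷ i · v) ◁ (j ℕ.+ i) · v ≡ X ◁ j · v
◁-▷-+ X i j v = trans (◁-+ (X ▷ i · v) j i v) (cong (_◁ j · v) (◁-▷ X i v))

norm-▷ : ∀ {m} (X : Vec ℤ m) j v → ‖ X ▷ j · v ‖² ≡ ‖ X ‖² + + j * (+ 2 * ⟨ X , v ⟩) + + j * + j * ‖ v ‖²
norm-▷ X j v = trans (norm-⊕ X ((+ j) ⊙ v)) (cong₂ _+_
  (+-congˡ ‖ X ‖² (trans (cong (+ 2 *_) (dot-⊙ʳ (+ j) X v)) (lemma (+ j) ⟨ X , v ⟩)))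
  (norm-⊙ (+ j) v))
  where
  lemma : ∀ j x → + 2 * (j * x) ≡ j * (+ 2 * x)
  lemma = solve-∀

∣lookup∣-▷ : ∀ {m} (X : Vec ℤ m) {j} v s {b c n} → ∣ Vec.lookup X s ∣ ℕ.≤ b → ∣ Vec.lookup v s ∣ ℕ.≤ c → j ℕ.≤ n →
  ∣ Vec.lookup (X ◁ j · v) s ∣ ℕ.≤ b ℕ.+ n ℕ.* c
∣lookup∣-▷ X {j} v s hb hc hn = subst (ℕ._≤ _) (cong ∣_∣ (sym (lookup-◁ X j v s)))
  (ℕₚ.≤-trans (ℤₚ.∣i-j∣≤∣i∣+∣j∣ (Vec.lookup X s) _) (ℕₚ.+-mono-≤ hb
    (subst (ℕ._≤ _) (sym (ℤₚ.abs-* (+ j) (Vec.lookup v s))) (ℕₚ.*-mono-≤ hn hc))))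

0^2* : ∀ k → .{{NonZero k}} → 0 ℕ.^ (2 ℕ.* k) ≡ 0
0^2* (suc k) = refl

-- The differences of (A − σ‖X‖²)₊^(2k) along a line vanish where it is polynomial; otherwise the
-- line segment meets the sphere, near which the function is at most (E A)^k.
module NearInvariance {m : ℕ} (k : ℕ) .{{_ : NonZero k}} (σ : ℤ) (0≤σ : 0ℤ ℤ.≤ σ) where

  gap : ℕ → Vec ℤ m → ℤ
  gap A X = + A - σ * ‖ X ‖²

  bump : ℕ → Vec ℤ m → ℤ
  bump A X = + (pos (gap A X) ℕ.^ (2 ℕ.* k))

  -- Along a line the weight is a quadratic to the power 2k times a linear function, of degree 4k +
  -- 1; one difference more annihilates it.
  degree order : ℕ
  degree = 2 ℕ.* k ℕ.* 2 ℕ.+ 1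
  order  = suc degree

  -- With L = `order`, the constant in (2tβ + t²c)² ≤ 2(2tβ)² + 2(t²c)² under |t| ≤ L, β² ≤ C A and
  -- c ≤ C.
  E : ℕ → ℕ
  E C = 8 ℕ.* (order ℕ.* order) ℕ.* C ℕ.+ 2 ℕ.* (order ℕ.* order ℕ.* (order ℕ.* order)) ℕ.* (C ℕ.* C)

  gap-▷ : ∀ A X j v → gap A (X ▷ j · v) ≡ gap A X + + j * (- (σ * (+ 2 * ⟨ X , v ⟩))) + + j * + j * (- (σ * ‖ v ‖²))
  gap-▷ A X j v = trans (cong (λ z → + A - σ * z) (norm-▷ X j v)) (lemma (+ A) σ ‖ X ‖² (+ j) (+ 2 * ⟨ X , v ⟩) ‖ v ‖²)
    where
    lemma : ∀ A σ n j x q → A - σ * (n + j * x + j * j * q) ≡ A - σ * n + j * (- (σ * x)) + j * j * (- (σ * q))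
    lemma = solve-∀

  -- On the way from X to a point outside, `gap` drops by 2tβ + t²c with β = σ⟨X,v⟩ and c = σ‖v‖².
  -- Cauchy-Schwarz gives β² ≤ C A. Hence within boundedly many steps of the sphere `gap` is only
  -- O(√A), against a maximum of A.
  layer : ∀ {A C} (X Y v : Vec ℤ m) t → Y ≡ X ⊕ t ⊙ v → ∣ t ∣ ℕ.≤ order → σ * ‖ v ‖² ℤ.≤ + C →
    0ℤ ℤ.≤ gap A X → gap A Y ℤ.< 0ℤ → pos (gap A X) ℕ.* pos (gap A X) ℕ.≤ E C ℕ.* A
  -- For A = 0 the estimate c² ≤ C² A of the general case breaks down, but then `gap` is nowhere
  -- positive.
  layer {zero} {C} X Y v t refl t≤ c≤C inside outside rewrite pos-neg {gap 0 X}
    (subst (ℤ._≤ 0ℤ) (sym (ℤₚ.+-identityˡ _)) (ℤₚ.neg-mono-≤ (*-nonNeg 0≤σ (norm≥0 X)))) = z≤n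
  layer {A@(suc _)} {C} X Y v t refl t≤ c≤C inside outside = ℤₚ.drop‿+≤+ (begin
    + (pos g ℕ.* pos g)                                                         ≡⟨ ℤₚ.pos-* (pos g) (pos g) ⟩
    + pos g * + pos g                                                           ≡⟨ cong₂ _*_ (pos-nonNeg inside) (pos-nonNeg inside) ⟩
    g * g                                                                       ≤⟨ *-mono-≤ inside 0≤δ g≤δ g≤δ ⟩
    δ * δ                                                                       ≤⟨ square-sum (+ 2 * t * β) (t * t * c) ⟩
    + 2 * ((+ 2 * t * β) * (+ 2 * t * β)) + + 2 * (t * t * c * (t * t * c))      ≡⟨ rearrange t β c ⟩
    + 8 * (t * t) * (β * β) + + 2 * (t * t * (t * t)) * (c * c)                 ≤⟨ ℤₚ.+-mono-≤ (*-mono-≤ (*-nonNeg {+ 8} (+≤+ z≤n) (i*i≥0 t)) (*-nonNeg 0≤C 0≤A) (*-monoˡ-≤ {c = + 8} (+≤+ z≤n) tt≤) ββ≤)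
                                                                                     (*-mono-≤ (*-nonNeg {+ 2} (+≤+ z≤n) (i*i≥0 (t * t))) (*-nonNeg (*-nonNeg 0≤C 0≤C) 0≤A) (*-monoˡ-≤ {c = + 2} (+≤+ z≤n) (*-mono-≤ (i*i≥0 t) (*-nonNeg 0≤L 0≤L) tt≤ tt≤)) cc≤) ⟩
    + 8 * (L * L) * (+ C * + A) + + 2 * (L * L * (L * L)) * (+ C * + C * + A)   ≡⟨ collect L (+ C) (+ A) ⟩
    (+ 8 * (L * L) * + C + + 2 * (L * L * (L * L)) * (+ C * + C)) * + A         ≡⟨ push ⟨
    + (E C ℕ.* A)                                                               ∎)
    where
    open ℤₚ.≤-Reasoning
    g δ β c L : ℤ
    g = gap A X
    β = σ * ⟨ X , v ⟩
    c = σ * ‖ v ‖²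
    δ = + 2 * t * β + t * t * c
    L = + order
    0≤L : 0ℤ ℤ.≤ L
    0≤L = +≤+ z≤n
    0≤C : 0ℤ ℤ.≤ + C
    0≤C = +≤+ z≤n
    0≤A : 0ℤ ℤ.≤ + A
    0≤A = +≤+ z≤n
    0≤c : 0ℤ ℤ.≤ c
    0≤c = *-nonNeg 0≤σ (norm≥0 v)
    gapY : gap A Y ≡ g - δ
    gapY = trans (cong (λ z → + A - σ * z) (trans (norm-⊕ X (t ⊙ v)) (cong₂ (λ y z → ‖ X ‖² + + 2 * y + z) (dot-⊙ʳ t X v) (norm-⊙ t v))))
      (lemma (+ A) σ ‖ X ‖² t ⟨ X , v ⟩ ‖ v ‖²)
      where
      lemma : ∀ A σ n t x q → A - σ * (n + + 2 * (t * x) + t * t * q) ≡ A - σ * n - (+ 2 * t * (σ * x) + t * t * (σ * q))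
      lemma = solve-∀
    g≤δ : g ℤ.≤ δ
    g≤δ = ℤₚ.i-j≤0⇒i≤j (subst (ℤ._≤ 0ℤ) gapY (ℤₚ.<⇒≤ outside))
    0≤δ : 0ℤ ℤ.≤ δ
    0≤δ = ℤₚ.≤-trans inside g≤δ
    square-sum : ∀ x y → (x + y) * (x + y) ℤ.≤ + 2 * (x * x) + + 2 * (y * y)
    square-sum x y = 0≤i-j⇒j≤i (subst (0ℤ ℤ.≤_) (lemma x y) (i*i≥0 (x - y)))
      where
      lemma : ∀ x y → (x - y) * (x - y) ≡ + 2 * (x * x) + + 2 * (y * y) - (x + y) * (x + y)
      lemma = solve-∀
    rearrange : ∀ t β c → + 2 * ((+ 2 * t * β) * (+ 2 * t * β)) + + 2 * (t * t * c * (t * t * c)) ≡ + 8 * (t * t) * (β * β) + + 2 * (t * t * (t * t)) * (c * c)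
    rearrange = solve-∀
    tt≤ : t * t ℤ.≤ L * L
    tt≤ = subst₂ ℤ._≤_ (∣i∣*∣i∣ t) (ℤₚ.pos-* order order) (+≤+ (ℕₚ.*-mono-≤ t≤ t≤))
    p≤A : σ * ‖ X ‖² ℤ.≤ + A
    p≤A = 0≤i-j⇒j≤i inside
    ββ≤ : β * β ℤ.≤ + C * + A
    ββ≤ = ℤₚ.≤-trans (subst₂ ℤ._≤_ (lemma₁ σ ⟨ X , v ⟩) (lemma₂ σ ‖ X ‖² ‖ v ‖²)
      (*-monoˡ-≤ (i*i≥0 σ) (cauchy-schwarz X v)))
      (*-mono-≤ 0≤c 0≤A c≤C p≤A)
      where
      lemma₁ : ∀ σ x → σ * σ * (x * x) ≡ σ * x * (σ * x)
      lemma₁ = solve-∀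
      lemma₂ : ∀ σ n q → σ * σ * (n * q) ≡ σ * q * (σ * n)
      lemma₂ = solve-∀
    cc≤ : c * c ℤ.≤ + C * + C * + A
    cc≤ = ℤₚ.≤-trans (*-mono-≤ 0≤c 0≤C c≤C c≤C)
      (subst (ℤ._≤ + C * + C * + A) (ℤₚ.*-identityʳ (+ C * + C)) (*-monoˡ-≤ {1ℤ} {+ A} (*-nonNeg 0≤C 0≤C) (+≤+ (s≤s z≤n))))
    collect : ∀ L C A → + 8 * (L * L) * (C * A) + + 2 * (L * L * (L * L)) * (C * C * A) ≡ (+ 8 * (L * L) * C + + 2 * (L * L * (L * L)) * (C * C)) * A
    collect = solve-∀
    push : + (E C ℕ.* A) ≡ (+ 8 * (L * L) * + C + + 2 * (L * L * (L * L)) * (+ C * + C)) * + A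
    push = trans (ℤₚ.pos-* (E C) A) (cong (_* + A) (trans (ℤₚ.pos-+ (8 ℕ.* (order ℕ.* order) ℕ.* C) (2 ℕ.* (order ℕ.* order ℕ.* (order ℕ.* order)) ℕ.* (C ℕ.* C))) (cong₂ _+_
      (trans (ℤₚ.pos-* (8 ℕ.* (order ℕ.* order)) C) (cong (_* + C) (trans (ℤₚ.pos-* 8 (order ℕ.* order)) (cong (+ 8 *_) LL))))
      (trans (ℤₚ.pos-* (2 ℕ.* (order ℕ.* order ℕ.* (order ℕ.* order))) (C ℕ.* C)) (cong₂ _*_
        (trans (ℤₚ.pos-* 2 (order ℕ.* order ℕ.* (order ℕ.* order))) (cong (+ 2 *_) (trans (ℤₚ.pos-* (order ℕ.* order) (order ℕ.* order)) (cong₂ _*_ LL LL))))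
        (ℤₚ.pos-* C C))))))
      where
      LL : + (order ℕ.* order) ≡ L * L
      LL = ℤₚ.pos-* order order

  bump-bound : ∀ {A C} (X Y v : Vec ℤ m) t → Y ≡ X ⊕ t ⊙ v → ∣ t ∣ ℕ.≤ order → σ * ‖ v ‖² ℤ.≤ + C →
    gap A Y ℤ.< 0ℤ → 0ℤ ℤ.≤ gap A X → pos (gap A X) ℕ.^ (2 ℕ.* k) ℕ.≤ (E C ℕ.* A) ℕ.^ k
  bump-bound {A} {C} X Y v t Y≡ t≤ c≤C outside inside = subst (ℕ._≤ (E C ℕ.* A) ℕ.^ k) (ℕₚ.^-*-assoc (pos (gap A X)) 2 k)
    (ℕₚ.^-monoˡ-≤ k (subst (ℕ._≤ E C ℕ.* A) (cong (pos (gap A X) ℕ.*_) (sym (ℕₚ.*-identityʳ _))) (layer X Y v t Y≡ t≤ c≤C inside outside)))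

  module Weighted (w : Vec ℤ m) (w₀ : ℤ) where

    -- The constant 1 yields the masses of residue classes and the slices of the laws, a coordinate
    -- function yields first moments.
    weight : Vec ℤ m → ℤ
    weight X = w₀ + ⟨ w , X ⟩

    F : ℕ → Vec ℤ m → ℤ
    F A X = bump A X * weight X

    F-bound : ∀ {A b lb} X → (0ℤ ℤ.≤ gap A X → ∣ weight X ∣ ℕ.≤ lb) →
      (0ℤ ℤ.≤ gap A X → pos (gap A X) ℕ.^ (2 ℕ.* k) ℕ.≤ b) → ∣ F A X ∣ ℕ.≤ b ℕ.* lb
    F-bound {A} {b} {lb} X hl hb = subst (ℕ._≤ b ℕ.* lb) (sym (ℤₚ.abs-* (bump A X) (weight X))) (split (ℤₚ.≤-total 0ℤ (gap A X)))
      where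
      split : 0ℤ ℤ.≤ gap A X ⊎ gap A X ℤ.≤ 0ℤ → pos (gap A X) ℕ.^ (2 ℕ.* k) ℕ.* ∣ weight X ∣ ℕ.≤ b ℕ.* lb
      split (inj₁ inside)  = ℕₚ.*-mono-≤ (hb inside) (hl inside)
      split (inj₂ outside) = subst (λ z → z ℕ.* ∣ weight X ∣ ℕ.≤ b ℕ.* lb)
        (sym (trans (cong (ℕ._^ (2 ℕ.* k)) (pos-neg outside)) (0^2* k))) z≤n

    F-poly : ∀ A Y v → (∀ i → i ℕ.≤ order → 0ℤ ℤ.≤ gap A (Y ▷ i · v)) → Δ^ order (λ i → F A (Y ▷ i · v)) 0 ≡ 0ℤ
    F-poly A Y v inside = trans (Δ^-local order {λ i → F A (Y ▷ i · v)} {f} 0 0 λ i i≤ → cong₂ _*_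
        (trans (pos-^ (2 ℕ.* k) (inside i i≤)) (cong (ℤ._^ (2 ℕ.* k)) (gap-▷ A Y i v)))
        (weight-▷ i))
      (poly-Δ^ degree {f} (poly-* (2 ℕ.* k ℕ.* 2) 1 {λ i → quad i ℤ.^ (2 ℕ.* k)} {lin}
        (poly-^ (2 ℕ.* k) 2 {quad} (poly-quadratic a b c)) (poly-linear (weight Y) ⟨ w , v ⟩)) 0)
      where
      a b c : ℤ
      a = gap A Y
      b = - (σ * (+ 2 * ⟨ Y , v ⟩))
      c = - (σ * ‖ v ‖²)
      quad lin f : ℕ → ℤ
      quad i = a + + i * b + + i * + i * c
      lin i = weight Y + + i * ⟨ w , v ⟩
      f i = quad i ℤ.^ (2 ℕ.* k) * lin i
      weight-▷ : ∀ i → weight (Y ▷ i · v) ≡ lin i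
      weight-▷ i = trans (cong (λ z → w₀ + z) (trans (dot-⊕ʳ w Y ((+ i) ⊙ v)) (+-congˡ ⟨ w , Y ⟩ (dot-⊙ʳ (+ i) w v))))
        (sym (ℤₚ.+-assoc w₀ ⟨ w , Y ⟩ (+ i * ⟨ w , v ⟩)))

    F-difference : ∀ {A C lb} → (∀ X → 0ℤ ℤ.≤ gap A X → ∣ weight X ∣ ℕ.≤ lb) →
      ∀ v → σ * ‖ v ‖² ℤ.≤ + C → ∀ Y →
      ∣ Δ^ order (λ i → F A (Y ▷ i · v)) 0 ∣ ℕ.≤ 2 ℕ.^ order ℕ.* ((E C ℕ.* A) ℕ.^ k ℕ.* lb)
    F-difference {A} {C} {lb} hl v c≤C Y with ℕₚ.anyUpTo? (λ i → gap A (Y ▷ i · v) ℤₚ.<? 0ℤ) (suc order)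
    ... | no none = subst (ℕ._≤ 2 ℕ.^ order ℕ.* ((E C ℕ.* A) ℕ.^ k ℕ.* lb)) (cong ∣_∣ (sym (F-poly A Y v λ i i≤ →
            ℤₚ.≮⇒≥ λ lt → none (i , s≤s i≤ , lt)))) z≤n
    ... | yes (j , s≤s j≤ , outside) = Δ^-bound order {λ i → F A (Y ▷ i · v)} 0 λ i i≤ → F-bound {b = (E C ℕ.* A) ℕ.^ k} (Y ▷ i · v) (hl (Y ▷ i · v))
            (bump-bound (Y ▷ i · v) (Y ▷ j · v) v (+ j - + i) (line i) (diff i≤ j≤) c≤C outside)
      where
      diff : ∀ {i} → i ℕ.≤ order → j ℕ.≤ order → ∣ + j - + i ∣ ℕ.≤ order
      diff {i} i≤ j≤ with ℕₚ.≤-total i j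
      ... | inj₁ i≤j = subst (ℕ._≤ order) (sym (cong ∣_∣ (trans (ℤₚ.m-n≡m⊖n j i) (ℤₚ.⊖-≥ i≤j)))) (ℕₚ.≤-trans (ℕₚ.m∸n≤m j i) j≤)
      ... | inj₂ j≤i = subst (ℕ._≤ order) (sym (trans (cong ∣_∣ (ℤₚ.m-n≡m⊖n j i)) (ℤₚ.∣⊖∣-≤ j≤i))) (ℕₚ.≤-trans (ℕₚ.m∸n≤m i j) i≤)
      line : ∀ i → Y ▷ j · v ≡ (Y ▷ i · v) ⊕ (+ j - + i) ⊙ v
      line i = vec-ext λ s → trans (lookup-▷ Y j v s) (sym (trans (lookup-⊕ (Y ▷ i · v) _ s)
        (trans (cong₂ _+_ (lookup-▷ Y i v s) (lookup-⊙ (+ j - + i) v s)) (lemma (Vec.lookup Y s) (+ i) (+ j) (Vec.lookup v s)))))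
        where
        lemma : ∀ y i j v → y + i * v + (j - i) * v ≡ y + j * v
        lemma = solve-∀

    -- As a function of j, the sum of χ(X - j v) F(X) has period D. The substitution X = Y + i v
    -- moves the step from `χ` to `F`, so the differences of this sequence of order `order` are sums
    -- of differences of `F` along v, which are small. By `periodic-small` the sequence is then
    -- nearly constant, and the claim compares its values at j = 1 and j = 0.
    near-invariance : ∀ {A B C V lb} (D : ℕ) → .{{_ : NonZero D}} →
      (χ : Vec ℤ m → ℤ) (v : Vec ℤ m) →
      (∀ X → ∣ χ X ∣ ℕ.≤ 1) → (∀ X → χ (X ◁ D · v) ≡ χ X) →
      (∀ X → 0ℤ ℤ.≤ gap A X → ∣ weight X ∣ ℕ.≤ lb) →
      (∀ X s → 0ℤ ℤ.≤ gap A X → ∣ Vec.lookup X s ∣ ℕ.≤ B) →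
      σ * ‖ v ‖² ℤ.≤ + C → (∀ s → ∣ Vec.lookup v s ∣ ℕ.≤ V) →
      ∣ ∑ (λ X → χ (X ⊖ v) * F A X) (box B m) - ∑ (λ X → χ X * F A X) (box B m) ∣ ℕ.≤
        D ℕ.^ degree ℕ.* (length (box (B ℕ.+ order ℕ.* V) m) ℕ.* (2 ℕ.^ order ℕ.* ((E C ℕ.* A) ℕ.^ k ℕ.* lb)))
    near-invariance {A} {B} {C} {V} {lb} D χ v χ≤1 χ-per hl hB c≤C hV =
      subst (ℕ._≤ D ℕ.^ degree ℕ.* ε) (cong ∣_∣ (cong₂ _-_
          (∑-cong′ (box B m) λ X → cong (λ z → χ (X ⊖ z) * F A X) 1⊙v)
          (∑-cong′ (box B m) λ X → cong (λ z → χ z * F A X) (0⊙v X))))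
        (periodic-small D degree {s} {ε} s-periodic s-small 0)
      where
      ε : ℕ
      ε = length (box (B ℕ.+ order ℕ.* V) m) ℕ.* (2 ℕ.^ order ℕ.* ((E C ℕ.* A) ℕ.^ k ℕ.* lb))
      -- Large enough to contain X - i v for every X in the original box and every i ≤ `order`.
      big : List (Vec ℤ m)
      big = box (B ℕ.+ order ℕ.* V) m
      s : ℕ → ℤ
      s j = ∑ (λ X → χ (X ◁ j · v) * F A X) (box B m)
      1⊙v : (+ 1) ⊙ v ≡ v
      1⊙v = vec-ext λ s → trans (lookup-⊙ (+ 1) v s) (ℤₚ.*-identityˡ (Vec.lookup v s))
      0⊙v : ∀ X → X ◁ 0 · v ≡ X
      0⊙v X = vec-ext λ s → trans (lookup-◁ X 0 v s) (ℤₚ.+-identityʳ (Vec.lookup X s))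
      s-periodic : Periodic D s
      s-periodic j = ∑-cong′ (box B m) λ X → cong (_* F A X) (trans (cong χ (trans (cong (λ z → X ◁ z · v) (ℕₚ.+-comm j D)) (◁-+ X D j v)))
        (χ-per (X ◁ j · v)))
      F≢0⇒inside : ∀ {X} → F A X ≢ 0ℤ → 0ℤ ℤ.≤ gap A X
      F≢0⇒inside {X} ne with ℤₚ.≤-total 0ℤ (gap A X)
      ... | inj₁ h = h
      ... | inj₂ h = contradiction (ℤₚ.∣i∣≡0⇒i≡0 (ℕₚ.n≤0⇒n≡0 (F-bound {b = 0} {lb = ∣ weight X ∣} X (λ _ → ℕₚ.≤-refl)
              (λ h′ → subst (ℕ._≤ 0) (sym (zero^ (ℤₚ.≤-antisym h h′))) z≤n)))) ne
        where
        zero^ : gap A X ≡ 0ℤ → pos (gap A X) ℕ.^ (2 ℕ.* k) ≡ 0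
        zero^ e = trans (cong (λ z → pos z ℕ.^ (2 ℕ.* k)) e) (0^2* k)
      translate : ∀ j i → i ℕ.≤ order → s (j ℕ.+ i) ≡ ∑ (λ Y → χ (Y ◁ j · v) * F A (Y ▷ i · v)) big
      translate j i i≤ = ∑-reindex _≟ᵛ_ (_▷ i · v) (_◁ i · v) (box-unique B m) (box-unique (B ℕ.+ order ℕ.* V) m)
        (λ X X∈ _ → ∈-box (B ℕ.+ order ℕ.* V) (X ◁ i · v) (λ s → ∣lookup∣-▷ X v s (∈-box⁻ B X∈ s) (hV s) i≤) , ▷-◁ X i v ,
          cong₂ (λ y z → χ y * F A z) (trans (sym (◁-+ X j i v)) refl) (▷-◁ X i v))
        (λ Y Y∈ ne → ∈-box B (Y ▷ i · v) (λ s → hB (Y ▷ i · v) s (F≢0⇒inside (*≢0ʳ (χ (Y ◁ j · v)) ne))) , ◁-▷ Y i v ,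
          cong (λ y → χ y * F A (Y ▷ i · v)) (◁-▷-+ Y i j v))
      s-small : ∀ j → ∣ Δ^ order s j ∣ ℕ.≤ ε
      s-small j = subst (ℕ._≤ ε) (cong ∣_∣ (sym (trans
          (Δ^-local order {s} {λ i → ∑ (λ Y → χ (Y ◁ j · v) * F A (Y ▷ i · v)) big} j 0 (translate j))
          (trans (Δ^-∑ order (λ Y i → χ (Y ◁ j · v) * F A (Y ▷ i · v)) big 0)
            (∑-cong′ big λ Y → Δ^-*ˡ order (χ (Y ◁ j · v)) (λ i → F A (Y ▷ i · v)) 0)))))
        (∑-bound big λ Y _ → subst (ℕ._≤ 2 ℕ.^ order ℕ.* ((E C ℕ.* A) ℕ.^ k ℕ.* lb))
          (sym (ℤₚ.abs-* (χ (Y ◁ j · v)) (Δ^ order (λ i → F A (Y ▷ i · v)) 0)))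
          (subst (∣ χ (Y ◁ j · v) ∣ ℕ.* ∣ Δ^ order (λ i → F A (Y ▷ i · v)) 0 ∣ ℕ.≤_) (ℕₚ.*-identityˡ _)
            (ℕₚ.*-mono-≤ (χ≤1 (Y ◁ j · v)) (F-difference hl v c≤C Y))))


divmod-unique : ∀ {σ} q q′ {r r′} → r ℕ.< σ → r′ ℕ.< σ → + r + q * + σ ≡ + r′ + q′ * + σ → q ≡ q′
divmod-unique {σ} q q′ {r} {r′} r< r′< eq = ℤₚ.i-j≡0⇒i≡j q q′ (ℤₚ.∣i∣≡0⇒i≡0 (small (∣ q - q′ ∣) (begin-strict
  ∣ q - q′ ∣ ℕ.* σ        ≡⟨ ℤₚ.abs-* (q - q′) (+ σ) ⟨
  ∣ (q - q′) * + σ ∣      ≡⟨ cong ∣_∣ (trans (lemma q q′ (+ σ) (+ r)) (trans (cong (_- (+ r + q′ * + σ)) eq) (lemma₂ (+ r) (+ r′) (q′ * + σ)))) ⟩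
  ∣ + r′ - + r ∣          <⟨ diff ⟩
  σ                       ∎)))
  where
  open ℕₚ.≤-Reasoning
  lemma : ∀ q q′ σ r → (q - q′) * σ ≡ r + q * σ - (r + q′ * σ)
  lemma = solve-∀
  lemma₂ : ∀ r r′ x → r′ + x - (r + x) ≡ r′ - r
  lemma₂ = solve-∀
  small : ∀ n → n ℕ.* σ ℕ.< σ → n ≡ 0
  small zero    _ = refl
  small (suc n) h = contradiction (ℕₚ.m≤m+n σ (n ℕ.* σ)) (ℕₚ.<⇒≱ h)
  diff : ∣ + r′ - + r ∣ ℕ.< σ
  diff with ℕₚ.≤-total r r′
  ... | inj₁ r≤r′ = subst (ℕ._< σ) (sym (cong ∣_∣ (trans (ℤₚ.m-n≡m⊖n r′ r) (ℤₚ.⊖-≥ r≤r′)))) (ℕₚ.≤-<-trans (ℕₚ.m∸n≤m r′ r) r′<)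
  ... | inj₂ r′≤r = subst (ℕ._< σ) (sym (trans (cong ∣_∣ (ℤₚ.m-n≡m⊖n r′ r)) (ℤₚ.∣⊖∣-≤ r′≤r))) (ℕₚ.≤-<-trans (ℕₚ.m∸n≤m r r′) r<)

module _ (D : ℕ) .{{_ : NonZero D}} where

  *-/ℕ : ∀ x → (+ D * x) /ℕ D ≡ x
  *-/ℕ x = divmod-unique {D} ((+ D * x) /ℕ D) x {(+ D * x) %ℕ D} {0} (n%ℕd<d (+ D * x) D) (ℕ.>-nonZero⁻¹ D)
    (trans (sym (a≡a%ℕn+[a/ℕn]*n (+ D * x) D)) (trans (ℤₚ.*-comm (+ D) x) (sym (ℤₚ.+-identityˡ _))))

  divᵛ : ∀ {m} → Vec ℤ m → Vec ℤ m
  divᵛ = Vec.map (_/ℕ D)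

  divᵛ-⊙ : ∀ {m} (v : Vec ℤ m) → divᵛ (+ D ⊙ v) ≡ v
  divᵛ-⊙ []      = refl
  divᵛ-⊙ (x ∷ v) = cong₂ _∷_ (*-/ℕ x) (divᵛ-⊙ v)

  Multiple : ∀ {m} → Vec ℤ m → Set
  Multiple v = v ≡ + D ⊙ divᵛ v

  multiple? : ∀ {m} (v : Vec ℤ m) → Dec (Multiple v)
  multiple? v = v ≟ᵛ (+ D ⊙ divᵛ v)

  multiple : ∀ {m} {v : Vec ℤ m} w → v ≡ + D ⊙ w → Multiple v
  multiple w refl = cong (+ D ⊙_) (sym (divᵛ-⊙ w))

  ⊙-⊖ : ∀ {m} c (v w : Vec ℤ m) → c ⊙ v ⊖ c ⊙ w ≡ c ⊙ (v ⊖ w)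
  ⊙-⊖ c v w = vec-ext λ s → trans (lookup-⊖ (c ⊙ v) (c ⊙ w) s) (trans (cong₂ _-_ (lookup-⊙ c v s) (lookup-⊙ c w s))
    (sym (trans (lookup-⊙ c (v ⊖ w) s) (trans (cong (c *_) (lookup-⊖ v w s)) (lemma c (Vec.lookup v s) (Vec.lookup w s))))))
    where
    lemma : ∀ c x y → c * (x - y) ≡ c * x - c * y
    lemma = solve-∀

  ⊙-⊕ : ∀ {m} c (v w : Vec ℤ m) → c ⊙ v ⊕ c ⊙ w ≡ c ⊙ (v ⊕ w)
  ⊙-⊕ c v w = vec-ext λ s → trans (lookup-⊕ (c ⊙ v) (c ⊙ w) s) (trans (cong₂ _+_ (lookup-⊙ c v s) (lookup-⊙ c w s))
    (sym (trans (lookup-⊙ c (v ⊕ w) s) (trans (cong (c *_) (lookup-⊕ v w s)) (ℤₚ.*-distribˡ-+ c (Vec.lookup v s) (Vec.lookup w s))))))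

  ⊖-⊕ : ∀ {m} (v w : Vec ℤ m) → v ⊖ w ⊕ w ≡ v
  ⊖-⊕ v w = vec-ext λ s → trans (lookup-⊕ (v ⊖ w) w s) (trans (cong (_+ Vec.lookup w s) (lookup-⊖ v w s)) (lemma (Vec.lookup v s) (Vec.lookup w s)))
    where
    lemma : ∀ x y → x - y + y ≡ x
    lemma = solve-∀

  multiple-shift : ∀ {m} (v w : Vec ℤ m) → ind (multiple? (v ◁ D · w)) ≡ ind (multiple? v)
  multiple-shift v w = ind-cong (multiple? (v ◁ D · w)) (multiple? v)
    (λ p → multiple (divᵛ (v ◁ D · w) ⊕ w) (trans (sym (⊖-⊕ v (+ D ⊙ w))) (trans (cong (_⊕ + D ⊙ w) p) (⊙-⊕ (+ D) (divᵛ (v ◁ D · w)) w))))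
    (λ p → multiple (divᵛ v ⊖ w) (trans (cong (_⊖ + D ⊙ w) p) (⊙-⊖ (+ D) (divᵛ v) w)))

^-distribʳ-* : ∀ m a b → (a ℕ.* b) ℕ.^ m ≡ a ℕ.^ m ℕ.* b ℕ.^ m
^-distribʳ-* zero    a b = refl
^-distribʳ-* (suc m) a b = trans (cong (a ℕ.* b ℕ.*_) (^-distribʳ-* m a b)) (lemma a b (a ℕ.^ m) (b ℕ.^ m))
  where
  lemma : ∀ a b x y → a ℕ.* b ℕ.* (x ℕ.* y) ≡ a ℕ.* x ℕ.* (b ℕ.* y)
  lemma = ℕ-Solver.solve-∀

length-box-bound : ∀ a b m N → .{{_ : NonZero N}} → length (box (a ℕ.* N ℕ.+ b) m) ℕ.≤ suc (2 ℕ.* (a ℕ.+ b)) ℕ.^ m ℕ.* N ℕ.^ m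
length-box-bound a b m N = subst₂ ℕ._≤_ (sym (length-box (a ℕ.* N ℕ.+ b) m)) (^-distribʳ-* m (suc (2 ℕ.* (a ℕ.+ b))) N)
  (ℕₚ.^-monoˡ-≤ m (begin
    suc ((a ℕ.* N ℕ.+ b) ℕ.+ (a ℕ.* N ℕ.+ b)) ≡⟨ cong (λ z → suc ((a ℕ.* N ℕ.+ b) ℕ.+ z)) (sym (ℕₚ.+-identityʳ _)) ⟩
    1 ℕ.+ 2 ℕ.* (a ℕ.* N ℕ.+ b)     ≤⟨ ℕₚ.+-mono-≤ (ℕ.>-nonZero⁻¹ N) (ℕₚ.*-monoʳ-≤ 2 (ℕₚ.+-monoʳ-≤ (a ℕ.* N) (ℕₚ.m≤m*n b N))) ⟩
    N ℕ.+ 2 ℕ.* (a ℕ.* N ℕ.+ b ℕ.* N) ≡⟨ cong (N ℕ.+_) (trans (cong (2 ℕ.*_) (sym (ℕₚ.*-distribʳ-+ N a b))) (sym (ℕₚ.*-assoc 2 (a ℕ.+ b) N))) ⟩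
    suc (2 ℕ.* (a ℕ.+ b)) ℕ.* N     ∎))
  where open ℕₚ.≤-Reasoning

-- ‖P + Q‖² ≤ 2‖P‖² + 2‖Q‖², since the two sides differ by ‖P - Q‖².
sq-diff-bound : ∀ {m} (p q : Vec ℤ m) a b σ → a ℕ.≤ σ → b ℕ.≤ σ →
  ‖ + a ⊙ p ⊕ + b ⊙ q ‖² ℤ.≤ + 2 * (+ σ * + σ) * (‖ p ‖² + ‖ q ‖²)
sq-diff-bound p q a b σ a≤ b≤ = ℤₚ.≤-trans (0≤i-j⇒j≤i (subst (0ℤ ℤ.≤_) eq (norm≥0 (+ a ⊙ p ⊖ + b ⊙ q))))
  (subst (+ 2 * (+ a * + a * ‖ p ‖²) + + 2 * (+ b * + b * ‖ q ‖²) ℤ.≤_) (lemma₃ (+ σ) ‖ p ‖² ‖ q ‖²)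
    (ℤₚ.+-mono-≤ (*-monoˡ-≤ {c = + 2} (+≤+ z≤n) (*-mono-≤ (i*i≥0 (+ a)) (norm≥0 p) (*-mono-≤ (+≤+ z≤n) (+≤+ z≤n) (+≤+ a≤) (+≤+ a≤)) ℤₚ.≤-refl))
      (*-monoˡ-≤ {c = + 2} (+≤+ z≤n) (*-mono-≤ (i*i≥0 (+ b)) (norm≥0 q) (*-mono-≤ (+≤+ z≤n) (+≤+ z≤n) (+≤+ b≤) (+≤+ b≤)) ℤₚ.≤-refl))))
  where
  P Q : Vec ℤ _
  P = + a ⊙ p
  Q = + b ⊙ q
  lemma₁ : ∀ x y d → x + + 2 * - d + y ≡ + 2 * x + + 2 * y - (x + + 2 * d + y)
  lemma₁ = solve-∀
  lemma₃ : ∀ s p q → + 2 * (s * s * p) + + 2 * (s * s * q) ≡ + 2 * (s * s) * (p + q)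
  lemma₃ = solve-∀
  eq : ‖ P ⊖ Q ‖² ≡ + 2 * (+ a * + a * ‖ p ‖²) + + 2 * (+ b * + b * ‖ q ‖²) - ‖ P ⊕ Q ‖²
  eq = trans (norm-⊕ P (neg Q)) (trans (cong₂ (λ x y → ‖ P ‖² + + 2 * x + y) (dot-negʳ P Q) (norm-neg Q))
    (trans (lemma₁ ‖ P ‖² ‖ Q ‖² ⟨ P , Q ⟩) (cong₂ _-_ (cong₂ (λ x y → + 2 * x + + 2 * y) (norm-⊙ (+ a) p) (norm-⊙ (+ b) q)) (sym (norm-⊕ P Q)))))

module Laws {m : ℕ} (k : ℕ) .{{_ : NonZero k}} (σ : ℕ) .{{_ : NonZero σ}} where

  open NearInvariance {m} k (+ σ) (+≤+ z≤n) public

  σ≥1 : 1 ℕ.≤ σ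
  σ≥1 = ℕ.>-nonZero⁻¹ σ

  W : ℕ → Vec ℤ m → ℤ
  W N = bump (N ℕ.* N)

  law : ℕ → Vec ℤ m → ℤ → ℤ
  law N u y = ∑ (λ V → ind (⟨ u , V ⟩ ℤₚ.≟ y) * W N V) (box N m)

  norm≤gap : ∀ A X → 0ℤ ℤ.≤ gap A X → + σ * ‖ X ‖² ℤ.≤ + A
  norm≤gap A X = 0≤i-j⇒j≤i

  W≢0 : ∀ A X → bump A X ≢ 0ℤ → 0ℤ ℤ.≤ gap A X
  W≢0 A X ne with ℤₚ.≤-total 0ℤ (gap A X)
  ... | inj₁ h = h
  ... | inj₂ h = contradiction (cong +_ (trans (cong (ℕ._^ (2 ℕ.* k)) (pos-neg h)) (0^2* k))) ne

  n≤σ*n : ∀ {n} → 0ℤ ℤ.≤ n → n ℤ.≤ + σ * n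
  n≤σ*n {n} h = subst (ℤ._≤ + σ * n) (ℤₚ.*-identityˡ n) (*-mono-≤ {1ℤ} {+ σ} (+≤+ z≤n) h (+≤+ σ≥1) ℤₚ.≤-refl)

  lookup-bound : ∀ b (X : Vec ℤ m) s → + σ * ‖ X ‖² ℤ.≤ + (b ℕ.* b) → ∣ Vec.lookup X s ∣ ℕ.≤ b
  lookup-bound b X s h = sq≤⇒∣∣≤ (Vec.lookup X s) b (ℤₚ.≤-trans (lookup²≤norm X s) (ℤₚ.≤-trans (n≤σ*n (norm≥0 X)) h))

  -- This is the purpose of the factor σ in `gap`: on the support of `W N`, every vector of squared
  -- norm σ takes values of modulus at most N.
  dot-bound : ∀ b (X u : Vec ℤ m) → ‖ u ‖² ≡ + σ → + σ * ‖ X ‖² ℤ.≤ + (b ℕ.* b) → ∣ ⟨ u , X ⟩ ∣ ℕ.≤ b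
  dot-bound b X u uu h = sq≤⇒∣∣≤ ⟨ u , X ⟩ b (ℤₚ.≤-trans (subst (λ z → ⟨ u , X ⟩ * ⟨ u , X ⟩ ℤ.≤ z * ‖ X ‖²) uu (cauchy-schwarz u X)) h)

  W-support : ∀ N V → W N V ≢ 0ℤ → V ∈ box N m
  W-support N V ne = ∈-box N V λ s → lookup-bound N V s (norm≤gap (N ℕ.* N) V (W≢0 (N ℕ.* N) V ne))

-- Slices of u and u′ with values (y, t) and (t, y): both are lattice sums over the same lattice
-- {⟨u,·⟩ = ⟨u′,·⟩ = 0}, shifted to centres at the same distance from the origin.
module Compare {m : ℕ} (k : ℕ) .{{_ : NonZero k}} (σ : ℕ) .{{_ : NonZero σ}} where

  open Laws {m} k σ
  open Weighted 𝟎 1ℤ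

  -- The dual vectors `e` and `e′` guarantee that every pair (y, t) is a pair of values under `u`
  -- and `u′`, so no slice is empty for arithmetic reasons.
  record Frame : Set where
    field
      u u′ e e′ : Vec ℤ m
      uu   : ‖ u ‖² ≡ + σ
      u′u′ : ‖ u′ ‖² ≡ + σ
      uu′  : ⟨ u , u′ ⟩ ≡ 0ℤ
      ue   : ⟨ u , e ⟩ ≡ 1ℤ
      u′e  : ⟨ u′ , e ⟩ ≡ 0ℤ
      ue′  : ⟨ u , e′ ⟩ ≡ 0ℤ
      u′e′ : ⟨ u′ , e′ ⟩ ≡ 1ℤ

  swapFrame : Frame → Frame
  swapFrame f = record
    { u = u′ ; u′ = u ; e = e′ ; e′ = e ; uu = u′u′ ; u′u′ = uu ; uu′ = trans (dot-comm u′ u) uu′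
    ; ue = u′e′ ; u′e = ue′ ; ue′ = u′e ; u′e′ = ue }
    where open Frame f

  weight-1 : ∀ X → weight X ≡ 1ℤ
  weight-1 X = cong (_+_ 1ℤ) (trans (dot-comm 𝟎 X) (dot-𝟎ʳ X))

  F≡bump : ∀ A X → F A X ≡ bump A X
  F≡bump A X = trans (cong (bump A X *_) (weight-1 X)) (ℤₚ.*-identityʳ (bump A X))

  -- The reference for all slices: the sum over the undisplaced lattice σΛ, where Λ consists of the
  -- lattice points orthogonal to `u` and `u′`. It treats the two vectors alike, which is what makes
  -- the slices (y, t) and (t, y) comparable.
  central : Frame → ℕ → ℕ → ℤ
  central f N A = ∑ (λ X → ind (multiple? σ X) * (ind (⟨ u , X ⟩ ℤₚ.≟ 0ℤ) * ind (⟨ u′ , X ⟩ ℤₚ.≟ 0ℤ)) * F A X) (box (σ ℕ.* N) m)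
    where open Frame f

  joint : Frame → ℕ → ℤ → ℤ → ℤ
  joint f N y t = ∑ (λ V → ind (⟨ u , V ⟩ ℤₚ.≟ y) * ind (⟨ u′ , V ⟩ ℤₚ.≟ t) * W N V) (box N m)
    where open Frame f

  joint-swap : ∀ f N y t → joint (swapFrame f) N y t ≡ joint f N t y
  joint-swap f N y t = ∑-cong′ (box N m) λ V → cong (_* W N V) (ℤₚ.*-comm (ind (⟨ u′ , V ⟩ ℤₚ.≟ y)) (ind (⟨ u , V ⟩ ℤₚ.≟ t)))
    where open Frame f

  central-swap : ∀ f N A → central (swapFrame f) N A ≡ central f N A
  central-swap f N A = ∑-cong′ (box (σ ℕ.* N) m) λ X → cong (λ z → ind (multiple? σ X) * z * F A X)
    (ℤₚ.*-comm (ind (⟨ u′ , X ⟩ ℤₚ.≟ 0ℤ)) (ind (⟨ u , X ⟩ ℤₚ.≟ 0ℤ)))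
    where open Frame f

  law-joint : ∀ f N y → law N (Frame.u f) y ≡ ∑ (joint f N y) (interval N)
  law-joint f N y = sym (trans (∑-swap (λ t V → ind (⟨ u , V ⟩ ℤₚ.≟ y) * ind (⟨ u′ , V ⟩ ℤₚ.≟ t) * W N V) (interval N) (box N m))
    (∑-cong′ (box N m) collapse))
    where
    open Frame f
    collapse : ∀ V → ∑ (λ t → ind (⟨ u , V ⟩ ℤₚ.≟ y) * ind (⟨ u′ , V ⟩ ℤₚ.≟ t) * W N V) (interval N) ≡ ind (⟨ u , V ⟩ ℤₚ.≟ y) * W N V
    collapse V with W N V ℤₚ.≟ 0ℤ
    ... | yes z = trans (∑-zero (interval N) λ t _ → trans (*-congˡ (ind (⟨ u , V ⟩ ℤₚ.≟ y) * ind (⟨ u′ , V ⟩ ℤₚ.≟ t)) z) (ℤₚ.*-zeroʳ (ind (⟨ u , V ⟩ ℤₚ.≟ y) * ind (⟨ u′ , V ⟩ ℤₚ.≟ t))))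
                    (sym (trans (*-congˡ (ind (⟨ u , V ⟩ ℤₚ.≟ y)) z) (ℤₚ.*-zeroʳ (ind (⟨ u , V ⟩ ℤₚ.≟ y)))))
    ... | no ne = trans (∑-single {a = ⟨ u′ , V ⟩} (interval-unique N)
                     (∈-interval (dot-bound N V u′ u′u′ (norm≤gap (N ℕ.* N) V (W≢0 (N ℕ.* N) V ne))))
                     λ t _ t≢ → cong (_* W N V) (trans (*-congˡ (ind (⟨ u , V ⟩ ℤₚ.≟ y)) (ind-no (⟨ u′ , V ⟩ ℤₚ.≟ t) (t≢ ∘ sym))) (ℤₚ.*-zeroʳ (ind (⟨ u , V ⟩ ℤₚ.≟ y)))))
                   (cong (_* W N V) (trans (*-congˡ (ind (⟨ u , V ⟩ ℤₚ.≟ y)) (ind-yes (⟨ u′ , V ⟩ ℤₚ.≟ ⟨ u′ , V ⟩) refl)) (ℤₚ.*-identityʳ (ind (⟨ u , V ⟩ ℤₚ.≟ y)))))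

  module _ (f : Frame) (N : ℕ) (y t : ℤ) where
    open Frame f

    -- For V with the values y and t, this is σ times the component of V orthogonal to `u` and `u′`;
    -- the factor σ keeps it integral.
    scaled : Vec ℤ m → Vec ℤ m
    scaled V = + σ ⊙ V ⊖ (y ⊙ u ⊕ t ⊙ u′)

    -- Pythagoras for the orthogonal vectors `u` and `u′` of squared norm σ. On the slice the radial
    -- weight becomes one with N² lowered to N² - (y² + t²), an expression symmetric in y and t.
    norm-scaled : ∀ V → ⟨ u , V ⟩ ≡ y → ⟨ u′ , V ⟩ ≡ t →
      + σ * + σ * (+ N * + N - + σ * ‖ V ‖²) ≡ + σ * + σ * (+ N * + N - (y * y + t * t)) - + σ * ‖ scaled V ‖²
    norm-scaled V refl refl = trans (lemma (+ σ) (+ N) ‖ V ‖² y t)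
      (cong (λ z → + σ * + σ * (+ N * + N - (y * y + t * t)) - + σ * z) (sym eq))
      where
      lemma : ∀ s n v y t → s * s * (n * n - s * v) ≡ s * s * (n * n - (y * y + t * t)) - s * (s * s * v + + 2 * - (s * (y * y + t * t)) + s * (y * y + t * t))
      lemma = solve-∀
      q : Vec ℤ m
      q = y ⊙ u ⊕ t ⊙ u′
      q·V : ⟨ V , q ⟩ ≡ y * y + t * t
      q·V = trans (dot-⊕ʳ V (y ⊙ u) (t ⊙ u′)) (cong₂ _+_
        (trans (dot-⊙ʳ y V u) (cong (y *_) (dot-comm V u))) (trans (dot-⊙ʳ t V u′) (cong (t *_) (dot-comm V u′))))
      q·q : ‖ q ‖² ≡ + σ * (y * y + t * t)
      q·q = trans (norm-⊕ (y ⊙ u) (t ⊙ u′)) (trans (cong₂ _+_ (cong₂ (λ a b → a + + 2 * b)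
          (trans (norm-⊙ y u) (cong (y * y *_) uu))
          (trans (dot-⊙ˡ y u (t ⊙ u′)) (cong (y *_) (trans (dot-⊙ʳ t u u′) (cong (t *_) uu′)))))
          (trans (norm-⊙ t u′) (cong (t * t *_) u′u′)))
        (lemma′ (+ σ) y t))
        where
        lemma′ : ∀ s y t → y * y * s + + 2 * (y * (t * 0ℤ)) + t * t * s ≡ s * (y * y + t * t)
        lemma′ = solve-∀
      eq : ‖ scaled V ‖² ≡ + σ * + σ * ‖ V ‖² + + 2 * - (+ σ * (y * y + t * t)) + + σ * (y * y + t * t)
      eq = trans (norm-⊕ (+ σ ⊙ V) (neg q)) (cong₂ _+_ (cong₂ (λ a b → a + + 2 * b) (norm-⊙ (+ σ) V)
        (trans (dot-negʳ (+ σ ⊙ V) q) (cong (-_) (trans (dot-⊙ˡ (+ σ) V q) (cong (+ σ *_) q·V))))) (trans (norm-neg q) q·q))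

    y₀ t₀ : ℕ
    y₀ = y %ℕ σ
    t₀ = t %ℕ σ

    y₁ t₁ : ℤ
    y₁ = y /ℕ σ
    t₁ = t /ℕ σ

    -- Both `p` and `p′` are orthogonal to `u` and to `u′`. Only the residues of y and t modulo σ
    -- enter `shift`, so its length is bounded independently of N; the quotients go into `θ`, which
    -- is invisible modulo σ after scaling.
    p p′ shift θ : Vec ℤ m
    p  = + σ ⊙ e ⊖ u
    p′ = + σ ⊙ e′ ⊖ u′
    shift = + y₀ ⊙ p ⊕ + t₀ ⊙ p′
    θ = y₁ ⊙ u ⊕ + y₀ ⊙ e ⊕ (t₁ ⊙ u′ ⊕ + t₀ ⊙ e′)

    u-shift : ⟨ u , shift ⟩ ≡ 0ℤ
    u-shift = trans (dot-⊕ʳ u (+ y₀ ⊙ p) (+ t₀ ⊙ p′)) (trans (cong₂ _+_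
        (trans (dot-⊙ʳ (+ y₀) u p) (cong (+ y₀ *_) (trans (dot-⊖ʳ u (+ σ ⊙ e) u) (cong₂ _-_ (trans (dot-⊙ʳ (+ σ) u e) (cong (+ σ *_) ue)) uu))))
        (trans (dot-⊙ʳ (+ t₀) u p′) (cong (+ t₀ *_) (trans (dot-⊖ʳ u (+ σ ⊙ e′) u′) (cong₂ _-_ (trans (dot-⊙ʳ (+ σ) u e′) (cong (+ σ *_) ue′)) uu′)))))
      (lemma (+ y₀) (+ t₀) (+ σ)))
      where
      lemma : ∀ a b s → a * (s * 1ℤ - s) + b * (s * 0ℤ - 0ℤ) ≡ 0ℤ
      lemma = solve-∀

    u′-shift : ⟨ u′ , shift ⟩ ≡ 0ℤ
    u′-shift = trans (dot-⊕ʳ u′ (+ y₀ ⊙ p) (+ t₀ ⊙ p′)) (trans (cong₂ _+_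
        (trans (dot-⊙ʳ (+ y₀) u′ p) (cong (+ y₀ *_) (trans (dot-⊖ʳ u′ (+ σ ⊙ e) u) (cong₂ _-_ (trans (dot-⊙ʳ (+ σ) u′ e) (cong (+ σ *_) u′e)) (trans (dot-comm u′ u) uu′)))))
        (trans (dot-⊙ʳ (+ t₀) u′ p′) (cong (+ t₀ *_) (trans (dot-⊖ʳ u′ (+ σ ⊙ e′) u′) (cong₂ _-_ (trans (dot-⊙ʳ (+ σ) u′ e′) (cong (+ σ *_) u′e′)) u′u′)))))
      (lemma (+ y₀) (+ t₀) (+ σ)))
      where
      lemma : ∀ a b s → a * (s * 0ℤ - 0ℤ) + b * (s * 1ℤ - s) ≡ 0ℤ
      lemma = solve-∀

    scaled-shift : ∀ V → scaled V ⊖ shift ≡ + σ ⊙ (V ⊖ θ)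
    scaled-shift V = vec-ext λ s → trans (lhs s) (trans
      (trans (cong₂ (λ a b → + σ * v s - (a * U s + b * U′ s) - (+ y₀ * (+ σ * ε s - U s) + + t₀ * (+ σ * ε′ s - U′ s)))
        (a≡a%ℕn+[a/ℕn]*n y σ) (a≡a%ℕn+[a/ℕn]*n t σ))
        (lemma (+ σ) (v s) (U s) (U′ s) (ε s) (ε′ s) (+ y₀) y₁ (+ t₀) t₁)) (sym (rhs s)))
      where
      v U U′ ε ε′ : Fin m → ℤ
      v s = Vec.lookup V s
      U s = Vec.lookup u s
      U′ s = Vec.lookup u′ s
      ε s = Vec.lookup e s
      ε′ s = Vec.lookup e′ s
      lemma : ∀ σ v u u′ e e′ y₀ y₁ t₀ t₁ →
        σ * v - ((y₀ + y₁ * σ) * u + (t₀ + t₁ * σ) * u′) - (y₀ * (σ * e - u) + t₀ * (σ * e′ - u′))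
        ≡ σ * (v - (y₁ * u + y₀ * e + (t₁ * u′ + t₀ * e′)))
      lemma = solve-∀
      lhs : ∀ s → Vec.lookup (scaled V ⊖ shift) s ≡ + σ * v s - (y * U s + t * U′ s) - (+ y₀ * (+ σ * ε s - U s) + + t₀ * (+ σ * ε′ s - U′ s))
      lhs s = trans (lookup-⊖ (scaled V) shift s) (cong₂ _-_
        (trans (lookup-⊖ (+ σ ⊙ V) (y ⊙ u ⊕ t ⊙ u′) s) (cong₂ _-_ (lookup-⊙ (+ σ) V s)
          (trans (lookup-⊕ (y ⊙ u) (t ⊙ u′) s) (cong₂ _+_ (lookup-⊙ y u s) (lookup-⊙ t u′ s)))))
        (trans (lookup-⊕ (+ y₀ ⊙ p) (+ t₀ ⊙ p′) s) (cong₂ _+_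
          (trans (lookup-⊙ (+ y₀) p s) (cong (+ y₀ *_) (trans (lookup-⊖ (+ σ ⊙ e) u s) (cong (_- U s) (lookup-⊙ (+ σ) e s)))))
          (trans (lookup-⊙ (+ t₀) p′ s) (cong (+ t₀ *_) (trans (lookup-⊖ (+ σ ⊙ e′) u′ s) (cong (_- U′ s) (lookup-⊙ (+ σ) e′ s))))))))
      rhs : ∀ s → Vec.lookup (+ σ ⊙ (V ⊖ θ)) s ≡ + σ * (v s - (y₁ * U s + + y₀ * ε s + (t₁ * U′ s + + t₀ * ε′ s)))
      rhs s = trans (lookup-⊙ (+ σ) (V ⊖ θ) s) (cong (+ σ *_) (trans (lookup-⊖ V θ s) (cong (λ z → v s - z)
        (trans (lookup-⊕ (y₁ ⊙ u ⊕ + y₀ ⊙ e) (t₁ ⊙ u′ ⊕ + t₀ ⊙ e′) s) (cong₂ _+_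
          (trans (lookup-⊕ (y₁ ⊙ u) (+ y₀ ⊙ e) s) (cong₂ _+_ (lookup-⊙ y₁ u s) (lookup-⊙ (+ y₀) e s)))
          (trans (lookup-⊕ (t₁ ⊙ u′) (+ t₀ ⊙ e′) s) (cong₂ _+_ (lookup-⊙ t₁ u′ s) (lookup-⊙ (+ t₀) e′ s))))))))

    u-scaled : ∀ V → ⟨ u , scaled V ⟩ ≡ + σ * (⟨ u , V ⟩ - y)
    u-scaled V = trans (dot-⊖ʳ u (+ σ ⊙ V) (y ⊙ u ⊕ t ⊙ u′)) (trans (cong₂ _-_ (dot-⊙ʳ (+ σ) u V)
        (trans (dot-⊕ʳ u (y ⊙ u) (t ⊙ u′)) (cong₂ _+_ (trans (dot-⊙ʳ y u u) (cong (y *_) uu)) (trans (dot-⊙ʳ t u u′) (cong (t *_) uu′)))))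
      (lemma (+ σ) ⟨ u , V ⟩ y t))
      where
      lemma : ∀ s x y t → s * x - (y * s + t * 0ℤ) ≡ s * (x - y)
      lemma = solve-∀

    u′-scaled : ∀ V → ⟨ u′ , scaled V ⟩ ≡ + σ * (⟨ u′ , V ⟩ - t)
    u′-scaled V = trans (dot-⊖ʳ u′ (+ σ ⊙ V) (y ⊙ u ⊕ t ⊙ u′)) (trans (cong₂ _-_ (dot-⊙ʳ (+ σ) u′ V)
        (trans (dot-⊕ʳ u′ (y ⊙ u) (t ⊙ u′)) (cong₂ _+_ (trans (dot-⊙ʳ y u′ u) (cong (y *_) (trans (dot-comm u′ u) uu′))) (trans (dot-⊙ʳ t u′ u′) (cong (t *_) u′u′)))))
      (lemma (+ σ) ⟨ u′ , V ⟩ y t))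
      where
      lemma : ∀ s x y t → s * x - (y * 0ℤ + t * s) ≡ s * (x - t)
      lemma = solve-∀

    χ : Vec ℤ m → ℤ
    χ X = ind (multiple? σ X) * (ind (⟨ u , X ⟩ ℤₚ.≟ 0ℤ) * ind (⟨ u′ , X ⟩ ℤₚ.≟ 0ℤ))

    χ-periodic : ∀ X → χ (X ◁ σ · shift) ≡ χ X
    χ-periodic X = cong₂ _*_ (multiple-shift σ X shift) (cong₂ _*_
      (cong (λ z → ind (z ℤₚ.≟ 0ℤ)) (invariant u u-shift)) (cong (λ z → ind (z ℤₚ.≟ 0ℤ)) (invariant u′ u′-shift)))
      where
      invariant : ∀ w → ⟨ w , shift ⟩ ≡ 0ℤ → ⟨ w , X ◁ σ · shift ⟩ ≡ ⟨ w , X ⟩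
      invariant w w·s = trans (dot-⊖ʳ w X (+ σ ⊙ shift)) (trans (cong (λ z → ⟨ w , X ⟩ - z)
        (trans (dot-⊙ʳ (+ σ) w shift) (trans (cong (+ σ *_) w·s) (ℤₚ.*-zeroʳ (+ σ))))) (ℤₚ.+-identityʳ ⟨ w , X ⟩))

    χ≤1 : ∀ X → ∣ χ X ∣ ℕ.≤ 1
    χ≤1 X = ℕₚ.≤-trans (ind-*-bound (multiple? σ X) _) (ℕₚ.≤-trans (ind-*-bound (⟨ u , X ⟩ ℤₚ.≟ 0ℤ) _) (∣ind∣≤1 (⟨ u′ , X ⟩ ℤₚ.≟ 0ℤ)))

    χ-scaled : ∀ V → χ (scaled V ⊖ shift) ≡ ind (⟨ u , V ⟩ ℤₚ.≟ y) * ind (⟨ u′ , V ⟩ ℤₚ.≟ t)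
    χ-scaled V = trans (cong₂ _*_ (ind-yes (multiple? σ (scaled V ⊖ shift)) (multiple σ (V ⊖ θ) (scaled-shift V)))
        (cong₂ _*_ (same u y u-shift (u-scaled V)) (same u′ t u′-shift (u′-scaled V))))
      (ℤₚ.*-identityˡ _)
      where
      same : ∀ w y → ⟨ w , shift ⟩ ≡ 0ℤ → ⟨ w , scaled V ⟩ ≡ + σ * (⟨ w , V ⟩ - y) →
        ind (⟨ w , scaled V ⊖ shift ⟩ ℤₚ.≟ 0ℤ) ≡ ind (⟨ w , V ⟩ ℤₚ.≟ y)
      same w y w·s w·V = ind-cong (⟨ w , scaled V ⊖ shift ⟩ ℤₚ.≟ 0ℤ) (⟨ w , V ⟩ ℤₚ.≟ y)
        (λ z → ℤₚ.i-j≡0⇒i≡j ⟨ w , V ⟩ y (cancel (trans (sym value) z)))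
        (λ z → trans value (trans (cong (λ x → + σ * (x - y)) z) (trans (cong (+ σ *_) (ℤₚ.+-inverseʳ y)) (ℤₚ.*-zeroʳ (+ σ)))))
        where
        value : ⟨ w , scaled V ⊖ shift ⟩ ≡ + σ * (⟨ w , V ⟩ - y)
        value = trans (dot-⊖ʳ w (scaled V) shift) (trans (cong₂ _-_ w·V w·s) (ℤₚ.+-identityʳ _))
        cancel : ∀ {x} → + σ * x ≡ 0ℤ → x ≡ 0ℤ
        cancel {x} h with ℤₚ.i*j≡0⇒i≡0∨j≡0 (+ σ) h
        ... | inj₁ σ≡0 = contradiction (ℤₚ.+-injective σ≡0) (ℕ.≢-nonZero⁻¹ σ)
        ... | inj₂ x≡0 = x≡0

    unscaled : Vec ℤ m → Vec ℤ m
    unscaled X = divᵛ σ (X ⊕ (y ⊙ u ⊕ t ⊙ u′))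

    unscaled-scaled : ∀ V → unscaled (scaled V) ≡ V
    unscaled-scaled V = trans (cong (divᵛ σ) (⊖-⊕ σ (+ σ ⊙ V) (y ⊙ u ⊕ t ⊙ u′))) (divᵛ-⊙ σ V)

    scaled-unscaled : ∀ X → Multiple σ (X ⊖ shift) → scaled (unscaled X) ≡ X
    scaled-unscaled X mult = trans (cong (_⊖ q) (trans (cong (λ z → + σ ⊙ divᵛ σ z) eq) (trans (cong (+ σ ⊙_) (divᵛ-⊙ σ Y)) (sym eq)))) (⊕-⊖ X q)
      where
      q Y : Vec ℤ m
      q = y ⊙ u ⊕ t ⊙ u′
      Y = divᵛ σ (X ⊖ shift) ⊕ θ
      ⊕-⊖ : ∀ (a b : Vec ℤ m) → a ⊕ b ⊖ b ≡ a
      ⊕-⊖ a b = vec-ext λ s → trans (lookup-⊖ (a ⊕ b) b s) (trans (cong (_- Vec.lookup b s) (lookup-⊕ a b s)) (lemma (Vec.lookup a s) (Vec.lookup b s)))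
        where
        lemma : ∀ x y → x + y - y ≡ x
        lemma = solve-∀
      -- X + q = (X − shift) + (shift + q), and scaled-shift at V = 0 says shift + q = σ θ
      eq : X ⊕ q ≡ + σ ⊙ Y
      eq = vec-ext λ s → trans (lookup-⊕ X q s) (trans (trans
        (split (Vec.lookup X s) (Vec.lookup q s) (Vec.lookup shift s))
        (cong₂ _+_ (trans (sym (lookup-⊖ X shift s)) (trans (cong (λ z → Vec.lookup z s) mult) (lookup-⊙ (+ σ) (divᵛ σ (X ⊖ shift)) s))) (sθ s)))
        (sym (trans (lookup-⊙ (+ σ) Y s) (trans (cong (+ σ *_) (lookup-⊕ (divᵛ σ (X ⊖ shift)) θ s)) (ℤₚ.*-distribˡ-+ (+ σ) _ (Vec.lookup θ s))))))
        where
        split : ∀ x q s → x + q ≡ x - s + (s + q)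
        split = solve-∀
        sθ : ∀ s → Vec.lookup shift s + Vec.lookup q s ≡ + σ * Vec.lookup θ s
        sθ s = trans (lemma (Vec.lookup shift s) (Vec.lookup q s) (+ σ) (z s)) (trans (cong (λ x → - x + + σ * z s) base) (lemma₂ (+ σ) (z s) (Vec.lookup θ s)))
          where
          z : Fin m → ℤ
          z = Vec.lookup (𝟎 {m})
          lemma : ∀ h q σ z → h + q ≡ - (σ * z - q - h) + σ * z
          lemma = solve-∀
          lemma₂ : ∀ σ z θ → - (σ * (z - θ)) + σ * z ≡ σ * θ
          lemma₂ = solve-∀
          base : + σ * z s - Vec.lookup q s - Vec.lookup shift s ≡ + σ * (z s - Vec.lookup θ s)
          base = trans (cong (_- Vec.lookup shift s) (trans (cong (_- Vec.lookup q s) (sym (lookup-⊙ (+ σ) 𝟎 s))) (sym (lookup-⊖ (+ σ ⊙ 𝟎) q s))))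
            (trans (sym (lookup-⊖ (scaled 𝟎) shift s)) (trans (cong (λ v → Vec.lookup v s) (scaled-shift 𝟎))
              (trans (lookup-⊙ (+ σ) (𝟎 ⊖ θ) s) (cong (+ σ *_) (lookup-⊖ 𝟎 θ s)))))

    S : ℕ
    S = (σ ℕ.* σ) ℕ.^ (2 ℕ.* k)

    module _ (A : ℕ) (A≡ : + A ≡ + σ * + σ * (+ N * + N - (y * y + t * t))) where

      gap-scaled : ∀ V → ⟨ u , V ⟩ ≡ y → ⟨ u′ , V ⟩ ≡ t → gap A (scaled V) ≡ + (σ ℕ.* σ) * gap (N ℕ.* N) V
      gap-scaled V hu hu′ = trans (cong (_- + σ * ‖ scaled V ‖²) A≡) (trans (sym (norm-scaled V hu hu′))
        (cong₂ (λ a b → a * (b - + σ * ‖ V ‖²)) (sym (ℤₚ.pos-* σ σ)) (sym (ℤₚ.pos-* N N))))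

      pos-scale : ∀ c z → pos (+ c * z) ≡ c ℕ.* pos z
      pos-scale c z with ℤₚ.≤-total 0ℤ z
      ... | inj₁ (+≤+ {n = n} _) = cong pos (sym (ℤₚ.pos-* c n))
      ... | inj₂ z≤0 = trans (pos-neg (subst (+ c * z ℤ.≤_) (ℤₚ.*-zeroʳ (+ c)) (ℤₚ.*-monoˡ-≤-nonNeg (+ c) z≤0)))
                         (sym (trans (cong (c ℕ.*_) (pos-neg z≤0)) (ℕₚ.*-zeroʳ c)))

      bump-scaled : ∀ V → ⟨ u , V ⟩ ≡ y → ⟨ u′ , V ⟩ ≡ t → F A (scaled V) ≡ + S * W N V
      bump-scaled V hu hu′ = trans (F≡bump A (scaled V)) (trans (cong +_ (trans (cong (ℕ._^ (2 ℕ.* k))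
          (trans (cong pos (gap-scaled V hu hu′)) (pos-scale (σ ℕ.* σ) (gap (N ℕ.* N) V))))
          (^-distribʳ-* (2 ℕ.* k) (σ ℕ.* σ) (pos (gap (N ℕ.* N) V)))))
        (ℤₚ.pos-* S (pos (gap (N ℕ.* N) V) ℕ.^ (2 ℕ.* k))))

      slice-term : ∀ V → χ (scaled V ⊖ shift) * F A (scaled V) ≡ + S * (ind (⟨ u , V ⟩ ℤₚ.≟ y) * ind (⟨ u′ , V ⟩ ℤₚ.≟ t) * W N V)
      slice-term V = ind-slice (⟨ u , V ⟩ ℤₚ.≟ y) (⟨ u′ , V ⟩ ℤₚ.≟ t) {s = + S} {W N V} (χ-scaled V) (bump-scaled V)

      A≤ : + A ℤ.≤ + ((σ ℕ.* N) ℕ.* (σ ℕ.* N))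
      A≤ = subst₂ ℤ._≤_ (sym A≡) rhs (*-monoˡ-≤ {b = + N * + N} (i*i≥0 (+ σ)) (0≤i-j⇒j≤i (subst (0ℤ ℤ.≤_) (lemma (+ N * + N) (y * y) (t * t))
        (ℤₚ.+-mono-≤ (i*i≥0 y) (i*i≥0 t)))))
        where
        lemma : ∀ n a b → a + b ≡ n - (n - (a + b))
        lemma = solve-∀
        lemma₂ : ∀ s n → s * s * (n * n) ≡ s * n * (s * n)
        lemma₂ = solve-∀
        rhs : + σ * + σ * (+ N * + N) ≡ + ((σ ℕ.* N) ℕ.* (σ ℕ.* N))
        rhs = trans (lemma₂ (+ σ) (+ N)) (sym (trans (ℤₚ.pos-* (σ ℕ.* N) (σ ℕ.* N)) (cong₂ _*_ (ℤₚ.pos-* σ N) (ℤₚ.pos-* σ N))))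

      support : ∀ X s → 0ℤ ℤ.≤ gap A X → ∣ Vec.lookup X s ∣ ℕ.≤ σ ℕ.* N
      support X s h = lookup-bound (σ ℕ.* N) X s (ℤₚ.≤-trans (norm≤gap A X h) A≤)

      F≢0 : ∀ X → F A X ≢ 0ℤ → 0ℤ ℤ.≤ gap A X
      F≢0 X ne = W≢0 A X (λ z → ne (trans (F≡bump A X) z))

      joint-sum : ∑ (λ X → χ (X ⊖ shift) * F A X) (box (σ ℕ.* N) m) ≡ + S * joint f N y t
      joint-sum = trans (∑-reindex _≟ᵛ_ scaled unscaled (box-unique (σ ℕ.* N) m) (box-unique N m) to from)
        (∑-*ˡ (+ S) (λ V → ind (⟨ u , V ⟩ ℤₚ.≟ y) * ind (⟨ u′ , V ⟩ ℤₚ.≟ t) * W N V) (box N m))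
        where
        to : ∀ X → X ∈ box (σ ℕ.* N) m → χ (X ⊖ shift) * F A X ≢ 0ℤ →
          unscaled X ∈ box N m × scaled (unscaled X) ≡ X ×
          + S * (ind (⟨ u , unscaled X ⟩ ℤₚ.≟ y) * ind (⟨ u′ , unscaled X ⟩ ℤₚ.≟ t) * W N (unscaled X)) ≡ χ (X ⊖ shift) * F A X
        to X _ ne = W-support N V (*≢0ʳ (ind (⟨ u , V ⟩ ℤₚ.≟ y) * ind (⟨ u′ , V ⟩ ℤₚ.≟ t)) (*≢0ʳ (+ S) ne′)) , back , sym term
          where
          V : Vec ℤ m
          V = unscaled X
          back : scaled V ≡ X
          back = scaled-unscaled X (ind-≢0 (multiple? σ (X ⊖ shift)) (*≢0ˡ (*≢0ˡ {χ (X ⊖ shift)} ne)))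
          term : χ (X ⊖ shift) * F A X ≡ + S * (ind (⟨ u , V ⟩ ℤₚ.≟ y) * ind (⟨ u′ , V ⟩ ℤₚ.≟ t) * W N V)
          term = trans (cong (λ z → χ (z ⊖ shift) * F A z) (sym back)) (slice-term V)
          ne′ : + S * (ind (⟨ u , V ⟩ ℤₚ.≟ y) * ind (⟨ u′ , V ⟩ ℤₚ.≟ t) * W N V) ≢ 0ℤ
          ne′ z = ne (trans term z)
        from : ∀ V → V ∈ box N m → + S * (ind (⟨ u , V ⟩ ℤₚ.≟ y) * ind (⟨ u′ , V ⟩ ℤₚ.≟ t) * W N V) ≢ 0ℤ →
          scaled V ∈ box (σ ℕ.* N) m × unscaled (scaled V) ≡ V ×
          χ (scaled V ⊖ shift) * F A (scaled V) ≡ + S * (ind (⟨ u , V ⟩ ℤₚ.≟ y) * ind (⟨ u′ , V ⟩ ℤₚ.≟ t) * W N V)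
        from V _ ne = ∈-box (σ ℕ.* N) (scaled V) (λ s → support (scaled V) s (F≢0 (scaled V) (*≢0ʳ (χ (scaled V ⊖ shift)) (λ z → ne (trans (sym (slice-term V)) z)))))
          , unscaled-scaled V , slice-term V

      joint≈central : ∀ C → + σ * ‖ shift ‖² ℤ.≤ + C → ∣ + S * joint f N y t - central f N A ∣ ℕ.≤
        σ ℕ.^ degree ℕ.* (length (box (σ ℕ.* N ℕ.+ order ℕ.* C) m) ℕ.* (2 ℕ.^ order ℕ.* ((E C ℕ.* A) ℕ.^ k ℕ.* 1)))
      joint≈central C hC = subst (λ z → ∣ z - central f N A ∣ ℕ.≤ _) joint-sum
        (near-invariance σ χ shift χ≤1 χ-periodic (λ X _ → ℕₚ.≤-reflexive (cong ∣_∣ (weight-1 X))) support hC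
          (λ s → ℤₚ.drop‿+≤+ (ℤₚ.≤-trans (∣i∣≤i² (Vec.lookup shift s)) (ℤₚ.≤-trans (lookup²≤norm shift s) (ℤₚ.≤-trans (n≤σ*n (norm≥0 shift)) hC)))))

module CompareLaws {m : ℕ} (k : ℕ) .{{_ : NonZero k}} (σ : ℕ) .{{_ : NonZero σ}} where

  open Laws {m} k σ
  open Compare {m} k σ
  open Frame

  private
    P P′ : Frame → Vec ℤ m
    P f  = + σ ⊙ e f ⊖ u f
    P′ f = + σ ⊙ e′ f ⊖ u′ f

  C₀ : Frame → ℕ
  C₀ f = pos (+ σ * (+ 2 * (+ σ * + σ) * (‖ P f ‖² + ‖ P′ f ‖²)))

  C₀-swap : ∀ f → C₀ (swapFrame f) ≡ C₀ f
  C₀-swap f = cong (λ z → pos (+ σ * (+ 2 * (+ σ * + σ) * z))) (ℤₚ.+-comm ‖ P′ f ‖² ‖ P f ‖²)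

  shift-bound : ∀ f N y t → + σ * ‖ shift f N y t ‖² ℤ.≤ + C₀ f
  shift-bound f N y t = subst (+ σ * ‖ shift f N y t ‖² ℤ.≤_) (sym (pos-nonNeg nn))
    (*-monoˡ-≤ {c = + σ} (+≤+ z≤n) (sq-diff-bound (P f) (P′ f) (y %ℕ σ) (t %ℕ σ) σ (ℕₚ.<⇒≤ (n%ℕd<d y σ)) (ℕₚ.<⇒≤ (n%ℕd<d t σ))))
    where
    nn : 0ℤ ℤ.≤ + σ * (+ 2 * (+ σ * + σ) * (‖ P f ‖² + ‖ P′ f ‖²))
    nn = *-nonNeg {+ σ} (+≤+ z≤n) (*-nonNeg (*-nonNeg {+ 2} (+≤+ z≤n) (i*i≥0 (+ σ))) (ℤₚ.+-mono-≤ (norm≥0 (P f)) (norm≥0 (P′ f))))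

  K₀ : Frame → ℕ
  K₀ f = σ ℕ.^ degree ℕ.* (suc (2 ℕ.* (σ ℕ.+ order ℕ.* C₀ f)) ℕ.^ m ℕ.* (2 ℕ.^ order ℕ.* (E (C₀ f) ℕ.* (σ ℕ.* σ)) ℕ.^ k))

  joint-outside : ∀ f N y t → + N * + N - (y * y + t * t) ℤ.< 0ℤ → joint f N y t ≡ 0ℤ
  joint-outside f N y t neg = ∑-zero (box N m) λ V _ → vanish V
    where
    vanish : ∀ V → ind (⟨ u f , V ⟩ ℤₚ.≟ y) * ind (⟨ u′ f , V ⟩ ℤₚ.≟ t) * W N V ≡ 0ℤ
    vanish V with ⟨ u f , V ⟩ ℤₚ.≟ y | ⟨ u′ f , V ⟩ ℤₚ.≟ t
    ... | no _ | d = refl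
    ... | yes _ | no _ = refl
    ... | yes hu | yes hu′ = trans (*-congˡ (1ℤ * 1ℤ) (cong +_ (trans (cong (ℕ._^ (2 ℕ.* k)) (pos-neg gap≤0)) (0^2* k)))) refl
      where
      gap≤0 : gap (N ℕ.* N) V ℤ.≤ 0ℤ
      gap≤0 with ℤₚ.≤-total (gap (N ℕ.* N) V) 0ℤ
      ... | inj₁ h = h
      ... | inj₂ h = contradiction (ℤₚ.≤-trans (subst (0ℤ ℤ.≤_) (norm-scaled f N y t V hu hu′)
              (*-nonNeg (i*i≥0 (+ σ)) (subst (λ z → 0ℤ ℤ.≤ z - + σ * ‖ V ‖²) (ℤₚ.pos-* N N) h)))
              (ℤₚ.≤-trans (subst (scaledGap - + σ * ‖ scaled f N y t V ‖² ℤ.≤_) (ℤₚ.+-identityʳ scaledGap)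
                (ℤₚ.+-monoʳ-≤ scaledGap (ℤₚ.neg-mono-≤ (*-nonNeg {+ σ} (+≤+ z≤n) (norm≥0 (scaled f N y t V)))))) ℤₚ.≤-refl))
              (ℤₚ.<⇒≱ scaledGap<0)
        where
        scaledGap : ℤ
        scaledGap = + σ * + σ * (+ N * + N - (y * y + t * t))
        scaledGap<0 : scaledGap ℤ.< 0ℤ
        scaledGap<0 = subst (scaledGap ℤ.<_) (ℤₚ.*-zeroʳ (+ σ * + σ))
          (subst (λ z → z * (+ N * + N - (y * y + t * t)) ℤ.< z * 0ℤ) (ℤₚ.pos-* σ σ)
            (ℤₚ.*-monoˡ-<-pos (+ (σ ℕ.* σ)) {{ℤ.positive (+<+ (ℕₚ.*-mono-≤ σ≥1 σ≥1))}} neg))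

  bound-≤ : ∀ f N A a b → .{{_ : NonZero N}} → A ≡ σ ℕ.* σ ℕ.* a → a ℕ.≤ b →
    σ ℕ.^ degree ℕ.* (length (box (σ ℕ.* N ℕ.+ order ℕ.* C₀ f) m) ℕ.* (2 ℕ.^ order ℕ.* ((E (C₀ f) ℕ.* A) ℕ.^ k ℕ.* 1)))
      ℕ.≤ K₀ f ℕ.* (N ℕ.^ m ℕ.* b ℕ.^ k)
  bound-≤ f N A a b refl a≤b = ℕₚ.≤-trans
    (ℕₚ.*-monoʳ-≤ (σ ℕ.^ degree) (ℕₚ.*-mono-≤ (length-box-bound σ (order ℕ.* C₀ f) m N)
      (ℕₚ.*-monoʳ-≤ (2 ℕ.^ order) (ℕₚ.≤-reflexive (ℕₚ.*-identityʳ _)))))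
    (ℕₚ.≤-trans (ℕₚ.*-monoʳ-≤ (σ ℕ.^ degree) (ℕₚ.*-monoʳ-≤ (L ℕ.* N ℕ.^ m) (ℕₚ.*-monoʳ-≤ (2 ℕ.^ order) power)))
      (ℕₚ.≤-reflexive (lemma (σ ℕ.^ degree) L (N ℕ.^ m) (2 ℕ.^ order) (G ℕ.^ k) (b ℕ.^ k))))
    where
    L G : ℕ
    L = suc (2 ℕ.* (σ ℕ.+ order ℕ.* C₀ f)) ℕ.^ m
    G = E (C₀ f) ℕ.* (σ ℕ.* σ)
    power : (E (C₀ f) ℕ.* (σ ℕ.* σ ℕ.* a)) ℕ.^ k ℕ.≤ G ℕ.^ k ℕ.* b ℕ.^ k
    power = subst (ℕ._≤ G ℕ.^ k ℕ.* b ℕ.^ k) (cong (ℕ._^ k) (ℕₚ.*-assoc (E (C₀ f)) (σ ℕ.* σ) a))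
      (subst (ℕ._≤ G ℕ.^ k ℕ.* b ℕ.^ k) (sym (^-distribʳ-* k G a)) (ℕₚ.*-monoʳ-≤ (G ℕ.^ k) (ℕₚ.^-monoˡ-≤ k a≤b)))
    lemma : ∀ s l n o g b → s ℕ.* (l ℕ.* n ℕ.* (o ℕ.* (g ℕ.* b))) ≡ s ℕ.* (l ℕ.* (o ℕ.* g)) ℕ.* (n ℕ.* b)
    lemma = ℕ-Solver.solve-∀

  radius : ℕ → ℤ → ℕ
  radius N y = pos (+ N * + N - y * y)

  triangle : ∀ a b c {n} → ∣ a - c ∣ ℕ.≤ n → ∣ b - c ∣ ℕ.≤ n → ∣ a - b ∣ ℕ.≤ 2 ℕ.* n
  triangle a b c {n} ha hb = subst₂ ℕ._≤_ (cong ∣_∣ (lemma a b c)) (cong (n ℕ.+_) (sym (ℕₚ.+-identityʳ n)))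
    (ℕₚ.≤-trans (ℤₚ.∣i-j∣≤∣i∣+∣j∣ (a - c) (b - c)) (ℕₚ.+-mono-≤ ha hb))
    where
    lemma : ∀ a b c → a - c - (b - c) ≡ a - b
    lemma = solve-∀

  -- Both slices are close to the same central sum: exchanging `u` and `u′` turns one slice into the
  -- other and fixes both `central` and the level A = σ²(N² - y² - t²).
  joint-inside : ∀ f N y t → .{{_ : NonZero N}} → 0ℤ ℤ.≤ + N * + N - (y * y + t * t) →
    ∣ joint f N y t - joint f N t y ∣ ℕ.≤ 2 ℕ.* (K₀ f ℕ.* (N ℕ.^ m ℕ.* radius N y ℕ.^ k))
  joint-inside f N y t 0≤z = ℕₚ.≤-trans scale (triangle (+ S₀ * joint f N y t) (+ S₀ * joint f N t y) (central f N A) near₁ near₂)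
    where
    z : ℤ
    z = + N * + N - (y * y + t * t)
    A S₀ bound : ℕ
    A = σ ℕ.* σ ℕ.* pos z
    S₀ = (σ ℕ.* σ) ℕ.^ (2 ℕ.* k)
    bound = K₀ f ℕ.* (N ℕ.^ m ℕ.* radius N y ℕ.^ k)
    A≡ : + A ≡ + σ * + σ * z
    A≡ = trans (ℤₚ.pos-* (σ ℕ.* σ) (pos z)) (cong₂ _*_ (ℤₚ.pos-* σ σ) (pos-nonNeg 0≤z))
    a≤ : pos z ℕ.≤ radius N y
    a≤ = pos-mono {z} {+ N * + N - y * y} (0≤i-j⇒j≤i {+ N * + N - y * y} {z} (subst (0ℤ ℤ.≤_) (lemma (+ N * + N) (y * y) (t * t)) (i*i≥0 t)))
      where
      lemma : ∀ n a b → b ≡ n - a - (n - (a + b))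
      lemma = solve-∀
    near₁ : ∣ + S₀ * joint f N y t - central f N A ∣ ℕ.≤ bound
    near₁ = ℕₚ.≤-trans (joint≈central f N y t A A≡ (C₀ f) (shift-bound f N y t)) (bound-≤ f N A (pos z) (radius N y) refl a≤)
    near₂ : ∣ + S₀ * joint f N t y - central f N A ∣ ℕ.≤ bound
    near₂ = subst₂ (λ i j → ∣ + S₀ * i - j ∣ ℕ.≤ bound) (joint-swap f N y t) (central-swap f N A)
      (ℕₚ.≤-trans (joint≈central (swapFrame f) N y t A A≡ (C₀ f)
          (subst (λ c → + σ * ‖ shift (swapFrame f) N y t ‖² ℤ.≤ + c) (C₀-swap f) (shift-bound (swapFrame f) N y t)))
        (bound-≤ f N A (pos z) (radius N y) refl a≤))
    S₀≥1 : 1 ℕ.≤ S₀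
    S₀≥1 = subst (ℕ._≤ S₀) (ℕₚ.^-zeroˡ (2 ℕ.* k)) (ℕₚ.^-monoˡ-≤ (2 ℕ.* k) (ℕₚ.*-mono-≤ σ≥1 σ≥1))
    scale : ∣ joint f N y t - joint f N t y ∣ ℕ.≤ ∣ + S₀ * joint f N y t - + S₀ * joint f N t y ∣
    scale = subst₂ ℕ._≤_ (ℕₚ.*-identityˡ _) (trans (sym (ℤₚ.abs-* (+ S₀) (joint f N y t - joint f N t y))) (cong ∣_∣ (lemma (+ S₀) (joint f N y t) (joint f N t y))))
      (ℕₚ.*-monoˡ-≤ ∣ joint f N y t - joint f N t y ∣ S₀≥1)
      where
      lemma : ∀ s a b → s * (a - b) ≡ s * a - s * b
      lemma = solve-∀

  joint-symmetric : ∀ f N y t → .{{_ : NonZero N}} →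
    ∣ joint f N y t - joint f N t y ∣ ℕ.≤ 2 ℕ.* (K₀ f ℕ.* (N ℕ.^ m ℕ.* radius N y ℕ.^ k))
  joint-symmetric f N y t with + N * + N - (y * y + t * t) ℤₚ.<? 0ℤ
  ... | yes neg = subst (ℕ._≤ 2 ℕ.* (K₀ f ℕ.* (N ℕ.^ m ℕ.* radius N y ℕ.^ k)))
          (sym (cong ∣_∣ (cong₂ _-_ (joint-outside f N y t neg)
            (joint-outside f N t y (subst (λ z → + N * + N - z ℤ.< 0ℤ) (ℤₚ.+-comm (y * y) (t * t)) neg))))) z≤n
  ... | no ¬neg = joint-inside f N y t (ℤₚ.≮⇒≥ ¬neg)

  -- The law of `u` sums the slices (y, t) over t, that of `u′` the slices (t, y). The summation
  -- over at most 3N values of t costs the additional factor N.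
  laws-close : ∀ f N y → .{{_ : NonZero N}} →
    ∣ law N (u f) y - law N (u′ f) y ∣ ℕ.≤ 6 ℕ.* K₀ f ℕ.* (N ℕ.^ suc m ℕ.* radius N y ℕ.^ k)
  laws-close f N y = begin
    ∣ law N (u f) y - law N (u′ f) y ∣                              ≡⟨ cong ∣_∣ eq ⟩
    ∣ ∑ (λ t → joint f N y t - joint f N t y) (interval N) ∣         ≤⟨ ∑-bound {f = λ t → joint f N y t - joint f N t y} (interval N) (λ t _ → joint-symmetric f N y t) ⟩
    length (interval N) ℕ.* (2 ℕ.* (K₀ f ℕ.* X))                    ≤⟨ ℕₚ.*-monoˡ-≤ (2 ℕ.* (K₀ f ℕ.* X)) len ⟩
    3 ℕ.* N ℕ.* (2 ℕ.* (K₀ f ℕ.* X))                                ≡⟨ lemma N (K₀ f) (N ℕ.^ m) (radius N y ℕ.^ k) ⟩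
    6 ℕ.* K₀ f ℕ.* (N ℕ.^ suc m ℕ.* radius N y ℕ.^ k)               ∎
    where
    open ℕₚ.≤-Reasoning
    X : ℕ
    X = N ℕ.^ m ℕ.* radius N y ℕ.^ k
    eq : law N (u f) y - law N (u′ f) y ≡ ∑ (λ t → joint f N y t - joint f N t y) (interval N)
    eq = trans (cong₂ _-_ (law-joint f N y) (trans (law-joint (swapFrame f) N y) (∑-cong′ (interval N) λ t → joint-swap f N y t)))
      (sym (∑-- (joint f N y) (λ t → joint f N t y) (interval N)))
    len : length (interval N) ℕ.≤ 3 ℕ.* N
    len = subst (ℕ._≤ 3 ℕ.* N) (sym (length-interval N)) (subst (suc (N ℕ.+ N) ℕ.≤_) (cong (λ z → N ℕ.+ (N ℕ.+ z)) (sym (ℕₚ.+-identityʳ N)))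
      (ℕₚ.+-monoˡ-≤ (N ℕ.+ N) (ℕ.>-nonZero⁻¹ N)))
    lemma : ∀ n k p r → 3 ℕ.* n ℕ.* (2 ℕ.* (k ℕ.* (p ℕ.* r))) ≡ 6 ℕ.* k ℕ.* (n ℕ.* p ℕ.* r)
    lemma = ℕ-Solver.solve-∀

-- Residue classes

unit : ∀ {m} → Fin m → Vec ℤ m
unit zero    = 1ℤ ∷ 𝟎
unit (suc s) = 0ℤ ∷ unit s

dot-unit : ∀ {m} (v : Vec ℤ m) s → ⟨ v , unit s ⟩ ≡ Vec.lookup v s
dot-unit (x ∷ v) zero    = trans (cong₂ _+_ (ℤₚ.*-identityʳ x) (dot-𝟎ʳ v)) (ℤₚ.+-identityʳ x)
dot-unit (x ∷ v) (suc s) = trans (cong₂ _+_ (ℤₚ.*-zeroʳ x) (dot-unit v s)) (ℤₚ.+-identityˡ _)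

∑-allFin-suc : ∀ {m} (f : Fin (suc m) → ℤ) → ∑ f (allFin (suc m)) ≡ f zero + ∑ (f ∘ suc) (allFin m)
∑-allFin-suc {m} f = +-congˡ (f zero) (trans (cong (∑ f) (sym (Listₚ.map-tabulate id suc))) (∑-map f suc (allFin m)))

dot-∑ : ∀ {m} (u v : Vec ℤ m) → ⟨ u , v ⟩ ≡ ∑ (λ s → Vec.lookup u s * Vec.lookup v s) (allFin m)
dot-∑ [] [] = refl
dot-∑ {suc m} (x ∷ u) (y ∷ v) = trans (+-congˡ (x * y) (dot-∑ u v))
  (sym (∑-allFin-suc {m} (λ s → Vec.lookup (x ∷ u) s * Vec.lookup (y ∷ v) s)))

norm-bound : ∀ {m} (v : Vec ℤ m) b → (∀ s → ∣ Vec.lookup v s ∣ ℕ.≤ b) → ‖ v ‖² ℤ.≤ + (m ℕ.* (b ℕ.* b))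
norm-bound []      b h = ℤₚ.≤-refl
norm-bound {suc m} (x ∷ v) b h = subst (x * x + ‖ v ‖² ℤ.≤_) (sym (ℤₚ.pos-+ (b ℕ.* b) (m ℕ.* (b ℕ.* b))))
  (ℤₚ.+-mono-≤ (subst (ℤ._≤ + (b ℕ.* b)) (∣i∣*∣i∣ x) (+≤+ (ℕₚ.*-mono-≤ (h zero) (h zero)))) (norm-bound v b (h ∘ suc)))

module Residues (M : ℕ) .{{_ : NonZero M}} where

  red : ∀ {m} → Vec ℤ m → Vec ℤ m
  red = Vec.map (λ x → + (x %ℕ M))

  Ω : (m : ℕ) → List (Vec ℤ m)
  Ω = cube (map +_ (upTo M))

  Ω-unique : ∀ m → Unique (Ω m)
  Ω-unique m = cube-unique m (Uniqueₚ.map⁺ ℤₚ.+-injective (Uniqueₚ.upTo⁺ M))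

  red-eq : ∀ {m} (V : Vec ℤ m) → V ≡ red V ⊕ + M ⊙ divᵛ M V
  red-eq []      = refl
  red-eq (x ∷ V) = cong₂ _∷_ (trans (a≡a%ℕn+[a/ℕn]*n x M) (+-congˡ (+ (x %ℕ M)) (ℤₚ.*-comm (x /ℕ M) (+ M)))) (red-eq V)

  red∈Ω : ∀ {m} (V : Vec ℤ m) → red V ∈ Ω m
  red∈Ω V = ∈-cube (red V) λ s → subst (_∈ map +_ (upTo M)) (sym (Vecₚ.lookup-map s _ V))
    (∈-map⁺ +_ (∈-upTo⁺ (n%ℕd<d (Vec.lookup V s) M)))

  red-unique : ∀ {m} {ω : Vec ℤ m} → ω ∈ Ω m → ∀ V Z → V ≡ ω ⊕ + M ⊙ Z → red V ≡ ω
  red-unique {ω = ω} ω∈ V Z refl = vec-ext λ s → coordinate s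
    where
    coordinate : ∀ s → Vec.lookup (red (ω ⊕ + M ⊙ Z)) s ≡ Vec.lookup ω s
    coordinate s with ∈-map⁻ +_ (∈-cube⁻ ω∈ s)
    ... | r , r∈ , eq = trans (Vecₚ.lookup-map s _ (ω ⊕ + M ⊙ Z)) (trans
          (residue (Vec.lookup (ω ⊕ + M ⊙ Z) s) (Vec.lookup Z s) (∈-upTo⁻ r∈)
            (trans (lookup-⊕ ω (+ M ⊙ Z) s) (cong₂ _+_ eq (trans (lookup-⊙ (+ M) Z s) (ℤₚ.*-comm (+ M) (Vec.lookup Z s))))))
          (sym eq))
      where
      residue : ∀ x z {r} → r ℕ.< M → x ≡ + r + z * + M → + (x %ℕ M) ≡ + r
      residue x z {r} r<M x≡ = +-cancelʳ (x /ℕ M * + M) (+ (x %ℕ M)) (+ r) (trans (sym (a≡a%ℕn+[a/ℕn]*n x M)) (trans x≡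
        (cong (λ q → + r + q * + M) (divmod-unique z (x /ℕ M) {r} {x %ℕ M} r<M (n%ℕd<d x M) (trans (sym x≡) (a≡a%ℕn+[a/ℕn]*n x M))))))
        where
        cancel : ∀ x c → x + c - c ≡ x
        cancel = solve-∀
        +-cancelʳ : ∀ c x y → x + c ≡ y + c → x ≡ y
        +-cancelʳ c x y h = trans (sym (cancel x c)) (trans (cong (_- c) h) (cancel y c))

  multiple⇔red : ∀ {m} {ω : Vec ℤ m} → ω ∈ Ω m → ∀ V → ind (multiple? M (V ⊖ ω)) ≡ ind (red V ≟ᵛ ω)
  multiple⇔red {ω = ω} ω∈ V = ind-cong (multiple? M (V ⊖ ω)) (red V ≟ᵛ ω)
    (λ p → red-unique ω∈ V (divᵛ M (V ⊖ ω)) (trans (sym (⊖-⊕ M V ω)) (trans (cong (_⊕ ω) p) (Vecₚ.zipWith-comm ℤₚ.+-comm _ ω))))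
    (λ { refl → multiple M (divᵛ M V) (vec-ext λ s → trans (lookup-⊖ V (red V) s) (trans
      (cong (_- Vec.lookup (red V) s) (trans (cong (λ z → Vec.lookup z s) (red-eq V)) (lookup-⊕ (red V) (+ M ⊙ divᵛ M V) s)))
      (lemma (Vec.lookup (red V) s) (Vec.lookup (+ M ⊙ divᵛ M V) s)))) })
    where
    lemma : ∀ a b → a + b - a ≡ b
    lemma = solve-∀

  0∈Ω : ∀ m → 𝟎 ∈ Ω m
  0∈Ω m = ∈-cube 𝟎 λ s → subst (_∈ map +_ (upTo M)) (sym (Vecₚ.lookup-replicate s 0ℤ)) (∈-map⁺ +_ (∈-upTo⁺ (ℕ.>-nonZero⁻¹ M)))

  Ω-lookup : ∀ {m} {ω : Vec ℤ m} → ω ∈ Ω m → ∀ s → ∣ Vec.lookup ω s ∣ ℕ.≤ M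
  Ω-lookup ω∈ s with ∈-map⁻ +_ (∈-cube⁻ ω∈ s)
  ... | r , r∈ , eq = subst (ℕ._≤ M) (cong ∣_∣ (sym eq)) (ℕₚ.<⇒≤ (∈-upTo⁻ r∈))

  Div : ℤ → Set
  Div x = x ≡ + M * (x /ℕ M)

  div? : ∀ x → Dec (Div x)
  div? x = x ℤₚ.≟ + M * (x /ℕ M)

  div-intro : ∀ {x} q → x ≡ + M * q → Div x
  div-intro q refl = cong (+ M *_) (sym (*-/ℕ M q))

  div-+ : ∀ x q → ind (div? (x + + M * q)) ≡ ind (div? x)
  div-+ x q = ind-cong (div? (x + + M * q)) (div? x)
    (λ p → div-intro ((x + + M * q) /ℕ M - q) (trans (lemma x (+ M * q)) (trans (cong (_- + M * q) p) (lemma₂ (+ M) ((x + + M * q) /ℕ M) q))))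
    (λ p → div-intro (x /ℕ M + q) (trans (cong (_+ + M * q) p) (sym (ℤₚ.*-distribˡ-+ (+ M) (x /ℕ M) q))))
    where
    lemma : ∀ x y → x ≡ x + y - y
    lemma = solve-∀
    lemma₂ : ∀ m a b → m * a - m * b ≡ m * (a - b)
    lemma₂ = solve-∀

  div-red : ∀ {m} (u V : Vec ℤ m) c → ind (div? (⟨ u , V ⟩ - c)) ≡ ind (div? (⟨ u , red V ⟩ - c))
  div-red u V c = trans (cong (λ z → ind (div? z)) eq) (div-+ (⟨ u , red V ⟩ - c) ⟨ u , divᵛ M V ⟩)
    where
    lemma : ∀ a b c → a + b - c ≡ a - c + b
    lemma = solve-∀
    eq : ⟨ u , V ⟩ - c ≡ ⟨ u , red V ⟩ - c + + M * ⟨ u , divᵛ M V ⟩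
    eq = trans (cong (λ z → ⟨ u , z ⟩ - c) (red-eq V)) (trans (cong (_- c) (trans (dot-⊕ʳ u (red V) (+ M ⊙ divᵛ M V))
      (+-congˡ ⟨ u , red V ⟩ (dot-⊙ʳ (+ M) u (divᵛ M V))))) (lemma ⟨ u , red V ⟩ (+ M * ⟨ u , divᵛ M V ⟩) c))

  count : ∀ {m} → Vec ℤ m → ℤ → ℤ
  count {m} u c = ∑ (λ ω → ind (div? (⟨ u , ω ⟩ - c))) (Ω m)

  -- ω ↦ ω + (⟨u′,ω⟩ − ⟨u,ω⟩)(e − e′) exchanges the values of u and u′.
  count-equal : ∀ {m} (u u′ e e′ : Vec ℤ m) → ⟨ u , e ⟩ ≡ 1ℤ → ⟨ u′ , e ⟩ ≡ 0ℤ → ⟨ u , e′ ⟩ ≡ 0ℤ → ⟨ u′ , e′ ⟩ ≡ 1ℤ →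
    ∀ c → count u c ≡ count u′ c
  count-equal {m} u u′ e e′ ue u′e ue′ u′e′ c = ∑-reindex _≟ᵛ_ τ τ (Ω-unique m) (Ω-unique m)
    (λ ω ω∈ _ → red∈Ω (swap ω) , involutive ω∈ , val₁ ω)
    (λ ω ω∈ _ → red∈Ω (swap ω) , involutive ω∈ , val₂ ω)
    where
    d : Vec ℤ m
    d = e ⊖ e′
    swap τ : Vec ℤ m → Vec ℤ m
    swap ω = ω ⊕ (⟨ u′ , ω ⟩ - ⟨ u , ω ⟩) ⊙ d
    τ ω = red (swap ω)
    u·d : ⟨ u , d ⟩ ≡ 1ℤ
    u·d = trans (dot-⊖ʳ u e e′) (cong₂ _-_ ue ue′)
    u′·d : ⟨ u′ , d ⟩ ≡ - 1ℤ
    u′·d = trans (dot-⊖ʳ u′ e e′) (cong₂ _-_ u′e u′e′)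
    dot-swap : ∀ w ω x → ⟨ w , d ⟩ ≡ x → ⟨ w , swap ω ⟩ ≡ ⟨ w , ω ⟩ + (⟨ u′ , ω ⟩ - ⟨ u , ω ⟩) * x
    dot-swap w ω x h = trans (dot-⊕ʳ w ω _) (+-congˡ ⟨ w , ω ⟩ (trans (dot-⊙ʳ (⟨ u′ , ω ⟩ - ⟨ u , ω ⟩) w d) (cong ((⟨ u′ , ω ⟩ - ⟨ u , ω ⟩) *_) h)))
    u-swap : ∀ ω → ⟨ u , swap ω ⟩ ≡ ⟨ u′ , ω ⟩
    u-swap ω = trans (dot-swap u ω 1ℤ u·d) (lemma ⟨ u , ω ⟩ ⟨ u′ , ω ⟩)
      where
      lemma : ∀ a b → a + (b - a) * 1ℤ ≡ b
      lemma = solve-∀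
    u′-swap : ∀ ω → ⟨ u′ , swap ω ⟩ ≡ ⟨ u , ω ⟩
    u′-swap ω = trans (dot-swap u′ ω (- 1ℤ) u′·d) (lemma ⟨ u , ω ⟩ ⟨ u′ , ω ⟩)
      where
      lemma : ∀ a b → b + (b - a) * - 1ℤ ≡ a
      lemma = solve-∀
    val₁ : ∀ ω → ind (div? (⟨ u′ , τ ω ⟩ - c)) ≡ ind (div? (⟨ u , ω ⟩ - c))
    val₁ ω = trans (sym (div-red u′ (swap ω) c)) (cong (λ z → ind (div? (z - c))) (u′-swap ω))
    val₂ : ∀ ω → ind (div? (⟨ u , τ ω ⟩ - c)) ≡ ind (div? (⟨ u′ , ω ⟩ - c))
    val₂ ω = trans (sym (div-red u (swap ω) c)) (cong (λ z → ind (div? (z - c))) (u-swap ω))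
    involutive : ∀ {ω} → ω ∈ Ω m → τ (τ ω) ≡ ω
    involutive {ω} ω∈ = red-unique ω∈ (swap (τ ω)) Y (vec-ext λ s →
      trans (lookup-⊕ (τ ω) ((⟨ u′ , τ ω ⟩ - ⟨ u , τ ω ⟩) ⊙ d) s) (trans (cong₂ (λ a b → a + b)
          (τω s) (trans (lookup-⊙ (⟨ u′ , τ ω ⟩ - ⟨ u , τ ω ⟩) d s) (cong₂ (λ a b → (a - b) * Vec.lookup d s)
            (dot-τ u′ (λ ω → ⟨ u , ω ⟩) u′-swap) (dot-τ u (λ ω → ⟨ u′ , ω ⟩) u-swap))))
        (trans (lemma (Vec.lookup ω s) ⟨ u , ω ⟩ ⟨ u′ , ω ⟩ (Vec.lookup d s) (+ M) (Vec.lookup Z s) ⟨ u , Z ⟩ ⟨ u′ , Z ⟩)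
          (sym (trans (lookup-⊕ ω (+ M ⊙ Y) s) (+-congˡ (Vec.lookup ω s) (trans (lookup-⊙ (+ M) Y s) (cong (+ M *_)
            (trans (lookup-⊕ (neg Z) (κ ⊙ d) s) (cong₂ _+_ (lookup-neg Z s) (lookup-⊙ κ d s)))))))))))
      where
      Z : Vec ℤ m
      Z = divᵛ M (swap ω)
      κ : ℤ
      κ = ⟨ u , Z ⟩ - ⟨ u′ , Z ⟩
      Y : Vec ℤ m
      Y = neg Z ⊕ κ ⊙ d
      unred : ∀ {a b c : ℤ} → a ≡ b + c → b ≡ a - c
      unred {a} {b} {c} h = trans (lem b c) (cong (_- c) (sym h))
        where
        lem : ∀ b c → b ≡ b + c - c
        lem = solve-∀
      τω : ∀ s → Vec.lookup (τ ω) s ≡ Vec.lookup ω s + (⟨ u′ , ω ⟩ - ⟨ u , ω ⟩) * Vec.lookup d s - + M * Vec.lookup Z s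
      τω s = trans (unred (trans (cong (λ z → Vec.lookup z s) (red-eq (swap ω))) (trans (lookup-⊕ (τ ω) (+ M ⊙ Z) s)
        (+-congˡ (Vec.lookup (τ ω) s) (lookup-⊙ (+ M) Z s)))))
        (cong (_- + M * Vec.lookup Z s) (trans (lookup-⊕ ω ((⟨ u′ , ω ⟩ - ⟨ u , ω ⟩) ⊙ d) s) (+-congˡ (Vec.lookup ω s) (lookup-⊙ (⟨ u′ , ω ⟩ - ⟨ u , ω ⟩) d s))))
      dot-τ : ∀ w (x : Vec ℤ m → ℤ) → (∀ ω → ⟨ w , swap ω ⟩ ≡ x ω) → ⟨ w , τ ω ⟩ ≡ x ω - + M * ⟨ w , Z ⟩
      dot-τ w x h = trans (unred (trans (cong (λ z → ⟨ w , z ⟩) (red-eq (swap ω))) (trans (dot-⊕ʳ w (τ ω) (+ M ⊙ Z))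
        (+-congˡ ⟨ w , τ ω ⟩ (dot-⊙ʳ (+ M) w Z))))) (cong (_- + M * ⟨ w , Z ⟩) (h ω))
      lemma : ∀ ω a b d M z p q → ω + (b - a) * d - M * z + (a - M * q - (b - M * p)) * d ≡ ω + M * (- z + (p - q) * d)
      lemma = solve-∀

module Jets {m : ℕ} (k : ℕ) .{{_ : NonZero k}} (σ : ℕ) .{{_ : NonZero σ}} (M : ℕ) .{{_ : NonZero M}} where

  open Laws {m} k σ public
  open Residues M public

  inClass : Vec ℤ m → Vec ℤ m → ℤ
  inClass ω V = ind (red V ≟ᵛ ω)

  mass : ℕ → Vec ℤ m → ℤ
  mass N ω = ∑ (λ V → inClass ω V * W N V) (box N m)

  moment : ℕ → Vec ℤ m → Fin m → ℤ
  moment N ω s = ∑ (λ V → inClass ω V * (W N V * Vec.lookup V s)) (box N m)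

  private
    C₁ : ℕ
    C₁ = σ ℕ.* (m ℕ.* (M ℕ.* M))

  K₁ : ℕ
  K₁ = M ℕ.^ degree ℕ.* (suc (2 ℕ.* (1 ℕ.+ order ℕ.* M)) ℕ.^ m ℕ.* (2 ℕ.^ order ℕ.* E C₁ ℕ.^ k))

  module _ (w : Vec ℤ m) (w₀ : ℤ) where
    open Weighted w w₀

    classSum : ℕ → Vec ℤ m → ℤ
    classSum N ω = ∑ (λ V → inClass ω V * F (N ℕ.* N) V) (box N m)

    -- `near-invariance` for the indicator of multiples of M, of period M along any vector, with
    -- displacement ω.
    classSum-close : ∀ N lb → .{{_ : NonZero N}} → (∀ X → 0ℤ ℤ.≤ gap (N ℕ.* N) X → ∣ weight X ∣ ℕ.≤ lb) → ∀ {ω} → ω ∈ Ω m →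
      ∣ classSum N ω - classSum N 𝟎 ∣ ℕ.≤ K₁ ℕ.* (N ℕ.^ m ℕ.* (N ℕ.* N) ℕ.^ k ℕ.* lb)
    classSum-close N lb hl {ω} ω∈ = ℕₚ.≤-trans
      (subst₂ (λ i j → ∣ i - j ∣ ℕ.≤ bound)
        (∑-cong′ (box N m) λ V → cong (_* F (N ℕ.* N) V) (multiple⇔red ω∈ V))
        (∑-cong′ (box N m) λ V → cong (_* F (N ℕ.* N) V) (trans (cong (λ z → ind (multiple? M z)) (sym (⊖-𝟎 V))) (multiple⇔red (0∈Ω m) V)))
        (near-invariance {N ℕ.* N} {N} {C₁} {M} {lb} M (λ X → ind (multiple? M X)) ω (λ X → ∣ind∣≤1 (multiple? M X))
          (λ X → multiple-shift M X ω) hl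
          (λ X s h → lookup-bound N X s (norm≤gap (N ℕ.* N) X h))
          (subst (+ σ * ‖ ω ‖² ℤ.≤_) (sym (ℤₚ.pos-* σ (m ℕ.* (M ℕ.* M)))) (*-monoˡ-≤ {c = + σ} (+≤+ z≤n) (norm-bound ω M (Ω-lookup ω∈))))
          (Ω-lookup ω∈)))
      (ℕₚ.≤-trans (ℕₚ.*-monoʳ-≤ (M ℕ.^ degree) (ℕₚ.*-mono-≤ len (ℕₚ.≤-reflexive (cong (λ z → 2 ℕ.^ order ℕ.* (z ℕ.* lb)) (^-distribʳ-* k (E C₁) (N ℕ.* N))))))
        (ℕₚ.≤-reflexive (lemma (M ℕ.^ degree) L (N ℕ.^ m) (2 ℕ.^ order) (E C₁ ℕ.^ k) ((N ℕ.* N) ℕ.^ k) lb)))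
      where
      L bound : ℕ
      L = suc (2 ℕ.* (1 ℕ.+ order ℕ.* M)) ℕ.^ m
      bound = M ℕ.^ degree ℕ.* (length (box (N ℕ.+ order ℕ.* M) m) ℕ.* (2 ℕ.^ order ℕ.* ((E C₁ ℕ.* (N ℕ.* N)) ℕ.^ k ℕ.* lb)))
      len : length (box (N ℕ.+ order ℕ.* M) m) ℕ.≤ L ℕ.* N ℕ.^ m
      len = subst (λ z → length (box (z ℕ.+ order ℕ.* M) m) ℕ.≤ L ℕ.* N ℕ.^ m) (ℕₚ.*-identityˡ N) (length-box-bound 1 (order ℕ.* M) m N)
      lemma : ∀ d l n o e a b → d ℕ.* (l ℕ.* n ℕ.* (o ℕ.* (e ℕ.* a ℕ.* b))) ≡ d ℕ.* (l ℕ.* (o ℕ.* e)) ℕ.* (n ℕ.* a ℕ.* b)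
      lemma = ℕ-Solver.solve-∀
      ⊖-𝟎 : ∀ (V : Vec ℤ m) → V ⊖ 𝟎 ≡ V
      ⊖-𝟎 V = vec-ext λ s → trans (lookup-⊖ V 𝟎 s) (trans (cong (λ z → Vec.lookup V s - z) (Vecₚ.lookup-replicate s 0ℤ)) (ℤₚ.+-identityʳ _))

  mass-close : ∀ N {ω} → .{{_ : NonZero N}} → ω ∈ Ω m → ∣ mass N ω - mass N 𝟎 ∣ ℕ.≤ K₁ ℕ.* (N ℕ.^ m ℕ.* (N ℕ.* N) ℕ.^ k)
  mass-close N {ω} ω∈ = subst₂ (λ i j → ∣ i - j ∣ ℕ.≤ K₁ ℕ.* (N ℕ.^ m ℕ.* (N ℕ.* N) ℕ.^ k)) (eq ω) (eq 𝟎)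
    (subst (∣ classSum 𝟎 1ℤ N ω - classSum 𝟎 1ℤ N 𝟎 ∣ ℕ.≤_) (cong (K₁ ℕ.*_) (ℕₚ.*-identityʳ _))
      (classSum-close 𝟎 1ℤ N 1 (λ X _ → ℕₚ.≤-reflexive (cong ∣_∣ (one X))) ω∈))
    where
    one : ∀ X → Weighted.weight 𝟎 1ℤ X ≡ 1ℤ
    one X = cong (_+_ 1ℤ) (trans (dot-comm 𝟎 X) (dot-𝟎ʳ X))
    eq : ∀ ω → classSum 𝟎 1ℤ N ω ≡ mass N ω
    eq ω = ∑-cong′ (box N m) λ V → *-congˡ (inClass ω V) (trans (*-congˡ (W N V) (one V)) (ℤₚ.*-identityʳ (W N V)))

  -- V ↦ -V preserves the class of 0 and the weight and reverses the coordinate. Other classes need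
  -- not be symmetric; their moments are small by comparison with this one.
  moment-0 : ∀ N s → moment N 𝟎 s ≡ 0ℤ
  moment-0 N s = self-neg (moment N 𝟎 s) (trans reflected (∑-neg (λ V → inClass 𝟎 V * (W N V * Vec.lookup V s)) (box N m)))
    where
    self-neg : ∀ x → x ≡ - x → x ≡ 0ℤ
    self-neg (+ zero)  _  = refl
    self-neg (+ suc n) ()
    self-neg -[1+ n ]  ()
    neg-neg : ∀ V → neg (neg V) ≡ V
    neg-neg V = vec-ext λ s → trans (lookup-neg (neg V) s) (trans (cong (-_) (lookup-neg V s)) (ℤₚ.neg-involutive _))
    class-neg : ∀ V → red V ≡ 𝟎 → red (neg V) ≡ 𝟎
    class-neg V h = red-unique (0∈Ω m) (neg V) (neg (divᵛ M V)) (vec-ext λ s → trans (lookup-neg V s) (trans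
      (cong (-_) (trans (cong (λ z → Vec.lookup z s) (red-eq V)) (trans (lookup-⊕ (red V) _ s) (cong₂ _+_
        (trans (cong (λ z → Vec.lookup z s) h) (Vecₚ.lookup-replicate s 0ℤ)) (lookup-⊙ (+ M) (divᵛ M V) s)))))
      (trans (lemma (+ M) (Vec.lookup (divᵛ M V) s)) (sym (trans (lookup-⊕ 𝟎 _ s) (cong₂ _+_ (Vecₚ.lookup-replicate s 0ℤ)
        (trans (lookup-⊙ (+ M) (neg (divᵛ M V)) s) (cong (+ M *_) (lookup-neg (divᵛ M V) s)))))))))
      where
      lemma : ∀ M x → - (0ℤ + M * x) ≡ 0ℤ + M * - x
      lemma = solve-∀
    term : ∀ V → - (inClass 𝟎 (neg V) * (W N (neg V) * Vec.lookup (neg V) s)) ≡ inClass 𝟎 V * (W N V * Vec.lookup V s)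
    term V = trans (cong₂ (λ a b → - (a * b))
        (ind-cong (red (neg V) ≟ᵛ 𝟎) (red V ≟ᵛ 𝟎) (λ h → trans (cong red (sym (neg-neg V))) (class-neg (neg V) h)) (class-neg V))
        (cong₂ _*_ (cong (λ z → + (pos (+ (N ℕ.* N) - + σ * z) ℕ.^ (2 ℕ.* k))) (norm-neg V)) (lookup-neg V s)))
      (lemma (inClass 𝟎 V) (W N V) (Vec.lookup V s))
      where
      lemma : ∀ a b c → - (a * (b * - c)) ≡ a * (b * c)
      lemma = solve-∀
    inBox : ∀ V → V ∈ box N m → neg V ∈ box N m
    inBox V V∈ = ∈-box N (neg V) λ s → subst (ℕ._≤ N) (sym (trans (cong ∣_∣ (lookup-neg V s)) (ℤₚ.∣-i∣≡∣i∣ (Vec.lookup V s)))) (∈-box⁻ N V∈ s)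
    reflected : moment N 𝟎 s ≡ ∑ (λ V → - (inClass 𝟎 V * (W N V * Vec.lookup V s))) (box N m)
    reflected = ∑-reindex _≟ᵛ_ neg neg (box-unique N m) (box-unique N m)
      (λ V V∈ _ → inBox V V∈ , neg-neg V , term V)
      (λ V V∈ _ → inBox V V∈ , neg-neg V , trans (sym (term (neg V))) (cong (λ z → - (inClass 𝟎 z * (W N z * Vec.lookup z s))) (neg-neg V)))

  moment-small : ∀ N {ω} s → .{{_ : NonZero N}} → ω ∈ Ω m → ∣ moment N ω s ∣ ℕ.≤ K₁ ℕ.* (N ℕ.^ m ℕ.* (N ℕ.* N) ℕ.^ k ℕ.* N)
  moment-small N {ω} s ω∈ = subst (ℕ._≤ K₁ ℕ.* (N ℕ.^ m ℕ.* (N ℕ.* N) ℕ.^ k ℕ.* N))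
    (cong ∣_∣ (trans (cong₂ _-_ (eq ω) (trans (eq 𝟎) (moment-0 N s))) (ℤₚ.+-identityʳ (moment N ω s))))
    (classSum-close (unit s) 0ℤ N N (λ X h → subst (ℕ._≤ N) (cong ∣_∣ (sym (value X))) (lookup-bound N X s (norm≤gap (N ℕ.* N) X h))) ω∈)
    where
    value : ∀ X → Weighted.weight (unit s) 0ℤ X ≡ Vec.lookup X s
    value X = trans (ℤₚ.+-identityˡ _) (trans (dot-comm (unit s) X) (dot-unit X s))
    eq : ∀ ω → classSum (unit s) 0ℤ N ω ≡ moment N ω s
    eq ω = ∑-cong′ (box N m) λ V → *-congˡ (inClass ω V) (*-congˡ (W N V) (value V))

-- Second antidifferences

module Antidifference (M : ℕ) .{{_ : NonZero M}} (R : ℕ) (D : ℤ → ℤ) where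

  open Residues M

  range : List ℤ
  range = interval R

  -- On multiples z = κM these are (κ - 1)₊ and (1 - κ)₊, the one-sided fundamental solutions of the
  -- second difference of step M. They differ by the affine function κ - 1.
  kernelʳ kernelˡ : ℤ → ℤ
  kernelʳ z = ind (div? z) * + pos (z /ℕ M - 1ℤ)
  kernelˡ z = ind (div? z) * + pos (1ℤ - z /ℕ M)

  q : ℤ → ℤ
  q y = ∑ (λ y′ → kernelʳ (y′ - y) * D y′) range

  /ℕ-shift : ∀ {z} → Div z → ∀ j → (z + + M * j) /ℕ M ≡ z /ℕ M + j
  /ℕ-shift {z} dz j = trans (cong (_/ℕ M) (trans (cong (_+ + M * j) dz) (sym (ℤₚ.*-distribˡ-+ (+ M) (z /ℕ M) j)))) (*-/ℕ M (z /ℕ M + j))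

  second-difference : ∀ κ → + pos (κ - 1ℤ) - + 2 * + pos (κ + 1ℤ - 1ℤ) + + pos (κ + + 2 - 1ℤ) ≡ ind (κ ℤₚ.≟ 0ℤ)
  second-difference (+ zero)        = refl
  second-difference (+ suc n) = trans (cong₂ (λ a b → + pos a - + 2 * + pos (+ suc n + 1ℤ - 1ℤ) + + pos b) (ℤₚ.+-comm (+ suc n) (- 1ℤ)) (lemma (+ suc n)))
    (trans (cong (λ a → + n - + 2 * + pos a + + pos (+ suc n + 1ℤ)) (lemma₂ (+ suc n)))
      (lemma₃ (+ n)))
    where
    lemma : ∀ x → x + + 2 - 1ℤ ≡ x + 1ℤ
    lemma = solve-∀
    lemma₂ : ∀ x → x + 1ℤ - 1ℤ ≡ x
    lemma₂ = solve-∀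
    lemma₃ : ∀ x → x - + 2 * (1ℤ + x) + (1ℤ + x + 1ℤ) ≡ 0ℤ
    lemma₃ = solve-∀
  second-difference -[1+ zero ]     = refl
  second-difference -[1+ suc zero ] = refl
  second-difference -[1+ suc (suc n) ] = refl

  kernel-difference : ∀ z → kernelʳ z - + 2 * kernelʳ (z + + M * 1ℤ) + kernelʳ (z + + M * + 2) ≡ ind (z ℤₚ.≟ 0ℤ)
  kernel-difference z with div? z in eq
  ... | yes dz = trans (cong₂ (λ a b → 1ℤ * + pos (z /ℕ M - 1ℤ) - + 2 * a + b) (value 1ℤ) (value (+ 2)))
      (trans (lemma (+ pos (z /ℕ M - 1ℤ)) (+ pos (z /ℕ M + 1ℤ - 1ℤ)) (+ pos (z /ℕ M + + 2 - 1ℤ)))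
        (trans (second-difference (z /ℕ M)) (ind-cong (z /ℕ M ℤₚ.≟ 0ℤ) (z ℤₚ.≟ 0ℤ)
          (λ h → trans dz (trans (cong (+ M *_) h) (ℤₚ.*-zeroʳ (+ M))))
          (λ h → trans (cong (_/ℕ M) (trans h (sym (ℤₚ.*-zeroʳ (+ M))))) (*-/ℕ M 0ℤ)))))
    where
    value : ∀ j → kernelʳ (z + + M * j) ≡ 1ℤ * + pos (z /ℕ M + j - 1ℤ)
    value j = cong₂ (λ a b → a * + pos (b - 1ℤ)) (trans (div-+ z j) (ind-yes (div? z) dz)) (/ℕ-shift dz j)
    lemma : ∀ a b c → 1ℤ * a - + 2 * (1ℤ * b) + 1ℤ * c ≡ a - + 2 * b + c
    lemma = solve-∀
  ... | no ¬dz = trans (cong₂ (λ a b → 0ℤ - + 2 * a + b) (value 1ℤ) (value (+ 2)))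
      (sym (ind-no (z ℤₚ.≟ 0ℤ) λ { refl → ¬dz (div-intro 0ℤ (sym (ℤₚ.*-zeroʳ (+ M)))) }))
    where
    value : ∀ j → kernelʳ (z + + M * j) ≡ 0ℤ
    value j = cong (_* + pos ((z + + M * j) /ℕ M - 1ℤ)) (trans (div-+ z j) (ind-no (div? z) ¬dz))

  q-difference : (∀ y → ¬ y ∈ range → D y ≡ 0ℤ) → ∀ y → q y - + 2 * q (y - + M * 1ℤ) + q (y - + M * + 2) ≡ D y
  q-difference supp y = trans (sym expand) (trans (∑-cong′ range term) pick)
    where
    f₀ f₁ f₂ : ℤ → ℤ
    f₀ y′ = kernelʳ (y′ - y) * D y′
    f₁ y′ = kernelʳ (y′ - (y - + M * 1ℤ)) * D y′
    f₂ y′ = kernelʳ (y′ - (y - + M * + 2)) * D y′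
    expand : ∑ (λ y′ → f₀ y′ - + 2 * f₁ y′ + f₂ y′) range ≡ q y - + 2 * q (y - + M * 1ℤ) + q (y - + M * + 2)
    expand = trans (∑-+ (λ y′ → f₀ y′ - + 2 * f₁ y′) f₂ range) (cong (_+ ∑ f₂ range)
      (trans (∑-- f₀ (λ y′ → + 2 * f₁ y′) range) (cong (λ a → ∑ f₀ range - a) (∑-*ˡ (+ 2) f₁ range))))
    move : ∀ y′ y a → y′ - (y - a) ≡ y′ - y + a
    move = solve-∀
    term : ∀ y′ → f₀ y′ - + 2 * f₁ y′ + f₂ y′ ≡ ind (y′ - y ℤₚ.≟ 0ℤ) * D y′
    term y′ = trans (cong₂ (λ a b → f₀ y′ - + 2 * (kernelʳ a * D y′) + kernelʳ b * D y′) (move y′ y (+ M * 1ℤ)) (move y′ y (+ M * + 2)))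
      (trans (lemma (kernelʳ (y′ - y)) (kernelʳ (y′ - y + + M * 1ℤ)) (kernelʳ (y′ - y + + M * + 2)) (D y′)) (cong (_* D y′) (kernel-difference (y′ - y))))
      where
      lemma : ∀ a b c d → a * d - + 2 * (b * d) + c * d ≡ (a - + 2 * b + c) * d
      lemma = solve-∀
    off : ∀ y′ → y′ ≢ y → ind (y′ - y ℤₚ.≟ 0ℤ) * D y′ ≡ 0ℤ
    off y′ ne = cong (_* D y′) (ind-no (y′ - y ℤₚ.≟ 0ℤ) (ne ∘ ℤₚ.i-j≡0⇒i≡j y′ y))
    pick : ∑ (λ y′ → ind (y′ - y ℤₚ.≟ 0ℤ) * D y′) range ≡ D y
    pick with ∣ y ∣ ℕₚ.≤? R
    ... | yes y≤ = trans (∑-single {a = y} (interval-unique R) (∈-interval y≤) (λ y′ _ → off y′))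
                     (trans (cong (_* D y) (ind-yes (y - y ℤₚ.≟ 0ℤ) (ℤₚ.+-inverseʳ y))) (ℤₚ.*-identityˡ (D y)))
    ... | no y≰ = trans (∑-zero range λ y′ y′∈ → off y′ λ { refl → y≰ (∈-interval⁻ {R} y′∈) }) (sym (supp y (y≰ ∘ ∈-interval⁻ {R})))

  kernelʳ-support : ∀ y′ y → kernelʳ (y′ - y) ≢ 0ℤ → y + + M * + 2 ℤ.≤ y′
  kernelʳ-support y′ y ne = subst (y + + M * + 2 ℤ.≤_) (trans (cong (_+_ y) (sym dz)) (lemma y y′)) (ℤₚ.+-monoʳ-≤ y (*-monoˡ-≤ {c = + M} (+≤+ z≤n) 2≤κ))
    where
    κ : ℤ
    κ = (y′ - y) /ℕ M
    dz : Div (y′ - y)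
    dz = ind-≢0 (div? (y′ - y)) (*≢0ˡ ne)
    lemma : ∀ y y′ → y + (y′ - y) ≡ y′
    lemma = solve-∀
    2≤κ : + 2 ℤ.≤ κ
    2≤κ = subst (+ 2 ℤ.≤_) (lemma₂ κ) (ℤₚ.+-monoʳ-≤ 1ℤ (ℤₚ.i<j⇒suc[i]≤j {0ℤ} {κ - 1ℤ} (pos-≢0 λ z → *≢0ʳ (ind (div? (y′ - y))) ne (cong +_ z))))
      where
      lemma₂ : ∀ κ → 1ℤ + (κ - 1ℤ) ≡ κ
      lemma₂ = solve-∀

  kernelˡ-support : ∀ y′ y → kernelˡ (y′ - y) ≢ 0ℤ → y′ ℤ.≤ y
  kernelˡ-support y′ y ne = ℤₚ.i-j≤0⇒i≤j (subst (ℤ._≤ 0ℤ) (sym dz) (subst (+ M * κ ℤ.≤_) (ℤₚ.*-zeroʳ (+ M)) (*-monoˡ-≤ {c = + M} (+≤+ z≤n) κ≤0)))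
    where
    κ : ℤ
    κ = (y′ - y) /ℕ M
    dz : Div (y′ - y)
    dz = ind-≢0 (div? (y′ - y)) (*≢0ˡ ne)
    κ≤0 : κ ℤ.≤ 0ℤ
    κ≤0 = 0≤i-j⇒j≤i (subst (0ℤ ℤ.≤_) (lemma κ) (ℤₚ.i≤j⇒0≤j-i {1ℤ} {1ℤ - κ} (ℤₚ.i<j⇒suc[i]≤j {0ℤ} {1ℤ - κ} (pos-≢0 λ z → *≢0ʳ (ind (div? (y′ - y))) ne (cong +_ z)))))
      where
      lemma : ∀ κ → 1ℤ - κ - 1ℤ ≡ 0ℤ - κ
      lemma = solve-∀

  kernel-bound : ∀ x j → + ∣ j ∣ ℤ.≤ 1ℤ + + ∣ x /ℕ M ∣ → ∣ ind (div? x) * + pos j ∣ ℕ.≤ suc ∣ x ∣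
  kernel-bound x j hj with div? x
  ... | no _ = z≤n
  ... | yes dx = subst (ℕ._≤ suc ∣ x ∣) (cong ∣_∣ (sym (ℤₚ.*-identityˡ (+ pos j))))
      (ℕₚ.≤-trans (pos≤∣∣ j) (ℕₚ.≤-trans (ℤₚ.drop‿+≤+ hj) (s≤s (subst (∣ x /ℕ M ∣ ℕ.≤_) (trans (sym (ℤₚ.abs-* (+ M) (x /ℕ M))) (cong ∣_∣ (sym dx)))
        (ℕₚ.m≤n*m ∣ x /ℕ M ∣ M)))))
    where
    pos≤∣∣ : ∀ j → pos j ℕ.≤ ∣ j ∣
    pos≤∣∣ (+ n)    = ℕₚ.≤-refl
    pos≤∣∣ -[1+ n ] = z≤n

  kernelʳ-bound : ∀ z → ∣ kernelʳ z ∣ ℕ.≤ suc ∣ z ∣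
  kernelʳ-bound z = kernel-bound z (z /ℕ M - 1ℤ) (+≤+ (subst (∣ z /ℕ M - 1ℤ ∣ ℕ.≤_) (ℕₚ.+-comm ∣ z /ℕ M ∣ 1) (ℤₚ.∣i-j∣≤∣i∣+∣j∣ (z /ℕ M) 1ℤ)))

  kernelˡ-bound : ∀ z → ∣ kernelˡ z ∣ ℕ.≤ suc ∣ z ∣
  kernelˡ-bound z = kernel-bound z (1ℤ - z /ℕ M) (+≤+ (ℤₚ.∣i-j∣≤∣i∣+∣j∣ 1ℤ (z /ℕ M)))

  sum-bound : ∀ (K : ℤ → ℤ) → (∀ z → ∣ K z ∣ ℕ.≤ suc ∣ z ∣) → ∀ y b → y ∈ range →
    (∀ y′ → y′ ∈ range → K (y′ - y) ≢ 0ℤ → ∣ D y′ ∣ ℕ.≤ b) →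
    ∣ ∑ (λ y′ → K (y′ - y) * D y′) range ∣ ℕ.≤ suc (R ℕ.+ R) ℕ.* (suc (R ℕ.+ R) ℕ.* b)
  sum-bound K hK y b y∈ hD = subst (λ l → ∣ ∑ (λ y′ → K (y′ - y) * D y′) range ∣ ℕ.≤ l ℕ.* (suc (R ℕ.+ R) ℕ.* b)) (length-interval R)
    (∑-bound {f = λ y′ → K (y′ - y) * D y′} range term)
    where
    term : ∀ y′ → y′ ∈ range → ∣ K (y′ - y) * D y′ ∣ ℕ.≤ suc (R ℕ.+ R) ℕ.* b
    term y′ y′∈ with K (y′ - y) ℤₚ.≟ 0ℤ
    ... | yes z = subst (ℕ._≤ suc (R ℕ.+ R) ℕ.* b) (cong ∣_∣ (sym (cong (_* D y′) z))) z≤n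
    ... | no ne = subst (ℕ._≤ suc (R ℕ.+ R) ℕ.* b) (sym (ℤₚ.abs-* (K (y′ - y)) (D y′)))
                    (ℕₚ.*-mono-≤ (ℕₚ.≤-trans (hK (y′ - y)) (s≤s (ℕₚ.≤-trans (ℤₚ.∣i-j∣≤∣i∣+∣j∣ y′ y) (ℕₚ.+-mono-≤ (∈-interval⁻ {R} y′∈) (∈-interval⁻ {R} y∈)))))
                      (hD y′ y′∈ ne))

  q-boundʳ : ∀ y b → y ∈ range → (∀ y′ → y + + M * + 2 ℤ.≤ y′ → ∣ D y′ ∣ ℕ.≤ b) → ∣ q y ∣ ℕ.≤ suc (R ℕ.+ R) ℕ.* (suc (R ℕ.+ R) ℕ.* b)
  q-boundʳ y b y∈ h = sum-bound kernelʳ kernelʳ-bound y b y∈ (λ y′ _ ne → h y′ (kernelʳ-support y′ y ne))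

  module _ (mass-0 : ∀ c → ∑ (λ y → ind (div? (y - c)) * D y) range ≡ 0ℤ)
           (mean-0 : ∀ c → ∑ (λ y → ind (div? (y - c)) * (y * D y)) range ≡ 0ℤ) where

    -- On each class the kernels differ by an affine function, which integrates to zero against `D`
    -- by `mass-0` and `mean-0`. The first formula for `q y` sees only y′ ≥ y + 2M and the second
    -- only y′ ≤ y, so `q y` can be estimated from whichever tail lies farther out, where `D` is
    -- smaller.
    q-left : ∀ y → q y ≡ ∑ (λ y′ → kernelˡ (y′ - y) * D y′) range
    q-left y = ℤₚ.i-j≡0⇒i≡j (q y) _ (cancel (trans (sym (∑-*ˡ-difference)) (trans (∑-cong′ range term) (trans split both-zero))))
      where
      f g : ℤ → ℤ
      f y′ = kernelʳ (y′ - y) * D y′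
      g y′ = kernelˡ (y′ - y) * D y′
      a b : ℤ → ℤ
      a y′ = ind (div? (y′ - y)) * (y′ * D y′)
      b y′ = ind (div? (y′ - y)) * D y′
      ∑-*ˡ-difference : ∑ (λ y′ → + M * (f y′ - g y′)) range ≡ + M * (∑ f range - ∑ g range)
      ∑-*ˡ-difference = trans (∑-*ˡ (+ M) (λ y′ → f y′ - g y′) range) (cong (+ M *_) (∑-- f g range))
      pos-pos : ∀ κ → + pos (κ - 1ℤ) - + pos (1ℤ - κ) ≡ κ - 1ℤ
      pos-pos κ = trans (cong (λ z → + pos (κ - 1ℤ) - + pos z) (flip κ)) (go (κ - 1ℤ))
        where
        flip : ∀ κ → 1ℤ - κ ≡ - (κ - 1ℤ)
        flip = solve-∀
        go : ∀ j → + pos j - + pos (- j) ≡ j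
        go (+ zero)  = refl
        go (+ suc n) = ℤₚ.+-identityʳ _
        go -[1+ n ]  = refl
      term : ∀ y′ → + M * (f y′ - g y′) ≡ a y′ - (y + + M) * b y′
      term y′ with div? (y′ - y)
      ... | no _ = trans (ℤₚ.*-zeroʳ (+ M)) (sym (trans (cong (λ z → 0ℤ - z) (ℤₚ.*-zeroʳ (y + + M))) refl))
      ... | yes dz = trans (lemma (+ M) (+ pos (κ - 1ℤ)) (+ pos (1ℤ - κ)) (D y′)) (trans (cong (λ z → + M * z * D y′) (pos-pos κ))
            (trans (lemma₂ (+ M) κ (D y′)) (trans (cong (λ z → (z - + M) * D y′) (sym dz)) (lemma₃ y′ y (+ M) (D y′)))))
        where
        κ : ℤ
        κ = (y′ - y) /ℕ M
        lemma : ∀ M p n d → M * (1ℤ * p * d - 1ℤ * n * d) ≡ M * (p - n) * d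
        lemma = solve-∀
        lemma₂ : ∀ M κ d → M * (κ - 1ℤ) * d ≡ (M * κ - M) * d
        lemma₂ = solve-∀
        lemma₃ : ∀ y′ y M d → (y′ - y - M) * d ≡ 1ℤ * (y′ * d) - (y + M) * (1ℤ * d)
        lemma₃ = solve-∀
      split : ∑ (λ y′ → a y′ - (y + + M) * b y′) range ≡ ∑ a range - (y + + M) * ∑ b range
      split = trans (∑-- a (λ y′ → (y + + M) * b y′) range) (cong (λ z → ∑ a range - z) (∑-*ˡ (y + + M) b range))
      both-zero : ∑ a range - (y + + M) * ∑ b range ≡ 0ℤ
      both-zero = cong₂ _-_ (mean-0 y) (trans (cong ((y + + M) *_) (mass-0 y)) (ℤₚ.*-zeroʳ (y + + M)))
      cancel : ∀ {x} → + M * x ≡ 0ℤ → x ≡ 0ℤ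
      cancel {x} h with ℤₚ.i*j≡0⇒i≡0∨j≡0 (+ M) h
      ... | inj₁ M≡0 = contradiction (ℤₚ.+-injective M≡0) (ℕ.≢-nonZero⁻¹ M)
      ... | inj₂ x≡0 = x≡0

    q-boundˡ : ∀ y b → y ∈ range → (∀ y′ → y′ ℤ.≤ y → ∣ D y′ ∣ ℕ.≤ b) → ∣ q y ∣ ℕ.≤ suc (R ℕ.+ R) ℕ.* (suc (R ℕ.+ R) ℕ.* b)
    q-boundˡ y b y∈ h = subst (λ z → ∣ z ∣ ℕ.≤ suc (R ℕ.+ R) ℕ.* (suc (R ℕ.+ R) ℕ.* b)) (sym (q-left y))
      (sum-bound kernelˡ kernelˡ-bound y b y∈ (λ y′ _ ne → h y′ (kernelˡ-support y′ y ne)))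

    -- Beyond the right end of the range the first formula for `q` has no nonzero term, beyond the
    -- left end the second has none.
    q-support : ∀ y → ¬ y ∈ range → q y ≡ 0ℤ
    q-support y y∉ with ℤₚ.≤-total 0ℤ y
    ... | inj₁ 0≤y = ∑-zero range λ y′ y′∈ → vanish y′ y′∈
      where
      vanish : ∀ y′ → y′ ∈ range → kernelʳ (y′ - y) * D y′ ≡ 0ℤ
      vanish y′ y′∈ with kernelʳ (y′ - y) ℤₚ.≟ 0ℤ
      ... | yes z = cong (_* D y′) z
      ... | no ne = contradiction (∈-interval {R} (abs-≤ 0≤y (ℤₚ.≤-trans (subst (ℤ._≤ y + + M * + 2) (ℤₚ.+-identityʳ y)
              (ℤₚ.+-monoʳ-≤ y (*-nonNeg {+ M} (+≤+ z≤n) (+≤+ z≤n)))) (kernelʳ-support y′ y ne)) (∈-interval⁻ {R} y′∈))) y∉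
        where
        abs-≤ : ∀ {y y′ R} → 0ℤ ℤ.≤ y → y ℤ.≤ y′ → ∣ y′ ∣ ℕ.≤ R → ∣ y ∣ ℕ.≤ R
        abs-≤ {+ _} {+ _} _ (+≤+ h) h′ = ℕₚ.≤-trans h h′
    ... | inj₂ y≤0 = trans (q-left y) (∑-zero range λ y′ y′∈ → vanish y′ y′∈)
      where
      vanish : ∀ y′ → y′ ∈ range → kernelˡ (y′ - y) * D y′ ≡ 0ℤ
      vanish y′ y′∈ with kernelˡ (y′ - y) ℤₚ.≟ 0ℤ
      ... | yes z = cong (_* D y′) z
      ... | no ne = contradiction (∈-interval {R} (abs-≤ y≤0 (kernelˡ-support y′ y ne) (∈-interval⁻ {R} y′∈))) y∉
        where
        abs-≤ : ∀ {y y′ R} → y ℤ.≤ 0ℤ → y′ ℤ.≤ y → ∣ y′ ∣ ℕ.≤ R → ∣ y ∣ ℕ.≤ R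
        abs-≤ {+ zero} _ _ _ = z≤n
        abs-≤ {+ suc _} (+≤+ ())
        abs-≤ { -[1+ _ ]} { -[1+ _ ]} _ (-≤- h) h′ = ℕₚ.≤-trans (s≤s h) h′

∑-point : ∀ (xs : List ℤ) (g : ℤ → ℤ) z → Unique xs → (¬ z ∈ xs → g z ≡ 0ℤ) →
  ∑ (λ y → ind (y ℤₚ.≟ z) * g y) xs ≡ g z
∑-point xs g z u out with Any.any? (z ℤₚ.≟_) xs
... | yes z∈ = trans (∑-single u z∈ λ y _ y≢ → cong (_* g y) (ind-no (y ℤₚ.≟ z) y≢))
                 (trans (cong (_* g z) (ind-yes (z ℤₚ.≟ z) refl)) (ℤₚ.*-identityˡ (g z)))
... | no z∉ = trans (∑-zero xs λ y y∈ → cong (_* g y) (ind-no (y ℤₚ.≟ z) λ { refl → z∉ y∈ })) (sym (out z∉))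

length-concatMap : ∀ {A B : Set} (f : A → List B) n xs → (∀ x → length (f x) ≡ n) → length (concatMap f xs) ≡ length xs ℕ.* n
length-concatMap f n []       h = refl
length-concatMap f n (x ∷ xs) h = trans (Listₚ.length-++ (f x)) (cong₂ ℕ._+_ (h x) (length-concatMap f n xs h))

∈-concatMap⁻ : ∀ {A B : Set} (f : A → List B) xs {b} → b ∈ concatMap f xs → ∃ λ x → x ∈ xs × b ∈ f x
∈-concatMap⁻ f (x ∷ xs) b∈ with ∈-++⁻ (f x) b∈
... | inj₁ h = x , here refl , h
... | inj₂ h = let y , y∈ , h′ = ∈-concatMap⁻ f xs h in y , there y∈ , h′

-- Signed measures and the exact correction of their laws

Atom : ℕ → Set
Atom m = Vec ℤ m × ℤ

integral : ∀ {m} → (Vec ℤ m → ℤ) → List (Atom m) → ℤ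
integral φ = ∑ (λ a → φ (proj₁ a) * proj₂ a)

lawOf : ∀ {m} → List (Atom m) → Vec ℤ m → ℤ → ℤ
lawOf μ u y = integral (λ x → ind (⟨ u , x ⟩ ℤₚ.≟ y)) μ

lawOf-push : ∀ {m} N (μ : List (Atom m)) u (g : ℤ → ℤ) →
  (∀ a → a ∈ μ → proj₂ a ≢ 0ℤ → ∣ ⟨ u , proj₁ a ⟩ ∣ ℕ.≤ N) →
  ∑ (λ y → g y * lawOf μ u y) (interval N) ≡ integral (λ x → g ⟨ u , x ⟩) μ
lawOf-push N μ u g supp = trans (∑-cong′ (interval N) λ y → sym (∑-*ˡ (g y) (λ a → ind (⟨ u , proj₁ a ⟩ ℤₚ.≟ y) * proj₂ a) μ))
  (trans (∑-swap (λ y a → g y * (ind (⟨ u , proj₁ a ⟩ ℤₚ.≟ y) * proj₂ a)) (interval N) μ) (∑-cong μ inner))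
  where
  inner : ∀ a → a ∈ μ → ∑ (λ y → g y * (ind (⟨ u , proj₁ a ⟩ ℤₚ.≟ y) * proj₂ a)) (interval N) ≡ g ⟨ u , proj₁ a ⟩ * proj₂ a
  inner a@(x , c) a∈ = trans (∑-cong′ (interval N) term) (∑-point (interval N) (λ y → g y * c) ⟨ u , x ⟩ (interval-unique N) out)
    where
    term : ∀ y → g y * (ind (⟨ u , x ⟩ ℤₚ.≟ y) * c) ≡ ind (y ℤₚ.≟ ⟨ u , x ⟩) * (g y * c)
    term y = trans (cong (λ z → g y * (z * c)) (ind-cong (⟨ u , x ⟩ ℤₚ.≟ y) (y ℤₚ.≟ ⟨ u , x ⟩) sym sym)) (lemma (g y) (ind (y ℤₚ.≟ ⟨ u , x ⟩)) c)
      where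
      lemma : ∀ a b c → a * (b * c) ≡ b * (a * c)
      lemma = solve-∀
    out : ¬ ⟨ u , x ⟩ ∈ interval N → g ⟨ u , x ⟩ * c ≡ 0ℤ
    out ∉ with c ℤₚ.≟ 0ℤ
    ... | yes z = trans (cong (g ⟨ u , x ⟩ *_) z) (ℤₚ.*-zeroʳ (g ⟨ u , x ⟩))
    ... | no c≢0 = contradiction (∈-interval (supp a a∈ c≢0)) ∉

-- All that the analytic part needs of the linear relation: `u₀` carries the law to which the others
-- are adjusted, the dual vectors `e` make all values attainable, and `kill` confines the correction
-- for i to the law of `u i`.
record System (r m σ M : ℕ) : Set where
  field
    u e v v′ : Fin r → Vec ℤ m
    u₀ e₀    : Vec ℤ m
    uu   : ∀ i → ‖ u i ‖² ≡ + σ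
    u₀u₀ : ‖ u₀ ‖² ≡ + σ
    uu₀  : ∀ i → ⟨ u i , u₀ ⟩ ≡ 0ℤ
    ue   : ∀ i → ⟨ u i , e i ⟩ ≡ 1ℤ
    u₀e  : ∀ i → ⟨ u₀ , e i ⟩ ≡ 0ℤ
    ue₀  : ∀ i → ⟨ u i , e₀ ⟩ ≡ 0ℤ
    u₀e₀ : ⟨ u₀ , e₀ ⟩ ≡ 1ℤ
    uv   : ∀ i → ⟨ u i , v i ⟩ ≡ + M
    uv′  : ∀ i → ⟨ u i , v′ i ⟩ ≡ + M
    kill : ∀ i j → j ≢ i → ⟨ u j , v i ⟩ ≡ 0ℤ ⊎ ⟨ u j , v′ i ⟩ ≡ 0ℤ

module Exactness {r m σ M : ℕ} .{{_ : NonZero σ}} .{{_ : NonZero M}} (sys : System r m σ M) (k : ℕ) .{{_ : NonZero k}} (N : ℕ) where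

  open System sys
  open Jets {m} k σ M

  frame : Fin r → Compare.Frame {m} k σ
  frame i = record { u = u i ; u′ = u₀ ; e = e i ; e′ = e₀ ; uu = uu i ; u′u′ = u₀u₀ ; uu′ = uu₀ i
                   ; ue = ue i ; u′e = u₀e i ; ue′ = ue₀ i ; u′e′ = u₀e₀ }

  defect : Vec ℤ m → ℤ
  defect ω = mass N 𝟎 - mass N ω

  -- `α` and `β` solve two requirements on the class of ω: α + Σβ = M · defect equalises the masses,
  -- and M · moment + M · defect · ω + Mβ = 0 centres every coordinate. Points of one class differ
  -- by multiples of M, so moving weight changes moments by multiples of M; the factor M in `base`
  -- therefore makes the solution integral.
  β : Vec ℤ m → Fin m → ℤ
  β ω s = - (moment N ω s + defect ω * Vec.lookup ω s)

  α : Vec ℤ m → ℤ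
  α ω = + M * defect ω - ∑ (β ω) (allFin m)

  base : List (Atom m)
  base = map (λ V → V , + M * W N V) (box N m)

  coreAtoms : Vec ℤ m → List (Atom m)
  coreAtoms ω = (ω , α ω) ∷ map (λ s → (ω ⊕ + M ⊙ unit s) , β ω s) (allFin m)

  -- Makes V uniformly distributed modulo M, with mean zero on each class.
  core : List (Atom m)
  core = concatMap coreAtoms (Ω m)

  core-cases : (P : Atom m → Set) → (∀ ω → ω ∈ Ω m → P (ω , α ω)) →
    (∀ ω → ω ∈ Ω m → ∀ s → P ((ω ⊕ + M ⊙ unit s) , β ω s)) → ∀ a → a ∈ core → P a
  core-cases P h h′ a a∈ with ∈-concatMap⁻ coreAtoms (Ω m) a∈
  ... | ω , ω∈ , here refl = h ω ω∈
  ... | ω , ω∈ , there a∈′ with ∈-map⁻ (λ s → (ω ⊕ + M ⊙ unit s) , β ω s) a∈′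
  ... | s , _ , refl = h′ ω ω∈ s

  module _ (w : Vec ℤ m) (c : ℤ) where

    G : Vec ℤ m → ℤ
    G V = ind (div? (⟨ w , V ⟩ - c))

    G-red : ∀ V → ∑ (λ ω → G ω * inClass ω V) (Ω m) ≡ G V
    G-red V = trans (∑-single (Ω-unique m) (red∈Ω V) λ ω _ ω≢ → trans (cong (G ω *_) (ind-no (red V ≟ᵛ ω) (ω≢ ∘ sym))) (ℤₚ.*-zeroʳ (G ω)))
      (trans (cong (G (red V) *_) (ind-yes (red V ≟ᵛ red V) refl)) (trans (ℤₚ.*-identityʳ (G (red V))) (sym (div-red w V c))))

    G-shift : ∀ ω s → G (ω ⊕ + M ⊙ unit s) ≡ G ω
    G-shift ω s = trans (cong (λ z → ind (div? z)) eq) (div-+ (⟨ w , ω ⟩ - c) ⟨ w , unit s ⟩)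
      where
      lemma : ∀ a b c → a + b - c ≡ a - c + b
      lemma = solve-∀
      eq : ⟨ w , ω ⊕ + M ⊙ unit s ⟩ - c ≡ ⟨ w , ω ⟩ - c + + M * ⟨ w , unit s ⟩
      eq = trans (cong (_- c) (trans (dot-⊕ʳ w ω (+ M ⊙ unit s)) (+-congˡ ⟨ w , ω ⟩ (dot-⊙ʳ (+ M) w (unit s))))) (lemma ⟨ w , ω ⟩ (+ M * ⟨ w , unit s ⟩) c)

    byClass : ∀ (f : Vec ℤ m → ℤ) → ∑ (λ V → G V * f V) (box N m) ≡ ∑ (λ ω → G ω * ∑ (λ V → inClass ω V * f V) (box N m)) (Ω m)
    byClass f = trans (∑-cong′ (box N m) λ V → trans (cong (_* f V) (sym (G-red V))) (trans (sym (∑-*ʳ (f V) (λ ω → G ω * inClass ω V) (Ω m)))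
        (∑-cong′ (Ω m) λ ω → ℤₚ.*-assoc (G ω) (inClass ω V) (f V))))
      (trans (∑-swap (λ V ω → G ω * (inClass ω V * f V)) (box N m) (Ω m))
        (∑-cong′ (Ω m) λ ω → ∑-*ˡ (G ω) (λ V → inClass ω V * f V) (box N m)))

    ∑-core : ∀ (φ : Vec ℤ m → ℤ) → integral φ core ≡ ∑ (λ ω → φ ω * α ω + ∑ (λ s → φ (ω ⊕ + M ⊙ unit s) * β ω s) (allFin m)) (Ω m)
    ∑-core φ = trans (∑-concatMap (λ a → φ (proj₁ a) * proj₂ a) coreAtoms (Ω m)) (∑-cong′ (Ω m) λ ω →
      +-congˡ (φ ω * α ω) (∑-map (λ a → φ (proj₁ a) * proj₂ a) (λ s → (ω ⊕ + M ⊙ unit s) , β ω s) (allFin m)))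

    -- Whether M divides ⟨w,V⟩ - c depends only on the class of V, and in the adjusted measure all
    -- classes have the same mass. What remains is the number of classes, which `count-equal` shows
    -- to be the same for `u i` and `u₀`.
    mass-integral : integral G (base ++ core) ≡ + M * mass N 𝟎 * count w c
    mass-integral = trans (∑-++ (λ a → G (proj₁ a) * proj₂ a) base core) (trans (cong₂ _+_ basePart corePart)
      (trans (sym (∑-+ (λ ω → + M * (G ω * mass N ω)) (λ ω → G ω * (+ M * defect ω)) (Ω m)))
        (trans (∑-cong′ (Ω m) λ ω → lemma (+ M) (G ω) (mass N ω) (mass N 𝟎)) (∑-*ˡ (+ M * mass N 𝟎) G (Ω m)))))
      where
      lemma : ∀ M g a z → M * (g * a) + g * (M * (z - a)) ≡ M * z * g
      lemma = solve-∀
      swap : ∀ g M w → g * (M * w) ≡ M * (g * w)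
      swap = solve-∀
      basePart : integral G base ≡ ∑ (λ ω → + M * (G ω * mass N ω)) (Ω m)
      basePart = trans (∑-map (λ a → G (proj₁ a) * proj₂ a) (λ V → V , + M * W N V) (box N m))
        (trans (∑-cong′ (box N m) λ V → swap (G V) (+ M) (W N V)) (trans (∑-*ˡ (+ M) (λ V → G V * W N V) (box N m))
          (trans (cong (+ M *_) (byClass (W N))) (sym (∑-*ˡ (+ M) (λ ω → G ω * mass N ω) (Ω m))))))
      corePart : integral G core ≡ ∑ (λ ω → G ω * (+ M * defect ω)) (Ω m)
      corePart = trans (∑-core G) (∑-cong′ (Ω m) λ ω → trans
        (+-congˡ (G ω * α ω) (trans (∑-cong′ (allFin m) λ s → cong (_* β ω s) (G-shift ω s)) (∑-*ˡ (G ω) (β ω) (allFin m))))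
        (lemma₂ (G ω) (+ M * defect ω) (∑ (β ω) (allFin m))))
        where
        lemma₂ : ∀ g d b → g * (d - b) + g * b ≡ g * d
        lemma₂ = solve-∀

    -- Within each class every coordinate has mean zero in the adjusted measure, hence so has every
    -- linear functional.
    mean-integral : integral (λ x → G x * ⟨ w , x ⟩) (base ++ core) ≡ 0ℤ
    mean-integral = trans (∑-++ (λ a → G (proj₁ a) * ⟨ w , proj₁ a ⟩ * proj₂ a) base core) (trans (cong₂ _+_ basePart corePart)
      (trans (sym (∑-+ (λ ω → + M * (G ω * mom ω)) (λ ω → G ω * (⟨ w , ω ⟩ * (+ M * defect ω) + + M * ∑ (λ s → Vec.lookup w s * β ω s) (allFin m))) (Ω m)))
        (∑-zero (Ω m) λ ω _ → trans (cong (λ z → + M * (G ω * mom ω) + G ω * (⟨ w , ω ⟩ * (+ M * defect ω) + + M * z)) (wβ ω))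
          (lemma (+ M) (G ω) (mom ω) ⟨ w , ω ⟩ (defect ω)))))
      where
      mom : Vec ℤ m → ℤ
      mom ω = ∑ (λ s → Vec.lookup w s * moment N ω s) (allFin m)
      lemma : ∀ M g x w d → M * (g * x) + g * (w * (M * d) + M * - (x + d * w)) ≡ 0ℤ
      lemma = solve-∀
      wβ : ∀ ω → ∑ (λ s → Vec.lookup w s * β ω s) (allFin m) ≡ - (mom ω + defect ω * ⟨ w , ω ⟩)
      wβ ω = trans (∑-cong′ (allFin m) λ s → lemma₁ (Vec.lookup w s) (moment N ω s) (defect ω) (Vec.lookup ω s))
        (trans (∑-neg (λ s → Vec.lookup w s * moment N ω s + defect ω * (Vec.lookup w s * Vec.lookup ω s)) (allFin m))
          (cong (-_) (trans (∑-+ (λ s → Vec.lookup w s * moment N ω s) (λ s → defect ω * (Vec.lookup w s * Vec.lookup ω s)) (allFin m))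
            (+-congˡ (mom ω) (trans (∑-*ˡ (defect ω) (λ s → Vec.lookup w s * Vec.lookup ω s) (allFin m)) (cong (defect ω *_) (sym (dot-∑ w ω))))))))
        where
        lemma₁ : ∀ w x d o → w * - (x + d * o) ≡ - (w * x + d * (w * o))
        lemma₁ = solve-∀
      swap : ∀ g w M x → g * w * (M * x) ≡ M * (g * (w * x))
      swap = solve-∀
      class-mom : ∀ ω → ∑ (λ V → inClass ω V * (⟨ w , V ⟩ * W N V)) (box N m) ≡ mom ω
      class-mom ω = trans (∑-cong′ (box N m) λ V → trans (cong (λ z → inClass ω V * (z * W N V)) (dot-∑ w V))
          (trans (lemma₁ (inClass ω V) (∑ (λ s → Vec.lookup w s * Vec.lookup V s) (allFin m)) (W N V)) (trans (sym (∑-*ʳ (inClass ω V * W N V) (λ s → Vec.lookup w s * Vec.lookup V s) (allFin m)))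
            (∑-cong′ (allFin m) λ s → lemma₂ (Vec.lookup w s) (Vec.lookup V s) (inClass ω V) (W N V)))))
        (trans (∑-swap (λ V s → Vec.lookup w s * (inClass ω V * (W N V * Vec.lookup V s))) (box N m) (allFin m))
          (∑-cong′ (allFin m) λ s → ∑-*ˡ (Vec.lookup w s) (λ V → inClass ω V * (W N V * Vec.lookup V s)) (box N m)))
        where
        lemma₁ : ∀ a b c → a * (b * c) ≡ b * (a * c)
        lemma₁ = solve-∀
        lemma₂ : ∀ w v a b → w * v * (a * b) ≡ w * (a * (b * v))
        lemma₂ = solve-∀
      basePart : integral (λ x → G x * ⟨ w , x ⟩) base ≡ ∑ (λ ω → + M * (G ω * mom ω)) (Ω m)
      basePart = trans (∑-map (λ a → G (proj₁ a) * ⟨ w , proj₁ a ⟩ * proj₂ a) (λ V → V , + M * W N V) (box N m))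
        (trans (∑-cong′ (box N m) λ V → swap (G V) ⟨ w , V ⟩ (+ M) (W N V)) (trans (∑-*ˡ (+ M) (λ V → G V * (⟨ w , V ⟩ * W N V)) (box N m))
          (trans (cong (+ M *_) (trans (byClass (λ V → ⟨ w , V ⟩ * W N V)) (∑-cong′ (Ω m) λ ω → cong (G ω *_) (class-mom ω))))
            (sym (∑-*ˡ (+ M) (λ ω → G ω * mom ω) (Ω m))))))
      corePart : integral (λ x → G x * ⟨ w , x ⟩) core ≡ ∑ (λ ω → G ω * (⟨ w , ω ⟩ * (+ M * defect ω) + + M * ∑ (λ s → Vec.lookup w s * β ω s) (allFin m))) (Ω m)
      corePart = trans (∑-core (λ x → G x * ⟨ w , x ⟩)) (∑-cong′ (Ω m) λ ω → trans (+-congˡ (G ω * ⟨ w , ω ⟩ * α ω)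
          (trans (∑-cong′ (allFin m) λ s → trans (cong₂ (λ a b → a * b * β ω s) (G-shift ω s) (dot-shift ω s)) (lemma₁ (G ω) ⟨ w , ω ⟩ (+ M) (Vec.lookup w s) (β ω s)))
            (trans (∑-+ (λ s → G ω * ⟨ w , ω ⟩ * β ω s) (λ s → G ω * + M * (Vec.lookup w s * β ω s)) (allFin m))
              (cong₂ _+_ (∑-*ˡ (G ω * ⟨ w , ω ⟩) (β ω) (allFin m)) (∑-*ˡ (G ω * + M) (λ s → Vec.lookup w s * β ω s) (allFin m))))))
        (lemma₂ (G ω) ⟨ w , ω ⟩ (+ M * defect ω) (∑ (β ω) (allFin m)) (+ M) (∑ (λ s → Vec.lookup w s * β ω s) (allFin m))))
        where
        dot-shift : ∀ ω s → ⟨ w , ω ⊕ + M ⊙ unit s ⟩ ≡ ⟨ w , ω ⟩ + + M * Vec.lookup w s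
        dot-shift ω s = trans (dot-⊕ʳ w ω (+ M ⊙ unit s)) (+-congˡ ⟨ w , ω ⟩ (trans (dot-⊙ʳ (+ M) w (unit s)) (cong (+ M *_) (dot-unit w s))))
        lemma₁ : ∀ g w M x b → g * (w + M * x) * b ≡ g * w * b + g * M * (x * b)
        lemma₁ = solve-∀
        lemma₂ : ∀ g w d b M x → g * w * (d - b) + (g * w * b + g * M * x) ≡ g * (w * d + M * x)
        lemma₂ = solve-∀

  Supported : List (Atom m) → Set
  Supported μ = ∀ w → ‖ w ‖² ≡ + σ → ∀ a → a ∈ μ → proj₂ a ≢ 0ℤ → ∣ ⟨ w , proj₁ a ⟩ ∣ ℕ.≤ N

  base-supported : Supported base
  base-supported w ww a a∈ ne with ∈-map⁻ (λ V → V , + M * W N V) a∈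
  ... | V , _ , refl = dot-bound N V w ww (norm≤gap (N ℕ.* N) V (W≢0 (N ℕ.* N) V (*≢0ʳ (+ M) ne)))

  module Corrected (core-supported : Supported core) where

    start : List (Atom m)
    start = base ++ core

    start-supported : Supported start
    start-supported w ww a a∈ ne with ∈-++⁻ base a∈
    ... | inj₁ a∈b = base-supported w ww a a∈b ne
    ... | inj₂ a∈c = core-supported w ww a a∈c ne

    D : Fin r → ℤ → ℤ
    D i y = lawOf start u₀ y - lawOf start (u i) y

    law-outside : ∀ w → ‖ w ‖² ≡ + σ → ∀ y → ¬ y ∈ interval N → lawOf start w y ≡ 0ℤ
    law-outside w ww y y∉ = ∑-zero start λ a a∈ → vanish a a∈
      where
      vanish : ∀ a → a ∈ start → ind (⟨ w , proj₁ a ⟩ ℤₚ.≟ y) * proj₂ a ≡ 0ℤ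
      vanish (x , c) a∈ with ⟨ w , x ⟩ ℤₚ.≟ y | c ℤₚ.≟ 0ℤ
      ... | no _  | _ = refl
      ... | yes _ | yes refl = refl
      ... | yes h | no c≢0 = contradiction (subst (_∈ interval N) h (∈-interval (start-supported w ww (x , c) a∈ c≢0))) y∉

    D-outside : ∀ i y → ¬ y ∈ interval N → D i y ≡ 0ℤ
    D-outside i y y∉ = cong₂ _-_ (law-outside u₀ u₀u₀ y y∉) (law-outside (u i) (uu i) y y∉)

    D-mass : ∀ i c → ∑ (λ y → ind (div? (y - c)) * D i y) (interval N) ≡ 0ℤ
    D-mass i c = trans (∑-cong′ (interval N) λ y → lemma (ind (div? (y - c))) (lawOf start u₀ y) (lawOf start (u i) y))
      (trans (∑-- (λ y → ind (div? (y - c)) * lawOf start u₀ y) (λ y → ind (div? (y - c)) * lawOf start (u i) y) (interval N))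
        (trans (cong₂ _-_ (value u₀ u₀u₀) (value (u i) (uu i)))
          (trans (cong (λ z → + M * mass N 𝟎 * count u₀ c - + M * mass N 𝟎 * z) (count-equal (u i) u₀ (e i) e₀ (ue i) (u₀e i) (ue₀ i) u₀e₀ c)) (ℤₚ.+-inverseʳ (+ M * mass N 𝟎 * count u₀ c)))))
      where
      lemma : ∀ g a b → g * (a - b) ≡ g * a - g * b
      lemma = solve-∀
      value : ∀ w → ‖ w ‖² ≡ + σ → ∑ (λ y → ind (div? (y - c)) * lawOf start w y) (interval N) ≡ + M * mass N 𝟎 * count w c
      value w ww = trans (lawOf-push N start w (λ y → ind (div? (y - c))) (start-supported w ww)) (mass-integral w c)

    D-mean : ∀ i c → ∑ (λ y → ind (div? (y - c)) * (y * D i y)) (interval N) ≡ 0ℤ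
    D-mean i c = trans (∑-cong′ (interval N) λ y → lemma (ind (div? (y - c))) y (lawOf start u₀ y) (lawOf start (u i) y))
      (trans (∑-- (λ y → ind (div? (y - c)) * y * lawOf start u₀ y) (λ y → ind (div? (y - c)) * y * lawOf start (u i) y) (interval N))
        (cong₂ _-_ (value u₀ u₀u₀) (value (u i) (uu i))))
      where
      lemma : ∀ g y a b → g * (y * (a - b)) ≡ g * y * a - g * y * b
      lemma = solve-∀
      value : ∀ w → ‖ w ‖² ≡ + σ → ∑ (λ y → ind (div? (y - c)) * y * lawOf start w y) (interval N) ≡ 0ℤ
      value w ww = trans (lawOf-push N start w (λ y → ind (div? (y - c)) * y) (start-supported w ww)) (mean-integral w c)

    module A (i : Fin r) = Antidifference M N (D i)

    q : Fin r → ℤ → ℤ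
    q i = A.q i

    -- A lattice point with value y under `u i` at bounded distance from the line spanned by `u i`.
    -- Among the points with this value it is nearly the closest to the origin, where the radial
    -- weight is greatest.
    foot : Fin r → ℤ → Vec ℤ m
    foot i y = (y /ℕ σ) ⊙ u i ⊕ + (y %ℕ σ) ⊙ e i

    u-foot : ∀ i y → ⟨ u i , foot i y ⟩ ≡ y
    u-foot i y = trans (dot-⊕ʳ (u i) ((y /ℕ σ) ⊙ u i) (+ (y %ℕ σ) ⊙ e i)) (trans (cong₂ _+_
        (trans (dot-⊙ʳ (y /ℕ σ) (u i) (u i)) (cong ((y /ℕ σ) *_) (uu i)))
        (trans (dot-⊙ʳ (+ (y %ℕ σ)) (u i) (e i)) (trans (cong (+ (y %ℕ σ) *_) (ue i)) (ℤₚ.*-identityʳ _))))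
      (trans (ℤₚ.+-comm ((y /ℕ σ) * + σ) (+ (y %ℕ σ))) (sym (a≡a%ℕn+[a/ℕn]*n y σ))))

    square : Fin r → ℤ → List (Atom m)
    square i y = (foot i y , q i y) ∷ (foot i y ⊕ v i , - q i y) ∷ (foot i y ⊕ v′ i , - q i y) ∷ (foot i y ⊕ v i ⊕ v′ i , q i y) ∷ []

    -- (1 − [v])(1 − [v′]) has law (1 − t^M)² under u i and law 0 under the other u j.
    correction : Fin r → List (Atom m)
    correction i = concatMap (square i) (interval N)

    law-correction : ∀ i w y → lawOf (correction i) w y ≡ ∑ (λ z → lawOf (square i z) w y) (interval N)
    law-correction i w y = ∑-concatMap (λ a → ind (⟨ w , proj₁ a ⟩ ℤₚ.≟ y) * proj₂ a) (square i) (interval N)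

    -- `u j` is orthogonal to one of the two edge directions, and the corners joined by this edge
    -- have opposite weights.
    law-other : ∀ i j y → j ≢ i → lawOf (correction i) (u j) y ≡ 0ℤ
    law-other i j y j≢i = trans (law-correction i (u j) y) (∑-zero (interval N) λ z _ → cancel z (kill i j j≢i))
      where
      I : Vec ℤ m → ℤ
      I x = ind (⟨ u j , x ⟩ ℤₚ.≟ y)
      stay : ∀ x w → ⟨ u j , w ⟩ ≡ 0ℤ → I (x ⊕ w) ≡ I x
      stay x w h = cong (λ z → ind (z ℤₚ.≟ y)) (trans (dot-⊕ʳ (u j) x w) (trans (+-congˡ ⟨ u j , x ⟩ h) (ℤₚ.+-identityʳ ⟨ u j , x ⟩)))
      lemma₁ : ∀ a b q → a * q + (a * - q + (b * - q + (b * q + 0ℤ))) ≡ 0ℤ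
      lemma₁ = solve-∀
      lemma₂ : ∀ a b q → a * q + (b * - q + (a * - q + (b * q + 0ℤ))) ≡ 0ℤ
      lemma₂ = solve-∀
      cancel : ∀ z → ⟨ u j , v i ⟩ ≡ 0ℤ ⊎ ⟨ u j , v′ i ⟩ ≡ 0ℤ → lawOf (square i z) (u j) y ≡ 0ℤ
      cancel z (inj₁ h) = trans (cong₂ (λ a b → I x * q i z + (a * - q i z + (I (x ⊕ v′ i) * - q i z + (b * q i z + 0ℤ)))) (stay x (v i) h)
          (trans (cong I (trans (Vecₚ.zipWith-assoc ℤₚ.+-assoc x (v i) (v′ i)) (trans (cong (x ⊕_) (Vecₚ.zipWith-comm ℤₚ.+-comm (v i) (v′ i)))
            (sym (Vecₚ.zipWith-assoc ℤₚ.+-assoc x (v′ i) (v i)))))) (stay (x ⊕ v′ i) (v i) h)))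
        (lemma₁ (I x) (I (x ⊕ v′ i)) (q i z))
        where
        x : Vec ℤ m
        x = foot i z
      cancel z (inj₂ h) = trans (cong₂ (λ a b → I x * q i z + (I (x ⊕ v i) * - q i z + (a * - q i z + (b * q i z + 0ℤ)))) (stay x (v′ i) h) (stay (x ⊕ v i) (v′ i) h))
        (lemma₂ (I x) (I (x ⊕ v i)) (q i z))
        where
        x : Vec ℤ m
        x = foot i z

    -- The square at z contributes q z, -2 q z and q z at z, z + M and z + 2M, so q y - 2 q (y - M)
    -- + q (y - 2M) = D y arrives at y. As `q` vanishes off the interval, restricting the feet to it
    -- loses nothing.
    law-same : ∀ i y → lawOf (correction i) (u i) y ≡ D i y
    law-same i y = trans (law-correction i (u i) y) (trans (∑-cong′ (interval N) term)
      (trans (trans (∑-+ (λ z → P z - + 2 * Q z) S (interval N)) (cong (_+ ∑ S (interval N)) (trans (∑-- P (λ z → + 2 * Q z) (interval N)) (cong (λ a → ∑ P (interval N) - a) (∑-*ˡ (+ 2) Q (interval N))))))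
        (trans (cong₂ _+_ (cong₂ (λ a b → a - + 2 * b) (point y) (point (y - + M * 1ℤ))) (point (y - + M * + 2)))
          (A.q-difference i (D-outside i) y))))
      where
      P Q S : ℤ → ℤ
      P z = ind (z ℤₚ.≟ y) * q i z
      Q z = ind (z ℤₚ.≟ y - + M * 1ℤ) * q i z
      S z = ind (z ℤₚ.≟ y - + M * + 2) * q i z
      point : ∀ x → ∑ (λ z → ind (z ℤₚ.≟ x) * q i z) (interval N) ≡ q i x
      point x = ∑-point (interval N) (q i) x (interval-unique N) (A.q-support i (D-mass i) (D-mean i) x)
      move : ∀ z a x → x ≡ z + a → ind (x ℤₚ.≟ y) ≡ ind (z ℤₚ.≟ y - a)
      move z a x refl = ind-cong (z + a ℤₚ.≟ y) (z ℤₚ.≟ y - a) (λ { refl → lemma z a }) (λ { refl → lemma₂ y a })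
        where
        lemma : ∀ z a → z ≡ z + a - a
        lemma = solve-∀
        lemma₂ : ∀ y a → y - a + a ≡ y
        lemma₂ = solve-∀
      term : ∀ z → lawOf (square i z) (u i) y ≡ P z - + 2 * Q z + S z
      term z = trans (cong₂ (λ a b → a * q i z + b) (cong (λ w → ind (w ℤₚ.≟ y)) (u-foot i z)) (cong₂ (λ a b → a * - q i z + b) step₁
          (cong₂ (λ a b → a * - q i z + (b * q i z + 0ℤ)) step₂ step₃)))
        (lemma (ind (z ℤₚ.≟ y)) (ind (z ℤₚ.≟ y - + M * 1ℤ)) (ind (z ℤₚ.≟ y - + M * + 2)) (q i z))
        where
        x : Vec ℤ m
        x = foot i z
        lemma : ∀ a b c q → a * q + (b * - q + (b * - q + (c * q + 0ℤ))) ≡ a * q - + 2 * (b * q) + c * q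
        lemma = solve-∀
        one : ∀ w → ⟨ u i , w ⟩ ≡ + M → ⟨ u i , x ⊕ w ⟩ ≡ z + + M * 1ℤ
        one w h = trans (dot-⊕ʳ (u i) x w) (cong₂ _+_ (u-foot i z) (trans h (sym (ℤₚ.*-identityʳ (+ M)))))
        step₁ : ind (⟨ u i , x ⊕ v i ⟩ ℤₚ.≟ y) ≡ ind (z ℤₚ.≟ y - + M * 1ℤ)
        step₁ = move z (+ M * 1ℤ) ⟨ u i , x ⊕ v i ⟩ (one (v i) (uv i))
        step₂ : ind (⟨ u i , x ⊕ v′ i ⟩ ℤₚ.≟ y) ≡ ind (z ℤₚ.≟ y - + M * 1ℤ)
        step₂ = move z (+ M * 1ℤ) ⟨ u i , x ⊕ v′ i ⟩ (one (v′ i) (uv′ i))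
        step₃ : ind (⟨ u i , x ⊕ v i ⊕ v′ i ⟩ ℤₚ.≟ y) ≡ ind (z ℤₚ.≟ y - + M * + 2)
        step₃ = move z (+ M * + 2) ⟨ u i , x ⊕ v i ⊕ v′ i ⟩ (trans (dot-⊕ʳ (u i) (x ⊕ v i) (v′ i)) (trans (cong₂ _+_ (one (v i) (uv i)) (uv′ i)) (lemma₂ z (+ M))))
          where
          lemma₂ : ∀ z M → z + M * 1ℤ + M ≡ z + M * + 2
          lemma₂ = solve-∀

    corrections total : List (Atom m)
    corrections = concatMap correction (allFin r)
    total = start ++ corrections

    corrections-cases : (P : Atom m → Set) → (∀ i y → y ∈ interval N → ∀ a → a ∈ square i y → P a) → ∀ a → a ∈ corrections → P a
    corrections-cases P h a a∈ =
      let i , _ , a∈′  = ∈-concatMap⁻ correction (allFin r) a∈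
          y , y∈ , a∈″ = ∈-concatMap⁻ (square i) (interval N) a∈′
      in h i y y∈ a a∈″

    length-corrections : length corrections ≡ r ℕ.* (suc (N ℕ.+ N) ℕ.* 4)
    length-corrections = trans (length-concatMap correction _ (allFin r) λ i → trans (length-concatMap (square i) 4 (interval N) λ _ → refl) (cong (ℕ._* 4) (length-interval N)))
      (cong (ℕ._* (suc (N ℕ.+ N) ℕ.* 4)) (Listₚ.length-tabulate {n = r} id))

    -- The common target is the law of `u₀` before the corrections, which may themselves change the
    -- law of `u₀`.
    law-total : ∀ j y → lawOf total (u j) y ≡ lawOf start u₀ y
    law-total j y = trans (∑-++ (λ a → ind (⟨ u j , proj₁ a ⟩ ℤₚ.≟ y) * proj₂ a) start corrections)
      (trans (+-congˡ (lawOf start (u j) y) (trans (∑-concatMap (λ a → ind (⟨ u j , proj₁ a ⟩ ℤₚ.≟ y) * proj₂ a) correction (allFin r))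
        (trans (∑-single (Uniqueₚ.allFin⁺ r) (∈-allFin j) (λ i _ i≢j → law-other i j y (i≢j ∘ sym))) (law-same j y))))
      (lemma (lawOf start (u j) y) (lawOf start u₀ y)))
      where
      lemma : ∀ a b → a + (b - a) ≡ b
      lemma = solve-∀

-- Size estimates and nonnegativity of the corrected weights

maxOver : ∀ {r} → (Fin r → ℕ) → ℕ
maxOver {zero}  f = 0
maxOver {suc r} f = f zero ℕ.⊔ maxOver (f ∘ suc)

≤-maxOver : ∀ {r} (f : Fin r → ℕ) i → f i ℕ.≤ maxOver f
≤-maxOver f zero    = ℕₚ.m≤m⊔n (f zero) _
≤-maxOver f (suc i) = ℕₚ.≤-trans (≤-maxOver (f ∘ suc) i) (ℕₚ.m≤n⊔m (f zero) _)

square-mono : ∀ a b → - b ℤ.≤ a → a ℤ.≤ b → a * a ℤ.≤ b * b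
square-mono a b h h′ = 0≤i-j⇒j≤i (subst (0ℤ ℤ.≤_) (lemma a b) (*-nonNeg (ℤₚ.i≤j⇒0≤j-i h′) (subst (0ℤ ℤ.≤_) (lemma₂ a b) (ℤₚ.i≤j⇒0≤j-i h))))
  where
  lemma : ∀ a b → (b - a) * (b + a) ≡ b * b - a * a
  lemma = solve-∀
  lemma₂ : ∀ a b → a - - b ≡ b + a
  lemma₂ = solve-∀

module Bounds {r m σ M : ℕ} .{{_ : NonZero σ}} .{{_ : NonZero M}} (sys : System r m σ M)
  (k : ℕ) .{{_ : NonZero k}} (k≡ : k ≡ 5 ℕ.+ m) where

  open System sys

  open Jets {m} k σ M
  open CompareLaws {m} k σ using (K₀; radius; laws-close)

  private
    frame : Fin r → Compare.Frame {m} k σ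
    frame = Exactness.frame sys k 0

  footBound : Fin r → Vec ℤ m → ℕ
  footBound i κ = pos (+ σ * (+ 2 * (+ σ * + σ) * (‖ e i ‖² + ‖ κ ‖²)))

  -- Up to powers of N and of the radius, `Kc` bounds the weights in `core`, `KD` the discrepancies
  -- `D i`, and `Kg` all corrections; its 9 stems from two factors 2N + 1 ≤ 3N. `nc` is the number
  -- of atoms of `core`, and 12 = 4 · 3 counts the corners of at most 3N squares for each i; the
  -- last 1 in `Kr` makes the domination strict. `CC`, `CF` and `CE` bound squared norms, for `CF`
  -- only the part transversal to `u i`.
  KL Kc nc KD Kg Kr CC CF CE N₀ : ℕ
  KL = maxOver (λ i → 6 ℕ.* K₀ (frame i))
  Kc = K₁ ℕ.* (suc m ℕ.* suc M)
  nc = length (Ω m) ℕ.* suc m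
  KD = M ℕ.* KL ℕ.+ 2 ℕ.* (nc ℕ.* (Kc ℕ.* 2 ℕ.^ k))
  Kg = 9 ℕ.* KD ℕ.+ Kc
  Kr = nc ℕ.+ r ℕ.* 12 ℕ.+ 1
  CC = σ ℕ.* (m ℕ.* ((M ℕ.+ M) ℕ.* (M ℕ.+ M)))
  CF = maxOver (λ i → footBound i 𝟎 ℕ.+ footBound i (v i) ℕ.+ footBound i (v′ i) ℕ.+ footBound i (v i ⊕ v′ i))
  CE = maxOver (λ i → pos (+ σ * ‖ e i ‖²))
  N₀ = suc (2 ℕ.* CF ℕ.+ 2 ℕ.* CC ℕ.+ CE ℕ.+ Kg ℕ.* Kr ℕ.* 4 ℕ.^ k)

  module _ (N : ℕ) (N≥ : N₀ ℕ.≤ N) where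

    instance
      N≢0 : NonZero N
      N≢0 = ℕ.>-nonZero (ℕₚ.≤-trans (s≤s z≤n) N≥)

    N≥1 : 1 ℕ.≤ N
    N≥1 = ℕ.>-nonZero⁻¹ N

    part : ∀ {a} → a ℕ.≤ 2 ℕ.* CF ℕ.+ 2 ℕ.* CC ℕ.+ CE ℕ.+ Kg ℕ.* Kr ℕ.* 4 ℕ.^ k → a ℕ.< N
    part h = ℕₚ.≤-trans (s≤s h) N≥

    N>2CF : 2 ℕ.* CF ℕ.< N
    N>2CF = part (ℕₚ.≤-trans (ℕₚ.m≤m+n (2 ℕ.* CF) (2 ℕ.* CC)) (ℕₚ.≤-trans (ℕₚ.m≤m+n _ CE) (ℕₚ.m≤m+n _ (Kg ℕ.* Kr ℕ.* 4 ℕ.^ k))))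
    N>2CC : 2 ℕ.* CC ℕ.< N
    N>2CC = part (ℕₚ.≤-trans (ℕₚ.m≤n+m (2 ℕ.* CC) (2 ℕ.* CF)) (ℕₚ.≤-trans (ℕₚ.m≤m+n _ CE) (ℕₚ.m≤m+n _ (Kg ℕ.* Kr ℕ.* 4 ℕ.^ k))))
    N>CE : CE ℕ.< N
    N>CE = part (ℕₚ.≤-trans (ℕₚ.m≤n+m CE (2 ℕ.* CF ℕ.+ 2 ℕ.* CC)) (ℕₚ.m≤m+n _ (Kg ℕ.* Kr ℕ.* 4 ℕ.^ k)))
    N>K : Kg ℕ.* Kr ℕ.* 4 ℕ.^ k ℕ.< N
    N>K = part (ℕₚ.m≤n+m (Kg ℕ.* Kr ℕ.* 4 ℕ.^ k) (2 ℕ.* CF ℕ.+ 2 ℕ.* CC ℕ.+ CE))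

    open Exactness sys k N hiding (frame)

    height : Vec ℤ m → ℕ
    height x = pos (gap (N ℕ.* N) x)

    -- A stands for N² - z², where z is the value under `u i` of a corner, or for N² in the case of
    -- `core`. The atom lies where the radial weight is at least (A/2)^(2k), while its own weight is
    -- of the order of A^k times a fixed power of N.
    Good : Atom m → Set
    Good (x , c) = c ≡ 0ℤ ⊎ ∃ λ A → N ℕ.≤ A × A ℕ.≤ 2 ℕ.* height x × ∣ c ∣ ℕ.≤ Kg ℕ.* (N ℕ.^ (3 ℕ.+ m) ℕ.* A ℕ.^ k)

    -- Here the exponent k = m + 5 is spent. Of N^k ≤ A^k, the part N^(m+3) pays for the estimate of
    -- c, one factor N for the number of atoms, and one for the constants Kg · Kr · 4^k < N.
    good-small : ∀ x c → Good (x , c) → ∣ c ∣ ℕ.* (Kr ℕ.* N) ℕ.≤ height x ℕ.^ (2 ℕ.* k)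
    good-small x c (inj₁ refl) = z≤n
    good-small x c (inj₂ (A , N≤A , A≤ , c≤)) = ℕₚ.*-cancelˡ-≤ (4 ℕ.^ k) {{ℕ.>-nonZero (ℕₚ.m^n>0 4 k)}} (begin
      4 ℕ.^ k ℕ.* (∣ c ∣ ℕ.* (Kr ℕ.* N))                                      ≤⟨ ℕₚ.*-monoʳ-≤ (4 ℕ.^ k) (ℕₚ.*-monoˡ-≤ (Kr ℕ.* N) c≤) ⟩
      4 ℕ.^ k ℕ.* (Kg ℕ.* (N ℕ.^ (3 ℕ.+ m) ℕ.* A ℕ.^ k) ℕ.* (Kr ℕ.* N))       ≡⟨ lemma (4 ℕ.^ k) Kg (N ℕ.^ (3 ℕ.+ m)) (A ℕ.^ k) Kr N ⟩
      Kg ℕ.* Kr ℕ.* 4 ℕ.^ k ℕ.* (N ℕ.* N ℕ.^ (3 ℕ.+ m)) ℕ.* A ℕ.^ k           ≤⟨ ℕₚ.*-monoˡ-≤ (A ℕ.^ k) (ℕₚ.*-monoˡ-≤ (N ℕ.* N ℕ.^ (3 ℕ.+ m)) (ℕₚ.<⇒≤ N>K)) ⟩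
      N ℕ.* (N ℕ.* N ℕ.^ (3 ℕ.+ m)) ℕ.* A ℕ.^ k                               ≡⟨ cong (λ z → N ℕ.^ z ℕ.* A ℕ.^ k) k≡ ⟨
      N ℕ.^ k ℕ.* A ℕ.^ k                                                     ≤⟨ ℕₚ.*-monoˡ-≤ (A ℕ.^ k) (ℕₚ.^-monoˡ-≤ k N≤A) ⟩
      A ℕ.^ k ℕ.* A ℕ.^ k                                                     ≡⟨ ^-distribʳ-* k A A ⟨
      (A ℕ.* A) ℕ.^ k                                                         ≤⟨ ℕₚ.^-monoˡ-≤ k (ℕₚ.*-mono-≤ A≤ A≤) ⟩
      (2 ℕ.* height x ℕ.* (2 ℕ.* height x)) ℕ.^ k                             ≡⟨ cong (ℕ._^ k) (lemma₂ (height x)) ⟩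
      (4 ℕ.* (height x ℕ.* (height x ℕ.* 1))) ℕ.^ k                           ≡⟨ ^-distribʳ-* k 4 (height x ℕ.^ 2) ⟩
      4 ℕ.^ k ℕ.* (height x ℕ.^ 2) ℕ.^ k                                      ≡⟨ cong (4 ℕ.^ k ℕ.*_) (ℕₚ.^-*-assoc (height x) 2 k) ⟩
      4 ℕ.^ k ℕ.* height x ℕ.^ (2 ℕ.* k)                                      ∎)
      where
      open ℕₚ.≤-Reasoning
      lemma : ∀ f g n a r N → f ℕ.* (g ℕ.* (n ℕ.* a) ℕ.* (r ℕ.* N)) ≡ g ℕ.* r ℕ.* f ℕ.* (N ℕ.* n) ℕ.* a
      lemma = ℕ-Solver.solve-∀
      lemma₂ : ∀ h → 2 ℕ.* h ℕ.* (2 ℕ.* h) ≡ 4 ℕ.* (h ℕ.* (h ℕ.* 1))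
      lemma₂ = ℕ-Solver.solve-∀

    Q cmax : ℕ
    Q = (N ℕ.* N) ℕ.^ k
    cmax = Kc ℕ.* (N ℕ.^ (1 ℕ.+ m) ℕ.* Q)

    defect-bound : ∀ {ω} → ω ∈ Ω m → ∣ defect ω ∣ ℕ.≤ K₁ ℕ.* (N ℕ.^ (1 ℕ.+ m) ℕ.* Q)
    defect-bound {ω} ω∈ = subst (ℕ._≤ K₁ ℕ.* (N ℕ.^ (1 ℕ.+ m) ℕ.* Q)) (ℤₚ.∣i-j∣≡∣j-i∣ (mass N ω) (mass N 𝟎))
      (ℕₚ.≤-trans (mass-close N ω∈) (ℕₚ.*-monoʳ-≤ K₁ (ℕₚ.*-monoˡ-≤ Q (ℕₚ.m≤n*m (N ℕ.^ m) N))))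

    β-bound : ∀ {ω} s → ω ∈ Ω m → ∣ β ω s ∣ ℕ.≤ K₁ ℕ.* suc M ℕ.* (N ℕ.^ (1 ℕ.+ m) ℕ.* Q)
    β-bound {ω} s ω∈ = subst₂ ℕ._≤_ (sym (ℤₚ.∣-i∣≡∣i∣ (moment N ω s + defect ω * Vec.lookup ω s))) (lemma K₁ (N ℕ.^ (1 ℕ.+ m) ℕ.* Q) M)
      (ℕₚ.≤-trans (ℤₚ.∣i+j∣≤∣i∣+∣j∣ (moment N ω s) (defect ω * Vec.lookup ω s)) (ℕₚ.+-mono-≤
        (subst (∣ moment N ω s ∣ ℕ.≤_) (lemma₂ K₁ (N ℕ.^ m) Q N) (moment-small N s ω∈))
        (subst (ℕ._≤ K₁ ℕ.* (N ℕ.^ (1 ℕ.+ m) ℕ.* Q) ℕ.* M) (sym (ℤₚ.abs-* (defect ω) (Vec.lookup ω s))) (ℕₚ.*-mono-≤ (defect-bound ω∈) (Ω-lookup ω∈ s)))))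
      where
      lemma : ∀ k x m → k ℕ.* x ℕ.+ k ℕ.* x ℕ.* m ≡ k ℕ.* suc m ℕ.* x
      lemma = ℕ-Solver.solve-∀
      lemma₂ : ∀ k a q n → k ℕ.* (a ℕ.* q ℕ.* n) ≡ k ℕ.* (n ℕ.* a ℕ.* q)
      lemma₂ = ℕ-Solver.solve-∀

    α-bound : ∀ {ω} → ω ∈ Ω m → ∣ α ω ∣ ℕ.≤ cmax
    α-bound {ω} ω∈ = ℕₚ.≤-trans (ℤₚ.∣i-j∣≤∣i∣+∣j∣ (+ M * defect ω) (∑ (β ω) (allFin m)))
      (ℕₚ.≤-trans (ℕₚ.+-mono-≤ (subst (ℕ._≤ M ℕ.* (K₁ ℕ.* X)) (sym (ℤₚ.abs-* (+ M) (defect ω))) (ℕₚ.*-monoʳ-≤ M (defect-bound ω∈)))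
          (subst (λ l → ∣ ∑ (β ω) (allFin m) ∣ ℕ.≤ l ℕ.* (K₁ ℕ.* suc M ℕ.* X)) (Listₚ.length-tabulate {n = m} id) (∑-bound {f = β ω} (allFin m) λ s _ → β-bound s ω∈)))
        (subst (M ℕ.* (K₁ ℕ.* X) ℕ.+ m ℕ.* (K₁ ℕ.* suc M ℕ.* X) ℕ.≤_) (lemma M K₁ X m) (ℕₚ.m≤n+m _ (K₁ ℕ.* X))))
      where
      X : ℕ
      X = N ℕ.^ (1 ℕ.+ m) ℕ.* Q
      lemma : ∀ M k x m → k ℕ.* x ℕ.+ (M ℕ.* (k ℕ.* x) ℕ.+ m ℕ.* (k ℕ.* suc M ℕ.* x)) ≡ k ℕ.* (suc m ℕ.* suc M) ℕ.* x
      lemma = ℕ-Solver.solve-∀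

    ∣unit∣≤1 : ∀ {m} (s t : Fin m) → ∣ Vec.lookup (unit s) t ∣ ℕ.≤ 1
    ∣unit∣≤1 zero    zero    = ℕₚ.≤-refl
    ∣unit∣≤1 zero    (suc t) = subst (λ z → ∣ z ∣ ℕ.≤ 1) (sym (Vecₚ.lookup-replicate t 0ℤ)) z≤n
    ∣unit∣≤1 (suc s) zero    = z≤n
    ∣unit∣≤1 (suc s) (suc t) = ∣unit∣≤1 s t

    coordinate : ∀ {ω} → ω ∈ Ω m → ∀ s t → ∣ Vec.lookup (ω ⊕ + M ⊙ unit s) t ∣ ℕ.≤ M ℕ.+ M
    coordinate {ω} ω∈ s t = subst (ℕ._≤ M ℕ.+ M) (cong ∣_∣ (sym (trans (lookup-⊕ ω (+ M ⊙ unit s) t) (+-congˡ (Vec.lookup ω t) (lookup-⊙ (+ M) (unit s) t)))))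
      (ℕₚ.≤-trans (ℤₚ.∣i+j∣≤∣i∣+∣j∣ (Vec.lookup ω t) _) (ℕₚ.+-mono-≤ (Ω-lookup ω∈ t)
        (subst₂ ℕ._≤_ (sym (ℤₚ.abs-* (+ M) (Vec.lookup (unit s) t))) (ℕₚ.*-identityʳ M) (ℕₚ.*-monoʳ-≤ M (∣unit∣≤1 s t)))))

    norm-CC : ∀ (x : Vec ℤ m) → (∀ s → ∣ Vec.lookup x s ∣ ℕ.≤ M ℕ.+ M) → + σ * ‖ x ‖² ℤ.≤ + CC
    norm-CC x h = subst (+ σ * ‖ x ‖² ℤ.≤_) (sym (ℤₚ.pos-* σ (m ℕ.* ((M ℕ.+ M) ℕ.* (M ℕ.+ M))))) (*-monoˡ-≤ {c = + σ} (+≤+ z≤n) (norm-bound x (M ℕ.+ M) h))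

    core-norm : ∀ a → a ∈ core → + σ * ‖ proj₁ a ‖² ℤ.≤ + CC
    core-norm = core-cases (λ a → + σ * ‖ proj₁ a ‖² ℤ.≤ + CC)
      (λ ω ω∈ → norm-CC ω (λ s → ℕₚ.≤-trans (Ω-lookup ω∈ s) (ℕₚ.m≤m+n M M)))
      (λ ω ω∈ s → norm-CC (ω ⊕ + M ⊙ unit s) (coordinate ω∈ s))

    core-weight : ∀ a → a ∈ core → ∣ proj₂ a ∣ ℕ.≤ cmax
    core-weight = core-cases (λ a → ∣ proj₂ a ∣ ℕ.≤ cmax) (λ ω ω∈ → α-bound ω∈)
      (λ ω ω∈ s → ℕₚ.≤-trans (β-bound s ω∈) (ℕₚ.*-monoˡ-≤ (N ℕ.^ (1 ℕ.+ m) ℕ.* Q) (ℕₚ.*-monoʳ-≤ K₁ (ℕₚ.m≤n*m (suc M) (suc m)))))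

    CC≤N : CC ℕ.≤ N
    CC≤N = ℕₚ.≤-trans (ℕₚ.m≤n*m CC 2) (ℕₚ.<⇒≤ N>2CC)

    N≤N*N : N ℕ.≤ N ℕ.* N
    N≤N*N = ℕₚ.m≤m*n N N

    core-supported : Supported core
    core-supported w ww a a∈ _ = dot-bound N (proj₁ a) w ww (ℤₚ.≤-trans (core-norm a a∈) (+≤+ (ℕₚ.≤-trans CC≤N N≤N*N)))

    -- If z ≤ CC then N² ≤ 2(N² − z), since N ≥ 2 CC.
    half : ∀ z C A → 2 ℕ.* C ℕ.≤ A → z ℤ.≤ + C → A ℕ.≤ 2 ℕ.* pos (+ A - z)
    half z C A 2C≤A z≤C = ℤₚ.drop‿+≤+ (subst (+ A ℤ.≤_) (sym (trans (ℤₚ.pos-* 2 (pos (+ A - z))) (cong (+ 2 *_) (pos-nonNeg nn))))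
      (0≤i-j⇒j≤i (subst (0ℤ ℤ.≤_) (lemma (+ A) z) (ℤₚ.i≤j⇒0≤j-i 2z≤A))))
      where
      2z≤A : + 2 * z ℤ.≤ + A
      2z≤A = ℤₚ.≤-trans (*-monoˡ-≤ {c = + 2} (+≤+ z≤n) z≤C) (subst (ℤ._≤ + A) (ℤₚ.pos-* 2 C) (+≤+ 2C≤A))
      z≤A : z ℤ.≤ + A
      z≤A = ℤₚ.≤-trans z≤C (+≤+ (ℕₚ.≤-trans (ℕₚ.m≤n*m C 2) 2C≤A))
      nn : 0ℤ ℤ.≤ + A - z
      nn = ℤₚ.i≤j⇒0≤j-i z≤A
      lemma : ∀ a z → a - + 2 * z ≡ + 2 * (a - z) - a
      lemma = solve-∀

    core-good : ∀ a → a ∈ core → Good a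
    core-good a a∈ = inj₂ (N ℕ.* N , N≤N*N , half (+ σ * ‖ proj₁ a ‖²) CC (N ℕ.* N) (ℕₚ.≤-trans (ℕₚ.<⇒≤ N>2CC) N≤N*N) (core-norm a a∈) ,
      ℕₚ.≤-trans (core-weight a a∈) (ℕₚ.*-mono-≤ (ℕₚ.m≤n+m Kc (9 ℕ.* KD)) (ℕₚ.*-monoˡ-≤ Q (ℕₚ.^-monoʳ-≤ N (ℕₚ.+-monoˡ-≤ m {1} {3} (s≤s z≤n))))))

    open Corrected core-supported

    length-core : length core ≡ nc
    length-core = length-concatMap coreAtoms (suc m) (Ω m) λ ω → cong suc (trans (Listₚ.length-map _ (allFin m)) (Listₚ.length-tabulate {n = m} id))

    -- The atoms of `core` stay near the origin, so only values with y² ≤ CC occur; there N² ≤ 2(N²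
    -- - y²), whence the factor 2^k.
    core-law : ∀ w → ‖ w ‖² ≡ + σ → ∀ y → ∣ lawOf core w y ∣ ℕ.≤ nc ℕ.* (Kc ℕ.* 2 ℕ.^ k) ℕ.* (N ℕ.^ (1 ℕ.+ m) ℕ.* radius N y ℕ.^ k)
    core-law w ww y = subst (∣ lawOf core w y ∣ ℕ.≤_) (trans (cong (ℕ._* B) length-core) (sym (ℕₚ.*-assoc nc (Kc ℕ.* 2 ℕ.^ k) (N ℕ.^ (1 ℕ.+ m) ℕ.* radius N y ℕ.^ k))))
      (∑-bound {f = λ a → ind (⟨ w , proj₁ a ⟩ ℤₚ.≟ y) * proj₂ a} core term)
      where
      B : ℕ
      B = Kc ℕ.* 2 ℕ.^ k ℕ.* (N ℕ.^ (1 ℕ.+ m) ℕ.* radius N y ℕ.^ k)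
      term : ∀ a → a ∈ core → ∣ ind (⟨ w , proj₁ a ⟩ ℤₚ.≟ y) * proj₂ a ∣ ℕ.≤ B
      term a a∈ = ind-*-cases (⟨ w , proj₁ a ⟩ ℤₚ.≟ y) (proj₂ a) λ h → (ℕₚ.≤-trans (core-weight a a∈)
              (ℕₚ.≤-trans (ℕₚ.*-monoʳ-≤ Kc (ℕₚ.*-monoʳ-≤ (N ℕ.^ (1 ℕ.+ m)) (Q≤ h))) (ℕₚ.≤-reflexive (lemma Kc (N ℕ.^ (1 ℕ.+ m)) (2 ℕ.^ k) (radius N y ℕ.^ k)))))
        where
        yy≤ : ⟨ w , proj₁ a ⟩ ≡ y → y * y ℤ.≤ + CC
        yy≤ h = ℤₚ.≤-trans (subst (λ z → y * y ℤ.≤ z * ‖ proj₁ a ‖²) ww (subst (λ z → z * z ℤ.≤ ‖ w ‖² * ‖ proj₁ a ‖²) h (cauchy-schwarz w (proj₁ a))))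
          (core-norm a a∈)
        Q≤ : ⟨ w , proj₁ a ⟩ ≡ y → Q ℕ.≤ 2 ℕ.^ k ℕ.* radius N y ℕ.^ k
        Q≤ h = subst (Q ℕ.≤_) (^-distribʳ-* k 2 (radius N y)) (ℕₚ.^-monoˡ-≤ k
          (subst (λ z → N ℕ.* N ℕ.≤ 2 ℕ.* pos (z - y * y)) (ℤₚ.pos-* N N) (half (y * y) CC (N ℕ.* N) (ℕₚ.≤-trans (ℕₚ.<⇒≤ N>2CC) N≤N*N) (yy≤ h))))
        lemma : ∀ c n t a → c ℕ.* (n ℕ.* (t ℕ.* a)) ≡ c ℕ.* t ℕ.* (n ℕ.* a)
        lemma = ℕ-Solver.solve-∀

    base-law : ∀ w y → lawOf base w y ≡ + M * law N w y
    base-law w y = trans (∑-map (λ a → ind (⟨ w , proj₁ a ⟩ ℤₚ.≟ y) * proj₂ a) (λ V → V , + M * W N V) (box N m))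
      (trans (∑-cong′ (box N m) λ V → lemma (ind (⟨ w , V ⟩ ℤₚ.≟ y)) (+ M) (W N V)) (∑-*ˡ (+ M) (λ V → ind (⟨ w , V ⟩ ℤₚ.≟ y) * W N V) (box N m)))
      where
      lemma : ∀ i M w → i * (M * w) ≡ M * (i * w)
      lemma = solve-∀

    D-bound : ∀ i y → ∣ D i y ∣ ℕ.≤ KD ℕ.* (N ℕ.^ (1 ℕ.+ m) ℕ.* radius N y ℕ.^ k)
    D-bound i y = subst₂ ℕ._≤_ (cong ∣_∣ (sym split)) (lemma₂ M KL (nc ℕ.* (Kc ℕ.* 2 ℕ.^ k)) X)
      (ℕₚ.≤-trans (ℤₚ.∣i+j∣≤∣i∣+∣j∣ (+ M * (law N u₀ y - law N (u i) y)) (lawOf core u₀ y - lawOf core (u i) y))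
        (ℕₚ.+-mono-≤ (subst (ℕ._≤ M ℕ.* (KL ℕ.* X)) (sym (ℤₚ.abs-* (+ M) (law N u₀ y - law N (u i) y))) (ℕₚ.*-monoʳ-≤ M main))
          (ℕₚ.≤-trans (ℤₚ.∣i-j∣≤∣i∣+∣j∣ (lawOf core u₀ y) (lawOf core (u i) y)) (ℕₚ.+-mono-≤ (core-law u₀ u₀u₀ y) (core-law (u i) (uu i) y)))))
      where
      X : ℕ
      X = N ℕ.^ (1 ℕ.+ m) ℕ.* radius N y ℕ.^ k
      main : ∣ law N u₀ y - law N (u i) y ∣ ℕ.≤ KL ℕ.* X
      main = subst (ℕ._≤ KL ℕ.* X) (ℤₚ.∣i-j∣≡∣j-i∣ (law N (u i) y) (law N u₀ y))
        (ℕₚ.≤-trans (laws-close (frame i) N y) (ℕₚ.*-monoˡ-≤ X (≤-maxOver (λ i → 6 ℕ.* K₀ (frame i)) i)))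
      lawOf-start : ∀ w → lawOf start w y ≡ + M * law N w y + lawOf core w y
      lawOf-start w = trans (∑-++ (λ a → ind (⟨ w , proj₁ a ⟩ ℤₚ.≟ y) * proj₂ a) base core) (cong (_+ lawOf core w y) (base-law w y))
      split : D i y ≡ + M * (law N u₀ y - law N (u i) y) + (lawOf core u₀ y - lawOf core (u i) y)
      split = trans (cong₂ _-_ (lawOf-start u₀) (lawOf-start (u i))) (lemma (+ M) (law N u₀ y) (law N (u i) y) (lawOf core u₀ y) (lawOf core (u i) y))
        where
        lemma : ∀ M a b c d → M * a + c - (M * b + d) ≡ M * (a - b) + (c - d)
        lemma = solve-∀
      lemma₂ : ∀ M L n x → M ℕ.* (L ℕ.* x) ℕ.+ (n ℕ.* x ℕ.+ n ℕ.* x) ≡ (M ℕ.* L ℕ.+ 2 ℕ.* n) ℕ.* x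
      lemma₂ = ℕ-Solver.solve-∀

    radius-mono : ∀ a b → a * a ℤ.≤ b * b → radius N b ℕ.≤ radius N a
    radius-mono a b h = pos-mono {+ N * + N - b * b} {+ N * + N - a * a} (ℤₚ.+-monoʳ-≤ (+ N * + N) (ℤₚ.neg-mono-≤ h))

    2N+1≤3N : suc (N ℕ.+ N) ℕ.≤ 3 ℕ.* N
    2N+1≤3N = subst (suc (N ℕ.+ N) ℕ.≤_) (cong (λ z → N ℕ.+ (N ℕ.+ z)) (sym (ℕₚ.+-identityʳ N))) (ℕₚ.+-monoˡ-≤ (N ℕ.+ N) N≥1)

    qBound : ℤ → ℕ
    qBound y = 9 ℕ.* KD ℕ.* (N ℕ.^ (3 ℕ.+ m) ℕ.* radius N y ℕ.^ k)

    -- The estimate has to hold with the radius at any corner of the square, whose value z lies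
    -- between y and y + 2M. The sign of the midpoint y + M decides which tail to use: if it is
    -- nonnegative, every y′ ≥ y + 2M satisfies |y′| ≥ |z|, and otherwise every y′ ≤ y does. In
    -- either case `D` on the tail is controlled by the radius at z.
    q-bound : ∀ i y → y ∈ interval N → ∀ z → y ℤ.≤ z → z ℤ.≤ y + + M * + 2 → ∣ q i y ∣ ℕ.≤ qBound z
    q-bound i y y∈ z y≤z z≤ = ℕₚ.≤-trans (bound (ℤₚ.≤-total 0ℤ (y + + M)))
      (ℕₚ.≤-trans (ℕₚ.*-mono-≤ 2N+1≤3N (ℕₚ.*-monoˡ-≤ b 2N+1≤3N)) (ℕₚ.≤-reflexive (lemma N KD (N ℕ.^ m) (radius N z ℕ.^ k))))
      where
      b : ℕ
      b = KD ℕ.* (N ℕ.^ (1 ℕ.+ m) ℕ.* radius N z ℕ.^ k)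
      lemma : ∀ n d a x → 3 ℕ.* n ℕ.* (3 ℕ.* n ℕ.* (d ℕ.* (n ℕ.* a ℕ.* x))) ≡ 9 ℕ.* d ℕ.* (n ℕ.* (n ℕ.* (n ℕ.* a)) ℕ.* x)
      lemma = ℕ-Solver.solve-∀
      smaller : ∀ y′ → z * z ℤ.≤ y′ * y′ → ∣ D i y′ ∣ ℕ.≤ b
      smaller y′ h = ℕₚ.≤-trans (D-bound i y′) (ℕₚ.*-monoʳ-≤ KD (ℕₚ.*-monoʳ-≤ (N ℕ.^ (1 ℕ.+ m)) (ℕₚ.^-monoˡ-≤ k (radius-mono z y′ h))))
      double : ∀ y M → y + M + (y + M) ≡ y + (y + M * + 2)
      double = solve-∀
      bound : 0ℤ ℤ.≤ y + + M ⊎ y + + M ℤ.≤ 0ℤ → ∣ q i y ∣ ℕ.≤ suc (N ℕ.+ N) ℕ.* (suc (N ℕ.+ N) ℕ.* b)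
      bound (inj₁ h) = A.q-boundʳ i y b y∈ λ y′ y′≥ → smaller y′ (square-mono z y′
        (ℤₚ.≤-trans (0≤i-j⇒j≤i (subst (0ℤ ℤ.≤_) (flip y y′) (ℤₚ.≤-trans (subst (0ℤ ℤ.≤_) (double y (+ M)) (ℤₚ.+-mono-≤ h h)) (ℤₚ.+-monoʳ-≤ y y′≥)))) y≤z)
        (ℤₚ.≤-trans z≤ y′≥))
        where
        flip : ∀ y y′ → y + y′ ≡ y - - y′
        flip = solve-∀
      bound (inj₂ h) = A.q-boundˡ i (D-mass i) (D-mean i) y b y∈ λ y′ y′≤y → smaller y′ (subst (z * z ℤ.≤_) (neg-square y′) (square-mono z (- y′)
        (subst (ℤ._≤ z) (sym (ℤₚ.neg-involutive y′)) (ℤₚ.≤-trans y′≤y y≤z))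
        (ℤₚ.≤-trans z≤ (ℤₚ.≤-trans (0≤i-j⇒j≤i (subst (0ℤ ℤ.≤_) (flip y (+ M)) (ℤₚ.neg-mono-≤ (ℤₚ.+-mono-≤ h h)))) (ℤₚ.neg-mono-≤ y′≤y)))))
        where
        neg-square : ∀ y → - y * - y ≡ y * y
        neg-square = solve-∀
        flip : ∀ y M → - (y + M + (y + M)) ≡ - y - (y + M * + 2)
        flip = solve-∀

    -- N² − y² is an integer, so once positive it is at least 2N − 1.
    radius-gap : ∀ y → 0 ℕ.< radius N y → N ℕ.≤ radius N y × + radius N y ≡ + N * + N - y * y
    radius-gap y h = ℤₚ.drop‿+≤+ (subst (+ N ℤ.≤_) (sym eq) N≤) , eq
      where
      a : ℕ
      a = ∣ y ∣
      0<gap : 0ℤ ℤ.< + N * + N - y * y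
      0<gap = pos-≢0 λ z → ℕₚ.<-irrefl (sym z) h
      eq : + radius N y ≡ + N * + N - y * y
      eq = pos-nonNeg (ℤₚ.<⇒≤ 0<gap)
      a<N : a ℕ.< N
      a<N = ℕₚ.≰⇒> λ N≤a → ℤₚ.<⇒≱ 0<gap (ℤₚ.i≤j⇒i-j≤0 (subst₂ ℤ._≤_ (ℤₚ.pos-* N N) (∣i∣*∣i∣ y) (+≤+ (ℕₚ.*-mono-≤ N≤a N≤a))))
      N≤ : + N ℤ.≤ + N * + N - y * y
      N≤ = subst₂ ℤ._≤_ (ℤₚ.*-identityˡ (+ N)) (trans (lemma (+ N) (+ a)) (cong (λ z → + N * + N - z) (trans (sym (ℤₚ.pos-* a a)) (∣i∣*∣i∣ y))))
        (*-mono-≤ {1ℤ} {+ N - + a} {+ N} {+ N + + a} (+≤+ z≤n) (+≤+ z≤n) (subst (ℤ._≤ + N - + a) (lemma₂ (+ a)) (ℤₚ.+-monoˡ-≤ (- + a) (+≤+ a<N)))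
          (+≤+ (ℕₚ.m≤m+n N a)))
        where
        lemma : ∀ n a → (n - a) * (n + a) ≡ n * n - a * a
        lemma = solve-∀
        lemma₂ : ∀ a → 1ℤ + a - a ≡ 1ℤ
        lemma₂ = solve-∀

    -- σ‖x‖² - ⟨u i,x⟩² does not change when multiples of `u i` are added to x, so it depends only
    -- on the bounded vector t. It is at most CF, and 2 CF < N ≤ radius, so `height` is at least
    -- half of the radius.
    height-bound : ∀ i y κ → footBound i κ ℕ.≤ CF → 0 ℕ.< radius N ⟨ u i , foot i y ⊕ κ ⟩ →
      radius N ⟨ u i , foot i y ⊕ κ ⟩ ℕ.≤ 2 ℕ.* height (foot i y ⊕ κ)
    height-bound i y κ hκ h = subst (λ g → radius N z ℕ.≤ 2 ℕ.* pos g) gap≡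
      (half P CF (radius N z) (ℕₚ.≤-trans (ℕₚ.<⇒≤ N>2CF) (proj₁ (radius-gap z h))) P≤)
      where
      x t : Vec ℤ m
      x = foot i y ⊕ κ
      t = + (y %ℕ σ) ⊙ e i ⊕ κ
      z P : ℤ
      z = ⟨ u i , x ⟩
      P = + σ * ‖ t ‖² - ⟨ u i , t ⟩ * ⟨ u i , t ⟩
      x≡ : x ≡ (y /ℕ σ) ⊙ u i ⊕ t
      x≡ = Vecₚ.zipWith-assoc ℤₚ.+-assoc ((y /ℕ σ) ⊙ u i) (+ (y %ℕ σ) ⊙ e i) κ
      perp : + σ * ‖ x ‖² ≡ z * z + P
      perp = trans (cong (λ w → + σ * ‖ w ‖²) x≡) (trans (cong (+ σ *_) (trans (norm-⊕ ((y /ℕ σ) ⊙ u i) t) (cong₂ (λ a b → a + + 2 * b + ‖ t ‖²)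
          (trans (norm-⊙ (y /ℕ σ) (u i)) (cong ((y /ℕ σ) * (y /ℕ σ) *_) (uu i))) (dot-⊙ˡ (y /ℕ σ) (u i) t))))
        (trans (lemma (+ σ) (y /ℕ σ) ⟨ u i , t ⟩ ‖ t ‖²) (cong (λ w → w * w + P) (sym (trans (cong (λ w → ⟨ u i , w ⟩) x≡)
          (trans (dot-⊕ʳ (u i) ((y /ℕ σ) ⊙ u i) t) (cong (_+ ⟨ u i , t ⟩) (trans (dot-⊙ʳ (y /ℕ σ) (u i) (u i)) (cong ((y /ℕ σ) *_) (uu i))))))))))
        where
        lemma : ∀ s w a n → s * (w * w * s + + 2 * (w * a) + n) ≡ (w * s + a) * (w * s + a) + (s * n - a * a)
        lemma = solve-∀
      gap≡ : + radius N z - P ≡ gap (N ℕ.* N) x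
      gap≡ = trans (cong (_- P) (proj₂ (radius-gap z h))) (trans (lemma (+ N * + N) (z * z) P) (cong₂ _-_ (sym (ℤₚ.pos-* N N)) (sym perp)))
        where
        lemma : ∀ n a p → n - a - p ≡ n - (a + p)
        lemma = solve-∀
      κ≡ : + 1 ⊙ κ ≡ κ
      κ≡ = vec-ext λ s → trans (lookup-⊙ (+ 1) κ s) (ℤₚ.*-identityˡ (Vec.lookup κ s))
      P≤ : P ℤ.≤ + CF
      P≤ = ℤₚ.≤-trans (subst (P ℤ.≤_) (ℤₚ.+-identityʳ (+ σ * ‖ t ‖²)) (ℤₚ.+-monoʳ-≤ (+ σ * ‖ t ‖²) (ℤₚ.neg-mono-≤ (i*i≥0 ⟨ u i , t ⟩))))
        (ℤₚ.≤-trans (*-monoˡ-≤ {c = + σ} (+≤+ z≤n) (subst (λ w → ‖ + (y %ℕ σ) ⊙ e i ⊕ w ‖² ℤ.≤ + 2 * (+ σ * + σ) * (‖ e i ‖² + ‖ κ ‖²)) κ≡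
            (sq-diff-bound (e i) κ (y %ℕ σ) 1 σ (ℕₚ.<⇒≤ (n%ℕd<d y σ)) σ≥1)))
          (ℤₚ.≤-trans (ℤₚ.≤-reflexive (sym (pos-nonNeg nn))) (+≤+ hκ)))
        where
        nn : 0ℤ ℤ.≤ + σ * (+ 2 * (+ σ * + σ) * (‖ e i ‖² + ‖ κ ‖²))
        nn = *-nonNeg {+ σ} (+≤+ z≤n) (*-nonNeg (*-nonNeg {+ 2} (+≤+ z≤n) (i*i≥0 (+ σ))) (ℤₚ.+-mono-≤ (norm≥0 (e i)) (norm≥0 κ)))

    square-good : ∀ i y → y ∈ interval N → ∀ κ c → footBound i κ ℕ.≤ CF → ∣ c ∣ ≡ ∣ q i y ∣ →
      y ℤ.≤ y + ⟨ u i , κ ⟩ → y + ⟨ u i , κ ⟩ ℤ.≤ y + + M * + 2 → Good (foot i y ⊕ κ , c)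
    square-good i y y∈ κ c hκ c≡ lo hi = split (radius N z ℕₚ.≟ 0)
      where
      z : ℤ
      z = ⟨ u i , foot i y ⊕ κ ⟩
      z≡ : z ≡ y + ⟨ u i , κ ⟩
      z≡ = trans (dot-⊕ʳ (u i) (foot i y) κ) (cong (_+ ⟨ u i , κ ⟩) (u-foot i y))
      c≤ : ∣ c ∣ ℕ.≤ qBound z
      c≤ = subst (ℕ._≤ qBound z) (sym c≡) (q-bound i y y∈ z (subst (y ℤ.≤_) (sym z≡) lo) (subst (ℤ._≤ y + + M * + 2) (sym z≡) hi))
      0^k : ∀ k → .{{NonZero k}} → 0 ℕ.^ k ≡ 0
      0^k (suc k) = refl
      split : Dec (radius N z ≡ 0) → Good (foot i y ⊕ κ , c)
      split (yes A≡0) = inj₁ (ℤₚ.∣i∣≡0⇒i≡0 (ℕₚ.n≤0⇒n≡0 (subst (∣ c ∣ ℕ.≤_) (trans (cong (λ a → 9 ℕ.* KD ℕ.* (N ℕ.^ (3 ℕ.+ m) ℕ.* a)) (trans (cong (ℕ._^ k) A≡0) (0^k k)))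
        (trans (cong (9 ℕ.* KD ℕ.*_) (ℕₚ.*-zeroʳ (N ℕ.^ (3 ℕ.+ m)))) (ℕₚ.*-zeroʳ (9 ℕ.* KD)))) c≤)))
      split (no A≢0) = inj₂ (radius N z , proj₁ (radius-gap z (ℕₚ.n≢0⇒n>0 A≢0)) , height-bound i y κ hκ (ℕₚ.n≢0⇒n>0 A≢0) ,
        ℕₚ.≤-trans c≤ (ℕₚ.*-monoˡ-≤ (N ℕ.^ (3 ℕ.+ m) ℕ.* radius N z ℕ.^ k) (ℕₚ.m≤m+n (9 ℕ.* KD) Kc)))

    footBounds : ∀ i → footBound i 𝟎 ℕ.+ footBound i (v i) ℕ.+ footBound i (v′ i) ℕ.+ footBound i (v i ⊕ v′ i) ℕ.≤ CF
    footBounds i = ≤-maxOver (λ i → footBound i 𝟎 ℕ.+ footBound i (v i) ℕ.+ footBound i (v′ i) ℕ.+ footBound i (v i ⊕ v′ i)) i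

    corrections-good : ∀ a → a ∈ corrections → Good a
    corrections-good = corrections-cases Good corner
      where
      steps : ∀ y j n → n ℕ.≤ 2 → j ≡ + M * + n → y ℤ.≤ y + j × y + j ℤ.≤ y + + M * + 2
      steps y j n n≤2 refl = subst (ℤ._≤ y + + M * + n) (ℤₚ.+-identityʳ y) (ℤₚ.+-monoʳ-≤ y (*-nonNeg {+ M} {+ n} (+≤+ z≤n) (+≤+ z≤n))) ,
        ℤₚ.+-monoʳ-≤ y (*-monoˡ-≤ {c = + M} (+≤+ z≤n) (+≤+ n≤2))
      place : ∀ i y → y ∈ interval N → ∀ κ c n → footBound i κ ℕ.≤ CF → ∣ c ∣ ≡ ∣ q i y ∣ → n ℕ.≤ 2 → ⟨ u i , κ ⟩ ≡ + M * + n → Good (foot i y ⊕ κ , c)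
      place i y y∈ κ c n hκ c≡ n≤2 κ≡ = let lo , hi = steps y ⟨ u i , κ ⟩ n n≤2 κ≡ in square-good i y y∈ κ c hκ c≡ lo hi
      ⊕-𝟎 : ∀ (x : Vec ℤ m) → x ⊕ 𝟎 ≡ x
      ⊕-𝟎 x = vec-ext λ s → trans (lookup-⊕ x 𝟎 s) (trans (+-congˡ (Vec.lookup x s) (Vecₚ.lookup-replicate s 0ℤ)) (ℤₚ.+-identityʳ _))
      F₀ F₁ F₂ F₃ : Fin r → ℕ
      F₀ i = footBound i 𝟎
      F₁ i = footBound i (v i)
      F₂ i = footBound i (v′ i)
      F₃ i = footBound i (v i ⊕ v′ i)
      corner : ∀ i y → y ∈ interval N → ∀ a → a ∈ square i y → Good a
      corner i y y∈ a (here refl) = subst (λ x → Good (x , q i y)) (⊕-𝟎 (foot i y))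
        (place i y y∈ 𝟎 (q i y) 0 (ℕₚ.≤-trans (ℕₚ.≤-trans (ℕₚ.m≤m+n (F₀ i) (F₁ i)) (ℕₚ.≤-trans (ℕₚ.m≤m+n (F₀ i ℕ.+ F₁ i) (F₂ i)) (ℕₚ.m≤m+n _ (F₃ i)))) (footBounds i))
          refl z≤n (trans (dot-𝟎ʳ (u i)) (sym (ℤₚ.*-zeroʳ (+ M)))))
      corner i y y∈ a (there (here refl)) =
        place i y y∈ (v i) (- q i y) 1 (ℕₚ.≤-trans (ℕₚ.≤-trans (ℕₚ.m≤n+m (F₁ i) (F₀ i)) (ℕₚ.≤-trans (ℕₚ.m≤m+n (F₀ i ℕ.+ F₁ i) (F₂ i)) (ℕₚ.m≤m+n _ (F₃ i)))) (footBounds i))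
          (ℤₚ.∣-i∣≡∣i∣ (q i y)) (s≤s z≤n) (trans (uv i) (sym (ℤₚ.*-identityʳ (+ M))))
      corner i y y∈ a (there (there (here refl))) =
        place i y y∈ (v′ i) (- q i y) 1 (ℕₚ.≤-trans (ℕₚ.≤-trans (ℕₚ.m≤n+m (F₂ i) (F₀ i ℕ.+ F₁ i)) (ℕₚ.m≤m+n _ (F₃ i))) (footBounds i))
          (ℤₚ.∣-i∣≡∣i∣ (q i y)) (s≤s z≤n) (trans (uv′ i) (sym (ℤₚ.*-identityʳ (+ M))))
      corner i y y∈ a (there (there (there (here refl)))) = subst (λ x → Good (x , q i y)) (sym (Vecₚ.zipWith-assoc ℤₚ.+-assoc (foot i y) (v i) (v′ i)))
        (place i y y∈ (v i ⊕ v′ i) (q i y) 2 (ℕₚ.≤-trans (ℕₚ.m≤n+m (F₃ i) (F₀ i ℕ.+ F₁ i ℕ.+ F₂ i)) (footBounds i))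
          refl ℕₚ.≤-refl (trans (dot-⊕ʳ (u i) (v i) (v′ i)) (trans (cong₂ _+_ (uv i) (uv′ i)) (lemma (+ M)))))
        where
        lemma : ∀ M → M + M ≡ M * + 2
        lemma = solve-∀

    rest : List (Atom m)
    rest = core ++ corrections

    rest-good : ∀ a → a ∈ rest → Good a
    rest-good a a∈ = [ core-good a , corrections-good a ]′ (∈-++⁻ core a∈)

    length-rest : suc (length rest) ℕ.≤ Kr ℕ.* N
    length-rest = subst (ℕ._≤ Kr ℕ.* N) (cong suc (sym (trans (Listₚ.length-++ core) (cong₂ ℕ._+_ length-core length-corrections))))
      (begin
        suc (nc ℕ.+ r ℕ.* (suc (N ℕ.+ N) ℕ.* 4))      ≤⟨ ℕₚ.+-mono-≤ N≥1 (ℕₚ.+-mono-≤ (ℕₚ.m≤m*n nc N) (ℕₚ.*-monoʳ-≤ r (ℕₚ.*-monoˡ-≤ 4 2N+1≤3N))) ⟩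
        N ℕ.+ (nc ℕ.* N ℕ.+ r ℕ.* (3 ℕ.* N ℕ.* 4))    ≡⟨ lemma N nc r ⟩
        Kr ℕ.* N                                      ∎)
      where
      open ℕₚ.≤-Reasoning
      lemma : ∀ N c r → N ℕ.+ (c ℕ.* N ℕ.+ r ℕ.* (3 ℕ.* N ℕ.* 4)) ≡ (c ℕ.+ r ℕ.* 12 ℕ.+ 1) ℕ.* N
      lemma = ℕ-Solver.solve-∀

    -- Atoms of `total` may share a point and may be negative; it is their collected weight at each
    -- point of the box that turns out nonnegative.
    ρ : Vec ℤ m → ℤ
    ρ V = ∑ (λ a → ind (proj₁ a ≟ᵛ V) * proj₂ a) total

    restAt : Vec ℤ m → ℤ
    restAt V = ∑ (λ a → ind (proj₁ a ≟ᵛ V) * proj₂ a) rest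

    ρ-split : ∀ V → V ∈ box N m → ρ V ≡ + M * W N V + restAt V
    ρ-split V V∈ = trans (∑-++ f start corrections) (trans (cong (_+ ∑ f corrections) (∑-++ f base core)) (trans (ℤₚ.+-assoc (∑ f base) (∑ f core) (∑ f corrections))
      (cong₂ _+_ basePart (sym (∑-++ f core corrections)))))
      where
      f : Atom m → ℤ
      f a = ind (proj₁ a ≟ᵛ V) * proj₂ a
      basePart : ∑ f base ≡ + M * W N V
      basePart = trans (∑-map f (λ V → V , + M * W N V) (box N m)) (trans (∑-single (box-unique N m) V∈ λ x _ x≢ → cong (_* (+ M * W N x)) (ind-no (x ≟ᵛ V) x≢))
        (trans (cong (_* (+ M * W N V)) (ind-yes (V ≟ᵛ V) refl)) (ℤₚ.*-identityˡ (+ M * W N V))))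

    restAt-bound : ∀ V → ∣ restAt V ∣ ℕ.* (Kr ℕ.* N) ℕ.≤ length rest ℕ.* height V ℕ.^ (2 ℕ.* k)
    restAt-bound V = subst (ℕ._≤ length rest ℕ.* height V ℕ.^ (2 ℕ.* k)) (trans (cong ∣_∣ (∑-*ʳ (+ (Kr ℕ.* N)) (λ a → ind (proj₁ a ≟ᵛ V) * proj₂ a) rest)) (ℤₚ.abs-* (restAt V) (+ (Kr ℕ.* N))))
      (∑-bound {f = λ a → ind (proj₁ a ≟ᵛ V) * proj₂ a * + (Kr ℕ.* N)} rest λ a a∈ → subst (λ z → ∣ z ∣ ℕ.≤ height V ℕ.^ (2 ℕ.* k)) (sym (ℤₚ.*-assoc (ind (proj₁ a ≟ᵛ V)) (proj₂ a) (+ (Kr ℕ.* N))))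
        (ind-*-cases (proj₁ a ≟ᵛ V) (proj₂ a * + (Kr ℕ.* N)) λ h → subst₂ ℕ._≤_ (sym (ℤₚ.abs-* (proj₂ a) (+ (Kr ℕ.* N)))) (cong (λ x → height x ℕ.^ (2 ℕ.* k)) h)
          (good-small (proj₁ a) (proj₂ a) (rest-good a a∈))))

    instance
      KrN≢0 : NonZero (Kr ℕ.* N)
      KrN≢0 = ℕ.>-nonZero (ℕₚ.≤-trans (s≤s z≤n) length-rest)

    dominates : ∀ T x → ∣ x ∣ ℕ.≤ T → 0ℤ ℤ.≤ + M * + T + x
    dominates T x h = ℤₚ.≤-trans (subst (0ℤ ℤ.≤_) (ℤₚ.+-comm x (+ T)) (0≤x+T x h))
      (ℤₚ.+-monoˡ-≤ x (subst (ℤ._≤ + M * + T) (ℤₚ.*-identityˡ (+ T)) (*-mono-≤ {1ℤ} {+ M} (+≤+ z≤n) (+≤+ z≤n) (+≤+ (ℕ.>-nonZero⁻¹ M)) ℤₚ.≤-refl)))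
      where
      0≤x+T : ∀ x → ∣ x ∣ ℕ.≤ T → 0ℤ ℤ.≤ x + + T
      0≤x+T (+ n)    _ = +≤+ z≤n
      0≤x+T -[1+ n ] h = subst (0ℤ ℤ.≤_) (trans (ℤₚ.m-n≡m⊖n T (suc n)) refl) (ℤₚ.i≤j⇒0≤j-i {+ suc n} {+ T} (+≤+ h))

    -- By `good-small` each atom of `rest` at V has modulus at most W N V divided by Kr · N, and
    -- `rest` has fewer than Kr · N atoms.
    ρ-nonNeg : ∀ V → V ∈ box N m → 0ℤ ℤ.≤ ρ V
    ρ-nonNeg V V∈ = subst (0ℤ ℤ.≤_) (sym (ρ-split V V∈)) (dominates (height V ℕ.^ (2 ℕ.* k)) (restAt V)
      (ℕₚ.*-cancelʳ-≤ ∣ restAt V ∣ (height V ℕ.^ (2 ℕ.* k)) (Kr ℕ.* N) (ℕₚ.≤-trans (restAt-bound V)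
        (subst (length rest ℕ.* height V ℕ.^ (2 ℕ.* k) ℕ.≤_) (ℕₚ.*-comm (Kr ℕ.* N) (height V ℕ.^ (2 ℕ.* k))) (ℕₚ.*-monoˡ-≤ (height V ℕ.^ (2 ℕ.* k)) (ℕₚ.<⇒≤ length-rest))))))

    ρ-positive : ∀ V → V ∈ box N m → 0 ℕ.< height V → 0ℤ ℤ.< ρ V
    ρ-positive V V∈ h = ℤₚ.≤∧≢⇒< (ρ-nonNeg V V∈) λ 0≡ρ → ℕₚ.<⇒≱ strict (subst (ℕ._≤ length rest ℕ.* T) (ℕₚ.*-comm T (Kr ℕ.* N))
        (ℕₚ.≤-trans (ℕₚ.*-monoˡ-≤ (Kr ℕ.* N) (T≤ (restAt V) (trans (sym (ρ-split V V∈)) (sym 0≡ρ)))) (restAt-bound V)))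
      where
      T : ℕ
      T = height V ℕ.^ (2 ℕ.* k)
      T>0 : 0 ℕ.< T
      T>0 = ℕₚ.m^n>0 (height V) {{ℕ.>-nonZero h}} (2 ℕ.* k)
      strict : length rest ℕ.* T ℕ.< Kr ℕ.* N ℕ.* T
      strict = ℕₚ.*-monoˡ-< T {{ℕ.>-nonZero T>0}} length-rest
      T≤ : ∀ x → + M * + T + x ≡ 0ℤ → T ℕ.≤ ∣ x ∣
      T≤ x eq = subst (T ℕ.≤_) (trans (sym (ℤₚ.abs-* (+ M) (+ T))) (trans (cong ∣_∣ (opposite (+ M * + T) x eq)) (ℤₚ.∣-i∣≡∣i∣ x))) (ℕₚ.m≤n*m T M)
        where
        lemma : ∀ a x → a ≡ a + x - x
        lemma = solve-∀
        opposite : ∀ a x → a + x ≡ 0ℤ → a ≡ - x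
        opposite a x h = trans (lemma a x) (trans (cong (_- x) h) (ℤₚ.+-identityˡ (- x)))

    height⇒box : ∀ x → 0 ℕ.< height x → x ∈ box N m
    height⇒box x h = ∈-box N x λ s → lookup-bound N x s (norm≤gap (N ℕ.* N) x (ℤₚ.<⇒≤ (pos-≢0 λ z → ℕₚ.<-irrefl (sym z) h)))

    good-support : ∀ a → Good a → proj₂ a ≢ 0ℤ → proj₁ a ∈ box N m
    good-support a (inj₁ z) ne = contradiction z ne
    good-support a (inj₂ (A , N≤A , A≤ , _)) ne = height⇒box (proj₁ a) (ℕₚ.n≢0⇒n>0 λ z → ℕₚ.<⇒≱ (ℕₚ.≤-trans N≥1 N≤A) (subst (A ℕ.≤_) (cong (2 ℕ.*_) z) A≤))

    total-support : ∀ a → a ∈ total → proj₂ a ≢ 0ℤ → proj₁ a ∈ box N m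
    total-support a a∈ ne = [ (λ a∈s → [ inBase , (λ a∈c → good-support a (core-good a a∈c) ne) ]′ (∈-++⁻ base a∈s)) ,
        (λ a∈c → good-support a (corrections-good a a∈c) ne) ]′ (∈-++⁻ start a∈)
      where
      inBase : a ∈ base → proj₁ a ∈ box N m
      inBase a∈b = let V , V∈ , a≡ = ∈-map⁻ (λ V → V , + M * W N V) a∈b in subst (λ a → proj₁ a ∈ box N m) (sym a≡) V∈

    ρ-law : ∀ w y → ∑ (λ V → ind (⟨ w , V ⟩ ℤₚ.≟ y) * ρ V) (box N m) ≡ lawOf total w y
    ρ-law w y = trans (∑-cong′ (box N m) λ V → sym (∑-*ˡ (I V) (λ a → ind (proj₁ a ≟ᵛ V) * proj₂ a) total))
      (trans (∑-swap (λ V a → I V * (ind (proj₁ a ≟ᵛ V) * proj₂ a)) (box N m) total) (∑-cong total collapse))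
      where
      I : Vec ℤ m → ℤ
      I V = ind (⟨ w , V ⟩ ℤₚ.≟ y)
      collapse : ∀ a → a ∈ total → ∑ (λ V → I V * (ind (proj₁ a ≟ᵛ V) * proj₂ a)) (box N m) ≡ I (proj₁ a) * proj₂ a
      collapse a a∈ = split (proj₂ a ℤₚ.≟ 0ℤ)
        where
        split : Dec (proj₂ a ≡ 0ℤ) → ∑ (λ V → I V * (ind (proj₁ a ≟ᵛ V) * proj₂ a)) (box N m) ≡ I (proj₁ a) * proj₂ a
        split (yes z) = trans (∑-zero (box N m) λ V _ → trans (cong (λ c → I V * (ind (proj₁ a ≟ᵛ V) * c)) z) (trans (cong (I V *_) (ℤₚ.*-zeroʳ (ind (proj₁ a ≟ᵛ V)))) (ℤₚ.*-zeroʳ (I V))))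
          (sym (trans (cong (I (proj₁ a) *_) z) (ℤₚ.*-zeroʳ (I (proj₁ a)))))
        split (no ne) = trans (∑-single (box-unique N m) (total-support a a∈ ne) λ V _ V≢ → trans (cong (λ c → I V * (c * proj₂ a)) (ind-no (proj₁ a ≟ᵛ V) (V≢ ∘ sym))) (ℤₚ.*-zeroʳ (I V)))
          (cong (I (proj₁ a) *_) (trans (cong (_* proj₂ a) (ind-yes (proj₁ a ≟ᵛ proj₁ a) refl)) (ℤₚ.*-identityˡ (proj₂ a))))

    e-height : ∀ i → 0 ℕ.< height (e i)
    e-height i = positive {gap (N ℕ.* N) (e i)} (below {+ σ * ‖ e i ‖²} {+ (N ℕ.* N)}
        (ℤₚ.≤-<-trans (subst (ℤ._≤ + CE) (pos-nonNeg (*-nonNeg {+ σ} (+≤+ z≤n) (norm≥0 (e i)))) (+≤+ (≤-maxOver (λ i → pos (+ σ * ‖ e i ‖²)) i)))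
          (+<+ (ℕₚ.<-≤-trans N>CE N≤N*N))))
      where
      positive : ∀ {z} → 0ℤ ℤ.< z → 0 ℕ.< pos z
      positive (+<+ h) = h
      below : ∀ {a b} → a ℤ.< b → 0ℤ ℤ.< b - a
      below {a} {b} h = subst (ℤ._< b - a) (ℤₚ.+-inverseʳ a) (ℤₚ.+-monoˡ-< (- a) h)

-- Solutions of the integral relation

record Solution {r : ℕ} (A : Fin r → ℤ) : Set where
  field
    atoms    : List ((Fin r → ℤ) × ℤ)
    nonNeg   : ∀ a → a ∈ atoms → 0ℤ ℤ.≤ proj₂ a
    relation : ∀ a → a ∈ atoms → ∑ (λ i → A i * proj₁ a i) (allFin r) ≡ 0ℤ
    law-eq   : ∀ i j y → ∑ (λ a → ind (proj₁ a i ℤₚ.≟ y) * proj₂ a) atoms ≡ ∑ (λ a → ind (proj₁ a j ℤₚ.≟ y) * proj₂ a) atoms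
    nonzero  : ∃ λ a → a ∈ atoms × 0ℤ ℤ.< proj₂ a × ∃ λ i → proj₁ a i ≢ 0ℤ

system-solution : ∀ {n m σ M} .{{_ : NonZero σ}} .{{_ : NonZero M}} (sys : System (suc n) m σ M) (A : Fin (suc n) → ℤ) →
  (∀ V → ∑ (λ i → A i * ⟨ System.u sys i , V ⟩) (allFin (suc n)) ≡ 0ℤ) → Solution A
system-solution {n} {m} {σ} {M} sys A rel = record
  { atoms    = map atom (box N m)
  ; nonNeg   = λ a a∈ → let V , V∈ , a≡ = ∈-map⁻ atom a∈ in subst (λ a → 0ℤ ℤ.≤ proj₂ a) (sym a≡) (B.ρ-nonNeg N ℕₚ.≤-refl V V∈)
  ; relation = λ a a∈ → let V , V∈ , a≡ = ∈-map⁻ atom a∈ in subst (λ a → ∑ (λ i → A i * proj₁ a i) (allFin (suc n)) ≡ 0ℤ) (sym a≡) (rel V)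
  ; law-eq   = λ i j y → trans (law i y) (sym (law j y))
  -- `e zero` has value 1 under `u zero` and lies inside the sphere, where the collected weight is
  -- strictly positive.
  ; nonzero  = atom (e zero) , ∈-map⁺ atom (B.height⇒box N ℕₚ.≤-refl (e zero) (B.e-height N ℕₚ.≤-refl zero)) ,
      B.ρ-positive N ℕₚ.≤-refl (e zero) (B.height⇒box N ℕₚ.≤-refl (e zero) (B.e-height N ℕₚ.≤-refl zero)) (B.e-height N ℕₚ.≤-refl zero) ,
      zero , λ h → contradiction (trans (sym (ue zero)) h) λ ()
  }
  where
  open System sys
  module B = Bounds sys (5 ℕ.+ m) refl
  N : ℕ
  N = B.N₀
  atom : Vec ℤ m → (Fin (suc n) → ℤ) × ℤ
  atom V = (λ i → ⟨ u i , V ⟩) , B.ρ N ℕₚ.≤-refl V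
  law : ∀ i y → ∑ (λ a → ind (proj₁ a i ℤₚ.≟ y) * proj₂ a) (map atom (box N m)) ≡ lawOf (Exactness.Corrected.start sys (5 ℕ.+ m) N (B.core-supported N ℕₚ.≤-refl)) u₀ y
  law i y = trans (∑-map (λ a → ind (proj₁ a i ℤₚ.≟ y) * proj₂ a) atom (box N m)) (trans (B.ρ-law N ℕₚ.≤-refl (u i) y)
    (Exactness.Corrected.law-total sys (5 ℕ.+ m) N (B.core-supported N ℕₚ.≤-refl) i y))

dot-++ : ∀ {d d′} (a c : Vec ℤ d) (b e : Vec ℤ d′) → ⟨ a Vec.++ b , c Vec.++ e ⟩ ≡ ⟨ a , c ⟩ + ⟨ b , e ⟩
dot-++ []      []      b e = sym (ℤₚ.+-identityˡ _)
dot-++ (x ∷ a) (y ∷ c) b e = trans (+-congˡ (x * y) (dot-++ a c b e)) (sym (ℤₚ.+-assoc (x * y) ⟨ a , c ⟩ ⟨ b , e ⟩))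

dot-𝟎ˡ : ∀ {m} (u : Vec ℤ m) → ⟨ 𝟎 , u ⟩ ≡ 0ℤ
dot-𝟎ˡ u = trans (dot-comm 𝟎 u) (dot-𝟎ʳ u)

module Columns {r : ℕ} (A : Fin r → ℤ) where

  col : (hs : List (Fin r → ℤ)) → Fin r → Vec ℤ (length hs)
  col []       i = []
  col (h ∷ hs) i = h i ∷ col hs i

  col-norm : ∀ hs i → ‖ col hs i ‖² ≡ ∑ (λ h → h i * h i) hs
  col-norm []       i = refl
  col-norm (h ∷ hs) i = +-congˡ (h i * h i) (col-norm hs i)

  col-member : ∀ {hs h} → h ∈ hs → ∃ λ x → ∀ i → ⟨ col hs i , x ⟩ ≡ h i
  col-member {h ∷ hs} (here refl) = 1ℤ ∷ 𝟎 , λ i → trans (cong₂ _+_ (ℤₚ.*-identityʳ (h i)) (dot-𝟎ʳ (col hs i))) (ℤₚ.+-identityʳ (h i))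
  col-member {h ∷ hs} (there h∈) = let x , eq = col-member h∈ in
    0ℤ ∷ x , λ i → trans (cong₂ _+_ (ℤₚ.*-zeroʳ (h i)) (eq i)) (ℤₚ.+-identityˡ _)

  col-relation : ∀ hs → (∀ h → h ∈ hs → ∑ (λ i → A i * h i) (allFin r) ≡ 0ℤ) → ∀ V → ∑ (λ i → A i * ⟨ col hs i , V ⟩) (allFin r) ≡ 0ℤ
  col-relation []       rel []      = ∑-zero (allFin r) λ i _ → ℤₚ.*-zeroʳ (A i)
  col-relation (h ∷ hs) rel (x ∷ V) = trans (∑-cong′ (allFin r) λ i → lemma (A i) (h i) x ⟨ col hs i , V ⟩)
    (trans (∑-+ (λ i → A i * h i * x) (λ i → A i * ⟨ col hs i , V ⟩) (allFin r))
      (cong₂ _+_ (trans (∑-*ʳ x (λ i → A i * h i) (allFin r)) (trans (cong (_* x) (rel h (here refl))) (ℤₚ.*-zeroˡ x)))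
        (col-relation hs (λ h h∈ → rel h (there h∈)) V)))
    where
    lemma : ∀ a h x d → a * (h * x + d) ≡ a * h * x + a * d
    lemma = solve-∀

-- A second copy of the coordinates provides the reference functional u₀ orthogonal to all u i.
columns-solution : ∀ {n} (A : Fin (suc n) → ℤ) (hs : List (Fin (suc n) → ℤ)) σ M .{{_ : NonZero σ}} .{{_ : NonZero M}} →
  (∀ h → h ∈ hs → ∑ (λ i → A i * h i) (allFin (suc n)) ≡ 0ℤ) →
  (∀ i → ∑ (λ h → h i * h i) hs ≡ + σ) →
  (∀ i → ∃ λ h → h ∈ hs × h i ≡ 1ℤ) →
  (∀ i → ∃ λ h → ∃ λ h′ → h ∈ hs × h′ ∈ hs × h i ≡ + M × h′ i ≡ + M × (∀ j → j ≢ i → h j ≡ 0ℤ ⊎ h′ j ≡ 0ℤ)) →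
  Solution A
columns-solution {n} A hs σ M rel norms units moves = system-solution {n} {d ℕ.+ d} {σ} {M} (record
  { u = λ i → col hs i Vec.++ 𝟎 ; u₀ = 𝟎 Vec.++ col hs zero
  ; e = λ i → left (proj₁ (proj₂ (units i))) ; e₀ = 𝟎 Vec.++ pre (proj₁ (proj₂ (units zero)))
  ; v = λ i → left (proj₁ (proj₂ (proj₂ (moves i)))) ; v′ = λ i → left (proj₁ (proj₂ (proj₂ (proj₂ (moves i)))))
  ; uu = λ i → trans (dot-++ (col hs i) (col hs i) 𝟎 𝟎) (trans (cong₂ _+_ (trans (col-norm hs i) (norms i)) (dot-𝟎ʳ (𝟎 {d}))) (ℤₚ.+-identityʳ (+ σ)))
  ; u₀u₀ = trans (dot-++ (𝟎 {d}) 𝟎 (col hs zero) (col hs zero)) (trans (cong₂ _+_ (dot-𝟎ʳ (𝟎 {d})) (trans (col-norm hs zero) (norms zero))) (ℤₚ.+-identityˡ (+ σ)))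
  ; uu₀ = λ i → cross (col hs i) (col hs zero)
  ; ue = λ i → trans (u-left (proj₁ (proj₂ (units i))) i) (proj₂ (proj₂ (units i)))
  ; u₀e = λ i → trans (dot-++ 𝟎 (pre (proj₁ (proj₂ (units i)))) (col hs zero) 𝟎) (cong₂ _+_ (dot-𝟎ˡ (pre (proj₁ (proj₂ (units i))))) (dot-𝟎ʳ (col hs zero)))
  ; ue₀ = λ i → cross (col hs i) (pre (proj₁ (proj₂ (units zero))))
  ; u₀e₀ = trans (dot-++ (𝟎 {d}) 𝟎 (col hs zero) (pre (proj₁ (proj₂ (units zero))))) (trans (cong₂ _+_ (dot-𝟎ʳ (𝟎 {d}))
      (trans (proj₂ (col-member (proj₁ (proj₂ (units zero)))) zero) (proj₂ (proj₂ (units zero))))) (ℤₚ.+-identityˡ 1ℤ))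
  ; uv = λ i → let _ , _ , h∈ , _ , hi , _ = moves i in trans (u-left h∈ i) hi
  ; uv′ = λ i → let _ , _ , _ , h′∈ , _ , h′i , _ = moves i in trans (u-left h′∈ i) h′i
  ; kill = λ i j j≢i → let _ , _ , h∈ , h′∈ , _ , _ , k = moves i in
      [ (λ z → inj₁ (trans (u-left h∈ j) z)) , (λ z → inj₂ (trans (u-left h′∈ j) z)) ]′ (k j j≢i)
  }) A relation
  where
  open Columns A
  d : ℕ
  d = length hs
  pre : ∀ {h} → h ∈ hs → Vec ℤ d
  pre h∈ = proj₁ (col-member h∈)
  left : ∀ {h} → h ∈ hs → Vec ℤ (d ℕ.+ d)
  left h∈ = pre h∈ Vec.++ 𝟎
  u-left : ∀ {h} (h∈ : h ∈ hs) i → ⟨ col hs i Vec.++ 𝟎 , left h∈ ⟩ ≡ h i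
  u-left {h} h∈ i = trans (dot-++ (col hs i) (pre h∈) (𝟎 {d}) 𝟎) (trans (cong₂ _+_ (proj₂ (col-member h∈) i) (dot-𝟎ʳ (𝟎 {d}))) (ℤₚ.+-identityʳ (h i)))
  cross : ∀ (a b : Vec ℤ d) → ⟨ a Vec.++ 𝟎 , 𝟎 Vec.++ b ⟩ ≡ 0ℤ
  cross a b = trans (dot-++ a 𝟎 𝟎 b) (cong₂ _+_ (dot-𝟎ʳ a) (dot-𝟎ˡ b))
  relation : ∀ V → ∑ (λ i → A i * ⟨ col hs i Vec.++ 𝟎 , V ⟩) (allFin (suc n)) ≡ 0ℤ
  relation V with Vec.splitAt d V
  ... | x , y , refl = trans (∑-cong′ (allFin (suc n)) λ i → cong (A i *_) (trans (dot-++ (col hs i) x 𝟎 y) (trans (+-congˡ ⟨ col hs i , x ⟩ (dot-𝟎ˡ y)) (ℤₚ.+-identityʳ _))))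
    (col-relation hs rel x)

-- Kernel vectors with equal second moments

∑-replicate : ∀ {A : Set} (f : A → ℤ) n x → ∑ f (replicate n x) ≡ + n * f x
∑-replicate f zero    x = sym (ℤₚ.*-zeroˡ (f x))
∑-replicate f (suc n) x = trans (+-congˡ (f x) (∑-replicate f n x)) (lemma (f x) (+ n))
  where
  lemma : ∀ a n → a + n * a ≡ (1ℤ + n) * a
  lemma = solve-∀

∈-replicate⁻ : ∀ {A : Set} n {x y : A} → y ∈ replicate n x → y ≡ x
∈-replicate⁻ (suc n) (here eq)   = eq
∈-replicate⁻ (suc n) (there y∈) = ∈-replicate⁻ n y∈

∈-concatMap⁺ : ∀ {A B : Set} (f : A → List B) {xs x b} → x ∈ xs → b ∈ f x → b ∈ concatMap f xs
∈-concatMap⁺ f {x ∷ xs} (here refl) b∈ = ∈-++⁺ˡ b∈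
∈-concatMap⁺ f {x ∷ xs} (there x∈)  b∈ = ∈-++⁺ʳ (f x) (∈-concatMap⁺ f x∈ b∈)

-- The sign of 0 is 1, so that `sgn²` holds without exception.
sgn : ℤ → ℤ
sgn (+ _)    = 1ℤ
sgn -[1+ _ ] = - 1ℤ

sgn-* : ∀ z → z * sgn z ≡ + ∣ z ∣
sgn-* (+ n)    = ℤₚ.*-identityʳ (+ n)
sgn-* -[1+ n ] = cong +_ (ℕₚ.*-identityʳ (suc n))

sgn² : ∀ z → sgn z * sgn z ≡ 1ℤ
sgn² (+ _)    = refl
sgn² -[1+ _ ] = refl

δ : ∀ {r} → Fin r → Fin r → ℤ
δ i j = ind (i Finₚ.≟ j)

δ-same : ∀ {r} (i : Fin r) → δ i i ≡ 1ℤ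
δ-same i = ind-yes (i Finₚ.≟ i) refl

δ-diff : ∀ {r} {i j : Fin r} → i ≢ j → δ i j ≡ 0ℤ
δ-diff {i = i} {j} ne = ind-no (i Finₚ.≟ j) ne

∑-δ : ∀ {r} (p : Fin r) (f : Fin r → ℤ) → ∑ (λ j → δ j p * f j) (allFin r) ≡ f p
∑-δ {r} p f = trans (∑-single (Uniqueₚ.allFin⁺ r) (∈-allFin p) λ j _ j≢p → cong (_* f j) (δ-diff j≢p))
  (trans (cong (_* f p) (δ-same p)) (ℤₚ.*-identityˡ (f p)))

module SecondMoments {r : ℕ} (A : Fin r → ℤ) (p : Fin r) where

  InKernel : (Fin r → ℤ) → Set
  InKernel h = ∑ (λ j → A j * h j) (allFin r) ≡ 0ℤ

  b : Fin r → ℤ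
  b j = + ∣ A j ∣

  B : ℤ
  B = b p

  pairing : (Fin r → ℤ) → ℤ
  pairing t = ∑ (λ j → b j * t j) (allFin r)

  -- Prescribes x_j = B sgn(A_j) t_j for j ≠ p; the coordinate p is forced by the relation.
  vec : (Fin r → ℤ) → Fin r → ℤ
  vec t j = B * (sgn (A j) * t j) - δ j p * (sgn (A p) * pairing t)

  vec-kernel : ∀ t → InKernel (vec t)
  vec-kernel t = trans (∑-cong′ (allFin r) term) (trans (∑-- (λ j → B * (b j * t j)) (λ j → δ j p * (A j * sgn (A p) * pairing t)) (allFin r))
    (trans (cong₂ _-_ (∑-*ˡ B (λ j → b j * t j) (allFin r)) (trans (∑-δ p (λ j → A j * sgn (A p) * pairing t)) (cong (_* pairing t) (sgn-* (A p)))))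
      (ℤₚ.+-inverseʳ (B * pairing t))))
    where
    term : ∀ j → A j * vec t j ≡ B * (b j * t j) - δ j p * (A j * sgn (A p) * pairing t)
    term j = trans (lemma (A j) B (sgn (A j)) (t j) (δ j p) (sgn (A p)) (pairing t)) (cong (λ z → B * (z * t j) - δ j p * (A j * sgn (A p) * pairing t)) (sgn-* (A j)))
      where
      lemma : ∀ a B s t d σ x → a * (B * (s * t) - d * (σ * x)) ≡ B * (a * s * t) - d * (a * σ * x)
      lemma = solve-∀

  vec²-other : ∀ t {j} → j ≢ p → vec t j * vec t j ≡ B * B * (t j * t j)
  vec²-other t {j} j≢p = trans (cong (λ d → (B * (sgn (A j) * t j) - d * X) * (B * (sgn (A j) * t j) - d * X)) (δ-diff j≢p))
    (trans (lemma B (sgn (A j)) (t j) X) (trans (cong (λ z → B * B * (z * (t j * t j))) (sgn² (A j))) (cong (B * B *_) (ℤₚ.*-identityˡ (t j * t j)))))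
    where
    X : ℤ
    X = sgn (A p) * pairing t
    lemma : ∀ B s t x → (B * (s * t) - 0ℤ * x) * (B * (s * t) - 0ℤ * x) ≡ B * B * (s * s * (t * t))
    lemma = solve-∀

  vec²-pivot : ∀ t → t p ≡ 0ℤ → vec t p * vec t p ≡ pairing t * pairing t
  vec²-pivot t tp≡0 = trans (cong₂ (λ d u → (B * (sgn (A p) * u) - d * (sgn (A p) * pairing t)) * (B * (sgn (A p) * u) - d * (sgn (A p) * pairing t))) (δ-same p) tp≡0)
    (trans (lemma B (sgn (A p)) (pairing t)) (trans (cong (_* (pairing t * pairing t)) (sgn² (A p))) (ℤₚ.*-identityˡ (pairing t * pairing t))))
    where
    lemma : ∀ B s x → (B * (s * 0ℤ) - 1ℤ * (s * x)) * (B * (s * 0ℤ) - 1ℤ * (s * x)) ≡ s * s * (x * x)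
    lemma = solve-∀

  t⁺ : Fin r → ℤ
  t⁺ j = 1ℤ - δ j p

  t⁻ : Fin r → Fin r → ℤ
  t⁻ k j = t⁺ j - δ j k

  t⁺-p : t⁺ p ≡ 0ℤ
  t⁺-p = cong (λ z → 1ℤ - z) (δ-same p)

  t⁺-other : ∀ {j} → j ≢ p → t⁺ j ≡ 1ℤ
  t⁺-other j≢p = cong (λ z → 1ℤ - z) (δ-diff j≢p)

  pairing-t⁻ : ∀ k → pairing (t⁻ k) ≡ pairing t⁺ - b k
  pairing-t⁻ k = trans (∑-cong′ (allFin r) λ j → lemma (b j) (t⁺ j) (δ j k)) (trans (∑-- (λ j → b j * t⁺ j) (λ j → δ j k * b j) (allFin r))
    (cong (λ z → pairing t⁺ - z) (∑-δ k b)))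
    where
    lemma : ∀ b t d → b * (t - d) ≡ b * t - d * b
    lemma = solve-∀

  -- Mixing vec t⁺, vec τ and the vec (t⁻ k) with the given vectors so that all coordinates get the
  -- same second moment: the weight of vec (t⁻ k) lowers coordinate k, and the first two straddle B at p.
  module Balance (τ : Fin r → ℤ) (τ-p : τ p ≡ 0ℤ) (τ² : ∀ {j} → j ≢ p → τ j * τ j ≡ 1ℤ)
                 (given-vectors : List (Fin r → ℤ))
                 (strict⁺ : 0ℤ ℤ.< pairing t⁺ * pairing t⁺ - B * B)
                 (strictτ : 0ℤ ℤ.< B * B - pairing τ * pairing τ) where

    S s P₀ Q₀ Z Z′ n₊ nτ : ℤ
    S = pairing t⁺
    s = pairing τ
    P₀ = S * S - B * B
    Q₀ = B * B - s * s

    T weight : Fin r → ℤ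
    T k = ∑ (λ h → h k * h k) given-vectors
    weight k = t⁺ k * (P₀ * T k)

    -- The second moment at p agrees with the others exactly when n₊ P₀ - nτ Q₀ + P₀ Z = 0. Taking
    -- nτ = P₀ Z′ forces n₊ = Z′ Q₀ - Z, and Z′ = |Z| makes this nonnegative because Q₀ ≥ 1.
    Z = B * B * T p - ∑ (λ k → t⁺ k * T k * (B * B - (S - b k) * (S - b k))) (allFin r)
    Z′ = + ∣ Z ∣
    n₊ = Z′ * Q₀ - Z
    nτ = P₀ * Z′

    T≥0 : ∀ k → 0ℤ ℤ.≤ T k
    T≥0 k = ∑-nonNeg given-vectors λ h _ → i*i≥0 (h k)

    t⁺≥0 : ∀ k → 0ℤ ℤ.≤ t⁺ k
    t⁺≥0 k with k Finₚ.≟ p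
    ... | yes _ = ℤₚ.≤-refl
    ... | no _  = +≤+ z≤n

    weight≥0 : ∀ k → 0ℤ ℤ.≤ weight k
    weight≥0 k = *-nonNeg (t⁺≥0 k) (*-nonNeg (ℤₚ.<⇒≤ strict⁺) (T≥0 k))

    nτ≥0 : 0ℤ ℤ.≤ nτ
    nτ≥0 = *-nonNeg {P₀} {Z′} (ℤₚ.<⇒≤ strict⁺) (+≤+ z≤n)

    n₊≥0 : 0ℤ ℤ.≤ n₊
    n₊≥0 = ℤₚ.i≤j⇒0≤j-i (ℤₚ.≤-trans (z≤∣z∣ Z) (subst (ℤ._≤ Z′ * Q₀) (ℤₚ.*-identityʳ Z′) (*-monoˡ-≤ {1ℤ} {Q₀} {Z′} (+≤+ z≤n) (ℤₚ.i<j⇒suc[i]≤j strictτ))))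
      where
      z≤∣z∣ : ∀ z → z ℤ.≤ + ∣ z ∣
      z≤∣z∣ (+ n)    = ℤₚ.≤-refl
      z≤∣z∣ -[1+ n ] = -≤+

    copies : ℤ
    copies = B * B * P₀

    copies≥0 : 0ℤ ℤ.≤ copies
    copies≥0 = *-nonNeg (i*i≥0 B) (ℤₚ.<⇒≤ strict⁺)

    vectors : List (Fin r → ℤ)
    vectors = replicate (pos n₊) (vec t⁺) ++ (replicate (pos nτ) (vec τ) ++
      (concatMap (λ k → replicate (pos (weight k)) (vec (t⁻ k))) (allFin r) ++ concatMap (replicate (pos copies)) given-vectors))

    Λ : ℤ
    Λ = n₊ + nτ + ∑ weight (allFin r)

    second-moment : ∀ i → ∑ (λ h → h i * h i) vectors ≡
      n₊ * (vec t⁺ i * vec t⁺ i) + (nτ * (vec τ i * vec τ i) + (∑ (λ k → weight k * (vec (t⁻ k) i * vec (t⁻ k) i)) (allFin r) + copies * T i))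
    second-moment i = trans (∑-++ sq (replicate (pos n₊) (vec t⁺)) _) (cong₂ _+_ (rep n₊≥0 (vec t⁺)) (trans (∑-++ sq (replicate (pos nτ) (vec τ)) _) (cong₂ _+_ (rep nτ≥0 (vec τ))
      (trans (∑-++ sq (concatMap (λ k → replicate (pos (weight k)) (vec (t⁻ k))) (allFin r)) _) (cong₂ _+_
        (trans (∑-concatMap sq (λ k → replicate (pos (weight k)) (vec (t⁻ k))) (allFin r)) (∑-cong′ (allFin r) λ k → rep (weight≥0 k) (vec (t⁻ k))))
        (trans (∑-concatMap sq (replicate (pos copies)) given-vectors) (trans (∑-cong′ given-vectors λ h → rep copies≥0 h) (∑-*ˡ copies sq given-vectors))))))))
      where
      sq : (Fin r → ℤ) → ℤ
      sq h = h i * h i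
      rep : ∀ {n} → 0ℤ ℤ.≤ n → ∀ h → ∑ sq (replicate (pos n) h) ≡ n * sq h
      rep {n} 0≤n h = trans (∑-replicate sq (pos n) h) (cong (_* sq h) (pos-nonNeg 0≤n))

    -- At i ≠ p every auxiliary vector has square B², except that `vec (t⁻ i)` vanishes there. The
    -- deficit B² · weight i equals copies · T i, the contribution of the given vectors. At p the
    -- choice of `n₊` and `nτ` settles the equation.
    balanced : ∀ i → ∑ (λ h → h i * h i) vectors ≡ B * B * Λ
    balanced i with i Finₚ.≟ p
    ... | no i≢p = trans (second-moment i) (trans (cong₂ _+_ (trans (cong (n₊ *_) (trans (vec²-other t⁺ i≢p) (cong (λ z → B * B * (z * z)) (t⁺-other i≢p)))) refl)
          (cong₂ (λ x y → nτ * x + (y + copies * T i)) (trans (vec²-other τ i≢p) (cong (B * B *_) (τ² i≢p))) others))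
        (lemma n₊ nτ (B * B) P₀ (T i) (∑ weight (allFin r))))
      where
      others : ∑ (λ k → weight k * (vec (t⁻ k) i * vec (t⁻ k) i)) (allFin r) ≡ B * B * (∑ weight (allFin r) - P₀ * T i)
      others = trans (∑-cong′ (allFin r) term) (trans (∑-*ˡ (B * B) (λ k → weight k - δ k i * weight k) (allFin r)) (cong (B * B *_)
        (trans (∑-- weight (λ k → δ k i * weight k) (allFin r)) (cong (λ z → ∑ weight (allFin r) - z) (trans (∑-δ i weight) (trans (cong (_* (P₀ * T i)) (t⁺-other i≢p)) (ℤₚ.*-identityˡ (P₀ * T i))))))))
        where
        idem : ∀ k → (1ℤ - δ i k) * (1ℤ - δ i k) ≡ 1ℤ - δ k i
        idem k with i Finₚ.≟ k
        ... | yes refl = cong (λ z → 1ℤ - z) (sym (δ-same i))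
        ... | no i≢k   = cong (λ z → 1ℤ - z) (sym (δ-diff (i≢k ∘ sym)))
        term : ∀ k → weight k * (vec (t⁻ k) i * vec (t⁻ k) i) ≡ B * B * (weight k - δ k i * weight k)
        term k = trans (cong (weight k *_) (trans (vec²-other (t⁻ k) i≢p) (cong (B * B *_) (trans (cong (λ z → (z - δ i k) * (z - δ i k)) (t⁺-other i≢p)) (idem k)))))
          (lemma₁ (weight k) (B * B) (δ k i))
          where
          lemma₁ : ∀ w b d → w * (b * (1ℤ - d)) ≡ b * (w - d * w)
          lemma₁ = solve-∀
      lemma : ∀ n m b P t w → n * (b * (1ℤ * 1ℤ)) + (m * (b * 1ℤ) + (b * (w - P * t) + b * P * t)) ≡ b * (n + m + w)
      lemma = solve-∀
    ... | yes refl = trans (second-moment p) (trans (cong₂ _+_ (cong (n₊ *_) (vec²-pivot t⁺ t⁺-p))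
          (cong₂ (λ x y → nτ * x + (y + copies * T p)) (vec²-pivot τ τ-p) others))
        (trans (lemma S s (B * B) (T p) Z′ Y (∑ weight (allFin r))) refl))
      where
      Y : ℤ
      Y = ∑ (λ k → t⁺ k * T k * (B * B - (S - b k) * (S - b k))) (allFin r)
      others : ∑ (λ k → weight k * (vec (t⁻ k) p * vec (t⁻ k) p)) (allFin r) ≡ B * B * ∑ weight (allFin r) - P₀ * Y
      others = trans (∑-cong′ (allFin r) term) (trans (∑-- (λ k → B * B * weight k) (λ k → P₀ * (t⁺ k * T k * (B * B - (S - b k) * (S - b k)))) (allFin r))
        (cong₂ _-_ (∑-*ˡ (B * B) weight (allFin r)) (∑-*ˡ P₀ (λ k → t⁺ k * T k * (B * B - (S - b k) * (S - b k))) (allFin r))))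
        where
        lemma₁ : ∀ t P T b x → t * (P * T) * (x * x) ≡ b * (t * (P * T)) - P * (t * T * (b - x * x))
        lemma₁ = solve-∀
        value : ∀ k → t⁺ k * (P₀ * T k) * (vec (t⁻ k) p * vec (t⁻ k) p) ≡ t⁺ k * (P₀ * T k) * ((S - b k) * (S - b k))
        value k with k Finₚ.≟ p
        ... | yes refl = refl
        ... | no k≢p = cong ((1ℤ - 0ℤ) * (P₀ * T k) *_) (trans (vec²-pivot (t⁻ k) (cong₂ _-_ t⁺-p (δ-diff (k≢p ∘ sym)))) (cong (λ z → z * z) (pairing-t⁻ k)))
        term : ∀ k → weight k * (vec (t⁻ k) p * vec (t⁻ k) p) ≡ B * B * weight k - P₀ * (t⁺ k * T k * (B * B - (S - b k) * (S - b k)))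
        term k = trans (value k) (lemma₁ (t⁺ k) P₀ (T k) (B * B) (S - b k))
      lemma : ∀ S s b T z Y w → (z * (b - s * s) - (b * T - Y)) * (S * S) + ((S * S - b) * z * (s * s) + (b * w - (S * S - b) * Y + b * (S * S - b) * T))
        ≡ b * (z * (b - s * s) - (b * T - Y) + (S * S - b) * z + w)
      lemma = solve-∀

    given∈ : B ≢ 0ℤ → ∀ {h} → h ∈ given-vectors → h ∈ vectors
    given∈ B≢0 {h} h∈ = ∈-++⁺ʳ (replicate (pos n₊) (vec t⁺)) (∈-++⁺ʳ (replicate (pos nτ) (vec τ))
      (∈-++⁺ʳ (concatMap (λ k → replicate (pos (weight k)) (vec (t⁻ k))) (allFin r)) (∈-concatMap⁺ (replicate (pos copies)) h∈ (member (pos copies) copies≢0))))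
      where
      member : ∀ n → n ≢ 0 → h ∈ replicate n h
      member zero    ne = contradiction refl ne
      member (suc n) ne = here refl
      copies≢0 : pos copies ≢ 0
      copies≢0 z = [ (λ BB≡0 → [ B≢0 , B≢0 ]′ (ℤₚ.i*j≡0⇒i≡0∨j≡0 B BB≡0)) , (λ P≡0 → ℤₚ.<-irrefl (sym P≡0) strict⁺) ]′
        (ℤₚ.i*j≡0⇒i≡0∨j≡0 (B * B) (trans (sym (pos-nonNeg copies≥0)) (cong +_ z)))

    vectors-kernel : (∀ h → h ∈ given-vectors → InKernel h) → ∀ h → h ∈ vectors → InKernel h
    vectors-kernel given-kernel h h∈ = [ constant (pos n₊) t⁺ , (λ h∈₁ → [ constant (pos nτ) τ , (λ h∈₂ →
        [ (λ h∈₃ → let k , _ , h∈₄ = ∈-concatMap⁻ (λ k → replicate (pos (weight k)) (vec (t⁻ k))) (allFin r) h∈₃ in constant (pos (weight k)) (t⁻ k) h∈₄)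
        , (λ h∈₃ → let g , g∈ , h∈₄ = ∈-concatMap⁻ (replicate (pos copies)) given-vectors h∈₃ in subst InKernel (sym (∈-replicate⁻ (pos copies) h∈₄)) (given-kernel g g∈)) ]′
        (∈-++⁻ (concatMap (λ k → replicate (pos (weight k)) (vec (t⁻ k))) (allFin r)) h∈₂)) ]′ (∈-++⁻ (replicate (pos nτ) (vec τ)) h∈₁)) ]′
        (∈-++⁻ (replicate (pos n₊) (vec t⁺)) h∈)
      where
      constant : ∀ n t → h ∈ replicate n (vec t) → InKernel h
      constant n t h∈ = subst InKernel (sym (∈-replicate⁻ n h∈)) (vec-kernel t)

argmax : ∀ {n} (f : Fin (suc n) → ℕ) → ∃ λ p → ∀ j → f j ℕ.≤ f p
argmax {zero}  f = zero , λ { zero → ℕₚ.≤-refl }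
argmax {suc n} f with argmax (f ∘ suc)
... | p , max with ℕₚ.≤-total (f zero) (f (suc p))
... | inj₁ h = suc p , λ { zero → h ; (suc j) → max j }
... | inj₂ h = zero , λ { zero → ℕₚ.≤-refl ; (suc j) → ℕₚ.≤-trans (max j) h }

-- The sign is chosen so that a t opposes s; then |a t + s| is the difference of |a| and |s|, at
-- most the larger of them.
balance-sign : ∀ a s {B} → ∣ a ∣ ℕ.≤ B → ∣ s ∣ ℕ.≤ B → ∃ λ t → t * t ≡ 1ℤ × ∣ a * t + s ∣ ℕ.≤ B
balance-sign a s {B} ha hs = sgn a * - sgn s , trans (lemma (sgn a) (sgn s)) (trans (cong₂ _*_ (sgn² a) (sgn² s)) refl) ,
  subst (ℕ._≤ B) (cong ∣_∣ (sym (trans (lemma₂ a (sgn a) (sgn s) s) (cong₂ (λ x y → x * - sgn s + y) (sgn-* a) (sym (abs-sgn s))))))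
    (subst (ℕ._≤ B) (trans (sym (abs-flip (+ ∣ s ∣ - + ∣ a ∣) s)) (cong ∣_∣ (lemma₃ (+ ∣ a ∣) (+ ∣ s ∣) (sgn s))))
      (ℕₚ.≤-trans (subst (ℕ._≤ ∣ s ∣ ℕ.⊔ ∣ a ∣) (cong ∣_∣ (sym (ℤₚ.m-n≡m⊖n ∣ s ∣ ∣ a ∣))) (ℤₚ.∣m⊝n∣≤m⊔n ∣ s ∣ ∣ a ∣)) (ℕₚ.⊔-lub hs ha)))
  where
  lemma : ∀ a s → a * - s * (a * - s) ≡ a * a * (s * s)
  lemma = solve-∀
  lemma₂ : ∀ a x y s → a * (x * - y) + s ≡ a * x * - y + s
  lemma₂ = solve-∀
  lemma₃ : ∀ a b s → (b - a) * s ≡ a * - s + b * s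
  lemma₃ = solve-∀
  abs-sgn : ∀ s → + ∣ s ∣ * sgn s ≡ s
  abs-sgn (+ n)    = ℤₚ.*-identityʳ (+ n)
  abs-sgn -[1+ n ] = cong -[1+_] (ℕₚ.*-identityʳ n)
  abs-flip : ∀ x s → ∣ x * sgn s ∣ ≡ ∣ x ∣
  abs-flip x s = trans (ℤₚ.abs-* x (sgn s)) (trans (cong (∣ x ∣ ℕ.*_) (one s)) (ℕₚ.*-identityʳ ∣ x ∣))
    where
    one : ∀ s → ∣ sgn s ∣ ≡ 1
    one (+ _)    = refl
    one -[1+ _ ] = refl

greedy-signs : ∀ {r} (a : Fin r → ℤ) B → (∀ j → ∣ a j ∣ ℕ.≤ B) →
  ∃ λ (t : Fin r → ℤ) → (∀ j → t j * t j ≡ 1ℤ) × ∣ ∑ (λ j → a j * t j) (allFin r) ∣ ℕ.≤ B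
greedy-signs {zero}  a B h = (λ ()) , (λ ()) , z≤n
greedy-signs {suc r} a B h with greedy-signs (a ∘ suc) B (h ∘ suc)
... | t , t² , small with balance-sign (a zero) (∑ (λ j → a (suc j) * t j) (allFin r)) (h zero) small
... | t₀ , t₀² , small₀ = t′ , (λ { zero → t₀² ; (suc j) → t² j }) ,
      subst (ℕ._≤ B) (cong ∣_∣ (sym (∑-allFin-suc (λ j → a j * t′ j)))) small₀
  where
  t′ : Fin (suc r) → ℤ
  t′ zero    = t₀
  t′ (suc j) = t j

common-multiple : ∀ {r} (A : Fin r → ℤ) → ∃ λ M → M ≢ 0 × ∀ j → A j ≢ 0ℤ → ∃ λ c → A j * c ≡ + M
common-multiple {zero}  A = 1 , (λ ()) , λ ()
common-multiple {suc r} A with common-multiple (A ∘ suc) | A zero ℤₚ.≟ 0ℤ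
... | M , M≢0 , div | yes z = M , M≢0 , λ { zero nz → contradiction z nz ; (suc j) → div j }
... | M , M≢0 , div | no nz = ∣ A zero ∣ ℕ.* M , (λ e → [ (λ z → nz (ℤₚ.∣i∣≡0⇒i≡0 z)) , M≢0 ]′ (ℕₚ.m*n≡0⇒m≡0∨n≡0 ∣ A zero ∣ e)) , multiples
  where
  multiples : ∀ j → A j ≢ 0ℤ → ∃ λ c → A j * c ≡ + (∣ A zero ∣ ℕ.* M)
  multiples zero    _  = sgn (A zero) * + M , trans (sym (ℤₚ.*-assoc (A zero) (sgn (A zero)) (+ M))) (trans (cong (_* + M) (sgn-* (A zero))) (sym (ℤₚ.pos-* ∣ A zero ∣ M)))
  multiples (suc j) nz′ = let c , eq = div j nz′ in
    c * + ∣ A zero ∣ , trans (sym (ℤₚ.*-assoc (A (suc j)) c (+ ∣ A zero ∣))) (trans (cong (_* + ∣ A zero ∣) eq) (trans (ℤₚ.*-comm (+ M) (+ ∣ A zero ∣)) (sym (ℤₚ.pos-* ∣ A zero ∣ M))))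

two-point-solution : ∀ {n} (A x : Fin (suc n) → ℤ) c → c ≢ 0ℤ → (∀ j → x j * x j ≡ c * c) →
  ∑ (λ j → A j * x j) (allFin (suc n)) ≡ 0ℤ → Solution A
two-point-solution {n} A x c c≢0 x² rel = record
  { atoms    = (x , 1ℤ) ∷ ((λ j → - x j) , 1ℤ) ∷ []
  ; nonNeg   = λ { _ (here refl) → +≤+ z≤n ; _ (there (here refl)) → +≤+ z≤n }
  ; relation = λ { _ (here refl) → rel
                 ; _ (there (here refl)) → trans (∑-cong′ (allFin (suc n)) λ j → sym (ℤₚ.neg-distribʳ-* (A j) (x j)))
                     (trans (∑-neg (λ j → A j * x j) (allFin (suc n))) (cong (-_) rel)) }
  ; law-eq   = λ i j y → [ (λ e → cong (law y) e) , (λ e → trans (cong (law y) e) (law-neg y (x j))) ]′ (same i j)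
  ; nonzero  = (x , 1ℤ) , here refl , +<+ (s≤s z≤n) , zero , λ z → [ c≢0 , c≢0 ]′ (ℤₚ.i*j≡0⇒i≡0∨j≡0 c (trans (sym (x² zero)) (cong (_* x zero) z)))
  }
  where
  law : ℤ → ℤ → ℤ
  law y z = ind (z ℤₚ.≟ y) * 1ℤ + (ind (- z ℤₚ.≟ y) * 1ℤ + 0ℤ)
  law-neg : ∀ y z → law y (- z) ≡ law y z
  law-neg y z = trans (cong (λ w → ind (- z ℤₚ.≟ y) * 1ℤ + (ind (w ℤₚ.≟ y) * 1ℤ + 0ℤ)) (ℤₚ.neg-involutive z))
    (lemma (ind (- z ℤₚ.≟ y)) (ind (z ℤₚ.≟ y)))
    where
    lemma : ∀ a b → a * 1ℤ + (b * 1ℤ + 0ℤ) ≡ b * 1ℤ + (a * 1ℤ + 0ℤ)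
    lemma = solve-∀
  same : ∀ i j → x i ≡ x j ⊎ x i ≡ - x j
  same i j = [ (λ h → inj₁ (ℤₚ.i-j≡0⇒i≡j (x i) (x j) h)) , (λ h → inj₂ (trans (lemma₁ (x i) (x j)) (trans (cong (_- x j) h) (ℤₚ.+-identityˡ (- x j))))) ]′
    (ℤₚ.i*j≡0⇒i≡0∨j≡0 (x i - x j) (trans (lemma (x i) (x j)) (trans (cong₂ _-_ (x² i) (x² j)) (ℤₚ.+-inverseʳ (c * c)))))
    where
    lemma : ∀ a b → (a - b) * (a + b) ≡ a * a - b * b
    lemma = solve-∀
    lemma₁ : ∀ a b → a ≡ a + b - b
    lemma₁ = solve-∀

square-≤ : ∀ i b → ∣ i ∣ ℕ.≤ b → i * i ℤ.≤ + b * + b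
square-≤ i b h = subst₂ ℤ._≤_ (∣i∣*∣i∣ i) (ℤₚ.pos-* b b) (+≤+ (ℕₚ.*-mono-≤ h h))

-- At a coordinate p with |A p| maximal, the archimedean condition gives B ≤ pairing t⁺, while
-- maximality provides signs with |pairing τ| ≤ B. Equality in one of these puts a vector with all
-- coordinates ±B into the kernel; if both are strict, the second moments can be balanced.
module Construction {n : ℕ} (A : Fin (suc n) → ℤ) (units : ∀ i → ∃ λ (h : Fin (suc n) → ℤ) → ∑ (λ j → A j * h j) (allFin (suc n)) ≡ 0ℤ × h i ≡ 1ℤ)
  (p : Fin (suc n)) (b≤B : ∀ j → ∣ A j ∣ ℕ.≤ ∣ A p ∣) (archimedean : + ∣ A p ∣ ℤ.≤ ∑ (λ j → + ∣ A j ∣ * (1ℤ - δ j p)) (allFin (suc n))) where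

  open SecondMoments A p

  masked : Fin (suc n) → ℤ
  masked j = b j * t⁺ j

  masked-bound : ∀ j → ∣ masked j ∣ ℕ.≤ ∣ A p ∣
  masked-bound j with j Finₚ.≟ p
  ... | yes _ = subst (ℕ._≤ ∣ A p ∣) (cong ∣_∣ (sym (ℤₚ.*-zeroʳ (b j)))) z≤n
  ... | no _  = subst (ℕ._≤ ∣ A p ∣) (cong ∣_∣ (sym (ℤₚ.*-identityʳ (b j)))) (b≤B j)

  P₀≥0 : 0ℤ ℤ.≤ pairing t⁺ * pairing t⁺ - B * B
  P₀≥0 = ℤₚ.i≤j⇒0≤j-i (*-mono-≤ {B} {pairing t⁺} (+≤+ z≤n) (ℤₚ.≤-trans (+≤+ z≤n) archimedean) archimedean archimedean)

  zero-case : B ≡ 0ℤ → Solution A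
  zero-case B≡0 = two-point-solution A (λ _ → 1ℤ) 1ℤ (λ ()) (λ _ → refl)
    (∑-zero (allFin (suc n)) λ j _ → trans (ℤₚ.*-identityʳ (A j)) (ℤₚ.∣i∣≡0⇒i≡0 (ℕₚ.n≤0⇒n≡0 (subst (∣ A j ∣ ℕ.≤_) (ℤₚ.+-injective B≡0) (b≤B j)))))

  pivot-case : ∀ t → t p ≡ 0ℤ → (∀ {j} → j ≢ p → t j * t j ≡ 1ℤ) → pairing t * pairing t ≡ B * B → B ≢ 0ℤ → Solution A
  pivot-case t t-p t² eq B≢0 = two-point-solution A (vec t) B B≢0 squares (vec-kernel t)
    where
    squares : ∀ j → vec t j * vec t j ≡ B * B
    squares j with j Finₚ.≟ p
    ... | yes refl = trans (vec²-pivot-eq) eq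
      where
      vec²-pivot-eq : (B * (sgn (A p) * t p) - 1ℤ * (sgn (A p) * pairing t)) * (B * (sgn (A p) * t p) - 1ℤ * (sgn (A p) * pairing t)) ≡ pairing t * pairing t
      vec²-pivot-eq = subst (λ d → (B * (sgn (A p) * t p) - d * (sgn (A p) * pairing t)) * (B * (sgn (A p) * t p) - d * (sgn (A p) * pairing t)) ≡ pairing t * pairing t) (δ-same p) (vec²-pivot t t-p)
    ... | no j≢p = subst (λ d → (B * (sgn (A j) * t j) - d * (sgn (A p) * pairing t)) * (B * (sgn (A j) * t j) - d * (sgn (A p) * pairing t)) ≡ B * B) (δ-diff j≢p)
      (trans (vec²-other t j≢p) (trans (cong (B * B *_) (t² j≢p)) (ℤₚ.*-identityʳ (B * B))))

  module Signed (signs : Fin (suc n) → ℤ) (signs² : ∀ j → signs j * signs j ≡ 1ℤ) (small : ∣ ∑ (λ j → masked j * signs j) (allFin (suc n)) ∣ ℕ.≤ ∣ A p ∣) where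

    τ : Fin (suc n) → ℤ
    τ j = t⁺ j * signs j

    τ-p : τ p ≡ 0ℤ
    τ-p = cong (_* signs p) t⁺-p

    τ² : ∀ {j} → j ≢ p → τ j * τ j ≡ 1ℤ
    τ² {j} j≢p = trans (cong₂ _*_ τ≡ τ≡) (signs² j)
      where
      τ≡ : τ j ≡ signs j
      τ≡ = trans (cong (_* signs j) (t⁺-other j≢p)) (ℤₚ.*-identityˡ (signs j))

    pairing-τ : ∣ pairing τ ∣ ℕ.≤ ∣ A p ∣
    pairing-τ = subst (ℕ._≤ ∣ A p ∣) (cong ∣_∣ (∑-cong′ (allFin (suc n)) λ j → ℤₚ.*-assoc (b j) (t⁺ j) (signs j)))
      small

    Q₀≥0 : 0ℤ ℤ.≤ B * B - pairing τ * pairing τ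
    Q₀≥0 = ℤₚ.i≤j⇒0≤j-i (square-≤ (pairing τ) ∣ A p ∣ pairing-τ)

    module Strict (B≢0 : B ≢ 0ℤ) (P₀>0 : 0ℤ ℤ.< pairing t⁺ * pairing t⁺ - B * B) (Q₀>0 : 0ℤ ℤ.< B * B - pairing τ * pairing τ) where

      A-p≢0 : A p ≢ 0ℤ
      A-p≢0 z = B≢0 (cong (λ z → + ∣ z ∣) z)

      not-strict : pairing t⁺ * pairing t⁺ ℤ.≤ B * B → ⊥
      not-strict h = ℤₚ.<⇒≱ P₀>0 (ℤₚ.i≤j⇒i-j≤0 h)

      masked-zero : ∀ j → ¬ (j ≢ p × A j ≢ 0ℤ) → masked j ≡ 0ℤ
      masked-zero j h with j Finₚ.≟ p
      ... | yes _ = ℤₚ.*-zeroʳ (b j)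
      ... | no j≢p with A j ℤₚ.≟ 0ℤ
      ... | yes z = cong (λ z → + ∣ z ∣ * 1ℤ) z
      ... | no nz = contradiction (j≢p , nz) h

      nonzero? : ∀ j → Dec (j ≢ p × A j ≢ 0ℤ)
      nonzero? j = ¬? (j Finₚ.≟ p) ×-dec ¬? (A j ℤₚ.≟ 0ℤ)

      second : ∃ λ j → j ≢ p × A j ≢ 0ℤ
      second = decide (Finₚ.any? nonzero?)
        where
        decide : Dec (∃ λ j → j ≢ p × A j ≢ 0ℤ) → ∃ λ j → j ≢ p × A j ≢ 0ℤ
        decide (yes h)   = h
        decide (no none) = ⊥-elim (not-strict (subst (λ z → z * z ℤ.≤ B * B) (sym (∑-zero (allFin (suc n)) λ j _ → masked-zero j λ h → none (j , h))) (i*i≥0 B)))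

      -- With at most one nonzero coefficient besides A p, `pairing t⁺` would be a single |A j| ≤ |A
      -- p|, against P₀ > 0.
      third : ∀ j₁ → ∃ λ j → j ≢ j₁ × j ≢ p × A j ≢ 0ℤ
      third j₁ = decide (Finₚ.any? third?)
        where
        third? : ∀ j → Dec (j ≢ j₁ × j ≢ p × A j ≢ 0ℤ)
        third? j = ¬? (j Finₚ.≟ j₁) ×-dec nonzero? j
        decide : Dec (∃ λ j → j ≢ j₁ × j ≢ p × A j ≢ 0ℤ) → ∃ λ j → j ≢ j₁ × j ≢ p × A j ≢ 0ℤ
        decide (yes h)   = h
        decide (no none) = ⊥-elim (not-strict (subst (λ z → z * z ℤ.≤ B * B) (sym single) (square-≤ (masked j₁) ∣ A p ∣ (masked-bound j₁))))
          where
          single : pairing t⁺ ≡ masked j₁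
          single = ∑-single (Uniqueₚ.allFin⁺ (suc n)) (∈-allFin j₁) λ j _ j≢ → masked-zero j λ h → none (j , j≢ , h)

      module Moves (j₁ j₂ : Fin (suc n)) (j₁≢p : j₁ ≢ p) (A-j₁≢0 : A j₁ ≢ 0ℤ) (j₂≢j₁ : j₂ ≢ j₁) (j₂≢p : j₂ ≢ p) (A-j₂≢0 : A j₂ ≢ 0ℤ)
        (M : ℕ) {{_ : NonZero M}} (cofactor : ∀ j → A j ≢ 0ℤ → ∃ λ c → A j * c ≡ + M) where

        -- Two moves at i with different partners j and k have supports {i, j} and {i, k} that meet
        -- only in i, which is the property `kill`. Among the three nonzero coefficients at p, j₁,
        -- j₂ two partners are left for any i.
        two-others : ∀ i → ∃ λ j → ∃ λ k → j ≢ i × k ≢ i × j ≢ k × A j ≢ 0ℤ × A k ≢ 0ℤ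
        two-others i = decide (i Finₚ.≟ p) (i Finₚ.≟ j₁)
          where
          decide : Dec (i ≡ p) → Dec (i ≡ j₁) → ∃ λ j → ∃ λ k → j ≢ i × k ≢ i × j ≢ k × A j ≢ 0ℤ × A k ≢ 0ℤ
          decide (yes refl) _          = j₁ , j₂ , j₁≢p , j₂≢p , j₂≢j₁ ∘ sym , A-j₁≢0 , A-j₂≢0
          decide (no _)     (yes refl) = p , j₂ , j₁≢p ∘ sym , j₂≢j₁ , j₂≢p ∘ sym , A-p≢0 , A-j₂≢0
          decide (no i≢p)   (no i≢j₁)  = p , j₁ , i≢p ∘ sym , i≢j₁ ∘ sym , j₁≢p ∘ sym , A-p≢0 , A-j₁≢0

        move : Fin (suc n) → ∀ j → A j ≢ 0ℤ → Fin (suc n) → ℤ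
        move i j nz t = δ t i * + M - δ t j * (A i * proj₁ (cofactor j nz))

        move-kernel : ∀ i j nz → InKernel (move i j nz)
        move-kernel i j nz = trans (∑-cong′ (allFin (suc n)) λ t → lemma (A t) (δ t i) (+ M) (δ t j) (A i * proj₁ (cofactor j nz)))
          (trans (∑-- (λ t → δ t i * (A t * + M)) (λ t → δ t j * (A t * (A i * proj₁ (cofactor j nz)))) (allFin (suc n)))
            (trans (cong₂ _-_ (∑-δ i (λ t → A t * + M)) (∑-δ j (λ t → A t * (A i * proj₁ (cofactor j nz)))))
              (trans (lemma₂ (A i) (+ M) (A j) (proj₁ (cofactor j nz))) (trans (cong (λ z → A i * (+ M - z)) (proj₂ (cofactor j nz))) (trans (cong (A i *_) (ℤₚ.+-inverseʳ (+ M))) (ℤₚ.*-zeroʳ (A i)))))))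
          where
          lemma : ∀ a d M d′ c → a * (d * M - d′ * c) ≡ d * (a * M) - d′ * (a * c)
          lemma = solve-∀
          lemma₂ : ∀ a M b c → a * M - b * (a * c) ≡ a * (M - b * c)
          lemma₂ = solve-∀

        move-self : ∀ i j nz → j ≢ i → move i j nz i ≡ + M
        move-self i j nz j≢i = trans (cong₂ (λ d d′ → d * + M - d′ * (A i * proj₁ (cofactor j nz))) (δ-same i) (δ-diff (j≢i ∘ sym)))
          (lemma (+ M) (A i * proj₁ (cofactor j nz)))
          where
          lemma : ∀ M c → 1ℤ * M - 0ℤ * c ≡ M
          lemma = solve-∀

        move-other : ∀ i j nz t → t ≢ i → t ≢ j → move i j nz t ≡ 0ℤ
        move-other i j nz t t≢i t≢j = cong₂ (λ d d′ → d * + M - d′ * (A i * proj₁ (cofactor j nz))) (δ-diff t≢i) (δ-diff t≢j)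

        move₁ move₂ : Fin (suc n) → Fin (suc n) → ℤ
        move₁ i = let j , _ , _ , _ , _ , nz , _ = two-others i in move i j nz
        move₂ i = let _ , k , _ , _ , _ , _ , nz = two-others i in move i k nz

        givens : Fin (suc n) → List (Fin (suc n) → ℤ)
        givens i = proj₁ (units i) ∷ move₁ i ∷ move₂ i ∷ []

        given-vectors : List (Fin (suc n) → ℤ)
        given-vectors = concatMap givens (allFin (suc n))

        given-kernel : ∀ h → h ∈ given-vectors → InKernel h
        given-kernel h h∈ with ∈-concatMap⁻ givens (allFin (suc n)) h∈
        ... | i , _ , here refl                 = proj₁ (proj₂ (units i))
        ... | i , _ , there (here refl)         = let j , _ , _ , _ , _ , nz , _ = two-others i in move-kernel i j nz
        ... | i , _ , there (there (here refl)) = let _ , k , _ , _ , _ , _ , nz = two-others i in move-kernel i k nz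

        open Balance τ τ-p τ² given-vectors P₀>0 Q₀>0

        present : ∀ i {h} → h ∈ givens i → h ∈ vectors
        present i h∈ = given∈ B≢0 (∈-concatMap⁺ givens (∈-allFin i) h∈)

        σ : ℕ
        σ = pos (B * B * Λ)

        1≤BBΛ : 1ℤ ℤ.≤ B * B * Λ
        1≤BBΛ = subst₂ ℤ._≤_ (cong₂ _*_ (proj₂ (proj₂ (units zero))) (proj₂ (proj₂ (units zero)))) (balanced zero)
          (∑-member-≤ {f = λ h → h zero * h zero} vectors (λ h _ → i*i≥0 (h zero)) (present zero (here refl)))

        σ≡ : + σ ≡ B * B * Λ
        σ≡ = pos-nonNeg (ℤₚ.≤-trans (+≤+ z≤n) 1≤BBΛ)

        instance
          σ≢0 : NonZero σ
          σ≢0 = ℕ.>-nonZero (ℤₚ.drop‿+≤+ (subst (1ℤ ℤ.≤_) (sym σ≡) 1≤BBΛ))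

        moves-solution : Solution A
        moves-solution = columns-solution A vectors σ M (vectors-kernel given-kernel) (λ i → trans (balanced i) (sym σ≡))
          (λ i → proj₁ (units i) , present i (here refl) , proj₂ (proj₂ (units i)))
          (λ i → let j , k , j≢i , k≢i , j≢k , nzj , nzk = two-others i in
            move₁ i , move₂ i , present i (there (here refl)) , present i (there (there (here refl))) , move-self i j nzj j≢i , move-self i k nzk k≢i ,
            λ t t≢i → kill i j k nzj nzk j≢k t t≢i)
          where
          kill : ∀ i j k nzj nzk → j ≢ k → ∀ t → t ≢ i → move i j nzj t ≡ 0ℤ ⊎ move i k nzk t ≡ 0ℤ
          kill i j k nzj nzk j≢k t t≢i = split (t Finₚ.≟ j)
            where
            split : Dec (t ≡ j) → move i j nzj t ≡ 0ℤ ⊎ move i k nzk t ≡ 0ℤ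
            split (no t≢j)  = inj₁ (move-other i j nzj t t≢i t≢j)
            split (yes t≡j) = inj₂ (move-other i k nzk t t≢i (j≢k ∘ trans (sym t≡j)))

      strict-case : Solution A
      strict-case =
        let j₁ , j₁≢p , A-j₁≢0           = second
            j₂ , j₂≢j₁ , j₂≢p , A-j₂≢0   = third j₁
            M , M≢0 , cofactor           = common-multiple A
        in Moves.moves-solution j₁ j₂ j₁≢p A-j₁≢0 j₂≢j₁ j₂≢p A-j₂≢0 M {{ℕ.≢-nonZero M≢0}} cofactor

    signed-solution : Solution A
    signed-solution = split₁ (B ℤₚ.≟ 0ℤ)
      where
      split₃ : B ≢ 0ℤ → 0ℤ ℤ.< pairing t⁺ * pairing t⁺ - B * B → Dec (0ℤ ℤ.< B * B - pairing τ * pairing τ) → Solution A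
      split₃ B≢0 P₀>0 (yes Q₀>0) = Strict.strict-case B≢0 P₀>0 Q₀>0
      split₃ B≢0 P₀>0 (no ¬Q) = pivot-case τ τ-p τ² (sym (ℤₚ.i-j≡0⇒i≡j (B * B) (pairing τ * pairing τ) (ℤₚ.≤-antisym (ℤₚ.≮⇒≥ ¬Q) Q₀≥0))) B≢0
      split₂ : B ≢ 0ℤ → Dec (0ℤ ℤ.< pairing t⁺ * pairing t⁺ - B * B) → Solution A
      split₂ B≢0 (yes P₀>0) = split₃ B≢0 P₀>0 (0ℤ ℤₚ.<? B * B - pairing τ * pairing τ)
      split₂ B≢0 (no ¬P) = pivot-case t⁺ t⁺-p (λ j≢p → cong (λ z → z * z) (t⁺-other j≢p))
        (ℤₚ.i-j≡0⇒i≡j (pairing t⁺ * pairing t⁺) (B * B) (ℤₚ.≤-antisym (ℤₚ.≮⇒≥ ¬P) P₀≥0)) B≢0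
      split₁ : Dec (B ≡ 0ℤ) → Solution A
      split₁ (yes B≡0) = zero-case B≡0
      split₁ (no B≢0)  = split₂ B≢0 (0ℤ ℤₚ.<? pairing t⁺ * pairing t⁺ - B * B)

  solution : Solution A
  solution = let signs , signs² , small = greedy-signs masked ∣ A p ∣ masked-bound in Signed.signed-solution signs signs² small

local-conditions⇒solution : ∀ {n} (A : Fin (suc n) → ℤ) → (∀ i → ∃ λ (h : Fin (suc n) → ℤ) → ∑ (λ j → A j * h j) (allFin (suc n)) ≡ 0ℤ × h i ≡ 1ℤ) →
  (∀ i → + ∣ A i ∣ ℤ.≤ ∑ (λ j → + ∣ A j ∣ * (1ℤ - δ j i)) (allFin (suc n))) → Solution A
local-conditions⇒solution A units archimedean = let p , b≤B = argmax (λ j → ∣ A j ∣) in Construction.solution A units p b≤B (archimedean p)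

-- The p-adic absolute value

ι : ℤ → ℚ
ι z = z ℚ./ 1

toℚᵘ-ι : ∀ z → ℚ.toℚᵘ (ι z) ℚᵘ.≃ mkℚᵘ z 0
toℚᵘ-ι z = ℚₚ.toℚᵘ-fromℚᵘ (mkℚᵘ z 0)

ι-+ : ∀ a b → ι (a + b) ≡ ι a ℚ.+ ι b
ι-+ a b = ℚₚ.toℚᵘ-injective (ℚᵘₚ.≃-trans (toℚᵘ-ι (a + b)) (ℚᵘₚ.≃-sym (ℚᵘₚ.≃-trans (ℚₚ.toℚᵘ-homo-+ (ι a) (ι b))
  (ℚᵘₚ.≃-trans (ℚᵘₚ.+-cong (toℚᵘ-ι a) (toℚᵘ-ι b)) (*≡* (lemma a b))))))
  where
  lemma : ∀ a b → (a * 1ℤ + b * 1ℤ) * 1ℤ ≡ (a + b) * 1ℤ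
  lemma = solve-∀

ι-* : ∀ a b → ι (a * b) ≡ ι a ℚ.* ι b
ι-* a b = ℚₚ.toℚᵘ-injective (ℚᵘₚ.≃-trans (toℚᵘ-ι (a * b)) (ℚᵘₚ.≃-sym (ℚᵘₚ.≃-trans (ℚₚ.toℚᵘ-homo-* (ι a) (ι b))
  (ℚᵘₚ.≃-trans (ℚᵘₚ.*-cong (toℚᵘ-ι a) (toℚᵘ-ι b)) (*≡* refl)))))

ι-neg : ∀ a → ι (- a) ≡ ℚ.- ι a
ι-neg (+ zero)  = refl
ι-neg (+ suc n) = refl
ι-neg -[1+ n ]  = sym (ℚ-group.⁻¹-involutive (ι (+ suc n)))

ι-injective : ∀ {a b} → ι a ≡ ι b → a ≡ b
ι-injective {a} {b} eq with ℚᵘₚ.≃-trans (ℚᵘₚ.≃-sym (toℚᵘ-ι a)) (ℚᵘₚ.≃-trans (ℚᵘₚ.≃-reflexive (cong ℚ.toℚᵘ eq)) (toℚᵘ-ι b))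
... | *≡* h = trans (sym (ℤₚ.*-identityʳ a)) (trans h (ℤₚ.*-identityʳ b))

ι-mono-≤ : ∀ {a b} → a ℤ.≤ b → ι a ℚ.≤ ι b
ι-mono-≤ {a} {b} h = ℚₚ.toℚᵘ-cancel-≤ (ℚᵘₚ.≤-trans (ℚᵘₚ.≤-reflexive (toℚᵘ-ι a)) (ℚᵘₚ.≤-trans (*≤* (ℤₚ.*-monoʳ-≤-nonNeg 1ℤ h)) (ℚᵘₚ.≤-reflexive (ℚᵘₚ.≃-sym (toℚᵘ-ι b)))))

ι-cancel-≤ : ∀ {a b} → ι a ℚ.≤ ι b → a ℤ.≤ b
ι-cancel-≤ {a} {b} h with ℤₚ.≤-total a b
... | inj₁ a≤b = a≤b
... | inj₂ b≤a = ℤₚ.≤-reflexive (ι-injective (ℚₚ.≤-antisym h (ι-mono-≤ b≤a)))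

ι-mono-< : ∀ {a b} → a ℤ.< b → ι a ℚ.< ι b
ι-mono-< {a} {b} h = ℚₚ.≰⇒> λ b≤a → ℤₚ.<⇒≱ h (ι-cancel-≤ b≤a)

/-ι : ∀ z d .{{_ : NonZero d}} → (z ℚ./ d) ℚ.* ι (+ d) ≡ ι z
/-ι z (suc d) = ℚₚ.toℚᵘ-injective (ℚᵘₚ.≃-trans (ℚₚ.toℚᵘ-homo-* (z ℚ./ suc d) (ι (+ suc d)))
  (ℚᵘₚ.≃-trans (ℚᵘₚ.*-cong (ℚₚ.toℚᵘ-fromℚᵘ (mkℚᵘ z d)) (toℚᵘ-ι (+ suc d))) (ℚᵘₚ.≃-trans (*≡* (lemma z (+ suc d))) (ℚᵘₚ.≃-sym (toℚᵘ-ι z)))))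
  where
  lemma : ∀ z d → z * d * 1ℤ ≡ z * (d * 1ℤ)
  lemma = solve-∀

lowest-terms : ∀ x → x ℚ.* ι (ℚ.↧ x) ≡ ι (ℚ.↥ x)
lowest-terms x@record{} = trans (cong (ℚ._* ι (ℚ.↧ x)) (sym (ℚₚ.↥p/↧p≡p x))) (/-ι (ℚ.↥ x) (ℚ.↧ₙ x))

ι-positive : ∀ {n} → 1 ℕ.≤ n → ℚ.Positive (ι (+ n))
ι-positive h = ℚ.positive (ι-mono-< {0ℤ} (+<+ h))

*-cancelʳ-≡ : ∀ {x y} n → 1 ℕ.≤ n → x ℚ.* ι (+ n) ≡ y ℚ.* ι (+ n) → x ≡ y
*-cancelʳ-≡ n h eq = ℚₚ.≤-antisym (ℚₚ.*-cancelʳ-≤-pos (ι (+ n)) {{ι-positive h}} (ℚₚ.≤-reflexive eq))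
  (ℚₚ.*-cancelʳ-≤-pos (ι (+ n)) {{ι-positive h}} (ℚₚ.≤-reflexive (sym eq)))

module Valuation (p : ℕ) (pp : Prime p) where

  instance
    p≢0 : NonZero p
    p≢0 = prime⇒nonZero pp

  p>1 : 1 ℕ.< p
  p>1 = ℕ.nonTrivial⇒n>1 p {{prime⇒nonTrivial pp}}

  v : ℕ → ℕ
  v = vp p

  pow>0 : ∀ k → 1 ℕ.≤ p ℕ.^ k
  pow>0 k = ℕₚ.m^n>0 p k

  multAux-spec : ∀ f n → 1 ℕ.≤ n → n ℕ.≤ f → p ℕ.^ multAux p f n ∣ℕ n × ¬ p ℕ.^ suc (multAux p f n) ∣ℕ n
  multAux-spec (suc f) (suc n) _ (s≤s n≤f) with suc n % p ℕₚ.≟ 0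
  ... | no ¬0 = divides (suc n) (sym (ℕₚ.*-identityʳ (suc n))) , λ d → ¬0 (n∣m⇒m%n≡0 (suc n) p (subst (_∣ℕ suc n) (ℕₚ.*-identityʳ p) d))
  ... | yes z = subst (p ℕ.* p ℕ.^ multAux p f q ∣ℕ_) back (*-monoʳ-∣ p (proj₁ IH)) ,
        λ d → proj₂ IH (*-cancelˡ-∣ p (subst (p ℕ.* (p ℕ.* p ℕ.^ multAux p f q) ∣ℕ_) (sym back) d))
    where
    q : ℕ
    q = suc n / p
    back : p ℕ.* q ≡ suc n
    back = m*[n/m]≡n (m%n≡0⇒n∣m (suc n) p z)
    IH : p ℕ.^ multAux p f q ∣ℕ q × ¬ p ℕ.^ suc (multAux p f q) ∣ℕ q
    IH = multAux-spec f q (ℕₚ.n≢0⇒n>0 λ q≡0 → contradiction (trans (sym back) (trans (cong (p ℕ.*_) q≡0) (ℕₚ.*-zeroʳ p))) λ ())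
      (ℕₚ.≤-trans (ℕ.s≤s⁻¹ (m/n<m (suc n) p p>1)) n≤f)

  v-divides : ∀ n → 1 ℕ.≤ n → p ℕ.^ v n ∣ℕ n
  v-divides n h = proj₁ (multAux-spec n n h ℕₚ.≤-refl)

  v-maximal : ∀ n → 1 ℕ.≤ n → ¬ p ℕ.^ suc (v n) ∣ℕ n
  v-maximal n h = proj₂ (multAux-spec n n h ℕₚ.≤-refl)

  pow-∣ : ∀ {j k} → j ℕ.≤ k → p ℕ.^ j ∣ℕ p ℕ.^ k
  pow-∣ {j} {k} h = subst (λ e → p ℕ.^ j ∣ℕ p ℕ.^ e) (ℕₚ.m+[n∸m]≡n h) (divides (p ℕ.^ (k ℕ.∸ j)) (trans (ℕₚ.^-distribˡ-+-* p j (k ℕ.∸ j)) (ℕₚ.*-comm (p ℕ.^ j) _)))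

  ≤v : ∀ k n → 1 ℕ.≤ n → p ℕ.^ k ∣ℕ n → k ℕ.≤ v n
  ≤v k n h d = ℕₚ.≮⇒≥ λ v<k → v-maximal n h (∣-trans (pow-∣ v<k) d)

  v-unique : ∀ k n → 1 ℕ.≤ n → p ℕ.^ k ∣ℕ n → ¬ p ℕ.^ suc k ∣ℕ n → v n ≡ k
  v-unique k n h d ¬d = ℕₚ.≤-antisym (ℕₚ.≮⇒≥ λ k<v → ¬d (∣-trans (pow-∣ k<v) (v-divides n h))) (≤v k n h d)

  -- The cofactors of the exact powers of p are prime to p, and by Euclid's lemma so is their
  -- product.
  v-* : ∀ m n → 1 ℕ.≤ m → 1 ℕ.≤ n → v (m ℕ.* n) ≡ v m ℕ.+ v n
  v-* m n hm hn with v-divides m hm | v-divides n hn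
  ... | divides m′ em | divides n′ en = v-unique (v m ℕ.+ v n) (m ℕ.* n) (ℕₚ.*-mono-≤ hm hn)
        (divides (m′ ℕ.* n′) eq) λ { (divides c ec) → [ bad m hm em , bad n hn en ]′ (euclidsLemma m′ n′ pp (divides c (cancel c ec))) }
    where
    eq : m ℕ.* n ≡ m′ ℕ.* n′ ℕ.* p ℕ.^ (v m ℕ.+ v n)
    eq = trans (cong₂ ℕ._*_ em en) (trans (lemma m′ (p ℕ.^ v m) n′ (p ℕ.^ v n)) (cong (m′ ℕ.* n′ ℕ.*_) (sym (ℕₚ.^-distribˡ-+-* p (v m) (v n)))))
      where
      lemma : ∀ a b c d → a ℕ.* b ℕ.* (c ℕ.* d) ≡ a ℕ.* c ℕ.* (b ℕ.* d)
      lemma = ℕ-Solver.solve-∀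
    cancel : ∀ c → m ℕ.* n ≡ c ℕ.* p ℕ.^ suc (v m ℕ.+ v n) → m′ ℕ.* n′ ≡ c ℕ.* p
    cancel c ec = ℕₚ.*-cancelʳ-≡ (m′ ℕ.* n′) (c ℕ.* p) (p ℕ.^ (v m ℕ.+ v n)) {{ℕ.>-nonZero (pow>0 (v m ℕ.+ v n))}}
      (trans (sym eq) (trans ec (sym (ℕₚ.*-assoc c p (p ℕ.^ (v m ℕ.+ v n))))))
    bad : ∀ x → (h : 1 ℕ.≤ x) → ∀ {x′} → x ≡ x′ ℕ.* p ℕ.^ v x → p ∣ℕ x′ → ⊥
    bad x h {x′} ex (divides c ec) = v-maximal x h (divides c (trans ex (trans (cong (ℕ._* p ℕ.^ v x) ec) (ℕₚ.*-assoc c p (p ℕ.^ v x)))))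

  π : ℕ → ℚ
  π k = ι (+ (p ℕ.^ k))

  π-+ : ∀ j k → π (j ℕ.+ k) ≡ π j ℚ.* π k
  π-+ j k = trans (cong (ι ∘ +_) (ℕₚ.^-distribˡ-+-* p j k)) (trans (cong ι (ℤₚ.pos-* (p ℕ.^ j) (p ℕ.^ k))) (ι-* (+ (p ℕ.^ j)) (+ (p ℕ.^ k))))

  π-mono : ∀ {j k} → j ℕ.≤ k → π j ℚ.≤ π k
  π-mono h = ι-mono-≤ (+≤+ (ℕₚ.^-monoʳ-≤ p h))

  π-cancel : ∀ {j k} → π j ℚ.≤ π k → j ℕ.≤ k
  π-cancel {j} {k} h = ℕₚ.≮⇒≥ λ k<j → ℕₚ.<⇒≱ (ℕₚ.^-monoʳ-< p p>1 k<j) (ℤₚ.drop‿+≤+ (ι-cancel-≤ h))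

  N : ℚ → ℚ
  N = padicAbs p pp

  N-0 : N 0ℚ ≡ 0ℚ
  N-0 = refl

  ∣∣≥1 : ∀ {z} → z ≢ 0ℤ → 1 ℕ.≤ ∣ z ∣
  ∣∣≥1 nz = ℕₚ.n≢0⇒n>0 (nz ∘ ℤₚ.∣i∣≡0⇒i≡0)

  ↥≢0 : ∀ {x} → x ≢ 0ℚ → ℚ.↥ x ≢ 0ℤ
  ↥≢0 {x} x≢0 z = x≢0 (ℚₚ.↥p≡0⇒p≡0 x z)

  N-lowest : ∀ x → x ≢ 0ℚ → N x ℚ.* π (v ∣ ℚ.↥ x ∣) ≡ π (v ∣ ℚ.↧ x ∣)
  N-lowest x x≢0 with x ℚₚ.≟ 0ℚ
  ... | yes z = contradiction z x≢0
  ... | no _  = /-ι (+ (p ℕ.^ v ∣ ℚ.↧ x ∣)) (p ℕ.^ v ∣ ℚ.↥ x ∣) {{ℕₚ.m^n≢0 p (v ∣ ℚ.↥ x ∣)}}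

  -- `padicAbs` is defined through lowest terms; cross-multiplication and additivity of the
  -- valuation extend the formula to an arbitrary fraction n/d, which products, sums and common
  -- denominators produce.
  N-fraction : ∀ x n d → n ≢ 0ℤ → d ≢ 0ℤ → x ℚ.* ι d ≡ ι n → N x ℚ.* π (v ∣ n ∣) ≡ π (v ∣ d ∣)
  N-fraction x n d n≢0 d≢0 rep = *-cancelʳ-≡ (p ℕ.^ v ∣ ℚ.↧ x ∣) (pow>0 (v ∣ ℚ.↧ x ∣)) (begin
    N x ℚ.* π (v ∣ n ∣) ℚ.* π (v ∣ ℚ.↧ x ∣)      ≡⟨ ℚₚ.*-assoc (N x) (π (v ∣ n ∣)) (π (v ∣ ℚ.↧ x ∣)) ⟩
    N x ℚ.* (π (v ∣ n ∣) ℚ.* π (v ∣ ℚ.↧ x ∣))    ≡⟨ cong (N x ℚ.*_) (π-+ (v ∣ n ∣) (v ∣ ℚ.↧ x ∣)) ⟨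
    N x ℚ.* π (v ∣ n ∣ ℕ.+ v ∣ ℚ.↧ x ∣)          ≡⟨ cong (λ e → N x ℚ.* π e) same ⟨
    N x ℚ.* π (v ∣ ℚ.↥ x ∣ ℕ.+ v ∣ d ∣)          ≡⟨ cong (N x ℚ.*_) (π-+ (v ∣ ℚ.↥ x ∣) (v ∣ d ∣)) ⟩
    N x ℚ.* (π (v ∣ ℚ.↥ x ∣) ℚ.* π (v ∣ d ∣))    ≡⟨ ℚₚ.*-assoc (N x) (π (v ∣ ℚ.↥ x ∣)) (π (v ∣ d ∣)) ⟨
    N x ℚ.* π (v ∣ ℚ.↥ x ∣) ℚ.* π (v ∣ d ∣)      ≡⟨ cong (ℚ._* π (v ∣ d ∣)) (N-lowest x x≢0) ⟩
    π (v ∣ ℚ.↧ x ∣) ℚ.* π (v ∣ d ∣)              ≡⟨ ℚₚ.*-comm (π (v ∣ ℚ.↧ x ∣)) (π (v ∣ d ∣)) ⟩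
    π (v ∣ d ∣) ℚ.* π (v ∣ ℚ.↧ x ∣)              ∎)
    where
    open ≡-Reasoning
    x≢0 : x ≢ 0ℚ
    x≢0 z = n≢0 (ι-injective {n} {0ℤ} (trans (sym rep) (trans (cong (ℚ._* ι d) z) (ℚₚ.*-zeroˡ (ι d)))))
    cross : ℚ.↥ x * d ≡ n * ℚ.↧ x
    cross = ι-injective (trans (ι-* (ℚ.↥ x) d) (trans (cong (ℚ._* ι d) (sym (lowest-terms x))) (trans (rearrange x (ι (ℚ.↧ x)) (ι d))
      (trans (cong (ℚ._* ι (ℚ.↧ x)) rep) (sym (ι-* n (ℚ.↧ x)))))))
      where
      rearrange : ∀ a b c → a ℚ.* b ℚ.* c ≡ a ℚ.* c ℚ.* b
      rearrange a b c = trans (ℚₚ.*-assoc a b c) (trans (cong (a ℚ.*_) (ℚₚ.*-comm b c)) (sym (ℚₚ.*-assoc a c b)))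
    same : v ∣ ℚ.↥ x ∣ ℕ.+ v ∣ d ∣ ≡ v ∣ n ∣ ℕ.+ v ∣ ℚ.↧ x ∣
    same = trans (sym (v-* ∣ ℚ.↥ x ∣ ∣ d ∣ (∣∣≥1 (↥≢0 x≢0)) (∣∣≥1 d≢0))) (trans (cong v (trans (sym (ℤₚ.abs-* (ℚ.↥ x) d)) (trans (cong ∣_∣ cross) (ℤₚ.abs-* n (ℚ.↧ x)))))
      (v-* ∣ n ∣ ∣ ℚ.↧ x ∣ (∣∣≥1 n≢0) (s≤s z≤n)))

  N-positive : ∀ x → x ≢ 0ℚ → 0ℚ ℚ.< N x
  N-positive x x≢0 = ℚₚ.*-cancelʳ-<-nonNeg (π (v ∣ ℚ.↥ x ∣)) {{ℚₚ.pos⇒nonNeg (π (v ∣ ℚ.↥ x ∣)) {{ι-positive (pow>0 (v ∣ ℚ.↥ x ∣))}}}}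
    (subst₂ ℚ._<_ (sym (ℚₚ.*-zeroˡ (π (v ∣ ℚ.↥ x ∣)))) (sym (N-lowest x x≢0)) (ι-mono-< {0ℤ} (+<+ (pow>0 (v ∣ ℚ.↧ x ∣)))))

  N-neg : ∀ x → N (ℚ.- x) ≡ N x
  N-neg x = split (x ℚₚ.≟ 0ℚ)
    where
    split : Dec (x ≡ 0ℚ) → N (ℚ.- x) ≡ N x
    split (yes refl) = refl
    split (no x≢0)   = *-cancelʳ-≡ (p ℕ.^ v ∣ ℚ.↥ x ∣) (pow>0 (v ∣ ℚ.↥ x ∣)) (trans (subst (λ k → N (ℚ.- x) ℚ.* π (v k) ≡ π (v ∣ ℚ.↧ x ∣)) (ℤₚ.∣-i∣≡∣i∣ (ℚ.↥ x))
      (N-fraction (ℚ.- x) (- ℚ.↥ x) (ℚ.↧ x) (λ z → ↥≢0 x≢0 (trans (sym (ℤₚ.neg-involutive (ℚ.↥ x))) (cong (-_) z))) (λ ()) opposite)) (sym (N-lowest x x≢0)))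
      where
      opposite : ℚ.- x ℚ.* ι (ℚ.↧ x) ≡ ι (- ℚ.↥ x)
      opposite = trans (sym (ℚₚ.neg-distribˡ-* x (ι (ℚ.↧ x)))) (trans (cong (ℚ.-_) (lowest-terms x)) (sym (ι-neg (ℚ.↥ x))))

  N-≰0 : ∀ x → x ≢ 0ℚ → ¬ N x ℚ.≤ 0ℚ
  N-≰0 x x≢0 h = ℚₚ.<-irrefl refl (ℚₚ.<-≤-trans (N-positive x x≢0) h)

  N-nonNeg : ∀ x → 0ℚ ℚ.≤ N x
  N-nonNeg x = split (x ℚₚ.≟ 0ℚ)
    where
    split : Dec (x ≡ 0ℚ) → 0ℚ ℚ.≤ N x
    split (yes refl) = ℚₚ.≤-refl
    split (no x≢0)   = ℚₚ.<⇒≤ (N-positive x x≢0)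

  ↧≢0 : ∀ x → ℚ.↧ x ≢ 0ℤ
  ↧≢0 x ()

  *-≢0 : ∀ {a b} → a ≢ 0ℤ → b ≢ 0ℤ → a * b ≢ 0ℤ
  *-≢0 {a} ha hb z = [ ha , hb ]′ (ℤₚ.i*j≡0⇒i≡0∨j≡0 a z)

  rearrange₄ : ∀ a b c d → a ℚ.* b ℚ.* (c ℚ.* d) ≡ a ℚ.* c ℚ.* (b ℚ.* d)
  rearrange₄ a b c d = trans (ℚₚ.*-assoc a b (c ℚ.* d)) (trans (cong (a ℚ.*_) (trans (sym (ℚₚ.*-assoc b c d)) (trans (cong (ℚ._* d) (ℚₚ.*-comm b c)) (ℚₚ.*-assoc c b d))))
    (sym (ℚₚ.*-assoc a c (b ℚ.* d))))

  N-* : ∀ x y → N (x ℚ.* y) ≡ N x ℚ.* N y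
  N-* x y = split (x ℚₚ.≟ 0ℚ) (y ℚₚ.≟ 0ℚ)
    where
    split : Dec (x ≡ 0ℚ) → Dec (y ≡ 0ℚ) → N (x ℚ.* y) ≡ N x ℚ.* N y
    split (yes refl) _ = trans (cong N (ℚₚ.*-zeroˡ y)) (sym (ℚₚ.*-zeroˡ (N y)))
    split _ (yes refl) = trans (cong N (ℚₚ.*-zeroʳ x)) (sym (ℚₚ.*-zeroʳ (N x)))
    split (no x≢0) (no y≢0) = *-cancelʳ-≡ (p ℕ.^ v ∣ n ∣) (pow>0 (v ∣ n ∣)) (trans product (sym (begin
        N x ℚ.* N y ℚ.* π (v ∣ n ∣)                                  ≡⟨ cong (λ z → N x ℚ.* N y ℚ.* z) (trans (cong π (v-abs (↥≢0 x≢0) (↥≢0 y≢0))) (π-+ (v ∣ ℚ.↥ x ∣) (v ∣ ℚ.↥ y ∣))) ⟩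
        N x ℚ.* N y ℚ.* (π (v ∣ ℚ.↥ x ∣) ℚ.* π (v ∣ ℚ.↥ y ∣))        ≡⟨ rearrange₄ (N x) (N y) (π (v ∣ ℚ.↥ x ∣)) (π (v ∣ ℚ.↥ y ∣)) ⟩
        N x ℚ.* π (v ∣ ℚ.↥ x ∣) ℚ.* (N y ℚ.* π (v ∣ ℚ.↥ y ∣))        ≡⟨ cong₂ ℚ._*_ (N-lowest x x≢0) (N-lowest y y≢0) ⟩
        π (v ∣ ℚ.↧ x ∣) ℚ.* π (v ∣ ℚ.↧ y ∣)                          ≡⟨ trans (cong π (v-abs (↧≢0 x) (↧≢0 y))) (π-+ (v ∣ ℚ.↧ x ∣) (v ∣ ℚ.↧ y ∣)) ⟨
        π (v ∣ d ∣)                                                  ∎)))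
      where
      open ≡-Reasoning
      n d : ℤ
      n = ℚ.↥ x * ℚ.↥ y
      d = ℚ.↧ x * ℚ.↧ y
      v-abs : ∀ {a b} → a ≢ 0ℤ → b ≢ 0ℤ → v ∣ a * b ∣ ≡ v ∣ a ∣ ℕ.+ v ∣ b ∣
      v-abs {a} {b} ha hb = trans (cong v (ℤₚ.abs-* a b)) (v-* ∣ a ∣ ∣ b ∣ (∣∣≥1 ha) (∣∣≥1 hb))
      product : N (x ℚ.* y) ℚ.* π (v ∣ n ∣) ≡ π (v ∣ d ∣)
      product = N-fraction (x ℚ.* y) n d (*-≢0 (↥≢0 x≢0) (↥≢0 y≢0)) (*-≢0 (↧≢0 x) (↧≢0 y))
        (trans (cong (x ℚ.* y ℚ.*_) (ι-* (ℚ.↧ x) (ℚ.↧ y))) (trans (rearrange₄ x y (ι (ℚ.↧ x)) (ι (ℚ.↧ y)))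
          (trans (cong₂ ℚ._*_ (lowest-terms x) (lowest-terms y)) (sym (ι-* (ℚ.↥ x) (ℚ.↥ y))))))

  N-compare : ∀ x y m n d → m ≢ 0ℤ → n ≢ 0ℤ → d ≢ 0ℤ → x ℚ.* ι d ≡ ι m → y ℚ.* ι d ≡ ι n → v ∣ n ∣ ℕ.≤ v ∣ m ∣ → N x ℚ.≤ N y
  N-compare x y m n d m≢0 n≢0 d≢0 rx ry h = ℚₚ.*-cancelʳ-≤-pos (π (v ∣ m ∣)) {{ι-positive (pow>0 (v ∣ m ∣))}}
    (ℚₚ.≤-trans (ℚₚ.≤-reflexive (trans (N-fraction x m d m≢0 d≢0 rx) (sym (N-fraction y n d n≢0 d≢0 ry))))
      (ℚₚ.*-monoˡ-≤-nonNeg (N y) {{ℚ.nonNegative (N-nonNeg y)}} (π-mono h)))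

  N-compare⁻ : ∀ x y m n d → m ≢ 0ℤ → n ≢ 0ℤ → d ≢ 0ℤ → x ℚ.* ι d ≡ ι m → y ℚ.* ι d ≡ ι n → N x ℚ.≤ N y → v ∣ n ∣ ℕ.≤ v ∣ m ∣
  N-compare⁻ x y m n d m≢0 n≢0 d≢0 rx ry h = π-cancel (ℚₚ.*-cancelˡ-≤-pos (N x) {{ℚ.positive (N-positive x x≢0)}}
    (ℚₚ.≤-trans (ℚₚ.*-monoʳ-≤-nonNeg (π (v ∣ n ∣)) {{ℚₚ.pos⇒nonNeg (π (v ∣ n ∣)) {{ι-positive (pow>0 (v ∣ n ∣))}}}} h)
      (ℚₚ.≤-reflexive (trans (N-fraction y n d n≢0 d≢0 ry) (sym (N-fraction x m d m≢0 d≢0 rx))))))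
    where
    x≢0 : x ≢ 0ℚ
    x≢0 z = m≢0 (ι-injective {m} {0ℤ} (trans (sym rx) (trans (cong (ℚ._* ι d) z) (ℚₚ.*-zeroˡ (ι d)))))

  -- Over the common denominator d, the power of p dividing the numerator with the smaller valuation
  -- divides both numerators and hence their sum.
  ultrametric : ∀ x y → N (x ℚ.+ y) ℚ.≤ N x ℚ.⊔ N y
  ultrametric x y = split (x ℚₚ.≟ 0ℚ) (y ℚₚ.≟ 0ℚ) ((x ℚ.+ y) ℚₚ.≟ 0ℚ)
    where
    d m n : ℤ
    d = ℚ.↧ x * ℚ.↧ y
    m = ℚ.↥ x * ℚ.↧ y
    n = ℚ.↥ y * ℚ.↧ x
    d≢0 : d ≢ 0ℤ
    d≢0 = *-≢0 (↧≢0 x) (↧≢0 y)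
    rx : x ℚ.* ι d ≡ ι m
    rx = trans (cong (x ℚ.*_) (ι-* (ℚ.↧ x) (ℚ.↧ y))) (trans (sym (ℚₚ.*-assoc x (ι (ℚ.↧ x)) (ι (ℚ.↧ y)))) (trans (cong (ℚ._* ι (ℚ.↧ y)) (lowest-terms x)) (sym (ι-* (ℚ.↥ x) (ℚ.↧ y)))))
    ry : y ℚ.* ι d ≡ ι n
    ry = trans (cong (λ z → y ℚ.* ι z) (ℤₚ.*-comm (ℚ.↧ x) (ℚ.↧ y))) (trans (cong (y ℚ.*_) (ι-* (ℚ.↧ y) (ℚ.↧ x)))
      (trans (sym (ℚₚ.*-assoc y (ι (ℚ.↧ y)) (ι (ℚ.↧ x)))) (trans (cong (ℚ._* ι (ℚ.↧ x)) (lowest-terms y)) (sym (ι-* (ℚ.↥ y) (ℚ.↧ x))))))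
    rxy : (x ℚ.+ y) ℚ.* ι d ≡ ι (m + n)
    rxy = trans (ℚₚ.*-distribʳ-+ (ι d) x y) (trans (cong₂ ℚ._+_ rx ry) (sym (ι-+ m n)))
    sum-divisible : ∀ k a b → k ∣ℕ ∣ a ∣ → k ∣ℕ ∣ b ∣ → k ∣ℕ ∣ a + b ∣
    sum-divisible k a b ha hb = ℤ-∣.∣⇒∣ᵤ (ℤ-∣.∣m∣n⇒∣m+n (ℤ-∣.∣ᵤ⇒∣ {+ k} {a} ha) (ℤ-∣.∣ᵤ⇒∣ {+ k} {b} hb))
    split : Dec (x ≡ 0ℚ) → Dec (y ≡ 0ℚ) → Dec (x ℚ.+ y ≡ 0ℚ) → N (x ℚ.+ y) ℚ.≤ N x ℚ.⊔ N y
    split (yes refl) _ _ = subst (ℚ._≤ 0ℚ ℚ.⊔ N y) (cong N (sym (ℚₚ.+-identityˡ y))) (ℚₚ.p≤q⊔p 0ℚ (N y))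
    split _ (yes refl) _ = subst (ℚ._≤ N x ℚ.⊔ 0ℚ) (cong N (sym (ℚₚ.+-identityʳ x))) (ℚₚ.p≤p⊔q (N x) 0ℚ)
    split _ _ (yes z) = subst (ℚ._≤ N x ℚ.⊔ N y) (sym (trans (cong N z) N-0)) (ℚₚ.≤-trans (N-nonNeg x) (ℚₚ.p≤p⊔q (N x) (N y)))
    split (no x≢0) (no y≢0) (no xy≢0) = order (ℕₚ.≤-total (v ∣ m ∣) (v ∣ n ∣))
      where
      m≢0 : m ≢ 0ℤ
      m≢0 = *-≢0 (↥≢0 x≢0) (↧≢0 y)
      n≢0 : n ≢ 0ℤ
      n≢0 = *-≢0 (↥≢0 y≢0) (↧≢0 x)
      mn≢0 : m + n ≢ 0ℤ
      mn≢0 z = xy≢0 (*-cancelʳ-≡ ∣ d ∣ (∣∣≥1 d≢0) (trans rxy (trans (cong ι z) (sym (ℚₚ.*-zeroˡ (ι (+ ∣ d ∣)))))))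
      order : v ∣ m ∣ ℕ.≤ v ∣ n ∣ ⊎ v ∣ n ∣ ℕ.≤ v ∣ m ∣ → N (x ℚ.+ y) ℚ.≤ N x ℚ.⊔ N y
      order (inj₁ h) = ℚₚ.≤-trans (N-compare (x ℚ.+ y) x (m + n) m d mn≢0 m≢0 d≢0 rxy rx
        (≤v (v ∣ m ∣) ∣ m + n ∣ (∣∣≥1 mn≢0) (sum-divisible (p ℕ.^ v ∣ m ∣) m n (v-divides ∣ m ∣ (∣∣≥1 m≢0)) (∣-trans (pow-∣ h) (v-divides ∣ n ∣ (∣∣≥1 n≢0))))))
        (ℚₚ.p≤p⊔q (N x) (N y))
      order (inj₂ h) = ℚₚ.≤-trans (N-compare (x ℚ.+ y) y (m + n) n d mn≢0 n≢0 d≢0 rxy ry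
        (≤v (v ∣ n ∣) ∣ m + n ∣ (∣∣≥1 mn≢0) (sum-divisible (p ℕ.^ v ∣ n ∣) m n (∣-trans (pow-∣ h) (v-divides ∣ m ∣ (∣∣≥1 m≢0))) (v-divides ∣ n ∣ (∣∣≥1 n≢0)))))
        (ℚₚ.p≤q⊔p (N x) (N y))

-- Local conditions on integers

common-denominator : ∀ r (a : Fin r → ℚ) → ∃ λ (Q : ℕ) → 1 ℕ.≤ Q × ∃ λ (A : Fin r → ℤ) → ∀ i → a i ℚ.* ι (+ Q) ≡ ι (A i)
common-denominator zero    a = 1 , s≤s z≤n , (λ ()) , λ ()
common-denominator (suc r) a = extend (common-denominator r (a ∘ suc))
  where
  open ≡-Reasoning
  extend : ∃ (λ (Q : ℕ) → 1 ℕ.≤ Q × ∃ λ (A : Fin r → ℤ) → ∀ i → a (suc i) ℚ.* ι (+ Q) ≡ ι (A i)) →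
    ∃ λ (Q : ℕ) → 1 ℕ.≤ Q × ∃ λ (A : Fin (suc r) → ℤ) → ∀ i → a i ℚ.* ι (+ Q) ≡ ι (A i)
  extend (Q , Q>0 , A , eq) = ℚ.↧ₙ (a zero) ℕ.* Q , ℕₚ.*-mono-≤ {1} {ℚ.↧ₙ (a zero)} (s≤s z≤n) Q>0 , A′ , eq′
    where
    D : ℤ
    D = ℚ.↧ (a zero)
    A′ : Fin (suc r) → ℤ
    A′ zero    = ℚ.↥ (a zero) * + Q
    A′ (suc i) = D * A i
    split : ι (+ (ℚ.↧ₙ (a zero) ℕ.* Q)) ≡ ι D ℚ.* ι (+ Q)
    split = trans (cong ι (ℤₚ.pos-* (ℚ.↧ₙ (a zero)) Q)) (ι-* D (+ Q))
    eq′ : ∀ i → a i ℚ.* ι (+ (ℚ.↧ₙ (a zero) ℕ.* Q)) ≡ ι (A′ i)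
    eq′ zero = begin
      a zero ℚ.* ι (+ (ℚ.↧ₙ (a zero) ℕ.* Q))   ≡⟨ cong (a zero ℚ.*_) split ⟩
      a zero ℚ.* (ι D ℚ.* ι (+ Q))             ≡⟨ ℚₚ.*-assoc (a zero) (ι D) (ι (+ Q)) ⟨
      a zero ℚ.* ι D ℚ.* ι (+ Q)               ≡⟨ cong (ℚ._* ι (+ Q)) (lowest-terms (a zero)) ⟩
      ι (ℚ.↥ (a zero)) ℚ.* ι (+ Q)             ≡⟨ ι-* (ℚ.↥ (a zero)) (+ Q) ⟨
      ι (ℚ.↥ (a zero) * + Q)                   ∎
    eq′ (suc i) = begin
      a (suc i) ℚ.* ι (+ (ℚ.↧ₙ (a zero) ℕ.* Q))   ≡⟨ cong (a (suc i) ℚ.*_) (trans split (ℚₚ.*-comm (ι D) (ι (+ Q)))) ⟩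
      a (suc i) ℚ.* (ι (+ Q) ℚ.* ι D)             ≡⟨ ℚₚ.*-assoc (a (suc i)) (ι (+ Q)) (ι D) ⟨
      a (suc i) ℚ.* ι (+ Q) ℚ.* ι D               ≡⟨ cong (ℚ._* ι D) (eq i) ⟩
      ι (A i) ℚ.* ι D                             ≡⟨ ι-* (A i) D ⟨
      ι (A i * D)                                 ≡⟨ cong ι (ℤₚ.*-comm (A i) D) ⟩
      ι (D * A i)                                 ∎

bezout : ∀ m n → ∃ λ (x : ℤ) → ∃ λ (y : ℤ) → + m * x + + n * y ≡ + gcd m n
bezout m n = from (Bézout.identity (gcd-GCD m n))
  where
  rearranged : ∀ d n y m x → d ℕ.+ y ℕ.* n ≡ x ℕ.* m → + m * + x + + n * - + y ≡ + d
  rearranged d n y m x eq = trans (cong (λ z → z + + n * - + y) (trans (ℤₚ.*-comm (+ m) (+ x)) (trans (sym (ℤₚ.pos-* x m))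
    (trans (cong +_ (sym eq)) (+-congˡ (+ d) (ℤₚ.pos-* y n)))))) (lemma (+ d) (+ y) (+ n))
    where
    lemma : ∀ d y n → d + y * n + n * (- y) ≡ d
    lemma = solve-∀
  from : Bézout.Identity (gcd m n) m n → ∃ λ (x : ℤ) → ∃ λ (y : ℤ) → + m * x + + n * y ≡ + gcd m n
  from (Bézout.+- x y eq) = + x , - + y , rearranged (gcd m n) n y m x eq
  from (Bézout.-+ x y eq) = - + x , + y , trans (ℤₚ.+-comm (+ m * - + x) (+ n * + y)) (rearranged (gcd m n) m x n y eq)

bezout-family : ∀ r (A : Fin r → ℤ) → ∃ λ (g : ℕ) → ∃ λ (c : Fin r → ℤ) →
  ∑ (λ j → A j * c j) (allFin r) ≡ + g × ∀ j → g ∣ℕ ∣ A j ∣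
bezout-family zero    A = 0 , (λ ()) , refl , λ ()
bezout-family (suc r) A = extend (bezout-family r (A ∘ suc))
  where
  a : ℕ
  a = ∣ A zero ∣
  extend : ∃ (λ (g : ℕ) → ∃ λ (c : Fin r → ℤ) → ∑ (λ j → A (suc j) * c j) (allFin r) ≡ + g × ∀ j → g ∣ℕ ∣ A (suc j) ∣) →
    ∃ λ (g : ℕ) → ∃ λ (c : Fin (suc r) → ℤ) → ∑ (λ j → A j * c j) (allFin (suc r)) ≡ + g × ∀ j → g ∣ℕ ∣ A j ∣
  extend (g , c , eq , div) = gcd a g , c′ , eq′ , div′
    where
    x y : ℤ
    x = proj₁ (bezout a g)
    y = proj₁ (proj₂ (bezout a g))
    c′ : Fin (suc r) → ℤ
    c′ zero    = sgn (A zero) * x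
    c′ (suc j) = c j * y
    eq′ : ∑ (λ j → A j * c′ j) (allFin (suc r)) ≡ + gcd a g
    eq′ = trans (∑-allFin-suc (λ j → A j * c′ j)) (trans (cong₂ _+_
      (trans (sym (ℤₚ.*-assoc (A zero) (sgn (A zero)) x)) (cong (_* x) (sgn-* (A zero))))
      (trans (∑-cong′ (allFin r) λ j → sym (ℤₚ.*-assoc (A (suc j)) (c j) y)) (trans (∑-*ʳ y (λ j → A (suc j) * c j) (allFin r)) (cong (_* y) eq))))
      (proj₂ (proj₂ (bezout a g))))
    div′ : ∀ j → gcd a g ∣ℕ ∣ A j ∣
    div′ zero    = gcd[m,n]∣m a g
    div′ (suc j) = ∣-trans (gcd[m,n]∣n a g) (div j)

-- Let d = gcd(g, m) and g = q d. A prime p dividing q would give p^(v(d)+1) | g, hence p^(v(d)+1) |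
-- m, hence p^(v(d)+1) | d, contrary to the maximality of v(d). So q has no prime factor.
∣-local : ∀ g m → 1 ℕ.≤ g → (∀ p → Prime p → ∀ k → p ℕ.^ k ∣ℕ g → p ℕ.^ k ∣ℕ m) → g ∣ℕ m
∣-local g m g>0 h = from (gcd[m,n]∣m g m)
  where
  d : ℕ
  d = gcd g m
  from : d ∣ℕ g → g ∣ℕ m
  from (divides q eq) = split (factorise q {{ℕ.>-nonZero q>0}})
    where
    q>0 : 1 ℕ.≤ q
    q>0 = ℕₚ.n≢0⇒n>0 λ q≡0 → ℕₚ.<⇒≢ g>0 (sym (trans eq (cong (ℕ._* d) q≡0)))
    d>0 : 1 ℕ.≤ d
    d>0 = ℕₚ.n≢0⇒n>0 λ d≡0 → ℕₚ.<⇒≢ g>0 (sym (trans eq (trans (cong (q ℕ.*_) d≡0) (ℕₚ.*-zeroʳ q))))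
    split : PrimeFactorisation q → g ∣ℕ m
    split record { factors = [] ; isFactorisation = q≡1 } =
      subst (_∣ℕ m) (sym (trans eq (trans (cong (ℕ._* d) q≡1) (ℕₚ.*-identityˡ d)))) (gcd[m,n]∣n g m)
    split record { factors = p ∷ ps ; isFactorisation = q≡ ; factorsPrime = pp ∷ _ } =
      contradiction (gcd-greatest p^∣g (h p pp (suc (v d)) p^∣g)) (v-maximal d d>0)
      where
      open Valuation p pp
      p∣ : ∀ {t} → q ≡ p ℕ.* t → p ∣ℕ q
      p∣ {t} e = divides t (trans e (ℕₚ.*-comm p t))
      p^∣g : p ℕ.^ suc (v d) ∣ℕ g
      p^∣g = subst (p ℕ.^ suc (v d) ∣ℕ_) (sym eq) (*-pres-∣ {p} {q} (p∣ q≡) (v-divides d d>0))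

-- The alternative x ≤ 0 comes from the value 0 assigned to an empty maximum; for the p-adic
-- absolute value of a nonzero number it is excluded by positivity.
maxExcept-attained : ∀ {r} (f : Fin r → ℚ) i x → x ℚ.≤ maxExcept f i → x ℚ.≤ 0ℚ ⊎ ∃ λ j → j ≢ i × x ℚ.≤ f j
maxExcept-attained {r} f i x = go (allFin r)
  where
  go : ∀ xs → x ℚ.≤ foldr (λ j s → if does (j Finₚ.≟ i) then s else f j ℚ.⊔ s) 0ℚ xs → x ℚ.≤ 0ℚ ⊎ ∃ λ j → j ≢ i × x ℚ.≤ f j
  go []       h = inj₁ h
  go (j ∷ xs) h with j Finₚ.≟ i
  ... | yes _  = go xs h
  ... | no j≢i = [ (λ e → inj₂ (j , j≢i , subst (x ℚ.≤_) e h)) , (λ e → go xs (subst (x ℚ.≤_) e h)) ]′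
    (ℚₚ.⊔-sel (f j) (foldr (λ j s → if does (j Finₚ.≟ i) then s else f j ℚ.⊔ s) 0ℚ xs))

module Integral {n} (a : Fin (suc n) → ℚ) (Q : ℕ) (Q>0 : 1 ℕ.≤ Q) (A : Fin (suc n) → ℤ) (aQ : ∀ i → a i ℚ.* ι (+ Q) ≡ ι (A i)) where

  a≢0 : ∀ {i} → A i ≢ 0ℤ → a i ≢ 0ℚ
  a≢0 {i} A≢0 a≡0 = A≢0 (ι-injective {A i} {0ℤ} (trans (sym (aQ i)) (trans (cong (ℚ._* ι (+ Q)) a≡0) (ℚₚ.*-zeroˡ (ι (+ Q))))))

  A≢0 : ∀ {i} → a i ≢ 0ℚ → A i ≢ 0ℤ
  A≢0 {i} a≢0 A≡0 = a≢0 (*-cancelʳ-≡ Q Q>0 (trans (aQ i) (trans (cong ι A≡0) (sym (ℚₚ.*-zeroˡ (ι (+ Q)))))))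

  dominated : PAdicCondition a → ∀ p → Prime p → ∀ i → A i ≢ 0ℤ →
    ∃ λ j → j ≢ i × A j ≢ 0ℤ × ∀ k → p ℕ.^ k ∣ℕ ∣ A j ∣ → p ℕ.^ k ∣ℕ ∣ A i ∣
  dominated padic p pp i Ai≢0 = [ (λ h → contradiction h (N-≰0 (a i) (a≢0 Ai≢0))) , found ]′
    (maxExcept-attained (λ j → N (a j)) i (N (a i)) (padic p pp i))
    where
    open Valuation p pp
    found : (∃ λ j → j ≢ i × N (a i) ℚ.≤ N (a j)) → ∃ λ j → j ≢ i × A j ≢ 0ℤ × ∀ k → p ℕ.^ k ∣ℕ ∣ A j ∣ → p ℕ.^ k ∣ℕ ∣ A i ∣
    found (j , j≢i , h) = j , j≢i , Aj≢0 , λ k d → ∣-trans (pow-∣ (ℕₚ.≤-trans (≤v k ∣ A j ∣ (∣∣≥1 Aj≢0) d)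
        (N-compare⁻ (a i) (a j) (A i) (A j) (+ Q) Ai≢0 Aj≢0 (λ z → ℕₚ.<⇒≢ Q>0 (sym (ℤₚ.+-injective z))) (aQ i) (aQ j) h))) (v-divides ∣ A i ∣ (∣∣≥1 Ai≢0))
      where
      Aj≢0 : A j ≢ 0ℤ
      Aj≢0 = A≢0 λ z → N-≰0 (a i) (a≢0 Ai≢0) (subst (N (a i) ℚ.≤_) (cong N z) h)

  units : PAdicCondition a → ∀ i → ∃ λ (h : Fin (suc n) → ℤ) → ∑ (λ j → A j * h j) (allFin (suc n)) ≡ 0ℤ × h i ≡ 1ℤ
  units padic i = from (bezout-family (suc n) λ j → A j * (1ℤ - δ j i))
    where
    from : (∃ λ (g : ℕ) → ∃ λ (c : Fin (suc n) → ℤ) → ∑ (λ j → A j * (1ℤ - δ j i) * c j) (allFin (suc n)) ≡ + g × ∀ j → g ∣ℕ ∣ A j * (1ℤ - δ j i) ∣) →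
      ∃ λ (h : Fin (suc n) → ℤ) → ∑ (λ j → A j * h j) (allFin (suc n)) ≡ 0ℤ × h i ≡ 1ℤ
    from (g , c , eq , div) = solve κ-exists
      where
      g∣ : ∀ {j} → j ≢ i → g ∣ℕ ∣ A j ∣
      g∣ {j} j≢i = subst (λ z → g ∣ℕ ∣ z ∣) (trans (cong (λ d → A j * (1ℤ - d)) (δ-diff j≢i)) (ℤₚ.*-identityʳ (A j))) (div j)
      g∣Ai : Dec (A i ≡ 0ℤ) → g ∣ℕ ∣ A i ∣
      g∣Ai (yes Ai≡0) = subst (λ z → g ∣ℕ ∣ z ∣) (sym Ai≡0) (g ∣0)
      g∣Ai (no Ai≢0)  = ∣-local g ∣ A i ∣ (ℕₚ.n≢0⇒n>0 g≢0) λ p pp k d →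
        let j , j≢i , _ , h = dominated padic p pp i Ai≢0 in h k (∣-trans d (g∣ j≢i))
        where
        g≢0 : g ≢ 0
        -- Were g = 0, all A j with j ≠ i would vanish. Condition (i) at a single prime forbids this
        -- when A i ≠ 0; the prime 2 is an arbitrary choice.
        g≢0 g≡0 = let j , j≢i , Aj≢0 , _ = dominated padic 2 prime[2] i Ai≢0 in
          Aj≢0 (ℤₚ.∣i∣≡0⇒i≡0 (0∣⇒≡0 (subst (_∣ℕ ∣ A j ∣) g≡0 (g∣ j≢i))))
      κ-exists : ∃ λ (κ : ℤ) → A i ≡ κ * + g
      κ-exists = from-divides (ℤ-∣.∣ᵤ⇒∣ {+ g} {A i} (g∣Ai (A i ℤₚ.≟ 0ℤ)))
        where
        from-divides : + g ℤ-∣.∣ A i → ∃ λ (κ : ℤ) → A i ≡ κ * + g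
        from-divides (ℤ-∣.divides κ e) = κ , e
      solve : (∃ λ (κ : ℤ) → A i ≡ κ * + g) → ∃ λ (h : Fin (suc n) → ℤ) → ∑ (λ j → A j * h j) (allFin (suc n)) ≡ 0ℤ × h i ≡ 1ℤ
      solve (κ , Ai≡) = h , kernel , at-i
        where
        h : Fin (suc n) → ℤ
        -- The Bézout combination c of the other coefficients yields g; multiplied by κ = A i / g
        -- and subtracted, it cancels the contribution A i of the coordinate 1 at i.
        h j = δ j i - (1ℤ - δ j i) * (c j * κ)
        term : ∀ a d c κ → a * (d - (1ℤ - d) * (c * κ)) ≡ d * a - a * (1ℤ - d) * c * κ
        term = solve-∀
        kernel : ∑ (λ j → A j * h j) (allFin (suc n)) ≡ 0ℤ
        kernel = trans (∑-cong′ (allFin (suc n)) λ j → term (A j) (δ j i) (c j) κ)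
          (trans (∑-- (λ j → δ j i * A j) (λ j → A j * (1ℤ - δ j i) * c j * κ) (allFin (suc n)))
          (trans (cong₂ _-_ (trans (∑-δ i A) Ai≡) (trans (∑-*ʳ κ (λ j → A j * (1ℤ - δ j i) * c j) (allFin (suc n))) (trans (cong (_* κ) eq) (ℤₚ.*-comm (+ g) κ))))
          (ℤₚ.+-inverseʳ (κ * + g))))
        at-i : h i ≡ 1ℤ
        at-i = cong (λ d → d - (1ℤ - d) * (c i * κ)) (δ-same i)

  ∣ι∣ : ∀ z → ℚ.∣ ι z ∣ ≡ ι (+ ∣ z ∣)
  ∣ι∣ (+ m)    = ℚₚ.0≤p⇒∣p∣≡p (ι-mono-≤ {0ℤ} {+ m} (+≤+ z≤n))
  ∣ι∣ -[1+ m ] = trans (ℚₚ.∣-p∣≡∣p∣ (ι (+ suc m))) (ℚₚ.0≤p⇒∣p∣≡p (ι-mono-≤ {0ℤ} {+ suc m} (+≤+ z≤n)))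

  ∣aQ∣ : ∀ i → ℚ.∣ a i ∣ ℚ.* ι (+ Q) ≡ ι (+ ∣ A i ∣)
  ∣aQ∣ i = trans (cong (ℚ.∣ a i ∣ ℚ.*_) (sym (∣ι∣ (+ Q)))) (trans (sym (ℚₚ.∣p*q∣≡∣p∣*∣q∣ (a i) (ι (+ Q)))) (trans (cong ℚ.∣_∣ (aQ i)) (∣ι∣ (A i))))

  archimedean : ArchimedeanCondition a → ∀ i → + ∣ A i ∣ ℤ.≤ ∑ (λ j → + ∣ A j ∣ * (1ℤ - δ j i)) (allFin (suc n))
  archimedean arch i = ι-cancel-≤ (subst₂ ℚ._≤_ (∣aQ∣ i) (scaled (allFin (suc n)))
    (ℚₚ.*-monoʳ-≤-nonNeg (ι (+ Q)) {{ℚₚ.pos⇒nonNeg (ι (+ Q)) {{ι-positive Q>0}}}} (arch i)))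
    where
    scaled : ∀ xs → foldr (λ j s → if does (j Finₚ.≟ i) then s else ℚ.∣ a j ∣ ℚ.+ s) 0ℚ xs ℚ.* ι (+ Q) ≡ ι (∑ (λ j → + ∣ A j ∣ * (1ℤ - δ j i)) xs)
    scaled []       = ℚₚ.*-zeroˡ (ι (+ Q))
    scaled (j ∷ xs) with j Finₚ.≟ i
    ... | yes _ = trans (scaled xs) (cong ι (sym (trans (cong (_+ ∑ (λ j → + ∣ A j ∣ * (1ℤ - δ j i)) xs) (ℤₚ.*-zeroʳ (+ ∣ A j ∣))) (ℤₚ.+-identityˡ (∑ (λ j → + ∣ A j ∣ * (1ℤ - δ j i)) xs)))))
    ... | no _  = trans (ℚₚ.*-distribʳ-+ (ι (+ Q)) ℚ.∣ a j ∣ _) (trans (cong₂ ℚ._+_ (trans (∣aQ∣ j) (cong ι (sym (ℤₚ.*-identityʳ (+ ∣ A j ∣))))) (scaled xs))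
      (sym (ι-+ (+ ∣ A j ∣ * 1ℤ) _)))

-- From integer weights to a rational probability distribution

sumℚ-ι : ∀ {X : Set} (f : X → ℤ) τ xs → sumℚ (map (λ x → ι (f x) ℚ.* τ) xs) ≡ ι (∑ f xs) ℚ.* τ
sumℚ-ι f τ []       = sym (ℚₚ.*-zeroˡ τ)
sumℚ-ι f τ (x ∷ xs) = trans (cong (ι (f x) ℚ.* τ ℚ.+_) (sumℚ-ι f τ xs))
  (trans (sym (ℚₚ.*-distribʳ-+ τ (ι (f x)) (ι (∑ f xs)))) (cong (ℚ._* τ) (sym (ι-+ (f x) (∑ f xs)))))

module Normalised {r} (a : Fin r → ℚ) (Q : ℕ) (Q>0 : 1 ℕ.≤ Q) (A : Fin r → ℤ) (aQ : ∀ i → a i ℚ.* ι (+ Q) ≡ ι (A i)) (S : Solution A) where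
  open Solution S

  T : ℤ
  T = ∑ proj₂ atoms

  T>0 : 0ℤ ℤ.< T
  T>0 = let _ , e∈ , w>0 , _ = nonzero in ℤₚ.<-≤-trans w>0 (∑-member-≤ atoms nonNeg e∈)

  ∣T∣>0 : 1 ℕ.≤ ∣ T ∣
  ∣T∣>0 = ℤₚ.drop‿+<+ (subst (0ℤ ℤ.<_) (sym (ℤₚ.0≤i⇒+∣i∣≡i (ℤₚ.<⇒≤ T>0))) T>0)

  instance
    ∣T∣≢0 : NonZero ∣ T ∣
    ∣T∣≢0 = ℕ.>-nonZero ∣T∣>0

  τ : ℚ
  τ = 1ℤ ℚ./ ∣ T ∣

  T*τ : ι T ℚ.* τ ≡ 1ℚ
  T*τ = trans (ℚₚ.*-comm (ι T) τ) (trans (cong (λ z → τ ℚ.* ι z) (sym (ℤₚ.0≤i⇒+∣i∣≡i (ℤₚ.<⇒≤ T>0)))) (/-ι 1ℤ ∣ T ∣))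

  τ>0 : 0ℚ ℚ.< τ
  τ>0 = ℚₚ.*-cancelʳ-<-nonNeg (ι (+ ∣ T ∣)) {{ℚₚ.pos⇒nonNeg (ι (+ ∣ T ∣)) {{ι-positive ∣T∣>0}}}}
    (subst₂ ℚ._<_ (sym (ℚₚ.*-zeroˡ (ι (+ ∣ T ∣)))) (sym (/-ι 1ℤ ∣ T ∣)) (ι-mono-< {0ℤ} {1ℤ} (+<+ (s≤s z≤n))))

  point : (Fin r → ℤ) × ℤ → Point r × ℚ
  point (x , c) = ι ∘ x , ι c ℚ.* τ

  distribution : FinDist r
  distribution = map point atoms

  isProbability : IsProbability distribution
  isProbability = Allₚ.map⁺ (All.tabulate λ {e} e∈ → subst (ℚ._≤ ι (proj₂ e) ℚ.* τ) (ℚₚ.*-zeroˡ τ)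
      (ℚₚ.*-monoʳ-≤-nonNeg τ {{ℚ.nonNegative (ℚₚ.<⇒≤ τ>0)}} (ι-mono-≤ {0ℤ} (nonNeg e e∈)))) ,
    trans (cong sumℚ (sym (Listₚ.map-∘ atoms))) (trans (sumℚ-ι proj₂ τ atoms) T*τ)

  sumFin-ι : ∀ (x : Fin r → ℤ) xs → sumℚ (map (λ i → a i ℚ.* ι (x i)) xs) ℚ.* ι (+ Q) ≡ ι (∑ (λ i → A i * x i) xs)
  sumFin-ι x []       = ℚₚ.*-zeroˡ (ι (+ Q))
  sumFin-ι x (i ∷ xs) = trans (ℚₚ.*-distribʳ-+ (ι (+ Q)) (a i ℚ.* ι (x i)) _) (trans (cong₂ ℚ._+_ term (sumFin-ι x xs))
    (sym (ι-+ (A i * x i) (∑ (λ i → A i * x i) xs))))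
    where
    term : a i ℚ.* ι (x i) ℚ.* ι (+ Q) ≡ ι (A i * x i)
    term = trans (ℚₚ.*-assoc (a i) (ι (x i)) (ι (+ Q))) (trans (cong (a i ℚ.*_) (ℚₚ.*-comm (ι (x i)) (ι (+ Q))))
      (trans (sym (ℚₚ.*-assoc (a i) (ι (+ Q)) (ι (x i)))) (trans (cong (ℚ._* ι (x i)) (aQ i)) (sym (ι-* (A i) (x i))))))

  supported : SupportedOnHyperplane a distribution
  supported = Allₚ.map⁺ (All.tabulate λ {e} e∈ → *-cancelʳ-≡ Q Q>0
    (trans (sumFin-ι (proj₁ e) (allFin r)) (trans (cong ι (relation e e∈)) (sym (ℚₚ.*-zeroˡ (ι (+ Q)))))))

  notPointMass : NotPointMassAtOrigin distribution
  notPointMass = let e , e∈ , w>0 , i , x≢0 = nonzero in lose (∈-map⁺ point e∈)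
    (subst (ℚ._< ι (proj₂ e) ℚ.* τ) (ℚₚ.*-zeroˡ τ) (ℚₚ.*-monoˡ-<-pos τ {{ℚ.positive τ>0}} (ι-mono-< {0ℤ} w>0)) ,
     λ h → x≢0 (ι-injective {proj₁ e i} {0ℤ} (h i)))

  marginal-ι : ∀ i y xs → marginal (map point xs) i (ι y) ≡ ι (∑ (λ e → ind (proj₁ e i ℤₚ.≟ y) * proj₂ e) xs) ℚ.* τ
  marginal-ι i y []       = sym (ℚₚ.*-zeroˡ τ)
  marginal-ι i y (e ∷ xs) = split (ι (proj₁ e i) ℚₚ.≟ ι y)
    where
    open ≡-Reasoning
    f : (Fin r → ℤ) × ℤ → ℤ
    f e = ind (proj₁ e i ℤₚ.≟ y) * proj₂ e
    P? : ∀ (e : Point r × ℚ) → Dec (proj₁ e i ≡ ι y)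
    P? e = proj₁ e i ℚₚ.≟ ι y
    split : Dec (ι (proj₁ e i) ≡ ι y) → marginal (map point (e ∷ xs)) i (ι y) ≡ ι (∑ f (e ∷ xs)) ℚ.* τ
    split (yes eq) = begin
      sumℚ (map proj₂ (filter P? (point e ∷ map point xs)))              ≡⟨ cong (sumℚ ∘ map proj₂) (Listₚ.filter-accept P? {point e} {map point xs} eq) ⟩
      ι (proj₂ e) ℚ.* τ ℚ.+ marginal (map point xs) i (ι y)              ≡⟨ cong (ι (proj₂ e) ℚ.* τ ℚ.+_) (marginal-ι i y xs) ⟩
      ι (proj₂ e) ℚ.* τ ℚ.+ ι (∑ f xs) ℚ.* τ                             ≡⟨ ℚₚ.*-distribʳ-+ τ (ι (proj₂ e)) (ι (∑ f xs)) ⟨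
      (ι (proj₂ e) ℚ.+ ι (∑ f xs)) ℚ.* τ                                 ≡⟨ cong (ℚ._* τ) (ι-+ (proj₂ e) (∑ f xs)) ⟨
      ι (proj₂ e + ∑ f xs) ℚ.* τ                                         ≡⟨ cong (λ z → ι (z + ∑ f xs) ℚ.* τ) (trans (cong (_* proj₂ e) (ind-yes (proj₁ e i ℤₚ.≟ y) (ι-injective eq))) (ℤₚ.*-identityˡ (proj₂ e))) ⟨
      ι (f e + ∑ f xs) ℚ.* τ                                             ∎
    split (no ne) = begin
      sumℚ (map proj₂ (filter P? (point e ∷ map point xs)))              ≡⟨ cong (sumℚ ∘ map proj₂) (Listₚ.filter-reject P? {point e} {map point xs} ne) ⟩
      marginal (map point xs) i (ι y)                                    ≡⟨ marginal-ι i y xs ⟩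
      ι (∑ f xs) ℚ.* τ                                                   ≡⟨ cong (λ z → ι z ℚ.* τ) (ℤₚ.+-identityˡ (∑ f xs)) ⟨
      ι (0ℤ + ∑ f xs) ℚ.* τ                                              ≡⟨ cong (λ z → ι (z * proj₂ e + ∑ f xs) ℚ.* τ) (ind-no (proj₁ e i ℤₚ.≟ y) (ne ∘ cong ι)) ⟨
      ι (f e + ∑ f xs) ℚ.* τ                                             ∎

  -- `law-eq` concerns integer values, and q is an arbitrary rational. If q is taken by one of the
  -- two coordinates at some atom, it is an integer; if by neither, both marginals are empty sums.
  equalMarginals : EqualMarginals distribution
  equalMarginals i j q = decide (Any.any? (λ e → ι (proj₁ e i) ℚₚ.≟ q) atoms) (Any.any? (λ e → ι (proj₁ e j) ℚₚ.≟ q) atoms)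
    where
    at-ι : ∀ y → ι y ≡ q → marginal distribution i q ≡ marginal distribution j q
    at-ι y refl = trans (marginal-ι i y atoms) (trans (cong (λ z → ι z ℚ.* τ) (law-eq i j y)) (sym (marginal-ι j y atoms)))
    none : ∀ i → ¬ Any (λ e → ι (proj₁ e i) ≡ q) atoms → marginal distribution i q ≡ 0ℚ
    none i ¬any = cong (sumℚ ∘ map proj₂) (Listₚ.filter-none (λ e → proj₁ e i ℚₚ.≟ q) (Allₚ.map⁺ (Allₚ.¬Any⇒All¬ atoms ¬any)))
    decide : Dec (Any (λ e → ι (proj₁ e i) ≡ q) atoms) → Dec (Any (λ e → ι (proj₁ e j) ≡ q) atoms) → marginal distribution i q ≡ marginal distribution j q
    decide (yes any) _ = let e , _ , eq = find any in at-ι (proj₁ e i) eq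
    decide _ (yes any) = let e , _ , eq = find any in at-ι (proj₁ e j) eq
    decide (no ¬i) (no ¬j) = trans (none i ¬i) (sym (none j ¬j))

-- Necessity

-- The common shape of `sumExcept` and `maxExcept`, with + or ⊔ as the operation, so that both local
-- conditions follow from one argument.
exceptFold : ∀ {r} → (ℚ → ℚ → ℚ) → (Fin r → ℚ) → Fin r → List (Fin r) → ℚ
exceptFold _•_ f i = foldr (λ j s → if does (j Finₚ.≟ i) then s else f j • s) 0ℚ

exceptFold-+ : ∀ {r} (f : Fin r → ℚ) i {xs} → Unique xs → i ∈ xs → f i ℚ.+ exceptFold ℚ._+_ f i xs ≡ sumℚ (map f xs)
exceptFold-+ {r} f i = present
  where
  absent : ∀ xs → All (i ≢_) xs → exceptFold ℚ._+_ f i xs ≡ sumℚ (map f xs)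
  absent []       _          = refl
  absent (j ∷ xs) (i≢j ∷ a) with j Finₚ.≟ i
  ... | yes j≡i = contradiction (sym j≡i) i≢j
  ... | no _    = cong (f j ℚ.+_) (absent xs a)
  present : ∀ {xs} → Unique xs → i ∈ xs → f i ℚ.+ exceptFold ℚ._+_ f i xs ≡ sumℚ (map f xs)
  present {j ∷ xs} (j∉ ∷ u) i∈ with j Finₚ.≟ i | i∈
  ... | yes refl | _         = cong (f j ℚ.+_) (absent xs j∉)
  ... | no j≢i   | here i≡j  = contradiction (sym i≡j) j≢i
  ... | no _     | there i∈′ = trans (sym (ℚₚ.+-assoc (f i) (f j) S)) (trans (cong (ℚ._+ S) (ℚₚ.+-comm (f i) (f j)))
    (trans (ℚₚ.+-assoc (f j) (f i) S) (cong (f j ℚ.+_) (present u i∈′))))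
    where
    S : ℚ
    S = exceptFold ℚ._+_ f i xs

list-argmax : ∀ {X : Set} (f : X → ℚ) {xs x} → x ∈ xs → ∃ λ m → m ∈ xs × ∀ y → y ∈ xs → f y ℚ.≤ f m
list-argmax f {x ∷ []}     _ = x , here refl , λ { y (here refl) → ℚₚ.≤-refl }
list-argmax f {x ∷ z ∷ xs} _ = compare (list-argmax f {z ∷ xs} (here refl))
  where
  compare : ∃ (λ m → m ∈ z ∷ xs × ∀ y → y ∈ z ∷ xs → f y ℚ.≤ f m) → ∃ λ m → m ∈ x ∷ z ∷ xs × ∀ y → y ∈ x ∷ z ∷ xs → f y ℚ.≤ f m
  compare (m , m∈ , h) = [ (λ x≤m → m , there m∈ , λ { y (here refl) → x≤m ; y (there y∈) → h y y∈ }) ,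
    (λ m≤x → x , here refl , λ { y (here refl) → ℚₚ.≤-refl ; y (there y∈) → ℚₚ.≤-trans (h y y∈) m≤x }) ]′ (ℚₚ.≤-total (f x) (f m))

NonNegWeights : ∀ {r} → FinDist r → Set
NonNegWeights = All (λ e → 0ℚ ℚ.≤ proj₂ e)

total-nonNeg : ∀ {r} {d : FinDist r} → NonNegWeights d → 0ℚ ℚ.≤ sumℚ (map proj₂ d)
total-nonNeg []       = ℚₚ.≤-refl
total-nonNeg (h ∷ hs) = ℚₚ.+-mono-≤ h (total-nonNeg hs)

total-positive : ∀ {r} {d : FinDist r} {e} → NonNegWeights d → e ∈ d → 0ℚ ℚ.< proj₂ e → 0ℚ ℚ.< sumℚ (map proj₂ d)
total-positive (_ ∷ hs) (here refl) w>0 = ℚₚ.+-mono-<-≤ w>0 (total-nonNeg hs)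
total-positive (h ∷ hs) (there e∈)  w>0 = ℚₚ.+-mono-≤-< h (total-positive hs e∈ w>0)

positive-member : ∀ {r} (d : FinDist r) → 0ℚ ℚ.< sumℚ (map proj₂ d) → ∃ λ e → e ∈ d × 0ℚ ℚ.< proj₂ e
positive-member []      h = contradiction h (ℚₚ.<-irrefl refl)
positive-member (e ∷ d) h = split (0ℚ ℚₚ.<? proj₂ e)
  where
  split : Dec (0ℚ ℚ.< proj₂ e) → ∃ λ e′ → e′ ∈ e ∷ d × 0ℚ ℚ.< proj₂ e′
  split (yes w>0) = e , here refl , w>0
  split (no w≯0)  = let e′ , e′∈ , w>0 = positive-member d tail>0 in e′ , there e′∈ , w>0
    where
    tail>0 : 0ℚ ℚ.< sumℚ (map proj₂ d)
    tail>0 = ℚₚ.<-≤-trans h (subst (proj₂ e ℚ.+ sumℚ (map proj₂ d) ℚ.≤_) (ℚₚ.+-identityˡ _) (ℚₚ.+-monoˡ-≤ (sumℚ (map proj₂ d)) (ℚₚ.≮⇒≥ w≯0)))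

-- The atom e makes the k-th marginal positive at its value; the i-th marginal is then positive
-- there too, and a positive sum of weights contains a positive weight.
value-shared : ∀ {r} {d : FinDist r} → NonNegWeights d → EqualMarginals d → ∀ {e} → e ∈ d → 0ℚ ℚ.< proj₂ e → ∀ k i →
  ∃ λ e′ → (e′ ∈ d × proj₁ e′ i ≡ proj₁ e k) × 0ℚ ℚ.< proj₂ e′
value-shared {d = d} nn eqm {e} e∈ w>0 k i =
  let e′ , e′∈ , w′>0 = positive-member (filter (λ e′ → proj₁ e′ i ℚₚ.≟ q) d) (subst (0ℚ ℚ.<_) (eqm k i q)
        (total-positive (Allₚ.filter⁺ (λ e′ → proj₁ e′ k ℚₚ.≟ q) nn) (∈-filter⁺ (λ e′ → proj₁ e′ k ℚₚ.≟ q) e∈ refl) w>0))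
  in e′ , ∈-filter⁻ (λ e′ → proj₁ e′ i ℚₚ.≟ q) e′∈ , w′>0
  where
  q : ℚ
  q = proj₁ e k

-- At an atom whose i-th coordinate is the largest value attained anywhere, the triangle inequality for N gives the local condition at i.
module Necessity (N : ℚ → ℚ) (_•_ : ℚ → ℚ → ℚ)
  (N-0 : N 0ℚ ≡ 0ℚ) (N-positive : ∀ x → x ≢ 0ℚ → 0ℚ ℚ.< N x) (N-neg : ∀ x → N (ℚ.- x) ≡ N x) (N-* : ∀ x y → N (x ℚ.* y) ≡ N x ℚ.* N y)
  (triangle : ∀ x y → N (x ℚ.+ y) ℚ.≤ N x • N y)
  (•-mono : ∀ {w x y z} → w ℚ.≤ x → y ℚ.≤ z → w • y ℚ.≤ x • z)
  (•-scale : ∀ c → 0ℚ ℚ.≤ c → ∀ x y → (x ℚ.* c) • (y ℚ.* c) ≡ (x • y) ℚ.* c) where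

  fold-triangle : ∀ {r} (f : Fin r → ℚ) i xs → N (exceptFold ℚ._+_ f i xs) ℚ.≤ exceptFold _•_ (N ∘ f) i xs
  fold-triangle f i []       = ℚₚ.≤-reflexive N-0
  fold-triangle f i (j ∷ xs) with does (j Finₚ.≟ i)
  ... | true  = fold-triangle f i xs
  ... | false = ℚₚ.≤-trans (triangle (f j) (exceptFold ℚ._+_ f i xs)) (•-mono ℚₚ.≤-refl (fold-triangle f i xs))

  fold-mono : ∀ {r} (f g : Fin r → ℚ) i xs → (∀ j → f j ℚ.≤ g j) → exceptFold _•_ f i xs ℚ.≤ exceptFold _•_ g i xs
  fold-mono f g i []       h = ℚₚ.≤-refl
  fold-mono f g i (j ∷ xs) h with does (j Finₚ.≟ i)
  ... | true  = fold-mono f g i xs h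
  ... | false = •-mono (h j) (fold-mono f g i xs h)

  fold-scale : ∀ {r} (f : Fin r → ℚ) c i xs → 0ℚ ℚ.≤ c → exceptFold _•_ (λ j → f j ℚ.* c) i xs ≡ exceptFold _•_ f i xs ℚ.* c
  fold-scale f c i []       c≥0 = sym (ℚₚ.*-zeroˡ c)
  fold-scale f c i (j ∷ xs) c≥0 with does (j Finₚ.≟ i)
  ... | true  = fold-scale f c i xs c≥0
  ... | false = trans (cong ((f j ℚ.* c) •_) (fold-scale f c i xs c≥0)) (•-scale c c≥0 (f j) (exceptFold _•_ f i xs))

  vanishing-sum : ∀ {r} (f : Fin r → ℚ) i → sumFin f ≡ 0ℚ → N (f i) ℚ.≤ exceptFold _•_ (N ∘ f) i (allFin r)
  vanishing-sum {r} f i eq = subst (ℚ._≤ exceptFold _•_ (N ∘ f) i (allFin r)) (trans (cong N opposite) (N-neg (f i))) (fold-triangle f i (allFin r))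
    where
    opposite : exceptFold ℚ._+_ f i (allFin r) ≡ ℚ.- f i
    opposite = ℚ-group.inverseʳ-unique (f i) _ (trans (exceptFold-+ f i (Uniqueₚ.allFin⁺ r) (∈-allFin i)) eq)

  condition : ∀ {r} (a : Fin r → ℚ) (d : FinDist r) → NonNegWeights d → SupportedOnHyperplane a d → NotPointMassAtOrigin d → EqualMarginals d →
    ∀ i → N (a i) ℚ.≤ exceptFold _•_ (N ∘ a) i (allFin r)
  condition {r} a d nn supp npm eqm i = let e₀ , e₀∈ , w₀>0 , x₀≢0 = find npm in at e₀ e₀∈ w₀>0 x₀≢0
    where
    positive? : ∀ (e : Point r × ℚ) → Dec (0ℚ ℚ.< proj₂ e)
    positive? e = 0ℚ ℚₚ.<? proj₂ e
    values : List ((Point r × ℚ) × Fin r)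
    values = cartesianProduct (filter positive? d) (allFin r)
    size : (Point r × ℚ) × Fin r → ℚ
    size (e , k) = N (proj₁ e k)
    member : ∀ {e} k → e ∈ d → 0ℚ ℚ.< proj₂ e → (e , k) ∈ values
    member k e∈ w>0 = ∈-cartesianProduct⁺ (∈-filter⁺ positive? e∈ w>0) (∈-allFin k)
    at : ∀ e₀ → e₀ ∈ d → 0ℚ ℚ.< proj₂ e₀ → ¬ (∀ k → proj₁ e₀ k ≡ 0ℚ) → N (a i) ℚ.≤ exceptFold _•_ (N ∘ a) i (allFin r)
    at e₀ e₀∈ w₀>0 x₀≢0 = maximal (list-argmax size (member i e₀∈ w₀>0))
      where
      maximal : ∃ (λ m → m ∈ values × ∀ y → y ∈ values → size y ℚ.≤ size m) → N (a i) ℚ.≤ exceptFold _•_ (N ∘ a) i (allFin r)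
      maximal ((e , k) , m∈ , largest) = shared (value-shared nn eqm (proj₁ e∈) (proj₂ e∈) k i)
        where
        e∈ : e ∈ d × 0ℚ ℚ.< proj₂ e
        e∈ = ∈-filter⁻ positive? (proj₁ (∈-cartesianProduct⁻ (filter positive? d) (allFin r) m∈))
        M : ℚ
        M = N (proj₁ e k)
        -- If the largest size were 0, all coordinates of `e₀` would vanish, but `e₀` is an atom of
        -- positive weight away from the origin.
        M>0 : 0ℚ ℚ.< M
        M>0 = N-positive (proj₁ e k) λ z → x₀≢0 λ l → vanish (proj₁ e₀ l) (ℚₚ.≤-trans (largest (e₀ , l) (member l e₀∈ w₀>0)) (ℚₚ.≤-reflexive (trans (cong N z) N-0)))
          where
          vanish : ∀ x → N x ℚ.≤ 0ℚ → x ≡ 0ℚ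
          vanish x h = decide (x ℚₚ.≟ 0ℚ)
            where
            decide : Dec (x ≡ 0ℚ) → x ≡ 0ℚ
            decide (yes eq) = eq
            decide (no ne)  = contradiction (ℚₚ.<-≤-trans (N-positive x ne) h) (ℚₚ.<-irrefl refl)
        shared : ∃ (λ e′ → (e′ ∈ d × proj₁ e′ i ≡ proj₁ e k) × 0ℚ ℚ.< proj₂ e′) → N (a i) ℚ.≤ exceptFold _•_ (N ∘ a) i (allFin r)
        shared (e′ , (e′∈ , eq) , w′>0) = ℚₚ.*-cancelʳ-≤-pos M {{ℚ.positive M>0}} (begin
          N (a i) ℚ.* M                                                  ≡⟨ cong (λ z → N (a i) ℚ.* N z) eq ⟨
          N (a i) ℚ.* N (x i)                                            ≡⟨ N-* (a i) (x i) ⟨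
          N (a i ℚ.* x i)                                                ≤⟨ vanishing-sum (λ j → a j ℚ.* x j) i (All.lookup supp e′∈) ⟩
          exceptFold _•_ (λ j → N (a j ℚ.* x j)) i (allFin r)            ≤⟨ fold-mono (λ j → N (a j ℚ.* x j)) (λ j → N (a j) ℚ.* M) i (allFin r) bound ⟩
          exceptFold _•_ (λ j → N (a j) ℚ.* M) i (allFin r)              ≡⟨ fold-scale (N ∘ a) M i (allFin r) (ℚₚ.<⇒≤ M>0) ⟩
          exceptFold _•_ (N ∘ a) i (allFin r) ℚ.* M                      ∎)
          where
          open ℚₚ.≤-Reasoning
          x : Fin r → ℚ
          x = proj₁ e′
          N-nonNeg : ∀ y → 0ℚ ℚ.≤ N y
          N-nonNeg y = decide (y ℚₚ.≟ 0ℚ)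
            where
            decide : Dec (y ≡ 0ℚ) → 0ℚ ℚ.≤ N y
            decide (yes refl) = ℚₚ.≤-reflexive (sym N-0)
            decide (no ne)    = ℚₚ.<⇒≤ (N-positive y ne)
          bound : ∀ j → N (a j ℚ.* x j) ℚ.≤ N (a j) ℚ.* M
          bound j = subst (ℚ._≤ N (a j) ℚ.* M) (sym (N-* (a j) (x j)))
            (ℚₚ.*-monoˡ-≤-nonNeg (N (a j)) {{ℚ.nonNegative (N-nonNeg (a j))}} (largest (e′ , j) (member j e′∈ w′>0)))

archimedean-necessary : ∀ {r} (a : Fin r → ℚ) (d : FinDist r) → NonNegWeights d → SupportedOnHyperplane a d → NotPointMassAtOrigin d → EqualMarginals d →
  ArchimedeanCondition a
archimedean-necessary = condition
  where
  ∣∣-positive : ∀ x → x ≢ 0ℚ → 0ℚ ℚ.< ℚ.∣ x ∣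
  ∣∣-positive x x≢0 = ℚₚ.≰⇒> λ h → x≢0 (ℚₚ.∣p∣≡0⇒p≡0 x (ℚₚ.≤-antisym h (ℚₚ.0≤∣p∣ x)))
  open Necessity ℚ.∣_∣ ℚ._+_ refl ∣∣-positive ℚₚ.∣-p∣≡∣p∣ ℚₚ.∣p*q∣≡∣p∣*∣q∣ ℚₚ.∣p+q∣≤∣p∣+∣q∣ ℚₚ.+-mono-≤ (λ c _ x y → sym (ℚₚ.*-distribʳ-+ c x y))

padic-necessary : ∀ {r} (a : Fin r → ℚ) (d : FinDist r) → NonNegWeights d → SupportedOnHyperplane a d → NotPointMassAtOrigin d → EqualMarginals d →
  PAdicCondition a
padic-necessary a d nn supp npm eqm p pp = condition a d nn supp npm eqm
  where
  open Valuation p pp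
  open Necessity N ℚ._⊔_ N-0 N-positive N-neg N-* ultrametric ℚₚ.⊔-mono-≤ (λ c c≥0 x y → sym (ℚₚ.*-distribʳ-⊔-nonNeg c {{ℚ.nonNegative c≥0}} x y))

solution⇒distribution : ∀ {r} (a : Fin r → ℚ) Q → 1 ℕ.≤ Q → (A : Fin r → ℤ) → (∀ i → a i ℚ.* ι (+ Q) ≡ ι (A i)) → Solution A →
  Σ (FinDist r) λ d → IsProbability d × SupportedOnHyperplane a d × NotPointMassAtOrigin d × EqualMarginals d
solution⇒distribution a Q Q>0 A aQ S = distribution , isProbability , supported , notPointMass , equalMarginals
  where open Normalised a Q Q>0 A aQ S

theorem1p1 : (n : ℕ) → (a : Fin (suc n) → ℚ) →
    (Σ (FinDist (suc n)) λ d →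
        IsProbability d × SupportedOnHyperplane a d
        × NotPointMassAtOrigin d × EqualMarginals d)
    ⇔ (PAdicCondition a × ArchimedeanCondition a)
theorem1p1 n a = mk⇔
  (λ (d , (nn , _) , supp , npm , eqm) → padic-necessary a d nn supp npm eqm , archimedean-necessary a d nn supp npm eqm)
  (λ (padic , arch) → let Q , Q>0 , A , aQ = common-denominator (suc n) a in
    solution⇒distribution a Q Q>0 A aQ (local-conditions⇒solution A (Integral.units a Q Q>0 A aQ padic) (Integral.archimedean a Q Q>0 A aQ arch)))
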